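{- Let $p\equiv 3\pmod 8$ be a prime, $q=p^s$, let $\ell$ be a positive divisor of $s$, and let $N$ be a positive divisor of $q-1$ with $\gcd\bigl(N,(q-1)/(p^\ell-1)\bigr)=2^m$, $m\ge 3$. Let $\theta=\gamma^N$ and $$\mathcal C=\Bigl\{\bigl(\mathrm{Tr}_{\mathbb F_q/\mathbb F_{p^\ell}}(\beta),\mathrm{Tr}_{\mathbb F_q/\mathbb F_{p^\ell}}(\beta\theta),\dots,\mathrm{Tr}_{\mathbb F_q/\mathbb F_{p^\ell}}(\beta\theta^{(q-1)/N-1})\bigr):\beta\in\mathbb F_q\Bigr\}.$$ Then $\mathcal C$ is an irreducible cyclic $[(q-1)/N,\,s/\ell]$ code over $\mathbb F_{p^\ell}$. Writing $c=\frac{p^\ell-1}{p^\ell N}$, its weight enumerator is \begin{align*} 1&+\tfrac{q-1}{4}X^{c(q-q^{1/2})}+\tfrac{q-1}{4}X^{c(q-q^{1/2}+4B_3q^{1/4})}+\tfrac{q-1}{4}X^{c(q-q^{1/2}-4B_3q^{1/4})}\\ &+\tfrac{q-1}{8}X^{c(q+3q^{1/2}+4A_3q^{1/4})}+\tfrac{q-1}{8}X^{c(q+3q^{1/2}-4A_3q^{1/4})} \end{align*} if $m=3$, and \begin{align*} 1&+\tfrac{q-1}{4}X^{c(q-q^{1/2}+4B_3q^{1/4})}+\tfrac{q-1}{4}X^{c(q-q^{1/2}-4B_3q^{1/4})} +\tfrac{q-1}{8}X^{c(q-q^{1/2}+8B_4q^{3/8})}+\tfrac{q-1}{8}X^{c(q-q^{1/2}-8B_4q^{3/8})}\\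 &+\sum_{t=2}^{m-3}\tfrac{q-1}{2^{t+2}}X^{c\left(q+3q^{1/2}-S_t+2^tA_{t+1}q^{\frac{2^{t-1}-1}{2^t}}+2^{t+2}B_{t+3}q^{\frac{2^{t+1}-1}{2^{t+2}}}\right)} +\sum_{t=2}^{m-3}\tfrac{q-1}{2^{t+2}}X^{c\left(q+3q^{1/2}-S_t+2^tA_{t+1}q^{\frac{2^{t-1}-1}{2^t}}-2^{t+2}B_{t+3}q^{\frac{2^{t+1}-1}{2^{t+2}}}\right)}\\ &+\tfrac{q-1}{2^{m-1}}X^{c\left(q+3q^{1/2}-S_{m-2}+2^{m-2}A_{m-1}q^{\frac{2^{m-3}-1}{2^{m-2}}}\right)}\\ &+\tfrac{q-1}{2^{m}}X^{c\left(q+3q^{1/2}-S_{m-1}+2^{m-1}A_mq^{\frac{2^{m-2}-1}{2^{m-1}}}\right)} +\tfrac{q-1}{2^{m}}X^{c\left(q+3q^{1/2}-S_{m-1}-2^{m-1}A_mq^{\frac{2^{m-2}-1}{2^{m-1}}}\right)} \end{align*} if $m\ge 4$.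
   Context: $\mathbb F_q$ is the finite field with $q=p^s$ elements, $\gamma$ is a fixed generator of $\mathbb F_q^*$, and $\mathrm{Tr}_{\mathbb F_q/\mathbb F_{p^\ell}}$ is the trace map from $\mathbb F_q$ to its subfield $\mathbb F_{p^\ell}$. A linear $[n,k]$ code over $\mathbb F_{p^\ell}$ is a $k$-dimensional subspace of $\mathbb F_{p^\ell}^n$; it is cyclic if it is invariant under cyclic shift of coordinates, and an irreducible cyclic code is one corresponding to an ideal of $\mathbb F_{p^\ell}[X]/\langle X^n-1\rangle$ generated by $(X^n-1)/f(X)$ with $f$ an irreducible divisor of $X^n-1$. The weight enumerator is $1+\sum_{j=1}^n a_jX^j$, where $a_j$ is the number of codewords with exactly $j$ nonzero coordinates (Hamming weight $j$). For $3\le r\le m$, the integers $A_r,B_r$ are defined by $p^{s/2^{r-2}}=A_r^2+2B_r^2$, $A_r\equiv -1\pmod 4$, $p\nmid A_r$; these determine $A_r$ and $|B_r|$ uniquely. For an integer $k$, $S_k=\sum_{r=3}^{k}2^{r-1}A_r q^{\frac{2^{r-2}-1}{2^{r-1}}}$ (empty sum is $0$). Powers of $q$ denote positive real roots. -}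

module Defs where

open import Level using (0ℓ)
open import Data.Nat as ℕ using (ℕ; zero; suc; _∸_; _^_; ⌊_/2⌋)
open import Data.Integer as ℤ using (ℤ; +_; -[1+_])
open import Data.Product using (Σ; ∃; _×_; _,_)
open import Data.List as List using (List; []; _∷_; upTo; length; filter; deduplicate; concatMap; _++_)
open import Data.List.Membership.Propositional using (_∈_)
open import Data.List.Relation.Unary.Unique.Propositional using (Unique)
open import Data.Vec as Vec using (Vec; tabulate; toList)
open import Data.Vec.Properties using (≡-dec)
open import Data.Fin using (Fin; toℕ)
open import Relation.Binary.PropositionalEquality using (_≡_; _≢_)
open import Relation.Binary.Definitions using (DecidableEquality)
open import Relation.Nullary using (¬?)
open import Relation.Nullary.Decidable using (⌊_⌋)
open import Algebra.Structures using (IsCommutativeRing)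
open import Data.Bool using (Bool; true; false; if_then_else_)

record FiniteField : Set₁ where
  infixl 6 _+_
  infixl 7 _*_
  field
    Carrier  : Set
    _+_ _*_  : Carrier → Carrier → Carrier
    -_       : Carrier → Carrier
    0# 1#    : Carrier
    isCommutativeRing : IsCommutativeRing _≡_ _+_ _*_ -_ 0# 1#
    0≢1      : 0# ≢ 1#
    inverse  : ∀ x → x ≢ 0# → ∃ λ y → x * y ≡ 1#
    _≟_      : DecidableEquality Carrier
    elements : List Carrier
    complete : ∀ x → x ∈ elements
    unique   : Unique elements

  card : ℕ
  card = length elements

  _^ᶠ_ : Carrier → ℕ → Carrier
  x ^ᶠ zero  = 1#
  x ^ᶠ suc k = x * (x ^ᶠ k)

  IsGenerator : Carrier → Set
  IsGenerator γ = γ ≢ 0# × (∀ x → x ≢ 0# → ∃ λ k → γ ^ᶠ k ≡ x)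

  sumᶠ : ℕ → (ℕ → Carrier) → Carrier
  sumᶠ zero    f = 0#
  sumᶠ (suc k) f = sumᶠ k f + f k

  -- Trace from F_q (q = p^s) to F_{p^ℓ}, where s = ℓ k :
  --   Tr(x) = Σ_{i=0}^{k-1} x^{p^{ℓ i}}
  Tr : (p ℓ k : ℕ) → Carrier → Carrier
  Tr p ℓ k x = sumᶠ k (λ i → x ^ᶠ (p ^ (ℓ ℕ.* i)))

  InSubfield : (p ℓ : ℕ) → Carrier → Set
  InSubfield p ℓ x = x ^ᶠ (p ^ ℓ) ≡ x

  codeword : (p ℓ k N n : ℕ) → Carrier → Carrier → Vec Carrier n
  codeword p ℓ k N n γ β = tabulate (λ (i : Fin n) → Tr p ℓ k (β * ((γ ^ᶠ N) ^ᶠ toℕ i)))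

  InCode : (p ℓ k N n : ℕ) → Carrier → Vec Carrier n → Set
  InCode p ℓ k N n γ v = ∃ λ β → codeword p ℓ k N n γ β ≡ v

  codewords : (p ℓ k N n : ℕ) → Carrier → List (Vec Carrier n)
  codewords p ℓ k N n γ =
    deduplicate (≡-dec _≟_) (List.map (codeword p ℓ k N n γ) elements)

  wt : ∀ {n} → Vec Carrier n → ℕ
  wt v = length (filter (λ x → ¬? (x ≟ 0#)) (toList v))

  weightCount : (p ℓ k N n : ℕ) → Carrier → ℕ → ℕ
  weightCount p ℓ k N n γ j =
    length (filter (λ v → wt v ℕ.≟ j) (codewords p ℓ k N n γ))

  _⊕_ : ∀ {n} → Vec Carrier n → Vec Carrier n → Vec Carrier n
  _⊕_ = Vec.zipWith _+_

  _⊙_ : ∀ {n} → Carrier → Vec Carrier n → Vec Carrier n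
  a ⊙ v = Vec.map (a *_) v

  shift : ∀ {n} → Vec Carrier n → Vec Carrier n
  shift {zero}  Vec.[]   = Vec.[]
  shift {suc n} v        = Vec.last v Vec.∷ Vec.init v

  zeroVec : ∀ {n} → Vec Carrier n
  zeroVec = Vec.replicate _ 0#

  IsCyclicSubspace : (p ℓ n : ℕ) → (Vec Carrier n → Set) → Set
  IsCyclicSubspace p ℓ n D =
      (∀ v → D v → ∀ i → InSubfield p ℓ (Vec.lookup v i))
    × D zeroVec
    × (∀ u v → D u → D v → D (u ⊕ v))
    × (∀ a v → InSubfield p ℓ a → D v → D (a ⊙ v))
    × (∀ v → D v → D (shift v))

  IsIrreducibleCyclic : (p ℓ n : ℕ) → (Vec Carrier n → Set) → Set₁
  IsIrreducibleCyclic p ℓ n D =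
      IsCyclicSubspace p ℓ n D
    × (∃ λ v → D v × v ≢ zeroVec)
    × (∀ (E : Vec Carrier n → Set) → IsCyclicSubspace p ℓ n E →
         (∀ v → E v → D v) → (∃ λ v → E v × v ≢ zeroVec) →
         ∀ v → D v → E v)

half^ : ℕ → ℕ → ℕ
half^ zero    x = x
half^ (suc k) x = half^ k ⌊ x /2⌋

-- q^{a / 2^k} = p^{s a / 2^k}  (exact under the hypotheses)
qpow : (p s a k : ℕ) → ℤ
qpow p s a k = + (p ^ half^ k (s ℕ.* a))

Ssum : (p s : ℕ) → (ℕ → ℤ) → ℕ → ℤ
Ssum p s A k = List.foldr ℤ._+_ (+ 0)
  (List.map (λ r → + (2 ^ (r ∸ 1)) ℤ.* A r ℤ.* qpow p s (2 ^ (r ∸ 2) ∸ 1) (r ∸ 1))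
            (List.map (3 ℕ.+_) (upTo (k ∸ 2))))

-- a term  coeff · X^{c·E}  of the weight enumerator is represented by (coeff , E)
Term : Set
Term = ℕ × ℤ

terms3 : (p s : ℕ) → (A B : ℕ → ℤ) → List Term
terms3 p s A B =
    (half^ 2 (q ∸ 1) , Q ℤ.- R2)
  ∷ (half^ 2 (q ∸ 1) , Q ℤ.- R2 ℤ.+ + 4 ℤ.* B 3 ℤ.* R4)
  ∷ (half^ 2 (q ∸ 1) , Q ℤ.- R2 ℤ.- + 4 ℤ.* B 3 ℤ.* R4)
  ∷ (half^ 3 (q ∸ 1) , Q ℤ.+ + 3 ℤ.* R2 ℤ.+ + 4 ℤ.* A 3 ℤ.* R4)
  ∷ (half^ 3 (q ∸ 1) , Q ℤ.+ + 3 ℤ.* R2 ℤ.- + 4 ℤ.* A 3 ℤ.* R4)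
  ∷ []
  where
  q = p ^ s
  Q = + q
  R2 = qpow p s 1 1
  R4 = qpow p s 1 2

terms≥4 : (p s m : ℕ) → (A B : ℕ → ℤ) → List Term
terms≥4 p s m A B =
    (half^ 2 (q ∸ 1) , Q ℤ.- R2 ℤ.+ + 4 ℤ.* B 3 ℤ.* qpow p s 1 2)
  ∷ (half^ 2 (q ∸ 1) , Q ℤ.- R2 ℤ.- + 4 ℤ.* B 3 ℤ.* qpow p s 1 2)
  ∷ (half^ 3 (q ∸ 1) , Q ℤ.- R2 ℤ.+ + 8 ℤ.* B 4 ℤ.* qpow p s 3 3)
  ∷ (half^ 3 (q ∸ 1) , Q ℤ.- R2 ℤ.- + 8 ℤ.* B 4 ℤ.* qpow p s 3 3)
  ∷ (concatMap middle (List.map (2 ℕ.+_) (upTo (m ∸ 4)))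
  ++ ( (half^ (m ∸ 1) (q ∸ 1) ,
          base (m ∸ 2) ℤ.+ + (2 ^ (m ∸ 2)) ℤ.* A (m ∸ 1) ℤ.* qpow p s (2 ^ (m ∸ 3) ∸ 1) (m ∸ 2))
     ∷ (half^ m (q ∸ 1) ,
          base (m ∸ 1) ℤ.+ + (2 ^ (m ∸ 1)) ℤ.* A m ℤ.* qpow p s (2 ^ (m ∸ 2) ∸ 1) (m ∸ 1))
     ∷ (half^ m (q ∸ 1) ,
          base (m ∸ 1) ℤ.- + (2 ^ (m ∸ 1)) ℤ.* A m ℤ.* qpow p s (2 ^ (m ∸ 2) ∸ 1) (m ∸ 1))
     ∷ []))
  where
  q = p ^ s
  Q = + q
  R2 = qpow p s 1 1
  base : ℕ → ℤ
  base k = Q ℤ.+ + 3 ℤ.* R2 ℤ.- Ssum p s A k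
  middle : ℕ → List Term
  middle t =
      (half^ (t ℕ.+ 2) (q ∸ 1) ,
        base t ℤ.+ + (2 ^ t) ℤ.* A (t ℕ.+ 1) ℤ.* qpow p s (2 ^ (t ∸ 1) ∸ 1) t
               ℤ.+ + (2 ^ (t ℕ.+ 2)) ℤ.* B (t ℕ.+ 3) ℤ.* qpow p s (2 ^ (t ℕ.+ 1) ∸ 1) (t ℕ.+ 2))
    ∷ (half^ (t ℕ.+ 2) (q ∸ 1) ,
        base t ℤ.+ + (2 ^ t) ℤ.* A (t ℕ.+ 1) ℤ.* qpow p s (2 ^ (t ∸ 1) ∸ 1) t
               ℤ.- + (2 ^ (t ℕ.+ 2)) ℤ.* B (t ℕ.+ 3) ℤ.* qpow p s (2 ^ (t ℕ.+ 1) ∸ 1) (t ℕ.+ 2))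
    ∷ []

-- coefficient of X^j in  1 + Σ_{(a,E)} a X^{c E},  c = (p^ℓ - 1)/(p^ℓ N):
-- a term (a,E) contributes to X^j iff  p^ℓ N j = (p^ℓ - 1) E.
enumCoeff : (p ℓ N : ℕ) → List Term → ℕ → ℕ
enumCoeff p ℓ N ts j = (if ⌊ j ℕ.≟ 0 ⌋ then 1 else 0) ℕ.+ go ts
  where
  go : List Term → ℕ
  go [] = 0
  go ((a , E) ∷ ts) =
    (if ⌊ + (p ^ ℓ ℕ.* N ℕ.* j) ℤ.≟ + (p ^ ℓ ∸ 1) ℤ.* E ⌋ then a else 0) ℕ.+ go ts

{-# OPTIONS --safe #-}
-- The weight of the codeword of β is an affine function of the Gauss period of order 2ᵐ at β⁻¹.
-- Going from order 2ʲ⁻¹ to 2ʲ adds to the reduced period 2ʲ⁻¹ times a term d_j, the contribution of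
-- the characters of exact order 2ʲ.  As p ≡ 3 (mod 8), invariance under Frobenius makes d_j vanish
-- or equal, up to sign, one of two integers x_j, y_j, so that the Gauss sum of order 2ʲ is
-- x_j + y_j√−2 (with y_j absent for j ≤ 2).
--
-- No complex characters are needed: on functions invariant under the multiplicative group K of the
-- subfield, summation against an additive character is integral, and it is a ring homomorphism (hat)
-- from additive convolution to ℤ.  Evaluating three convolutions gives x_j² + 2y_j² = q, the relation
-- (x_j + y_j√−2)² = J (x_{j−1} + y_{j−1}√−2) for a Jacobi sum J, and J = x₁ = −√q when j ≥ 4.
-- For j = 3, J modulo p is a binomial coefficient prime to p by Lucas' theorem.  Together these
-- give the exact power of p in x_j, and x_j, y_j are ±A_j, ±B_j times that power because a primitive
-- representation of a power of p by a² + 2b² is unique.  The signs of x_j for j < m follow from the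
-- integrality of the periods, read modulo powers of 2.
module Submission where

open import Defs
open import Data.Nat as ℕ using (ℕ; zero; suc; z≤n; s≤s; _∸_; _!)
import Data.Nat.Properties as ℕP
import Data.Nat.Divisibility as ∣ℕ
open ∣ℕ using (divides)
open import Data.Nat.DivMod using (_%_; _/_; m≡m%n+[m/n]*n; m%n<n; m/n*n≡m)
import Data.Integer as ℤ
open ℤ using (ℤ; -[1+_])
import Data.Integer.Properties as ℤP
import Data.Fin.Properties as FinP
open import Data.Fin as Fin using (Fin; toℕ; fromℕ; inject₁)
open import Data.Maybe as Maybe using (Maybe)
open import Data.List as List using (List; []; _∷_; length; map; applyUpTo; upTo; _++_)
import Data.List.Properties as ListP
open import Data.List.Membership.Propositional using (_∈_)
open import Data.List.Membership.Propositional.Properties using (∈-∃++; ∈-++⁻; ∈-++⁺ˡ; ∈-++⁺ʳ; ∈-map⁺)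
open import Data.List.Relation.Unary.Any using (here; there)
import Data.List.Relation.Unary.Any as Any
import Data.List.Relation.Unary.Any.Properties as AnyP
open import Data.List.Relation.Unary.All as All using (All)
import Data.List.Relation.Unary.All.Properties as AllP
open import Data.List.Relation.Unary.Unique.Propositional using (Unique)
open import Data.List.Relation.Unary.AllPairs using ([]; _∷_)
open import Data.List.Relation.Binary.Permutation.Propositional as Perm using (_↭_; ↭-refl; ↭-sym; ↭-trans; prep; ↭⇒↭ₛ)
open import Data.List.Relation.Binary.Permutation.Propositional.Properties using (↭-length; ∈-resp-↭) renaming (shift to ↭-shift)
import Data.List.Relation.Binary.Permutation.Setoid.Properties as PermS
open import Data.Product using (∃; _×_; _,_; proj₁; proj₂)
open import Data.Sum using (_⊎_; inj₁; inj₂; [_,_]′)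
open import Data.Empty using (⊥; ⊥-elim)
open import Function using (_∘_; id)
open import Relation.Nullary using (Dec; yes; no; ¬_; does)
open import Relation.Nullary.Decidable using (dec⇒maybe; ¬?; ⌊_⌋)
open import Data.Bool using (if_then_else_)
open import Algebra.Structures using (IsCommutativeSemiring; IsCommutativeRing)
import Algebra.Properties.CommutativeSemigroup as CSg
import Algebra.Properties.Ring
open import Algebra.Bundles using (CommutativeSemigroup; CommutativeRing)
open import Algebra.Solver.Ring.AlmostCommutativeRing using (fromCommutativeRing; _-Raw-AlmostCommutative⟶_)
import Algebra.Solver.Ring
open import Relation.Binary.PropositionalEquality
open import Data.Nat.Primality using (Prime; prime⇒nonZero; prime⇒nonTrivial; euclidsLemma)
import Data.Nat.Coprimality as Coprimality
open import Data.Nat.Combinatorics using (_C_; nCn≡1; nCk≡nC[n∸k]; k>n⇒nCk≡0; nCk+nC[k+1]≡[n+1]C[k+1]; nCk≡n!/k![n-k]!; k![n∸k]!∣n!)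
open import Data.Nat.GCD using (gcd; gcd[m,n]∣m; gcd[m,n]∣n; gcd-GCD; module Bézout; GCD; module GCD)
open import Data.Integer.Tactic.RingSolver using (solve-∀)
import Data.Nat.Tactic.RingSolver as ℕSolver
open import Data.Vec as Vec using (Vec; lookup; tabulate)
import Data.Vec.Properties as VecP
import Data.List.Relation.Unary.Unique.Propositional.Properties as UniqueP

-- Integrality comes from 2^m dividing (q-1)/(p^ℓ-1): every character of order dividing 2^m is then
-- trivial on K, so an additive character may be replaced by any function with the same average over
-- K. The difference `ω` of the indicators of 0 and 1 is one. The price is that convolution kernels
-- must be K-invariant in each variable separately. For j ≥ 3 the powers of p modulo 2^j are the
-- residues 1 and 3 modulo 8; the field they fix is ℚ(√-2), with √-2 = ζ + ζ³ for ζ of order 8.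
-- Exponents of γ modulo 2^j stand for powers of a root of unity, and Frobenius invariance leaves
-- two integers per level. From level 4 on χρ, with ρ quadratic, is a Frobenius conjugate of χ,
-- because 1 + 2^(j-1) is 1 modulo 8; this makes the Jacobi sum J(χ, ρ) collapse to the Gauss sum of
-- ρ. At level 3 that residue is 5, so J has to be studied modulo p instead. The residue of x_j
-- modulo 4 is read from the period of order 2^(j+1). Hence the sign of x_m stays open, as do the
-- signs of all y_j; the enumerator contains both signs with equal coefficients.

-- The pigeonhole principle, in the form that turns a surjective reindexing into a permutation.
unique-⊆⇒↭ : {X : Set} (xs ys : List X) → Unique xs → (∀ {x} → x ∈ xs → x ∈ ys) →
  length ys ℕ.≤ length xs → xs ↭ ys
unique-⊆⇒↭ [] [] _ _ _ = ↭-refl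
unique-⊆⇒↭ (x ∷ xs) ys (x∉xs ∷ u) sub len with ∈-∃++ (sub (here refl))
... | as , bs , refl = ↭-trans (prep x rec) (↭-sym (↭-shift x as bs))
  where
  sub′ : ∀ {y} → y ∈ xs → y ∈ as ++ bs
  sub′ {y} y∈ with ∈-++⁻ as (sub (there y∈))
  ... | inj₁ p = ∈-++⁺ˡ p
  ... | inj₂ (here y≡x) = ⊥-elim (All.lookup x∉xs y∈ (sym y≡x))
  ... | inj₂ (there p) = ∈-++⁺ʳ as p
  len′ : length (as ++ bs) ℕ.≤ length xs
  len′ = ℕP.≤-pred (subst (ℕ._≤ suc (length xs)) (↭-length (↭-shift x as bs)) len)
  rec : xs ↭ as ++ bs
  rec = unique-⊆⇒↭ xs (as ++ bs) u sub′ len′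

-- Finite sums in a commutative semiring.

module Sum {A : Set} {_+_ _*_ : A → A → A} {0# 1# : A}
           (isCS : IsCommutativeSemiring _≡_ _+_ _*_ 0# 1#) where
  open IsCommutativeSemiring isCS using (+-assoc; +-comm; +-identityˡ; +-identityʳ;
    *-identityˡ; distribˡ; distribʳ; zeroˡ; zeroʳ; *-comm; *-assoc)
  private
    +-sg : CommutativeSemigroup _ _
    +-sg = record { isCommutativeSemigroup = IsCommutativeSemiring.+-isCommutativeSemigroup isCS }
    open CSg +-sg using (interchange; x∙yz≈y∙xz)

  ι : ℕ → A
  ι zero = 0#
  ι (suc n) = 1# + ι n

  𝟙 : {P : Set} → Dec P → A
  𝟙 d = if does d then 1# else 0#

  𝟙-yes : {P : Set} (d : Dec P) → P → 𝟙 d ≡ 1#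
  𝟙-yes (yes _) _ = refl
  𝟙-yes (no ¬p) p = ⊥-elim (¬p p)

  𝟙-no : {P : Set} (d : Dec P) → ¬ P → 𝟙 d ≡ 0#
  𝟙-no (yes p) ¬p = ⊥-elim (¬p p)
  𝟙-no (no _) _ = refl

  𝟙-cong : {P Q : Set} (d : Dec P) (e : Dec Q) → (P → Q) → (Q → P) → 𝟙 d ≡ 𝟙 e
  𝟙-cong (yes p) e f g = sym (𝟙-yes e (f p))
  𝟙-cong (no ¬p) e f g = sym (𝟙-no e (¬p ∘ g))

  ι-+ : ∀ a b → ι (a ℕ.+ b) ≡ ι a + ι b
  ι-+ zero b = sym (+-identityˡ _)
  ι-+ (suc a) b = trans (cong (1# +_) (ι-+ a b)) (sym (+-assoc _ _ _))

  ι-* : ∀ a b → ι (a ℕ.* b) ≡ ι a * ι b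
  ι-* zero b = sym (zeroˡ _)
  ι-* (suc a) b = trans (ι-+ b (a ℕ.* b)) (trans (cong₂ _+_ (sym (*-identityˡ _)) (ι-* a b)) (sym (distribʳ _ _ _)))

  module _ {X : Set} where
    ΣL : List X → (X → A) → A
    ΣL [] f = 0#
    ΣL (x ∷ xs) f = f x + ΣL xs f

    ΣL-cong : ∀ xs {f g : X → A} → (∀ x → f x ≡ g x) → ΣL xs f ≡ ΣL xs g
    ΣL-cong [] e = refl
    ΣL-cong (x ∷ xs) e = cong₂ _+_ (e x) (ΣL-cong xs e)

    ΣL-0 : ∀ xs {f : X → A} → (∀ x → f x ≡ 0#) → ΣL xs f ≡ 0#
    ΣL-0 [] e = refl
    ΣL-0 (x ∷ xs) e = trans (cong₂ _+_ (e x) (ΣL-0 xs e)) (+-identityˡ _)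

    ΣL-+ : ∀ xs (f g : X → A) → ΣL xs (λ x → f x + g x) ≡ ΣL xs f + ΣL xs g
    ΣL-+ [] f g = sym (+-identityˡ _)
    ΣL-+ (x ∷ xs) f g = trans (cong ((f x + g x) +_) (ΣL-+ xs f g)) (interchange _ _ _ _)

    ΣL-*ˡ : ∀ xs c (f : X → A) → ΣL xs (λ x → c * f x) ≡ c * ΣL xs f
    ΣL-*ˡ [] c f = sym (zeroʳ c)
    ΣL-*ˡ (x ∷ xs) c f = trans (cong ((c * f x) +_) (ΣL-*ˡ xs c f)) (sym (distribˡ _ _ _))

    ΣL-*ʳ : ∀ xs c (f : X → A) → ΣL xs (λ x → f x * c) ≡ ΣL xs f * c
    ΣL-*ʳ xs c f = trans (ΣL-cong xs λ x → *-comm _ _) (trans (ΣL-*ˡ xs c f) (*-comm _ _))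

    ΣL-↭ : ∀ {xs ys} (f : X → A) → xs ↭ ys → ΣL xs f ≡ ΣL ys f
    ΣL-↭ f Perm.refl = refl
    ΣL-↭ f (Perm.prep x p) = cong (f x +_) (ΣL-↭ f p)
    ΣL-↭ f (Perm.swap x y p) = trans (cong (λ z → f x + (f y + z)) (ΣL-↭ f p)) (x∙yz≈y∙xz _ _ _)
    ΣL-↭ f (Perm.trans p q) = trans (ΣL-↭ f p) (ΣL-↭ f q)

    ΣL-const : ∀ (xs : List X) c → ΣL xs (λ _ → c) ≡ ι (length xs) * c
    ΣL-const [] c = sym (zeroˡ c)
    ΣL-const (x ∷ xs) c = trans (cong₂ _+_ (sym (*-identityˡ c)) (ΣL-const xs c)) (sym (distribʳ _ _ _))

  ΣL-map : {X Y : Set} (g : X → Y) (xs : List X) (f : Y → A) → ΣL (map g xs) f ≡ ΣL xs (f ∘ g)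
  ΣL-map g [] f = refl
  ΣL-map g (x ∷ xs) f = cong (f (g x) +_) (ΣL-map g xs f)

  ΣL-swap : {X Y : Set} (xs : List X) (ys : List Y) (f : X → Y → A) →
    ΣL xs (λ x → ΣL ys (f x)) ≡ ΣL ys (λ y → ΣL xs (λ x → f x y))
  ΣL-swap [] ys f = sym (ΣL-0 ys λ _ → refl)
  ΣL-swap (x ∷ xs) ys f = trans (cong (ΣL ys (f x) +_) (ΣL-swap xs ys f)) (sym (ΣL-+ ys _ _))

  Σ< : ℕ → (ℕ → A) → A
  Σ< zero f = 0#
  Σ< (suc n) f = f 0 + Σ< n (f ∘ suc)

  ΣL-applyUpTo : {X : Set} (g : ℕ → X) (n : ℕ) (f : X → A) → ΣL (applyUpTo g n) f ≡ Σ< n (f ∘ g)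
  ΣL-applyUpTo g zero f = refl
  ΣL-applyUpTo g (suc n) f = cong (f (g 0) +_) (ΣL-applyUpTo (g ∘ suc) n f)

  Σ<-cong : ∀ n {f g : ℕ → A} → (∀ i → i ℕ.< n → f i ≡ g i) → Σ< n f ≡ Σ< n g
  Σ<-cong zero e = refl
  Σ<-cong (suc n) e = cong₂ _+_ (e 0 (s≤s z≤n)) (Σ<-cong n λ i i<n → e (suc i) (s≤s i<n))

  Σ<-0 : ∀ n {f : ℕ → A} → (∀ i → i ℕ.< n → f i ≡ 0#) → Σ< n f ≡ 0#
  Σ<-0 zero e = refl
  Σ<-0 (suc n) e = trans (cong₂ _+_ (e 0 (s≤s z≤n)) (Σ<-0 n λ i i<n → e (suc i) (s≤s i<n))) (+-identityˡ _)

  Σ<-+ : ∀ n (f g : ℕ → A) → Σ< n (λ i → f i + g i) ≡ Σ< n f + Σ< n g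
  Σ<-+ zero f g = sym (+-identityˡ _)
  Σ<-+ (suc n) f g = trans (cong ((f 0 + g 0) +_) (Σ<-+ n (f ∘ suc) (g ∘ suc))) (interchange _ _ _ _)

  Σ<-*ˡ : ∀ n c (f : ℕ → A) → Σ< n (λ i → c * f i) ≡ c * Σ< n f
  Σ<-*ˡ zero c f = sym (zeroʳ c)
  Σ<-*ˡ (suc n) c f = trans (cong ((c * f 0) +_) (Σ<-*ˡ n c (f ∘ suc))) (sym (distribˡ _ _ _))

  Σ<-const : ∀ n c → Σ< n (λ _ → c) ≡ ι n * c
  Σ<-const zero c = sym (zeroˡ c)
  Σ<-const (suc n) c = trans (cong₂ _+_ (sym (*-identityˡ c)) (Σ<-const n c)) (sym (distribʳ _ _ _))

  Σ<-swapL : {X : Set} (n : ℕ) (xs : List X) (f : ℕ → X → A) →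
    Σ< n (λ i → ΣL xs (f i)) ≡ ΣL xs (λ x → Σ< n (λ i → f i x))
  Σ<-swapL zero xs f = sym (ΣL-0 xs λ _ → refl)
  Σ<-swapL (suc n) xs f = trans (cong (ΣL xs (f 0) +_) (Σ<-swapL n xs (f ∘ suc))) (sym (ΣL-+ xs _ _))

  Σ<-swap : (n k : ℕ) (f : ℕ → ℕ → A) →
    Σ< n (λ i → Σ< k (f i)) ≡ Σ< k (λ j → Σ< n (λ i → f i j))
  Σ<-swap zero k f = sym (Σ<-0 k λ _ _ → refl)
  Σ<-swap (suc n) k f = trans (cong (Σ< k (f 0) +_) (Σ<-swap n k (f ∘ suc))) (sym (Σ<-+ k _ _))

  Σ<-++ : ∀ a b (f : ℕ → A) → Σ< (a ℕ.+ b) f ≡ Σ< a f + Σ< b (λ i → f (a ℕ.+ i))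
  Σ<-++ zero b f = sym (+-identityˡ _)
  Σ<-++ (suc a) b f = trans (cong (f 0 +_) (Σ<-++ a b (f ∘ suc))) (sym (+-assoc _ _ _))

  Σ<-snoc : ∀ n (f : ℕ → A) → Σ< (suc n) f ≡ Σ< n f + f n
  Σ<-snoc zero f = +-comm _ _
  Σ<-snoc (suc n) f = trans (cong (f 0 +_) (Σ<-snoc n (f ∘ suc))) (sym (+-assoc _ _ _))

  Σ<-even-odd : ∀ n (f : ℕ → A) →
    Σ< (n ℕ.* 2) f ≡ Σ< n (λ i → f (i ℕ.* 2)) + Σ< n (λ i → f (suc (i ℕ.* 2)))
  Σ<-even-odd zero f = sym (+-identityˡ _)
  Σ<-even-odd (suc n) f = trans (sym (+-assoc _ _ _))
    (trans (cong ((f 0 + f 1) +_) (Σ<-even-odd n (λ i → f (suc (suc i))))) (interchange _ _ _ _))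

  Σ<-rotate : ∀ n (f : ℕ → A) → f n ≡ f 0 → Σ< n (f ∘ suc) ≡ Σ< n f
  Σ<-rotate zero f e = refl
  Σ<-rotate (suc n) f e = trans (Σ<-snoc n (f ∘ suc)) (trans (+-comm _ _) (cong (_+ Σ< n (f ∘ suc)) e))

  Σ<-periodic : ∀ a b (f : ℕ → A) → (∀ e → f (b ℕ.+ e) ≡ f e) → Σ< (a ℕ.* b) f ≡ ι a * Σ< b f
  Σ<-periodic zero b f per = sym (zeroˡ _)
  Σ<-periodic (suc a) b f per = begin
    Σ< (b ℕ.+ a ℕ.* b) f                             ≡⟨ Σ<-++ b (a ℕ.* b) f ⟩
    Σ< b f + Σ< (a ℕ.* b) (λ i → f (b ℕ.+ i))          ≡⟨ cong (Σ< b f +_) (Σ<-cong (a ℕ.* b) λ i _ → per i) ⟩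
    Σ< b f + Σ< (a ℕ.* b) f                          ≡⟨ cong₂ _+_ (sym (*-identityˡ _)) (Σ<-periodic a b f per) ⟩
    (1# * Σ< b f) + (ι a * Σ< b f)                   ≡⟨ sym (distribʳ _ _ _) ⟩
    (1# + ι a) * Σ< b f                              ∎
    where open ≡-Reasoning

-- Arithmetic of a finite field and sums over its elements.

module FieldBase (F : FiniteField) where
  open FiniteField F public
  open IsCommutativeRing isCommutativeRing public using (isCommutativeSemiring; +-assoc; +-comm; +-identityˡ; +-identityʳ;
    *-identityˡ; *-identityʳ; distribˡ; distribʳ; zeroˡ; zeroʳ; *-comm; *-assoc; -‿inverseˡ; -‿inverseʳ; +-congˡ; +-congʳ; *-congˡ; *-congʳ)
  commutativeRing : CommutativeRing _ _
  commutativeRing = record { isCommutativeRing = isCommutativeRing }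
  open Algebra.Properties.Ring (CommutativeRing.ring commutativeRing) public
    using (-‿distribˡ-*; -‿distribʳ-*; -‿involutive; -0#≈0#; -‿+-comm)

  module SF = Sum isCommutativeSemiring
  open SF public using (ι; ι-+; ι-*)

  -- Also the coefficient map of the ring solver below; the separate clause for 1 makes ιℤ 1 reduce to 1#.
  ιℤ : ℤ → Carrier
  ιℤ (ℤ.+ 0) = 0#
  ιℤ (ℤ.+ 1) = 1#
  ιℤ (ℤ.+ suc (suc n)) = ι (suc (suc n))
  ιℤ -[1+ n ] = - ι (suc n)

  ιℤ-pos : ∀ n → ιℤ (ℤ.+ n) ≡ ι n
  ιℤ-pos 0 = refl
  ιℤ-pos 1 = sym (+-identityʳ 1#)
  ιℤ-pos (suc (suc n)) = refl

  private
    +-commutativeSemigroup : CommutativeSemigroup _ _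
    +-commutativeSemigroup = record { isCommutativeSemigroup = IsCommutativeSemiring.+-isCommutativeSemigroup isCommutativeSemiring }

    neg-zero : - 0# ≡ 0#
    neg-zero = -0#≈0#

  ιℤ-⊖ : ∀ m n → ιℤ (m ℤ.⊖ n) ≡ ι m + (- ι n)
  ιℤ-⊖ zero zero = sym (trans (+-identityˡ _) neg-zero)
  ιℤ-⊖ zero (suc n) = sym (+-identityˡ _)
  ιℤ-⊖ (suc m) zero = trans (ιℤ-pos (suc m)) (sym (trans (cong (ι (suc m) +_) neg-zero) (+-identityʳ _)))
  ιℤ-⊖ (suc m) (suc n) = trans (cong ιℤ (ℤP.[1+m]⊖[1+n]≡m⊖n m n)) (trans (ιℤ-⊖ m n) (begin
    ι m + (- ι n)                              ≡⟨ sym (+-identityˡ _) ⟩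
    0# + (ι m + (- ι n))                       ≡⟨ +-congʳ (sym (-‿inverseʳ 1#)) ⟩
    (1# + (- 1#)) + (ι m + (- ι n))            ≡⟨ interchange _ _ _ _ ⟩
    (1# + ι m) + ((- 1#) + (- ι n))            ≡⟨ +-congˡ (-‿+-comm 1# (ι n)) ⟩
    (1# + ι m) + (- (1# + ι n))                ∎))
    where
    open ≡-Reasoning
    open CSg +-commutativeSemigroup using (interchange)

  ιℤ-+ : ∀ x y → ιℤ (x ℤ.+ y) ≡ ιℤ x + ιℤ y
  ιℤ-+ (ℤ.+ m) (ℤ.+ n) = trans (ιℤ-pos (m ℕ.+ n)) (trans (ι-+ m n) (sym (cong₂ _+_ (ιℤ-pos m) (ιℤ-pos n))))
  ιℤ-+ (ℤ.+ m) -[1+ n ] = trans (ιℤ-⊖ m (suc n)) (+-congʳ (sym (ιℤ-pos m)))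
  ιℤ-+ -[1+ m ] (ℤ.+ n) = trans (ιℤ-⊖ n (suc m)) (trans (+-comm _ _) (+-congˡ (sym (ιℤ-pos n))))
  ιℤ-+ -[1+ m ] -[1+ n ] = trans (cong -_ (trans (cong (λ k → 1# + ι k) (sym (ℕP.+-suc m n))) (ι-+ (suc m) (suc n))))
                                 (sym (-‿+-comm _ _))

  ιℤ-neg : ∀ x → ιℤ (ℤ.- x) ≡ - ιℤ x
  ιℤ-neg (ℤ.+ zero) = sym neg-zero
  ιℤ-neg (ℤ.+ suc n) = cong -_ (sym (ιℤ-pos (suc n)))
  ιℤ-neg -[1+ n ] = trans (ιℤ-pos (suc n)) (sym (-‿involutive _))

  private
    ιℤ-*ℕ : ∀ m y → ιℤ (ℤ.+ m ℤ.* y) ≡ ι m * ιℤ y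
    ιℤ-*ℕ m (ℤ.+ n) = trans (cong ιℤ (sym (ℤP.pos-* m n)))
      (trans (ιℤ-pos (m ℕ.* n)) (trans (ι-* m n) (*-congˡ (sym (ιℤ-pos n)))))
    ιℤ-*ℕ m -[1+ n ] = begin
      ιℤ (ℤ.+ m ℤ.* -[1+ n ])       ≡⟨ cong ιℤ (sym (ℤP.neg-distribʳ-* (ℤ.+ m) (ℤ.+ suc n))) ⟩
      ιℤ (ℤ.- (ℤ.+ m ℤ.* ℤ.+ suc n))  ≡⟨ ιℤ-neg (ℤ.+ m ℤ.* ℤ.+ suc n) ⟩
      - ιℤ (ℤ.+ m ℤ.* ℤ.+ suc n)      ≡⟨ cong -_ (ιℤ-*ℕ m (ℤ.+ suc n)) ⟩
      - (ι m * ιℤ (ℤ.+ suc n))      ≡⟨ cong (λ z → - (ι m * z)) (ιℤ-pos (suc n)) ⟩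
      - (ι m * ι (suc n))         ≡⟨ -‿distribʳ-* _ _ ⟩
      ι m * (- ι (suc n))         ∎
      where open ≡-Reasoning

  ιℤ-* : ∀ x y → ιℤ (x ℤ.* y) ≡ ιℤ x * ιℤ y
  ιℤ-* (ℤ.+ m) y = trans (ιℤ-*ℕ m y) (*-congʳ (sym (ιℤ-pos m)))
  ιℤ-* -[1+ m ] y = begin
    ιℤ (-[1+ m ] ℤ.* y)       ≡⟨ cong ιℤ (sym (ℤP.neg-distribˡ-* (ℤ.+ suc m) y)) ⟩
    ιℤ (ℤ.- (ℤ.+ suc m ℤ.* y))  ≡⟨ ιℤ-neg (ℤ.+ suc m ℤ.* y) ⟩
    - ιℤ (ℤ.+ suc m ℤ.* y)      ≡⟨ cong -_ (ιℤ-*ℕ (suc m) y) ⟩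
    - (ι (suc m) * ιℤ y)      ≡⟨ -‿distribˡ-* _ _ ⟩
    (- ι (suc m)) * ιℤ y      ∎
    where open ≡-Reasoning

  private
    acr = fromCommutativeRing commutativeRing
    morphism : CommutativeRing.rawRing ℤP.+-*-commutativeRing -Raw-AlmostCommutative⟶ acr
    morphism = record { ⟦_⟧ = ιℤ ; +-homo = ιℤ-+ ; *-homo = ιℤ-* ; -‿homo = ιℤ-neg
                      ; 0-homo = refl ; 1-homo = refl }
  module FSolver = Algebra.Solver.Ring (CommutativeRing.rawRing ℤP.+-*-commutativeRing) acr morphism
    (λ x y → Maybe.map (cong ιℤ) (dec⇒maybe (x ℤ.≟ y)))

  infixl 6 _−_
  _−_ : Carrier → Carrier → Carrier
  x − y = x + (- y)

  ^-+ : ∀ x a b → x ^ᶠ (a ℕ.+ b) ≡ (x ^ᶠ a) * (x ^ᶠ b)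
  ^-+ x zero b = sym (*-identityˡ _)
  ^-+ x (suc a) b = trans (cong (x *_) (^-+ x a b)) (sym (*-assoc _ _ _))

  1^ : ∀ n → 1# ^ᶠ n ≡ 1#
  1^ zero = refl
  1^ (suc n) = trans (*-identityˡ _) (1^ n)

  *-^ : ∀ x y n → (x * y) ^ᶠ n ≡ (x ^ᶠ n) * (y ^ᶠ n)
  *-^ x y zero = sym (*-identityˡ _)
  *-^ x y (suc n) = trans (cong ((x * y) *_) (*-^ x y n))
    (solve 4 (λ a b c d → (a :* b) :* (c :* d) := (a :* c) :* (b :* d)) refl x y _ _)
    where open FSolver

  ^-* : ∀ x a b → x ^ᶠ (a ℕ.* b) ≡ (x ^ᶠ a) ^ᶠ b
  ^-* x zero b = sym (1^ b)
  ^-* x (suc a) b = trans (^-+ x b (a ℕ.* b)) (trans (cong ((x ^ᶠ b) *_) (^-* x a b)) (sym (*-^ x _ b)))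

  ^-comm : ∀ x a b → (x ^ᶠ a) ^ᶠ b ≡ (x ^ᶠ b) ^ᶠ a
  ^-comm x a b = trans (sym (^-* x a b)) (trans (cong (x ^ᶠ_) (ℕP.*-comm a b)) (^-* x b a))

  0^ : ∀ n → 0 ℕ.< n → 0# ^ᶠ n ≡ 0#
  0^ (suc n) _ = zeroˡ _

  -- The value inv 0 = 0 makes inv an involution of the whole field.
  inv : Carrier → Carrier
  inv x with x ≟ 0#
  ... | yes _ = 0#
  ... | no ¬0 = proj₁ (inverse x ¬0)

  inv-r : ∀ {x} → x ≢ 0# → x * inv x ≡ 1#
  inv-r {x} x≢0 with x ≟ 0#
  ... | yes e = ⊥-elim (x≢0 e)
  ... | no ¬0 = proj₂ (inverse x ¬0)

  inv-l : ∀ {x} → x ≢ 0# → inv x * x ≡ 1#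
  inv-l x≢0 = trans (*-comm _ _) (inv-r x≢0)

  1≢0 : 1# ≢ 0#
  1≢0 e = 0≢1 (sym e)

  inv-cancel : ∀ {x} y → x ≢ 0# → x * (inv x * y) ≡ y
  inv-cancel y x≢0 = trans (sym (*-assoc _ _ _)) (trans (cong (_* y) (inv-r x≢0)) (*-identityˡ y))

  *-cancelˡ : ∀ {x y z} → x ≢ 0# → x * y ≡ x * z → y ≡ z
  *-cancelˡ {x} {y} {z} x≢0 e = trans (sym (l y)) (trans (cong (inv x *_) e) (l z))
    where
    l : ∀ y → inv x * (x * y) ≡ y
    l y = trans (sym (*-assoc _ _ _)) (trans (cong (_* y) (inv-l x≢0)) (*-identityˡ y))

  *-≢0 : ∀ {x y} → x ≢ 0# → y ≢ 0# → x * y ≢ 0#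
  *-≢0 x≢0 y≢0 e = y≢0 (*-cancelˡ x≢0 (trans e (sym (zeroʳ _))))

  ^-≢0 : ∀ {x} n → x ≢ 0# → x ^ᶠ n ≢ 0#
  ^-≢0 zero x≢0 = 1≢0
  ^-≢0 (suc n) x≢0 = *-≢0 x≢0 (^-≢0 n x≢0)

  inv-≢0 : ∀ {x} → x ≢ 0# → inv x ≢ 0#
  inv-≢0 {x} x≢0 e = 1≢0 (trans (sym (inv-r x≢0)) (trans (cong (x *_) e) (zeroʳ x)))

  integral : ∀ {x y} → x * y ≡ 0# → x ≡ 0# ⊎ y ≡ 0#
  integral {x} {y} e with x ≟ 0# | y ≟ 0#
  ... | yes p | _ = inj₁ p
  ... | no _ | yes p = inj₂ p
  ... | no p | no p′ = ⊥-elim (*-≢0 p p′ e)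

  −≡0 : ∀ {x y} → x − y ≡ 0# → x ≡ y
  −≡0 {x} {y} e = trans (solve 2 (λ x y → x := (x :- y) :+ y) refl x y) (trans (cong (_+ y) e) (+-identityˡ y))
    where open FSolver

  ≡⇒−≡0 : ∀ {x y} → x ≡ y → x − y ≡ 0#
  ≡⇒−≡0 refl = -‿inverseʳ _

  square≡1 : ∀ {x} → x * x ≡ 1# → x ≡ 1# ⊎ x ≡ - 1#
  square≡1 {x} e with integral {x − 1#} {x + 1#}
    (trans (solve 1 (λ x → (x :- con (ℤ.+ 1)) :* (x :+ con (ℤ.+ 1)) := x :* x :- con (ℤ.+ 1)) refl x) (≡⇒−≡0 e))
    where open FSolver
  ... | inj₁ p = inj₁ (−≡0 p)
  ... | inj₂ p = inj₂ (−≡0 (trans (cong (x +_) (-‿involutive 1#)) p))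

  module FieldSum {A : Set} {_⊞_ _⊠_ : A → A → A} {0A 1A : A}
                  (isCS : IsCommutativeSemiring _≡_ _⊞_ _⊠_ 0A 1A) where
    open Sum isCS public
    open IsCommutativeSemiring isCS using () renaming (+-identityˡ to +-idˡ; +-identityʳ to +-idʳ; *-identityˡ to *-idˡ; zeroˡ to 0*)

    ΣF : (Carrier → A) → A
    ΣF = ΣL elements

    -- A right inverse suffices: it makes `σ` surjective, and `unique-⊆⇒↭` turns a surjection of a
    -- finite set into a permutation.
    ΣF-reindex : (σ τ : Carrier → Carrier) → (∀ x → σ (τ x) ≡ x) → (f : Carrier → A) →
      ΣF (λ x → f (σ x)) ≡ ΣF f
    ΣF-reindex σ τ inverse f = trans (sym (ΣL-map σ elements f)) (sym (ΣL-↭ f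
      (unique-⊆⇒↭ elements (map σ elements) unique
        (λ {x} _ → subst (_∈ map σ elements) (inverse x) (∈-map⁺ σ (complete (τ x))))
        (ℕP.≤-reflexive (ListP.length-map σ elements)))))

    ΣF-δ : ∀ a (f : Carrier → A) → ΣF (λ x → 𝟙 (x ≟ a) ⊠ f x) ≡ f a
    ΣF-δ a f = go elements unique (complete a)
      where
      none : ∀ xs → All (a ≢_) xs → ΣL xs (λ x → 𝟙 (x ≟ a) ⊠ f x) ≡ 0A
      none [] _ = refl
      none (x ∷ xs) (a≢x All.∷ rest) = trans (cong₂ _⊞_ (trans (cong (_⊠ f x) (𝟙-no (x ≟ a) (a≢x ∘ sym))) (0* _)) (none xs rest)) (+-idˡ _)
      go : ∀ xs → Unique xs → a ∈ xs → ΣL xs (λ x → 𝟙 (x ≟ a) ⊠ f x) ≡ f a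
      go (x ∷ xs) (x∉ ∷ u) (here refl) = trans (cong₂ _⊞_ (trans (cong (_⊠ f x) (𝟙-yes (x ≟ a) refl)) (*-idˡ _)) (none xs x∉)) (+-idʳ _)
      go (x ∷ xs) (x∉ ∷ u) (there a∈) = trans (cong₂ _⊞_ (trans (cong (_⊠ f x) (𝟙-no (x ≟ a) (All.lookup x∉ a∈))) (0* _)) (go xs u a∈)) (+-idˡ _)

    ΣF-scale : ∀ {c} → c ≢ 0# → (f : Carrier → A) → ΣF (λ x → f (c * x)) ≡ ΣF f
    ΣF-scale {c} c≢0 f = ΣF-reindex (c *_) (inv c *_) (λ x → inv-cancel x c≢0) f

    ΣF-translate : ∀ c (f : Carrier → A) → ΣF (λ x → f (x + c)) ≡ ΣF f
    ΣF-translate c f = ΣF-reindex (_+ c) (_− c)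
      (λ x → solve 2 (λ x c → (x :- c) :+ c := x) refl x c) f
      where open FSolver

    ΣF-reflect : ∀ c (f : Carrier → A) → ΣF (λ x → f (c − x)) ≡ ΣF f
    ΣF-reflect c f = ΣF-reindex (λ x → c − x) (λ x → c − x)
      (λ x → solve 2 (λ x c → c :- (c :- x) := x) refl x c) f
      where open FSolver

-- The cyclic group of nonzero elements and power sums.

module CyclicField (F : FiniteField) (γ : FiniteField.Carrier F) (gen : FiniteField.IsGenerator F γ)
                   (q₁ : ℕ) (card≡ : FiniteField.card F ≡ suc q₁) where
  open FieldBase F public

  γ≢0 : γ ≢ 0#
  γ≢0 = proj₁ gen

  private
    nonzeros : ∃ λ xs → elements ↭ 0# ∷ xs
    nonzeros with ∈-∃++ (complete 0#)
    ... | as , bs , e = as ++ bs , subst (_↭ 0# ∷ (as ++ bs)) (sym e) (↭-shift 0# as bs)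

    nz = proj₁ nonzeros

    length-nz : length nz ≡ q₁
    length-nz = ℕP.suc-injective (trans (sym (↭-length (proj₂ nonzeros))) card≡)

    ∈nz : ∀ {x} → x ≢ 0# → x ∈ nz
    ∈nz {x} x≢0 with ∈-resp-↭ (proj₂ nonzeros) (complete x)
    ... | here e = ⊥-elim (x≢0 e)
    ... | there p = p

    collision : ∃ λ o → (0 ℕ.< o) × (o ℕ.≤ q₁) × γ ^ᶠ o ≡ 1#
    collision with FinP.pigeonhole {length nz} {suc (length nz)} (ℕP.n<1+n _)
                     (λ i → Any.index (∈nz (^-≢0 (toℕ i) γ≢0)))
    ... | i , j , i<j , e = toℕ j ∸ toℕ i , ℕP.m<n⇒0<n∸m i<j ,
        ℕP.≤-trans (ℕP.m∸n≤m (toℕ j) (toℕ i)) (ℕP.≤-trans (FinP.toℕ≤pred[n] j) (ℕP.≤-reflexive length-nz)) ,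
        *-cancelˡ (^-≢0 (toℕ i) γ≢0) (trans (sym (^-+ γ (toℕ i) _)) (trans (cong (γ ^ᶠ_) (ℕP.m+[n∸m]≡n (ℕP.<⇒≤ i<j)))
          (trans (sym same) (sym (*-identityʳ _)))))
      where
      same : γ ^ᶠ toℕ i ≡ γ ^ᶠ toℕ j
      same = trans (AnyP.lookup-index (∈nz (^-≢0 (toℕ i) γ≢0)))
        (trans (cong (List.lookup nz) e) (sym (AnyP.lookup-index (∈nz (^-≢0 (toℕ j) γ≢0)))))

    ^-% : ∀ o .{{_ : ℕ.NonZero o}} → γ ^ᶠ o ≡ 1# → ∀ e → γ ^ᶠ e ≡ γ ^ᶠ (e % o)
    ^-% o γᵒ e = trans (cong (γ ^ᶠ_) (trans (m≡m%n+[m/n]*n e o) (cong (e % o ℕ.+_) (ℕP.*-comm (e / o) o))))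
      (trans (^-+ γ (e % o) _) (trans (*-congˡ (trans (^-* γ o (e / o)) (trans (cong (_^ᶠ (e / o)) γᵒ) (1^ (e / o))))) (*-identityʳ _)))

    -- Reducing logarithms modulo o shows that 0 and the first o powers of γ exhaust F. Comparing
    -- lengths then forces the o found in `collision` to be q - 1.
    enumeration : ∀ o → 0 ℕ.< o → o ℕ.≤ q₁ → γ ^ᶠ o ≡ 1# → elements ↭ 0# ∷ applyUpTo (γ ^ᶠ_) o
    enumeration o@(suc _) 0<o o≤ γᵒ = unique-⊆⇒↭ _ _ unique (λ {x} _ → mem x) len
      where
      len : suc (length (applyUpTo (γ ^ᶠ_) o)) ℕ.≤ length elements
      len = subst₂ ℕ._≤_ (cong suc (sym (ListP.length-applyUpTo (γ ^ᶠ_) o))) (sym card≡) (s≤s o≤)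
      mem : ∀ x → x ∈ 0# ∷ applyUpTo (γ ^ᶠ_) o
      mem x with x ≟ 0#
      ... | yes e = here e
      ... | no x≢0 with proj₂ gen x x≢0
      ... | e , γᵉ = there (AnyP.applyUpTo⁺ (γ ^ᶠ_) (trans (sym γᵉ) (^-% o γᵒ e)) (m%n<n e o))

    order : (0 ℕ.< q₁) × (γ ^ᶠ q₁ ≡ 1#)
    order with collision
    ... | o , 0<o , o≤ , γᵒ = subst (λ z → (0 ℕ.< z) × (γ ^ᶠ z ≡ 1#)) o≡ (0<o , γᵒ)
      where
      o≡ : o ≡ q₁
      o≡ = ℕP.suc-injective (trans (cong suc (sym (ListP.length-applyUpTo (γ ^ᶠ_) o)))
        (trans (sym (↭-length (enumeration o 0<o o≤ γᵒ))) card≡))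

  0<q₁ : 0 ℕ.< q₁
  0<q₁ = proj₁ order

  γ^q₁ : γ ^ᶠ q₁ ≡ 1#
  γ^q₁ = proj₂ order

  elements↭powers : elements ↭ 0# ∷ applyUpTo (γ ^ᶠ_) q₁
  elements↭powers = enumeration q₁ 0<q₁ ℕP.≤-refl γ^q₁

  log : ∀ x → x ≢ 0# → ∃ λ e → γ ^ᶠ e ≡ x
  log = proj₂ gen

  x^q₁ : ∀ {x} → x ≢ 0# → x ^ᶠ q₁ ≡ 1#
  x^q₁ x≢0 with log _ x≢0
  ... | e , refl = trans (^-comm γ e q₁) (trans (cong (_^ᶠ e) γ^q₁) (1^ e))

  x^q : ∀ x → x ^ᶠ suc q₁ ≡ x
  x^q x with x ≟ 0#
  ... | yes refl = zeroˡ _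
  ... | no x≢0 = trans (cong (x *_) (x^q₁ x≢0)) (*-identityʳ x)

  γ^≡1⇒∣ : ∀ e → γ ^ᶠ e ≡ 1# → q₁ ∣ℕ.∣ e
  γ^≡1⇒∣ e γᵉ = ∣ℕ.m%n≡0⇒n∣m e q₁ (zero-rem (e % q₁) (m%n<n e q₁) (trans (sym (^-% q₁ γ^q₁ e)) γᵉ))
    where
    instance
      q₁≢0 : ℕ.NonZero q₁
      q₁≢0 = ℕ.>-nonZero 0<q₁
    distinct : ∀ n r → r ℕ.< n → Unique (0# ∷ applyUpTo (γ ^ᶠ_) n) → γ ^ᶠ r ≡ 1# → r ≡ 0
    distinct _ zero _ _ _ = refl
    distinct (suc n) (suc r) (s≤s r<n) (_ ∷ (1∉ ∷ _)) γʳ =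
      ⊥-elim (AllP.applyUpTo⁻ (λ i → γ ^ᶠ suc i) n 1∉ r<n (sym γʳ))
    zero-rem : ∀ r → r ℕ.< q₁ → γ ^ᶠ r ≡ 1# → r ≡ 0
    zero-rem r r< = distinct q₁ r r< (PermS.Unique-resp-↭ (setoid Carrier) (↭⇒↭ₛ elements↭powers) unique)

  ∣⇒γ^≡1 : ∀ {e} → q₁ ∣ℕ.∣ e → γ ^ᶠ e ≡ 1#
  ∣⇒γ^≡1 (divides a refl) = trans (cong (γ ^ᶠ_) (ℕP.*-comm a q₁)) (trans (^-* γ q₁ a) (trans (cong (_^ᶠ a) γ^q₁) (1^ a)))

  module CyclicSum {A : Set} {_⊞_ _⊠_ : A → A → A} {0A 1A : A}
                   (isCS : IsCommutativeSemiring _≡_ _⊞_ _⊠_ 0A 1A) where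
    open FieldSum isCS public

    ΣF-powers : ∀ (f : Carrier → A) → ΣF f ≡ f 0# ⊞ Σ< q₁ (λ e → f (γ ^ᶠ e))
    ΣF-powers f = trans (ΣL-↭ f elements↭powers) (cong (f 0# ⊞_) (ΣL-applyUpTo (γ ^ᶠ_) q₁ f))

  private module S = CyclicSum isCommutativeSemiring

  -- Replacing x by x + 1 in the sum of all elements does not change it, yet adds 1 once for every
  -- element.
  ι-card : ι (suc q₁) ≡ 0#
  ι-card = trans (sym (trans (S.ΣL-const elements 1#) (trans (*-identityʳ _) (cong ι card≡)))) Σ1
    where
    open FSolver
    translated : S.ΣF (λ x → x) + S.ΣF (λ _ → 1#) ≡ S.ΣF (λ x → x)
    translated = trans (sym (S.ΣL-+ elements _ _)) (S.ΣF-translate 1# (λ x → x))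
    Σ1 : S.ΣF (λ _ → 1#) ≡ 0#
    Σ1 = trans (solve 2 (λ a b → b := (a :+ b) :- a) refl (S.ΣF (λ x → x)) _) (≡⇒−≡0 translated)

  -- Scaling the variable by γ multiplies the power sum by γᵉ.
  power-sum-0 : ∀ e → ¬ (q₁ ∣ℕ.∣ e) → S.ΣF (_^ᶠ e) ≡ 0#
  power-sum-0 e ∤e with integral {γ ^ᶠ e − 1#} {S.ΣF (_^ᶠ e)} eq
    where
    open FSolver
    S₀ = S.ΣF (_^ᶠ e)
    scaled : (γ ^ᶠ e) * S₀ ≡ S₀
    scaled = trans (sym (S.ΣL-*ˡ elements _ _)) (trans (S.ΣL-cong elements λ x → sym (*-^ γ x e)) (S.ΣF-scale γ≢0 (_^ᶠ e)))
    eq : (γ ^ᶠ e − 1#) * S₀ ≡ 0#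
    eq = trans (solve 2 (λ g s → (g :- con (ℤ.+ 1)) :* s := g :* s :- s) refl (γ ^ᶠ e) S₀) (≡⇒−≡0 scaled)
  ... | inj₁ p = ⊥-elim (∤e (γ^≡1⇒∣ e (−≡0 p)))
  ... | inj₂ p = p

  power-sum-neg1 : ∀ e → 0 ℕ.< e → q₁ ∣ℕ.∣ e → S.ΣF (_^ᶠ e) ≡ - 1#
  power-sum-neg1 e 0<e (divides a refl) = begin
    S.ΣF (_^ᶠ e)                               ≡⟨ S.ΣF-powers _ ⟩
    (0# ^ᶠ e) + S.Σ< q₁ (λ i → (γ ^ᶠ i) ^ᶠ e)  ≡⟨ cong₂ _+_ (0^ e 0<e) (S.Σ<-cong q₁ λ i _ → all-one i) ⟩
    0# + S.Σ< q₁ (λ _ → 1#)                    ≡⟨ trans (+-identityˡ _) (trans (S.Σ<-const q₁ 1#) (*-identityʳ _)) ⟩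
    ι q₁                                       ≡⟨ solve 1 (λ x → x := (con (ℤ.+ 1) :+ x) :- con (ℤ.+ 1)) refl (ι q₁) ⟩
    (1# + ι q₁) − 1#                           ≡⟨ cong (_− 1#) ι-card ⟩
    0# − 1#                                    ≡⟨ +-identityˡ _ ⟩
    - 1#                                       ∎
    where
    open ≡-Reasoning
    open FSolver using (solve; _:=_; _:+_; _:-_; con)
    all-one : ∀ i → (γ ^ᶠ i) ^ᶠ e ≡ 1#
    all-one i = trans (^-comm γ i e) (trans (cong (_^ᶠ i) (∣⇒γ^≡1 (divides a refl))) (1^ i))

-- Characteristic p: binomial theorem and Frobenius.

-- `R′ · 2^m` is (q-1)/(p^ℓ-1). The theory of the periods depends only on this divisibility; N and
-- the code enter in `Weights`.
record Setting : Set₁ where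
  field
    F       : FiniteField
    γ       : FiniteField.Carrier F
    gen     : FiniteField.IsGenerator F γ
    p w     : ℕ
    prime   : Prime p
    p≡8w+3  : p ≡ 3 ℕ.+ w ℕ.* 8
    s ℓ k   : ℕ
    1≤ℓ     : 1 ℕ.≤ ℓ
    s≡ℓk    : s ≡ ℓ ℕ.* k
    card≡p^s : FiniteField.card F ≡ p ℕ.^ s
    m R′    : ℕ
    3≤m     : 3 ℕ.≤ m
    R≡      : (R′ ℕ.* 2 ℕ.^ m) ℕ.* (p ℕ.^ ℓ ∸ 1) ≡ p ℕ.^ s ∸ 1

module Characteristic (σ : Setting) where
  open Setting σ public using (γ; gen; p; w; prime; p≡8w+3; s; ℓ; k; 1≤ℓ; s≡ℓk; card≡p^s; m; R′; 3≤m; R≡)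

  instance
    p≢0 : ℕ.NonZero p
    p≢0 = prime⇒nonZero prime

  1<p : 1 ℕ.< p
  1<p = ℕ.nonTrivial⇒n>1 p {{prime⇒nonTrivial prime}}

  1≤p^ : ∀ i → 1 ℕ.≤ p ℕ.^ i
  1≤p^ i = ℕP.m^n>0 p i

  q₁ : ℕ
  q₁ = p ℕ.^ s ∸ 1

  suc-q₁ : suc q₁ ≡ p ℕ.^ s
  suc-q₁ = ℕP.m+[n∸m]≡n (1≤p^ s)

  open CyclicField (Setting.F σ) γ gen q₁ (trans card≡p^s (sym suc-q₁)) public

  ι-^ : ∀ a n → ι (a ℕ.^ n) ≡ ι a ^ᶠ n
  ι-^ a zero = +-identityʳ 1#
  ι-^ a (suc n) = trans (ι-* a (a ℕ.^ n)) (*-congˡ (ι-^ a n))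

  ι-p : ι p ≡ 0#
  ι-p with ι p ≟ 0#
  ... | yes e = e
  ... | no ≢0 = ⊥-elim (^-≢0 s ≢0 (trans (sym (ι-^ p s)) (trans (cong ι (sym suc-q₁)) ι-card)))

  ι-p* : ∀ x → ι (x ℕ.* p) ≡ 0#
  ι-p* x = trans (ι-* x p) (trans (*-congˡ ι-p) (zeroʳ _))

  private
    ι-suc-≢0 : ∀ {a b} x → suc a ≡ b → ι a ≡ 0# → ι b ≡ 0# → x ≡ 0#
    ι-suc-≢0 x refl a0 b0 = ⊥-elim (1≢0 (trans (sym (+-identityʳ 1#)) (trans (cong (1# +_) (sym a0)) b0)))

    ι<p-≢0 : ∀ r → r ℕ.< p → ι r ≡ 0# → r ≡ 0
    ι<p-≢0 zero _ _ = refl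
    ι<p-≢0 r@(suc _) r<p r0 with Coprimality.coprime-Bézout (Coprimality.prime⇒coprime prime r<p)
    ... | Bézout.+- x y eq = ⊥-elim (1≢0 (ι-suc-≢0 1# eq (trans (ι-* y r) (trans (*-congˡ r0) (zeroʳ _))) (ι-p* x)))
    ... | Bézout.-+ x y eq = ⊥-elim (1≢0 (ι-suc-≢0 1# eq (ι-p* x) (trans (ι-* y r) (trans (*-congˡ r0) (zeroʳ _)))))

  p∣⇒ι≡0 : ∀ {n} → p ∣ℕ.∣ n → ι n ≡ 0#
  p∣⇒ι≡0 (divides x refl) = ι-p* x

  p∣⇒ιℤ≡0 : ∀ {x} → p ∣ℕ.∣ ℤ.∣ x ∣ → ιℤ x ≡ 0#
  p∣⇒ιℤ≡0 {ℤ.+ n} d = trans (ιℤ-pos n) (p∣⇒ι≡0 d)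
  p∣⇒ιℤ≡0 { -[1+ n ] } d = trans (cong -_ (p∣⇒ι≡0 d)) (-0#≈0#)

  ι-!-≢0 : ∀ n → n ℕ.< p → ι (n !) ≢ 0#
  ι-!-≢0 zero _ e = 1≢0 (trans (sym (+-identityʳ 1#)) e)
  ι-!-≢0 (suc n) n<p e with integral (trans (sym (ι-* (suc n) (n !))) e)
  ... | inj₂ e′ = ι-!-≢0 n (ℕP.<-trans (ℕP.n<1+n n) n<p) e′
  ... | inj₁ e′ with ι<p-≢0 (suc n) n<p e′
  ... | ()

  C-factorials : ∀ {n i} → i ℕ.≤ n → (n C i) ℕ.* (i ! ℕ.* (n ∸ i) !) ≡ n !
  C-factorials {n} {i} i≤n = trans (cong (ℕ._* (i ! ℕ.* (n ∸ i) !)) (nCk≡n!/k![n-k]! i≤n)) (m/n*n≡m (k![n∸k]!∣n! i≤n))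
    where instance _ = i ℕP.!* (n ∸ i) !≢0

  ι-C-≢0 : ∀ {n i} → i ℕ.≤ n → n ℕ.< p → ι (n C i) ≢ 0#
  ι-C-≢0 {n} {i} i≤n n<p e = ι-!-≢0 n n<p (trans (cong ι (sym (C-factorials i≤n))) (trans (ι-* (n C i) _) (trans (*-congʳ e) (zeroˡ _))))

  ι-pCi : ∀ i → 0 ℕ.< i → i ℕ.< p → ι (p C i) ≡ 0#
  ι-pCi i 0<i i<p with integral {ι (p C i)} {ι (i ! ℕ.* (p ∸ i) !)}
    (trans (sym (ι-* (p C i) _)) (trans (cong ι (C-factorials (ℕP.<⇒≤ i<p))) (p!≡0 p refl)))
    where
    p!≡0 : ∀ n → n ≡ p → ι (n !) ≡ 0#
    p!≡0 zero e = ⊥-elim (ℕP.<⇒≢ (ℕP.<-trans (s≤s z≤n) 1<p) e)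
    p!≡0 (suc n) e = trans (ι-* (suc n) (n !)) (trans (*-congʳ (trans (cong ι e) ι-p)) (zeroˡ _))
  ... | inj₁ z = z
  ... | inj₂ z with integral (trans (sym (ι-* (i !) ((p ∸ i) !))) z)
  ... | inj₁ z′ = ⊥-elim (ι-!-≢0 i i<p z′)
  ... | inj₂ z′ = ⊥-elim (ι-!-≢0 (p ∸ i) (ℕP.∸-monoʳ-< 0<i (ℕP.<⇒≤ i<p)) z′)

  private module S = CyclicSum isCommutativeSemiring

  binomial : ∀ x n N → n ℕ.< N → (1# + x) ^ᶠ n ≡ S.Σ< N (λ i → ι (n C i) * (x ^ᶠ i))
  binomial x zero (suc N) _ = sym (trans (cong₂ _+_ (trans (*-identityʳ _) (+-identityʳ 1#))
    (S.Σ<-0 N λ i _ → trans (*-congʳ (cong ι (k>n⇒nCk≡0 {0} {suc i} (s≤s z≤n)))) (zeroˡ _))) (+-identityʳ _))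
  binomial x (suc n) (suc N) (s≤s n<N) = sym (begin
    ι (suc n C 0) * 1# + S.Σ< N (λ i → ι (suc n C suc i) * (x * (x ^ᶠ i)))
      ≡⟨ cong₂ _+_ refl (S.Σ<-cong N λ i _ → term i) ⟩
    t0 + S.Σ< N (λ i → x * (ι (n C i) * (x ^ᶠ i)) + ι (n C suc i) * (x * (x ^ᶠ i)))
      ≡⟨ +-congˡ (trans (S.Σ<-+ N _ _) (+-congʳ (S.Σ<-*ˡ N x _))) ⟩
    t0 + (x * S.Σ< N (λ i → ι (n C i) * (x ^ᶠ i)) + rest)
      ≡⟨ solve 3 (λ a b c → a :+ (b :+ c) := (a :+ c) :+ b) refl t0 _ rest ⟩
    S.Σ< (suc N) (λ i → ι (n C i) * (x ^ᶠ i)) + x * S.Σ< N (λ i → ι (n C i) * (x ^ᶠ i))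
      ≡⟨ cong₂ (λ a b → a + x * b) (sym (binomial x n (suc N) (ℕP.m<n⇒m<1+n n<N))) (sym (binomial x n N n<N)) ⟩
    (1# + x) ^ᶠ n + x * ((1# + x) ^ᶠ n)
      ≡⟨ solve 2 (λ x a → a :+ x :* a := (con (ℤ.+ 1) :+ x) :* a) refl x _ ⟩
    (1# + x) * ((1# + x) ^ᶠ n)  ∎)
    where
    open ≡-Reasoning
    open FSolver using (solve; _:=_; _:+_; _:*_; con)
    t0 rest : Carrier
    t0 = ι (n C 0) * 1#
    rest = S.Σ< N (λ i → ι (n C suc i) * (x * (x ^ᶠ i)))
    term : ∀ i → ι (suc n C suc i) * (x * (x ^ᶠ i)) ≡ x * (ι (n C i) * (x ^ᶠ i)) + ι (n C suc i) * (x * (x ^ᶠ i))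
    term i = trans (*-congʳ (trans (cong ι (sym (nCk+nC[k+1]≡[n+1]C[k+1] n i))) (ι-+ (n C i) _)))
      (solve 4 (λ a b x y → (a :+ b) :* (x :* y) := x :* (a :* y) :+ b :* (x :* y)) refl (ι (n C i)) _ x _)

  private
    frob-1+ : ∀ x → (1# + x) ^ᶠ p ≡ 1# + (x ^ᶠ p)
    frob-1+ x = go p refl
      where
      open ≡-Reasoning
      go : ∀ n → n ≡ p → (1# + x) ^ᶠ n ≡ 1# + (x ^ᶠ n)
      go zero e = ⊥-elim (ℕP.<⇒≢ (ℕP.<-trans (s≤s z≤n) 1<p) e)
      go (suc n) e = begin
        (1# + x) ^ᶠ suc n ≡⟨ binomial x (suc n) (suc (suc n)) ℕP.≤-refl ⟩
        S.Σ< (suc (suc n)) f ≡⟨ S.Σ<-snoc (suc n) f ⟩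
        (f 0 + S.Σ< n (f ∘ suc)) + f (suc n) ≡⟨ cong₂ (λ a b → (a + b) + f (suc n)) f0 (S.Σ<-0 n mid) ⟩
        (1# + 0#) + f (suc n) ≡⟨ cong₂ _+_ (+-identityʳ 1#) (trans (*-congʳ (trans (cong ι (nCn≡1 (suc n))) (+-identityʳ 1#))) (*-identityˡ _)) ⟩
        1# + (x ^ᶠ suc n) ∎
        where
        f : ℕ → Carrier
        f i = ι (suc n C i) * (x ^ᶠ i)
        mid : ∀ i → i ℕ.< n → f (suc i) ≡ 0#
        mid i i<n = trans (*-congʳ (trans (cong (λ z → ι (z C suc i)) e) (ι-pCi (suc i) (s≤s z≤n) (subst (suc i ℕ.<_) e (s≤s i<n))))) (zeroˡ _)
        f0 : f 0 ≡ 1#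
        f0 = trans (*-identityʳ _) (+-identityʳ 1#)

  -- Homogeneity: taking the factor x out of x + y reduces to the one-variable case `frob-1+`, where
  -- the inner binomial coefficients vanish.
  frob-+ : ∀ x y → (x + y) ^ᶠ p ≡ (x ^ᶠ p) + (y ^ᶠ p)
  frob-+ x y with x ≟ 0#
  ... | yes refl = trans (cong (_^ᶠ p) (+-identityˡ y)) (sym (trans (+-congʳ (0^ p (ℕP.<-trans (s≤s z≤n) 1<p))) (+-identityˡ _)))
  ... | no x≢0 = begin
    (x + y) ^ᶠ p                            ≡⟨ cong (λ z → (x + z) ^ᶠ p) (sym (inv-cancel y x≢0)) ⟩
    (x + x * (inv x * y)) ^ᶠ p              ≡⟨ cong (_^ᶠ p) (solve 2 (λ x z → x :+ x :* z := x :* (con (ℤ.+ 1) :+ z)) refl x _) ⟩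
    (x * (1# + inv x * y)) ^ᶠ p             ≡⟨ trans (*-^ x _ p) (*-congˡ (frob-1+ _)) ⟩
    (x ^ᶠ p) * (1# + ((inv x * y) ^ᶠ p))    ≡⟨ solve 2 (λ x z → x :* (con (ℤ.+ 1) :+ z) := x :+ x :* z) refl (x ^ᶠ p) _ ⟩
    (x ^ᶠ p) + (x ^ᶠ p) * ((inv x * y) ^ᶠ p) ≡⟨ +-congˡ (trans (sym (*-^ x _ p)) (cong (_^ᶠ p) (inv-cancel y x≢0))) ⟩
    (x ^ᶠ p) + (y ^ᶠ p)                     ∎
    where
    open ≡-Reasoning
    open FSolver using (solve; _:=_; _:+_; _:*_; con)

  0^p^ : ∀ i → 0# ^ᶠ (p ℕ.^ i) ≡ 0#
  0^p^ i = 0^ (p ℕ.^ i) (1≤p^ i)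

  frobⁱ-+ : ∀ i x y → (x + y) ^ᶠ (p ℕ.^ i) ≡ (x ^ᶠ (p ℕ.^ i)) + (y ^ᶠ (p ℕ.^ i))
  frobⁱ-+ zero x y = trans (*-identityʳ _) (sym (cong₂ _+_ (*-identityʳ x) (*-identityʳ y)))
  frobⁱ-+ (suc i) x y = begin
    (x + y) ^ᶠ (p ℕ.* p ℕ.^ i)                 ≡⟨ ^-* (x + y) p _ ⟩
    ((x + y) ^ᶠ p) ^ᶠ (p ℕ.^ i)                ≡⟨ cong (_^ᶠ (p ℕ.^ i)) (frob-+ x y) ⟩
    ((x ^ᶠ p) + (y ^ᶠ p)) ^ᶠ (p ℕ.^ i)         ≡⟨ frobⁱ-+ i _ _ ⟩
    ((x ^ᶠ p) ^ᶠ (p ℕ.^ i)) + ((y ^ᶠ p) ^ᶠ (p ℕ.^ i)) ≡⟨ sym (cong₂ _+_ (^-* x p _) (^-* y p _)) ⟩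
    (x ^ᶠ (p ℕ.* p ℕ.^ i)) + (y ^ᶠ (p ℕ.* p ℕ.^ i)) ∎
    where open ≡-Reasoning

  frobⁱ-neg : ∀ i x → (- x) ^ᶠ (p ℕ.^ i) ≡ - (x ^ᶠ (p ℕ.^ i))
  frobⁱ-neg i x = −≡0 (trans (+-congˡ (-‿involutive _)) (trans (sym (frobⁱ-+ i (- x) x))
    (trans (cong (_^ᶠ (p ℕ.^ i)) (-‿inverseˡ x)) (0^p^ i))))

  frob-− : ∀ x y → (x − y) ^ᶠ p ≡ (x ^ᶠ p) − (y ^ᶠ p)
  frob-− x y = trans (frob-+ x (- y)) (+-congˡ (subst (λ n → (- y) ^ᶠ n ≡ - (y ^ᶠ n)) (ℕP.*-identityʳ p) (frobⁱ-neg 1 y)))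

-- Characters of 2-power order, through their integer coefficients.

x≡-x⇒x≡0 : ∀ {x : ℤ} → x ≡ ℤ.- x → x ≡ ℤ.0ℤ
x≡-x⇒x≡0 {ℤ.+ zero} _ = refl
x≡-x⇒x≡0 {ℤ.+ suc n} ()
x≡-x⇒x≡0 { -[1+ n ] } ()

odd-^ : ∀ i w → ∃ λ h → (3 ℕ.+ w ℕ.* 8) ℕ.^ i ≡ 1 ℕ.+ h ℕ.* 2
odd-^ zero w = 0 , refl
odd-^ (suc i) w with odd-^ i w
... | h , e = 1 ℕ.+ 3 ℕ.* h ℕ.+ w ℕ.* 4 ℕ.+ w ℕ.* h ℕ.* 8 , trans (cong ((3 ℕ.+ w ℕ.* 8) ℕ.*_) e) (lem w h)
  where
  lem : ∀ w h → (3 ℕ.+ w ℕ.* 8) ℕ.* (1 ℕ.+ h ℕ.* 2) ≡ 1 ℕ.+ (1 ℕ.+ 3 ℕ.* h ℕ.+ w ℕ.* 4 ℕ.+ w ℕ.* h ℕ.* 8) ℕ.* 2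
  lem = ℕSolver.solve-∀

module Characters (σ : Setting) where
  open Characteristic σ public
  module Z = CyclicSum ℤP.+-*-isCommutativeSemiring
  open Z public using (ΣF; 𝟙; 𝟙-yes; 𝟙-no; 𝟙-cong)

  ιZ : ∀ n → Z.ι n ≡ ℤ.+ n
  ιZ zero = refl
  ιZ (suc n) = cong (λ z → ℤ.1ℤ ℤ.+ z) (ιZ n)

  P : ℕ
  P = p ℕ.^ ℓ

  P-odd : ∃ λ h → P ≡ 1 ℕ.+ h ℕ.* 2
  P-odd = subst (λ z → ∃ λ h → z ℕ.^ ℓ ≡ 1 ℕ.+ h ℕ.* 2) (sym p≡8w+3) (odd-^ ℓ w)

  f : ℕ
  f = R′ ℕ.* (P ∸ 1)

  f-even : ∃ λ h → f ≡ h ℕ.* 2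
  f-even = R′ ℕ.* proj₁ P-odd , trans (cong (λ z → R′ ℕ.* (z ∸ 1)) (proj₂ P-odd)) (sym (ℕP.*-assoc R′ _ 2))

  q₁≡f*2^m : q₁ ≡ f ℕ.* 2 ℕ.^ m
  q₁≡f*2^m = trans (sym R≡) (lem R′ (2 ℕ.^ m) (P ∸ 1))
    where
    lem : ∀ a b c → a ℕ.* b ℕ.* c ≡ a ℕ.* c ℕ.* b
    lem = ℕSolver.solve-∀

  0<f : 0 ℕ.< f
  0<f = ℕP.n≢0⇒n>0 λ f0 → ℕP.<⇒≢ 0<q₁ (sym (trans q₁≡f*2^m (cong (ℕ._* 2 ℕ.^ m) f0)))

  -- (q − 1) / 2ʲ
  ex : ℕ → ℕ
  ex j = f ℕ.* 2 ℕ.^ (m ∸ j)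

  0<ex : ∀ j → 0 ℕ.< ex j
  0<ex j = ℕP.*-mono-≤ 0<f (ℕP.m^n>0 2 (m ∸ j))

  ex0 : ex 0 ≡ q₁
  ex0 = sym q₁≡f*2^m

  ex-even : ∀ j → ∃ λ h → ex j ≡ h ℕ.* 2
  ex-even j = proj₁ f-even ℕ.* 2 ℕ.^ (m ∸ j) , trans (cong (ℕ._* 2 ℕ.^ (m ∸ j)) (proj₂ f-even)) (lem (proj₁ f-even) (2 ℕ.^ (m ∸ j)))
    where
    lem : ∀ a b → a ℕ.* 2 ℕ.* b ≡ a ℕ.* b ℕ.* 2
    lem = ℕSolver.solve-∀

  ex-+ : ∀ i j → i ℕ.+ j ℕ.≤ m → ex (i ℕ.+ j) ℕ.* 2 ℕ.^ i ≡ ex j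
  ex-+ i j i+j≤m = trans (ℕP.*-assoc f _ _) (cong (f ℕ.*_) (trans (sym (ℕP.^-distribˡ-+-* 2 (m ∸ (i ℕ.+ j)) i))
    (cong (2 ℕ.^_) (ℕP.+-cancelʳ-≡ j _ _ (trans (ℕP.+-assoc (m ∸ (i ℕ.+ j)) i j)
      (trans (ℕP.m∸n+n≡m i+j≤m) (sym (ℕP.m∸n+n≡m (ℕP.≤-trans (ℕP.m≤n+m j i) i+j≤m)))))))))

  ex-suc : ∀ j → suc j ℕ.≤ m → ex (suc j) ℕ.* 2 ≡ ex j
  ex-suc j = ex-+ 1 j

  ex-2^ : ∀ j → j ℕ.≤ m → ex j ℕ.* 2 ℕ.^ j ≡ q₁
  ex-2^ j j≤m = trans (cong (λ z → ex z ℕ.* 2 ℕ.^ j) (sym (ℕP.+-identityʳ j)))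
    (trans (ex-+ j 0 (subst (ℕ._≤ m) (sym (ℕP.+-identityʳ j)) j≤m)) ex0)

  ex-suc-2^ : ∀ j → suc j ℕ.≤ m → ex (suc j) ℕ.* 2 ℕ.^ j ≡ ex 1
  ex-suc-2^ j j<m = trans (cong (λ z → ex z ℕ.* 2 ℕ.^ j) (ℕP.+-comm 1 j)) (ex-+ j 1 (subst (ℕ._≤ m) (ℕP.+-comm 1 j) j<m))

  1≤m : 1 ℕ.≤ m
  1≤m = ℕP.≤-trans (s≤s z≤n) 3≤m

  ex1<q₁ : ex 1 ℕ.< q₁
  ex1<q₁ = subst (ex 1 ℕ.<_) (trans (ex-suc 0 1≤m) ex0) (ℕP.m<m*n (ex 1) 2 {{ℕ.>-nonZero (0<ex 1)}} (s≤s (s≤s z≤n)))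

  γ^ex1≢1 : γ ^ᶠ ex 1 ≢ 1#
  γ^ex1≢1 e = ℕP.<⇒≱ ex1<q₁ (∣ℕ.∣⇒≤ {{ℕ.>-nonZero (0<ex 1)}} (γ^≡1⇒∣ (ex 1) e))

  γ^ex1 : γ ^ᶠ ex 1 ≡ - 1#
  γ^ex1 = [ (λ e → ⊥-elim (γ^ex1≢1 e)) , id ]′ (square≡1 sq)
    where
    sq : (γ ^ᶠ ex 1) * (γ ^ᶠ ex 1) ≡ 1#
    sq = trans (*-congˡ (sym (*-identityʳ _))) (trans (sym (^-* γ (ex 1) 2)) (trans (cong (γ ^ᶠ_) (trans (ex-suc 0 1≤m) ex0)) γ^q₁))

  -1≢1 : - 1# ≢ 1#
  -1≢1 e = γ^ex1≢1 (trans γ^ex1 e)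

  -1^even : ∀ h → (- 1#) ^ᶠ (h ℕ.* 2) ≡ 1#
  -1^even zero = refl
  -1^even (suc h) = trans (cong (λ z → (- 1#) * ((- 1#) * z)) (-1^even h))
    (solve 0 ((:- con (ℤ.+ 1)) :* ((:- con (ℤ.+ 1)) :* con (ℤ.+ 1)) := con (ℤ.+ 1)) refl)
    where open FSolver

  -1^ex : ∀ j → (- 1#) ^ᶠ ex j ≡ 1#
  -1^ex j = trans (cong ((- 1#) ^ᶠ_) (proj₂ (ex-even j))) (-1^even (proj₁ (ex-even j)))

  sgn : Carrier → ℤ
  sgn y = 𝟙 (y ≟ 1#) ℤ.- 𝟙 (y ≟ (- 1#))

  sgn-1 : ∀ {y} → y ≡ 1# → sgn y ≡ ℤ.1ℤ
  sgn-1 {y} e = cong₂ ℤ._-_ (𝟙-yes (y ≟ 1#) e) (𝟙-no (y ≟ (- 1#)) λ e′ → -1≢1 (trans (sym e′) e))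

  sgn-−1 : ∀ {y} → y ≡ - 1# → sgn y ≡ ℤ.-1ℤ
  sgn-−1 {y} e = cong₂ ℤ._-_ (𝟙-no (y ≟ 1#) λ e′ → -1≢1 (trans (sym e) e′)) (𝟙-yes (y ≟ (- 1#)) e)

  sgn-0 : ∀ {y} → y ≢ 1# → y ≢ - 1# → sgn y ≡ ℤ.0ℤ
  sgn-0 {y} n1 n2 = cong₂ ℤ._-_ (𝟙-no (y ≟ 1#) n1) (𝟙-no (y ≟ (- 1#)) n2)

  data SgnView (y : Carrier) : Set where
    pos  : y ≡ 1# → sgn y ≡ ℤ.1ℤ → SgnView y
    neg  : y ≡ - 1# → sgn y ≡ ℤ.-1ℤ → SgnView y
    none : y ≢ 1# → y ≢ - 1# → sgn y ≡ ℤ.0ℤ → SgnView y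

  sgnView : ∀ y → SgnView y
  sgnView y with y ≟ 1# | y ≟ (- 1#)
  ... | yes e | _ = pos e (sgn-1 e)
  ... | no _ | yes e = neg e (sgn-−1 e)
  ... | no a | no b = none a b (sgn-0 a b)

  -1*-1 : (- 1#) * (- 1#) ≡ 1#
  -1*-1 = solve 0 ((:- con (ℤ.+ 1)) :* (:- con (ℤ.+ 1)) := con (ℤ.+ 1)) refl
    where open FSolver

  sgn-flip : ∀ y → sgn ((- 1#) * y) ≡ ℤ.- sgn y
  sgn-flip y with sgnView y
  ... | pos e v = trans (sgn-−1 (trans (*-congˡ e) (*-identityʳ _))) (cong ℤ.-_ (sym v))
  ... | neg e v = trans (sgn-1 (trans (*-congˡ e) -1*-1)) (cong ℤ.-_ (sym v))
  ... | none a b v = trans (sgn-0 (λ e → b (trans (back e) (*-identityʳ _))) (λ e → a (trans (back e) -1*-1))) (cong ℤ.-_ (sym v))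
    where
    back : ∀ {z} → (- 1#) * y ≡ z → y ≡ (- 1#) * z
    back {z} e = trans (trans (sym (*-identityˡ y)) (*-congʳ (sym -1*-1))) (trans (*-assoc _ _ _) (*-congˡ e))

  -- The coefficient of 1 in a character of order 2ʲ with values in ℤ[ζ], ζ^(2ʲ⁻¹) = −1:
  -- it is 1 on the subgroup of index 2ʲ, −1 on its translate by γ^(2ʲ⁻¹), 0 elsewhere.
  ε : ℕ → Carrier → ℤ
  ε j x = sgn (x ^ᶠ ex j)

  ρ : Carrier → ℤ
  ρ = ε 1

  -- For j ≤ m, the indicator of the nonzero 2^j-th powers.
  one : ℕ → Carrier → ℤ
  one j x = 𝟙 ((x ^ᶠ ex j) ≟ 1#)

  ε-0 : ∀ j → ε j 0# ≡ ℤ.0ℤ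
  ε-0 j = trans (cong sgn (0^ (ex j) (0<ex j))) (sgn-0 0≢1 λ e → 0≢1
    (trans (sym (zeroʳ (- 1#))) (trans (*-congˡ e) -1*-1)))

  ε-same : ∀ j {u} x → u ^ᶠ ex j ≡ 1# → ε j (u * x) ≡ ε j x
  ε-same j x e = cong sgn (trans (*-^ _ x (ex j)) (trans (*-congʳ e) (*-identityˡ _)))

  ε-flip : ∀ j {u} x → u ^ᶠ ex j ≡ - 1# → ε j (u * x) ≡ ℤ.- ε j x
  ε-flip j x e = trans (cong sgn (trans (*-^ _ x (ex j)) (*-congʳ e))) (sgn-flip _)

  frob-1 : ∀ {y} → y ^ᶠ p ≡ 1# → y ≡ 1#
  frob-1 {y} e = −≡0 (root (trans (frob-− y 1#) (≡⇒−≡0 (trans e (sym (1^ p))))))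
    where
    root : ∀ {z} → z ^ᶠ p ≡ 0# → z ≡ 0#
    root {z} e with z ≟ 0#
    ... | yes z0 = z0
    ... | no z≢0 = ⊥-elim (^-≢0 p z≢0 e)

  frob-−1 : (- 1#) ^ᶠ p ≡ - 1#
  frob-−1 = trans (cong ((- 1#) ^ᶠ_) (trans p≡8w+3 (lem w))) (trans (*-congˡ (-1^even (1 ℕ.+ w ℕ.* 4))) (*-identityʳ _))
    where
    lem : ∀ w → 3 ℕ.+ w ℕ.* 8 ≡ 1 ℕ.+ (1 ℕ.+ w ℕ.* 4) ℕ.* 2
    lem = ℕSolver.solve-∀

  frob-inj : ∀ {x y} → x ^ᶠ p ≡ y ^ᶠ p → x ≡ y
  frob-inj {x} {y} e with (x − y) ≟ 0#
  ... | yes z = −≡0 z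
  ... | no ≢0 = ⊥-elim (^-≢0 p ≢0 (trans (frob-− x y) (≡⇒−≡0 e)))

  sgn-frob : ∀ y → sgn (y ^ᶠ p) ≡ sgn y
  sgn-frob y = cong₂ ℤ._-_ (𝟙-cong ((y ^ᶠ p) ≟ 1#) (y ≟ 1#) frob-1 λ e → trans (cong (_^ᶠ p) e) (1^ p))
    (𝟙-cong ((y ^ᶠ p) ≟ (- 1#)) (y ≟ (- 1#)) (λ e → frob-inj (trans e (sym frob-−1))) λ e → trans (cong (_^ᶠ p) e) frob-−1)

  ε-frob : ∀ j x → ε j (x ^ᶠ p) ≡ ε j x
  ε-frob j x = trans (cong sgn (^-comm x p (ex j))) (sgn-frob _)

  sq-^ : ∀ x j → suc j ℕ.≤ m → (x * x) ^ᶠ ex (suc j) ≡ x ^ᶠ ex j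
  sq-^ x j j<m = trans (cong (_^ᶠ ex (suc j)) (*-congˡ (sym (*-identityʳ x)))) (trans (sym (^-* x 2 (ex (suc j))))
    (cong (x ^ᶠ_) (trans (ℕP.*-comm 2 (ex (suc j))) (ex-suc j j<m))))

  -- The square of a character of order 2^(j+1) has order 2^j; this is how the recurrences descend
  -- one level.
  ε-sq : ∀ j x → suc j ℕ.≤ m → ε (suc j) (x * x) ≡ ε j x
  ε-sq j x j<m = cong sgn (sq-^ x j j<m)

  -- The subgroup of index 2^j is the union of two cosets of the next one, told apart by y = 1 and y
  -- = -1; `ε` is the difference of their indicators.
  one-rec : ∀ j x → suc j ℕ.≤ m → ℤ.+ 2 ℤ.* one (suc j) x ≡ one j x ℤ.+ ε (suc j) x
  one-rec j x j<m = trans (alg (𝟙 (y ≟ 1#)) (𝟙 (y ≟ (- 1#)))) (cong (ℤ._+ ε (suc j) x) (sym split))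
    where
    y : Carrier
    y = x ^ᶠ ex (suc j)
    alg : ∀ a b → ℤ.+ 2 ℤ.* a ≡ (a ℤ.+ b) ℤ.+ (a ℤ.- b)
    alg = solve-∀
    y² : x ^ᶠ ex j ≡ y * y
    y² = trans (sym (sq-^ x j j<m)) (*-^ x x (ex (suc j)))
    split : one j x ≡ 𝟙 (y ≟ 1#) ℤ.+ 𝟙 (y ≟ (- 1#))
    split with sgnView y
    ... | pos e _ = trans (𝟙-yes ((x ^ᶠ ex j) ≟ 1#) (trans y² (trans (cong₂ _*_ e e) (*-identityˡ _))))
      (sym (cong₂ ℤ._+_ (𝟙-yes (y ≟ 1#) e) (𝟙-no (y ≟ (- 1#)) λ e′ → -1≢1 (trans (sym e′) e))))
    ... | neg e _ = trans (𝟙-yes ((x ^ᶠ ex j) ≟ 1#) (trans y² (trans (cong₂ _*_ e e) -1*-1)))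
      (sym (cong₂ ℤ._+_ (𝟙-no (y ≟ 1#) λ e′ → -1≢1 (trans (sym e) e′)) (𝟙-yes (y ≟ (- 1#)) e)))
    ... | none a b _ = trans (𝟙-no ((x ^ᶠ ex j) ≟ 1#) (λ e → [ a , b ]′ (square≡1 (trans (sym y²) e))))
      (sym (cong₂ ℤ._+_ (𝟙-no (y ≟ 1#) a) (𝟙-no (y ≟ (- 1#)) b)))

  one-0 : ∀ j → one j 0# ≡ ℤ.0ℤ
  one-0 j = 𝟙-no ((0# ^ᶠ ex j) ≟ 1#) λ e → 0≢1 (trans (sym (0^ (ex j) (0<ex j))) e)

  -- K is the set of nonzero elements of the subfield of order P.
  InK : Carrier → Set
  InK c = c ^ᶠ (P ∸ 1) ≡ 1#

  -- Here the divisibility of (q-1)/(P-1) by 2^m is used: each `ex j` is a multiple of P - 1, so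
  -- everything defined through x^(ex j) is invariant under K.
  InK-^ex : ∀ j {c} → InK c → c ^ᶠ ex j ≡ 1#
  InK-^ex j {c} e = trans (cong (c ^ᶠ_) (trans (cong (ℕ._* 2 ℕ.^ (m ∸ j)) (ℕP.*-comm R′ (P ∸ 1))) (ℕP.*-assoc (P ∸ 1) R′ _)))
    (trans (^-* c (P ∸ 1) _) (trans (cong (_^ᶠ (R′ ℕ.* 2 ℕ.^ (m ∸ j))) e) (1^ (R′ ℕ.* 2 ℕ.^ (m ∸ j)))))

  γ^half : ∀ j → suc j ℕ.≤ m → (γ ^ᶠ (2 ℕ.^ j)) ^ᶠ ex (suc j) ≡ - 1#
  γ^half j j<m = trans (sym (^-* γ (2 ℕ.^ j) (ex (suc j)))) (trans (cong (γ ^ᶠ_) (trans (ℕP.*-comm (2 ℕ.^ j) (ex (suc j))) (ex-suc-2^ j j<m))) γ^ex1)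

  γ^full : ∀ j a → j ℕ.≤ m → (γ ^ᶠ (2 ℕ.^ j ℕ.* a)) ^ᶠ ex j ≡ 1#
  γ^full j a j≤m = trans (sym (^-* γ (2 ℕ.^ j ℕ.* a) (ex j))) (∣⇒γ^≡1 (divides a (trans (lem (2 ℕ.^ j) a (ex j)) (cong (a ℕ.*_) (ex-2^ j j≤m)))))
    where
    lem : ∀ x a y → x ℕ.* a ℕ.* y ≡ a ℕ.* (y ℕ.* x)
    lem = ℕSolver.solve-∀

  -- Multiplying the variable by γ^(2^j) permutes F and changes the sign of `ε`.
  Σε : ∀ j g → suc j ℕ.≤ m → ΣF (λ x → ε (suc j) (g * x)) ≡ ℤ.0ℤ
  Σε j g j<m = x≡-x⇒x≡0 (begin
    ΣF (λ x → ε (suc j) (g * x))            ≡⟨ sym (Z.ΣF-scale (^-≢0 (2 ℕ.^ j) γ≢0) _) ⟩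
    ΣF (λ x → ε (suc j) (g * (h * x)))      ≡⟨ Z.ΣL-cong elements (λ x → trans (cong (ε (suc j)) (swap g h x)) (trans (ε-flip (suc j) (g * x) (γ^half j j<m)) (neg1 _))) ⟩
    ΣF (λ x → ℤ.-1ℤ ℤ.* ε (suc j) (g * x))  ≡⟨ trans (Z.ΣL-*ˡ elements ℤ.-1ℤ _) (sym (neg1 _)) ⟩
    ℤ.- ΣF (λ x → ε (suc j) (g * x))        ∎)
    where
    open ≡-Reasoning
    h : Carrier
    h = γ ^ᶠ (2 ℕ.^ j)
    swap : ∀ g h x → g * (h * x) ≡ h * (g * x)
    swap = solve 3 (λ g h x → g :* (h :* x) := h :* (g :* x)) refl
      where open FSolver
    neg1 : ∀ x → ℤ.- x ≡ ℤ.-1ℤ ℤ.* x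
    neg1 = solve-∀

  ρ-view : ∀ {x} → x ≢ 0# → (x ^ᶠ ex 1 ≡ 1# × ρ x ≡ ℤ.1ℤ) ⊎ (x ^ᶠ ex 1 ≡ - 1# × ρ x ≡ ℤ.-1ℤ)
  ρ-view {x} x≢0 with square≡1 (trans (sym (*-^ x x (ex 1))) (trans (sq-^ x 0 1≤m) (trans (cong (x ^ᶠ_) ex0) (x^q₁ x≢0))))
  ... | inj₁ e = inj₁ (e , sgn-1 e)
  ... | inj₂ e = inj₂ (e , sgn-−1 e)

  ρ-* : ∀ x y → ρ (x * y) ≡ ρ x ℤ.* ρ y
  ρ-* x y with x ≟ 0#
  ... | yes refl = trans (cong ρ (zeroˡ y)) (trans (ε-0 1) (sym (cong (ℤ._* ρ y) (ε-0 1))))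
  ... | no x≢0 with ρ-view x≢0
  ... | inj₁ (e , v) = trans (ε-same 1 y e) (sym (trans (cong (ℤ._* ρ y) v) (ℤP.*-identityˡ _)))
  ... | inj₂ (e , v) = trans (ε-flip 1 y e) (sym (trans (cong (ℤ._* ρ y) v) (ℤP.-1*i≡-i _)))

  ρ-γ : ρ γ ≡ ℤ.-1ℤ
  ρ-γ = sgn-−1 γ^ex1

  ρ-even : ∀ e → ρ (γ ^ᶠ (e ℕ.* 2)) ≡ ℤ.1ℤ
  ρ-even zero = sgn-1 (1^ (ex 1))
  ρ-even (suc e) = trans (ρ-* γ _) (trans (cong₂ ℤ._*_ ρ-γ (trans (ρ-* γ _) (cong₂ ℤ._*_ ρ-γ (ρ-even e)))) refl)

  ρ-odd : ∀ e → ρ (γ ^ᶠ suc (e ℕ.* 2)) ≡ ℤ.-1ℤ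
  ρ-odd e = trans (ρ-* γ _) (cong₂ ℤ._*_ ρ-γ (ρ-even e))

  -- `1 + ρ u` is the number of square roots of u, including u = 0, where `ρ` is 0.
  Σ-squares : ∀ (g : Carrier → ℤ) → ΣF (λ v → g (v * v)) ≡ ΣF (λ u → (ℤ.1ℤ ℤ.+ ρ u) ℤ.* g u)
  Σ-squares g = begin
    ΣF (λ v → g (v * v)) ≡⟨ Z.ΣF-powers _ ⟩
    g (0# * 0#) ℤ.+ Z.Σ< q₁ sq ≡⟨ cong₂ ℤ._+_ (trans (cong g (zeroˡ 0#)) (sym (trans (cong (λ z → (ℤ.1ℤ ℤ.+ z) ℤ.* g 0#) (ε-0 1)) (ℤP.*-identityˡ _))))
         (trans (cong (λ n → Z.Σ< n sq) q₁≡) (trans (Z.Σ<-periodic 2 (ex 1) sq per) (sym odd-even))) ⟩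
    (ℤ.1ℤ ℤ.+ ρ 0#) ℤ.* g 0# ℤ.+ Z.Σ< q₁ rhs ≡⟨ sym (Z.ΣF-powers _) ⟩
    ΣF (λ u → (ℤ.1ℤ ℤ.+ ρ u) ℤ.* g u) ∎
    where
    open ≡-Reasoning
    sq rhs : ℕ → ℤ
    sq e = g ((γ ^ᶠ e) * (γ ^ᶠ e))
    rhs e = (ℤ.1ℤ ℤ.+ ρ (γ ^ᶠ e)) ℤ.* g (γ ^ᶠ e)
    q₁≡ : q₁ ≡ 2 ℕ.* ex 1
    q₁≡ = trans (sym (trans (ex-suc 0 1≤m) ex0)) (ℕP.*-comm (ex 1) 2)
    per : ∀ e → sq (ex 1 ℕ.+ e) ≡ sq e
    per e = cong g (trans (cong₂ _*_ (^-+ γ (ex 1) e) (^-+ γ (ex 1) e)) (trans (cong (λ z → (z * (γ ^ᶠ e)) * (z * (γ ^ᶠ e))) γ^ex1)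
      (solve 1 (λ x → (:- con (ℤ.+ 1) :* x) :* (:- con (ℤ.+ 1) :* x) := x :* x) refl (γ ^ᶠ e))))
      where open FSolver using (solve; _:=_; _:*_; :-_; con)
    sq≡ : ∀ e → γ ^ᶠ (e ℕ.* 2) ≡ (γ ^ᶠ e) * (γ ^ᶠ e)
    sq≡ e = trans (^-* γ e 2) (*-congˡ (*-identityʳ _))
    odd-even : Z.Σ< q₁ rhs ≡ Z.ι 2 ℤ.* Z.Σ< (ex 1) sq
    odd-even = begin
      Z.Σ< q₁ rhs ≡⟨ cong (λ n → Z.Σ< n rhs) (trans q₁≡ (ℕP.*-comm 2 (ex 1))) ⟩
      Z.Σ< (ex 1 ℕ.* 2) rhs ≡⟨ Z.Σ<-even-odd (ex 1) rhs ⟩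
      Z.Σ< (ex 1) (λ i → rhs (i ℕ.* 2)) ℤ.+ Z.Σ< (ex 1) (λ i → rhs (suc (i ℕ.* 2)))
        ≡⟨ cong₂ ℤ._+_ (Z.Σ<-cong (ex 1) λ e _ → cong₂ ℤ._*_ (cong (λ z → ℤ.1ℤ ℤ.+ z) (ρ-even e)) (cong g (sq≡ e)))
             (Z.Σ<-0 (ex 1) λ e _ → cong (λ z → (ℤ.1ℤ ℤ.+ z) ℤ.* g (γ ^ᶠ suc (e ℕ.* 2))) (ρ-odd e)) ⟩
      Z.Σ< (ex 1) (λ i → ℤ.+ 2 ℤ.* sq i) ℤ.+ ℤ.0ℤ ≡⟨ trans (ℤP.+-identityʳ _) (Z.Σ<-*ˡ (ex 1) (ℤ.+ 2) sq) ⟩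
      Z.ι 2 ℤ.* Z.Σ< (ex 1) sq ∎

  -- Squaring is iterated: on the support of `one (suc j)` the factor `1 + ρ` equals 2, so each step
  -- doubles the multiplicity. The value of g at 0 must vanish because `one j` does.
  Σ-powers : ∀ j (g : Carrier → ℤ) → g 0# ≡ ℤ.0ℤ → j ℕ.≤ m →
    ΣF (λ x → g (x ^ᶠ (2 ℕ.^ j))) ≡ ℤ.+ (2 ℕ.^ j) ℤ.* ΣF (λ y → one j y ℤ.* g y)
  Σ-powers zero g g0 _ = trans (Z.ΣL-cong elements λ x → trans (cong g (*-identityʳ x)) (pt x)) (sym (ℤP.*-identityˡ _))
    where
    pt : ∀ y → g y ≡ one 0 y ℤ.* g y
    pt y with y ≟ 0#
    ... | yes refl = trans g0 (sym (trans (cong (one 0 0# ℤ.*_) g0) (ℤP.*-zeroʳ (one 0 0#))))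
    ... | no y≢0 = sym (trans (cong (ℤ._* g y) (𝟙-yes ((y ^ᶠ ex 0) ≟ 1#) (trans (cong (y ^ᶠ_) ex0) (x^q₁ y≢0)))) (ℤP.*-identityˡ _))
  Σ-powers (suc j) g g0 j<m = begin
    ΣF (λ x → g (x ^ᶠ (2 ℕ.^ suc j))) ≡⟨ Z.ΣL-cong elements (λ x → cong g (trans (cong (x ^ᶠ_) (ℕP.*-comm 2 (2 ℕ.^ j))) (trans (^-* x (2 ℕ.^ j) 2) (*-congˡ (*-identityʳ _))))) ⟩
    ΣF (λ x → g ((x ^ᶠ (2 ℕ.^ j)) * (x ^ᶠ (2 ℕ.^ j)))) ≡⟨ Σ-powers j (λ u → g (u * u)) (trans (cong g (zeroˡ 0#)) g0) (ℕP.<⇒≤ j<m) ⟩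
    N ℤ.* ΣF (λ y → one j y ℤ.* g (y * y)) ≡⟨ cong (N ℤ.*_) (Z.ΣL-cong elements λ y → cong (λ z → 𝟙 (z ≟ 1#) ℤ.* g (y * y)) (sym (sq-^ y j j<m))) ⟩
    N ℤ.* ΣF (λ y → one (suc j) (y * y) ℤ.* g (y * y)) ≡⟨ cong (N ℤ.*_) (Σ-squares (λ u → one (suc j) u ℤ.* g u)) ⟩
    N ℤ.* ΣF (λ u → (ℤ.1ℤ ℤ.+ ρ u) ℤ.* (one (suc j) u ℤ.* g u)) ≡⟨ cong (N ℤ.*_) (trans (Z.ΣL-cong elements pt) (Z.ΣL-*ˡ elements (ℤ.+ 2) _)) ⟩
    N ℤ.* (ℤ.+ 2 ℤ.* ΣF (λ u → one (suc j) u ℤ.* g u)) ≡⟨ trans (sym (ℤP.*-assoc N (ℤ.+ 2) _)) (cong (ℤ._* ΣF (λ u → one (suc j) u ℤ.* g u)) (trans (sym (ℤP.pos-* (2 ℕ.^ j) 2)) (cong (λ z → ℤ.+ z) (ℕP.*-comm (2 ℕ.^ j) 2)))) ⟩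
    ℤ.+ (2 ℕ.^ suc j) ℤ.* ΣF (λ y → one (suc j) y ℤ.* g y) ∎
    where
    open ≡-Reasoning
    N : ℤ
    N = ℤ.+ (2 ℕ.^ j)
    pt : ∀ u → (ℤ.1ℤ ℤ.+ ρ u) ℤ.* (one (suc j) u ℤ.* g u) ≡ ℤ.+ 2 ℤ.* (one (suc j) u ℤ.* g u)
    pt u with (u ^ᶠ ex (suc j)) ≟ 1#
    ... | no _ = ℤP.*-zeroʳ (ℤ.1ℤ ℤ.+ ρ u)
    ... | yes e = cong (λ z → (ℤ.1ℤ ℤ.+ z) ℤ.* (ℤ.1ℤ ℤ.* g u)) (sgn-1 (trans (cong (u ^ᶠ_) (sym (ex-suc-2^ j j<m)))
      (trans (^-* u (ex (suc j)) (2 ℕ.^ j)) (trans (cong (_^ᶠ (2 ℕ.^ j)) e) (1^ (2 ℕ.^ j))))))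

-- The trace and an integral substitute for the additive Fourier transform.

module TraceTransform (σ : Setting) where
  open Characters σ public
  private module S = CyclicSum isCommutativeSemiring

  tr : Carrier → Carrier
  tr = Tr p ℓ k

  private
    sumᶠ≡Σ< : ∀ n g → sumᶠ n g ≡ S.Σ< n g
    sumᶠ≡Σ< zero g = refl
    sumᶠ≡Σ< (suc n) g = trans (+-congʳ (sumᶠ≡Σ< n g)) (sym (S.Σ<-snoc n g))

  conj : ℕ → Carrier → Carrier
  conj i x = x ^ᶠ (p ℕ.^ (ℓ ℕ.* i))

  tr≡ : ∀ x → tr x ≡ S.Σ< k (λ i → conj i x)
  tr≡ x = sumᶠ≡Σ< k (λ i → conj i x)

  tr-+ : ∀ x y → tr (x + y) ≡ tr x + tr y
  tr-+ x y = trans (tr≡ (x + y)) (trans (S.Σ<-cong k λ i _ → frobⁱ-+ (ℓ ℕ.* i) x y)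
    (trans (S.Σ<-+ k _ _) (sym (cong₂ _+_ (tr≡ x) (tr≡ y)))))

  frobⁱ-Σ< : ∀ i n g → (S.Σ< n g) ^ᶠ (p ℕ.^ i) ≡ S.Σ< n (λ j → g j ^ᶠ (p ℕ.^ i))
  frobⁱ-Σ< i zero g = 0^p^ i
  frobⁱ-Σ< i (suc n) g = trans (frobⁱ-+ i _ _) (+-congˡ (frobⁱ-Σ< i n (g ∘ suc)))

  conj-fix : ∀ i {c} → c ^ᶠ P ≡ c → conj i c ≡ c
  conj-fix zero {c} e = trans (cong (λ n → c ^ᶠ (p ℕ.^ n)) (ℕP.*-zeroʳ ℓ)) (*-identityʳ c)
  conj-fix (suc i) {c} e = trans (cong (c ^ᶠ_) (trans (cong (p ℕ.^_) (ℕP.*-suc ℓ i)) (ℕP.^-distribˡ-+-* p ℓ _)))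
    (trans (^-* c P _) (trans (cong (_^ᶠ (p ℕ.^ (ℓ ℕ.* i))) e) (conj-fix i e)))

  tr-* : ∀ {c} x → c ^ᶠ P ≡ c → tr (c * x) ≡ c * tr x
  tr-* {c} x e = trans (tr≡ (c * x)) (trans (S.Σ<-cong k λ i _ → trans (*-^ c x (p ℕ.^ (ℓ ℕ.* i))) (*-congʳ (conj-fix i e)))
    (trans (S.Σ<-*ˡ k c _) (*-congˡ (sym (tr≡ x)))))

  conj-k : ∀ x → conj k x ≡ x
  conj-k x = trans (cong (x ^ᶠ_) (trans (cong (p ℕ.^_) (sym s≡ℓk)) (sym suc-q₁))) (x^q x)

  conj-0 : ∀ x → conj 0 x ≡ x
  conj-0 x = trans (cong (λ n → x ^ᶠ (p ℕ.^ n)) (ℕP.*-zeroʳ ℓ)) (*-identityʳ x)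

  tr-fixed : ∀ x → tr x ^ᶠ P ≡ tr x
  tr-fixed x = begin
    tr x ^ᶠ P ≡⟨ cong (_^ᶠ P) (tr≡ x) ⟩
    S.Σ< k (λ i → conj i x) ^ᶠ P ≡⟨ frobⁱ-Σ< ℓ k _ ⟩
    S.Σ< k (λ i → conj i x ^ᶠ P) ≡⟨ S.Σ<-cong k (λ i _ → trans (sym (^-* x (p ℕ.^ (ℓ ℕ.* i)) P)) (cong (x ^ᶠ_)
         (trans (sym (ℕP.^-distribˡ-+-* p (ℓ ℕ.* i) ℓ)) (cong (p ℕ.^_) (trans (ℕP.+-comm (ℓ ℕ.* i) ℓ) (sym (ℕP.*-suc ℓ i))))))) ⟩
    S.Σ< k (λ i → conj (suc i) x) ≡⟨ S.Σ<-rotate k (λ i → conj i x) (trans (conj-k x) (sym (conj-0 x))) ⟩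
    S.Σ< k (λ i → conj i x) ≡⟨ sym (tr≡ x) ⟩
    tr x ∎
    where open ≡-Reasoning

  tr-frob : ∀ x → tr (x ^ᶠ p) ≡ tr x ^ᶠ p
  tr-frob x = sym (trans (cong (_^ᶠ p) (tr≡ x)) (trans (subst (λ n → S.Σ< k (λ i → conj i x) ^ᶠ n ≡ S.Σ< k (λ j → conj j x ^ᶠ n)) (ℕP.*-identityʳ p) (frobⁱ-Σ< 1 k _))
    (trans (S.Σ<-cong k λ i _ → ^-comm x (p ℕ.^ (ℓ ℕ.* i)) p) (sym (tr≡ (x ^ᶠ p))))))

  0<k : 0 ℕ.< k
  0<k = ℕP.n≢0⇒n>0 λ k0 → ℕP.<⇒≢ 0<q₁ (sym (cong (λ n → p ℕ.^ n ∸ 1) (trans s≡ℓk (trans (cong (ℓ ℕ.*_) k0) (ℕP.*-zeroʳ ℓ)))))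

  0<s : 0 ℕ.< s
  0<s = subst (0 ℕ.<_) (sym s≡ℓk) (ℕP.*-mono-≤ 1≤ℓ 0<k)

  p^<p^ : ∀ {a b} → a ℕ.< b → p ℕ.^ a ℕ.< p ℕ.^ b
  p^<p^ = ℕP.^-monoʳ-< p 1<p

  -- The functions x ↦ x^(Pⁱ), i < k, are independent: pair them with x^(q−2).
  tr≢0 : ¬ (∀ x → tr x ≡ 0#)
  tr≢0 all0 = 1≢0 (trans (sym (-‿involutive 1#)) (trans (cong -_ (trans (sym total) zero-total)) -0#≈0#))
    where
    open ≡-Reasoning
    zero-total : S.ΣF (λ x → tr x * (x ^ᶠ (q₁ ∸ 1))) ≡ 0#
    zero-total = S.ΣL-0 elements λ x → trans (*-congʳ (all0 x)) (zeroˡ _)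
    -- Modulo q - 1 this exponent is P^i - 1, which is 0 for i = 0 and lies strictly between 0 and q
    -- - 1 for 0 < i < k. So only the first power sum survives.
    e : ℕ → ℕ
    e i = p ℕ.^ (ℓ ℕ.* i) ℕ.+ (q₁ ∸ 1)
    e≡ : ∀ i → e i ≡ q₁ ℕ.+ (p ℕ.^ (ℓ ℕ.* i) ∸ 1)
    e≡ i = trans (cong (ℕ._+ (q₁ ∸ 1)) (sym (ℕP.m+[n∸m]≡n (1≤p^ (ℓ ℕ.* i)))))
      (trans (lem (p ℕ.^ (ℓ ℕ.* i) ∸ 1) (q₁ ∸ 1)) (cong (ℕ._+ (p ℕ.^ (ℓ ℕ.* i) ∸ 1)) (ℕP.m+[n∸m]≡n 0<q₁)))
      where
      lem : ∀ a b → (1 ℕ.+ a) ℕ.+ b ≡ (1 ℕ.+ b) ℕ.+ a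
      lem = ℕSolver.solve-∀
    vanish : ∀ i → 0 ℕ.< i → i ℕ.< k → S.ΣF (_^ᶠ e i) ≡ 0#
    vanish i 0<i i<k = power-sum-0 (e i) λ d →
      ℕP.<⇒≱ small (∣ℕ.∣⇒≤ {{ℕ.>-nonZero pos′}} (∣ℕ.∣m+n∣m⇒∣n (subst (q₁ ∣ℕ.∣_) (e≡ i) d) ∣ℕ.∣-refl))
      where
      0<ℓi : 0 ℕ.< ℓ ℕ.* i
      0<ℓi = ℕP.*-mono-≤ 1≤ℓ 0<i
      pos′ : 0 ℕ.< p ℕ.^ (ℓ ℕ.* i) ∸ 1
      pos′ = ℕP.m<n⇒0<n∸m (p^<p^ 0<ℓi)
      small : p ℕ.^ (ℓ ℕ.* i) ∸ 1 ℕ.< q₁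
      small = ℕP.∸-monoˡ-< (p^<p^ (subst (ℓ ℕ.* i ℕ.<_) (sym s≡ℓk) (ℕP.*-monoʳ-< ℓ {{ℕ.>-nonZero 1≤ℓ}} i<k))) (1≤p^ (ℓ ℕ.* i))
    first : S.ΣF (_^ᶠ e 0) ≡ - 1#
    first = power-sum-neg1 (e 0) (subst (0 ℕ.<_) (sym e0) 0<q₁) (subst (q₁ ∣ℕ.∣_) (sym e0) ∣ℕ.∣-refl)
      where
      e0 : e 0 ≡ q₁
      e0 = trans (e≡ 0) (trans (cong (λ n → q₁ ℕ.+ (p ℕ.^ n ∸ 1)) (ℕP.*-zeroʳ ℓ)) (ℕP.+-identityʳ q₁))
    split : ∀ n → n ≡ k → 0 ℕ.< n → S.Σ< n (λ i → S.ΣF (_^ᶠ e i)) ≡ - 1#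
    split (suc n) n≡k _ = trans (cong₂ _+_ first (S.Σ<-0 n λ i i<n → vanish (suc i) (s≤s z≤n) (subst (suc i ℕ.<_) n≡k (s≤s i<n)))) (+-identityʳ _)
    total : S.ΣF (λ x → tr x * (x ^ᶠ (q₁ ∸ 1))) ≡ - 1#
    total = begin
      S.ΣF (λ x → tr x * (x ^ᶠ (q₁ ∸ 1))) ≡⟨ S.ΣL-cong elements (λ x → trans (*-congʳ (tr≡ x)) (trans (*-comm _ _) (sym (S.Σ<-*ˡ k _ _)))) ⟩
      S.ΣF (λ x → S.Σ< k (λ i → (x ^ᶠ (q₁ ∸ 1)) * conj i x)) ≡⟨ sym (S.Σ<-swapL k elements _) ⟩
      S.Σ< k (λ i → S.ΣF (λ x → (x ^ᶠ (q₁ ∸ 1)) * conj i x)) ≡⟨ S.Σ<-cong k (λ i _ → S.ΣL-cong elements λ x → trans (*-comm _ _) (sym (^-+ x (p ℕ.^ (ℓ ℕ.* i)) (q₁ ∸ 1)))) ⟩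
      S.Σ< k (λ i → S.ΣF (_^ᶠ e i)) ≡⟨ split k refl 0<k ⟩
      - 1# ∎

  -- Summed over the multiples of a subfield element t by K, this gives P - 1 for t = 0 and -1
  -- otherwise, exactly as a nontrivial additive character of the subfield does.
  ω : Carrier → ℤ
  ω t = 𝟙 (t ≟ 0#) ℤ.- 𝟙 (t ≟ 1#)

  -- On functions invariant under K this is the value at a nontrivial additive character.
  hat : (Carrier → ℤ) → ℤ
  hat g = ΣF (λ x → ω (tr x) ℤ.* g x)

  hat-cong : ∀ {g h} → (∀ x → g x ≡ h x) → hat g ≡ hat h
  hat-cong e = Z.ΣL-cong elements λ x → cong (ω (tr x) ℤ.*_) (e x)

  hat-+ : ∀ g h → hat (λ x → g x ℤ.+ h x) ≡ hat g ℤ.+ hat h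
  hat-+ g h = trans (Z.ΣL-cong elements λ x → ℤP.*-distribˡ-+ (ω (tr x)) (g x) (h x)) (Z.ΣL-+ elements _ _)

  hat-* : ∀ c g → hat (λ x → c ℤ.* g x) ≡ c ℤ.* hat g
  hat-* c g = trans (Z.ΣL-cong elements λ x → lem (ω (tr x)) c (g x)) (Z.ΣL-*ˡ elements c _)
    where
    lem : ∀ a c b → a ℤ.* (c ℤ.* b) ≡ c ℤ.* (a ℤ.* b)
    lem = solve-∀

  hat-neg : ∀ g → hat (λ x → ℤ.- g x) ≡ ℤ.- hat g
  hat-neg g = trans (hat-cong λ x → sym (ℤP.-1*i≡-i (g x))) (trans (hat-* ℤ.-1ℤ g) (ℤP.-1*i≡-i (hat g)))

  tr-0 : tr 0# ≡ 0#
  tr-0 = trans (cong tr (sym (zeroˡ 0#))) (trans (tr-* 0# (0^p^ ℓ)) (zeroˡ _))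

  ω-0 : ω 0# ≡ ℤ.1ℤ
  ω-0 = cong₂ ℤ._-_ (𝟙-yes (0# ≟ 0#) refl) (𝟙-no (0# ≟ 1#) 0≢1)

  hat-δ : hat (λ x → 𝟙 (x ≟ 0#)) ≡ ℤ.1ℤ
  hat-δ = trans (Z.ΣL-cong elements λ x → ℤP.*-comm (ω (tr x)) (𝟙 (x ≟ 0#)))
    (trans (Z.ΣF-δ 0# (λ x → ω (tr x))) (trans (cong ω tr-0) ω-0))

  ω-frob : ∀ t → ω (t ^ᶠ p) ≡ ω t
  ω-frob t = cong₂ ℤ._-_ (𝟙-cong ((t ^ᶠ p) ≟ 0#) (t ≟ 0#) (λ e → frob-inj (trans e (sym 0^p))) λ e → trans (cong (_^ᶠ p) e) 0^p)
    (𝟙-cong ((t ^ᶠ p) ≟ 1#) (t ≟ 1#) frob-1 λ e → trans (cong (_^ᶠ p) e) (1^ p))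
    where
    0^p : 0# ^ᶠ p ≡ 0#
    0^p = 0^ p (ℕP.<-trans (s≤s z≤n) 1<p)

  ΣF-frob : ∀ (g : Carrier → ℤ) → ΣF (λ x → g (x ^ᶠ p)) ≡ ΣF g
  ΣF-frob = Z.ΣF-reindex (_^ᶠ p) (_^ᶠ (p ℕ.^ (s ∸ 1))) λ x → trans (sym (^-* x (p ℕ.^ (s ∸ 1)) p))
    (trans (cong (x ^ᶠ_) (trans (ℕP.*-comm (p ℕ.^ (s ∸ 1)) p) (trans (cong (p ℕ.^_) (ℕP.m+[n∸m]≡n 0<s)) (sym suc-q₁)))) (x^q x))

  -- The trace commutes with Frobenius, and `ω` only distinguishes 0 and 1, which Frobenius fixes.
  hat-frob : ∀ g → hat (λ x → g (x ^ᶠ p)) ≡ hat g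
  hat-frob g = trans (Z.ΣL-cong elements λ x → cong (ℤ._* g (x ^ᶠ p)) (sym (trans (cong ω (tr-frob x)) (ω-frob (tr x)))))
    (ΣF-frob (λ x → ω (tr x) ℤ.* g x))

  suc-P₁ : suc (P ∸ 1) ≡ P
  suc-P₁ = ℕP.m+[n∸m]≡n (1≤p^ ℓ)

  0<P₁ : 0 ℕ.< P ∸ 1
  0<P₁ = ℕP.m<n⇒0<n∸m (p^<p^ 1≤ℓ)

  InK⇒fixed : ∀ {c} → InK c → c ^ᶠ P ≡ c
  InK⇒fixed {c} e = trans (cong (c ^ᶠ_) (sym suc-P₁)) (trans (*-congˡ e) (*-identityʳ c))

  fixed⇒InK : ∀ {c} → c ≢ 0# → c ^ᶠ P ≡ c → InK c
  fixed⇒InK {c} c≢0 e = *-cancelˡ c≢0 (trans (trans (cong (c ^ᶠ_) suc-P₁) e) (sym (*-identityʳ c)))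

  InK-≢0 : ∀ {c} → InK c → c ≢ 0#
  InK-≢0 e refl = 0≢1 (trans (sym (0^ (P ∸ 1) 0<P₁)) e)

  InK-* : ∀ {c d} → InK c → InK d → InK (c * d)
  InK-* {c} {d} e e′ = trans (*-^ c d (P ∸ 1)) (trans (cong₂ _*_ e e′) (*-identityˡ 1#))

  InK-inv : ∀ {c} → InK c → InK (inv c)
  InK-inv {c} e = trans (sym (*-identityˡ _)) (trans (*-congʳ (sym e)) (trans (sym (*-^ c (inv c) (P ∸ 1)))
    (trans (cong (_^ᶠ (P ∸ 1)) (inv-r (InK-≢0 e))) (1^ (P ∸ 1)))))

  InK-−1 : InK (- 1#)
  InK-−1 = trans (cong (λ n → (- 1#) ^ᶠ (n ∸ 1)) (proj₂ P-odd)) (-1^even (proj₁ P-odd))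

  κ : Carrier → ℤ
  κ c = 𝟙 ((c ^ᶠ (P ∸ 1)) ≟ 1#)

  κ-yes : ∀ {c} → InK c → κ c ≡ ℤ.1ℤ
  κ-yes {c} e = 𝟙-yes ((c ^ᶠ (P ∸ 1)) ≟ 1#) e

  κ-0 : κ 0# ≡ ℤ.0ℤ
  κ-0 = 𝟙-no ((0# ^ᶠ (P ∸ 1)) ≟ 1#) λ e → InK-≢0 e refl

  P₁ : ℤ
  P₁ = ℤ.+ (P ∸ 1)

  private
    Rq : ℕ
    Rq = R′ ℕ.* 2 ℕ.^ m

  q₁≡P₁R : q₁ ≡ (P ∸ 1) ℕ.* (R′ ℕ.* 2 ℕ.^ m)
  q₁≡P₁R = trans (sym R≡) (ℕP.*-comm (R′ ℕ.* 2 ℕ.^ m) (P ∸ 1))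

  γ^R-InK : InK (γ ^ᶠ (R′ ℕ.* 2 ℕ.^ m))
  γ^R-InK = trans (sym (^-* γ (R′ ℕ.* 2 ℕ.^ m) (P ∸ 1))) (trans (cong (γ ^ᶠ_) R≡) γ^q₁)

  -- γ^e lies in K exactly when (q-1)/(P-1) divides e, hence once in each block of that length.
  Σκ : ΣF κ ≡ P₁
  Σκ = begin
    ΣF κ ≡⟨ Z.ΣF-powers κ ⟩
    κ 0# ℤ.+ Z.Σ< q₁ (λ e → κ (γ ^ᶠ e)) ≡⟨ trans (cong (ℤ._+ Z.Σ< q₁ (λ e → κ (γ ^ᶠ e))) κ-0) (ℤP.+-identityˡ _) ⟩
    Z.Σ< q₁ (λ e → κ (γ ^ᶠ e)) ≡⟨ cong (λ n → Z.Σ< n (λ e → κ (γ ^ᶠ e))) q₁≡P₁R ⟩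
    Z.Σ< ((P ∸ 1) ℕ.* Rq) (λ e → κ (γ ^ᶠ e)) ≡⟨ Z.Σ<-periodic (P ∸ 1) Rq (λ e → κ (γ ^ᶠ e)) per ⟩
    Z.ι (P ∸ 1) ℤ.* Z.Σ< Rq (λ e → κ (γ ^ᶠ e)) ≡⟨ cong₂ ℤ._*_ (ιZ (P ∸ 1)) (block Rq refl 0<R) ⟩
    P₁ ℤ.* ℤ.1ℤ ≡⟨ ℤP.*-identityʳ P₁ ⟩
    P₁ ∎
    where
    open ≡-Reasoning
    per : ∀ e → κ (γ ^ᶠ (Rq ℕ.+ e)) ≡ κ (γ ^ᶠ e)
    per e = cong (λ z → 𝟙 (z ≟ 1#)) (trans (cong (_^ᶠ (P ∸ 1)) (^-+ γ Rq e)) (trans (*-^ _ (γ ^ᶠ e) (P ∸ 1))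
      (trans (*-congʳ γ^R-InK) (*-identityˡ _))))
    0<R : 0 ℕ.< Rq
    0<R = ℕP.n≢0⇒n>0 λ e → ℕP.<⇒≢ 0<q₁ (sym (trans q₁≡P₁R (trans (cong ((P ∸ 1) ℕ.*_) e) (ℕP.*-zeroʳ (P ∸ 1)))))
    out : ∀ e → 0 ℕ.< e → e ℕ.< Rq → κ (γ ^ᶠ e) ≡ ℤ.0ℤ
    out e 0<e e<R = 𝟙-no (((γ ^ᶠ e) ^ᶠ (P ∸ 1)) ≟ 1#) λ z → ℕP.<⇒≱ e<R (∣ℕ.∣⇒≤ {{ℕ.>-nonZero 0<e}}
      (∣ℕ.*-cancelˡ-∣ (P ∸ 1) {{ℕ.>-nonZero 0<P₁}} (subst₂ ∣ℕ._∣_ q₁≡P₁R (ℕP.*-comm e (P ∸ 1)) (γ^≡1⇒∣ (e ℕ.* (P ∸ 1)) (trans (^-* γ e (P ∸ 1)) z)))))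
    block : ∀ n → n ≡ Rq → 0 ℕ.< n → Z.Σ< n (λ e → κ (γ ^ᶠ e)) ≡ ℤ.1ℤ
    block (suc n) e _ = trans (cong₂ ℤ._+_ (κ-yes (1^ (P ∸ 1)))
      (Z.Σ<-0 n λ i i<n → out (suc i) (s≤s z≤n) (subst (suc i ℕ.<_) e (s≤s i<n)))) refl

  Σκδ : ∀ a → ΣF (λ c → κ c ℤ.* 𝟙 (c ≟ a)) ≡ κ a
  Σκδ a = trans (Z.ΣL-cong elements λ c → ℤP.*-comm (κ c) (𝟙 (c ≟ a))) (Z.ΣF-δ a κ)

  τ : Carrier → ℤ
  τ u = ΣF (λ c → κ c ℤ.* ω (c * u))

  -- For u ≠ 0 in the subfield no c in K gives c u = 0 and exactly one, the inverse of u, gives c u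
  -- = 1.
  τ-val : ∀ u → u ^ᶠ P ≡ u → τ u ≡ ℤ.+ P ℤ.* 𝟙 (u ≟ 0#) ℤ.- ℤ.1ℤ
  τ-val u fix with u ≟ 0#
  ... | yes refl = trans (Z.ΣL-cong elements λ c → trans (cong (κ c ℤ.*_) (trans (cong ω (zeroʳ c)) ω-0)) (ℤP.*-identityʳ (κ c)))
        (trans Σκ (trans (alg P₁) (cong (λ z → ℤ.+ z ℤ.* ℤ.1ℤ ℤ.- ℤ.1ℤ) suc-P₁)))
    where
    alg : ∀ x → x ≡ (ℤ.1ℤ ℤ.+ x) ℤ.* ℤ.1ℤ ℤ.- ℤ.1ℤ
    alg = solve-∀
  ... | no u≢0 = trans (Z.ΣL-cong elements pt) (trans (Z.ΣL-*ˡ elements ℤ.-1ℤ _)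
        (trans (cong (ℤ.-1ℤ ℤ.*_) (trans (Σκδ (inv u)) (κ-yes (InK-inv (fixed⇒InK u≢0 fix))))) (sym (cong (ℤ._- ℤ.1ℤ) (ℤP.*-zeroʳ (ℤ.+ P))))))
    where
    alg : ∀ x → ℤ.- x ≡ ℤ.-1ℤ ℤ.* x
    alg = solve-∀
    pt : ∀ c → κ c ℤ.* ω (c * u) ≡ ℤ.-1ℤ ℤ.* (κ c ℤ.* 𝟙 (c ≟ inv u))
    pt c with c ≟ 0#
    ... | yes refl = trans (cong (ℤ._* ω (0# * u)) κ-0) (sym (cong (λ z → ℤ.-1ℤ ℤ.* (z ℤ.* 𝟙 (0# ≟ inv u))) κ-0))
    ... | no c≢0 = trans (cong (κ c ℤ.*_) ω≡) (alg′ (κ c) (𝟙 (c ≟ inv u)))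
      where
      alg′ : ∀ a b → a ℤ.* (ℤ.0ℤ ℤ.- b) ≡ ℤ.-1ℤ ℤ.* (a ℤ.* b)
      alg′ = solve-∀
      ω≡ : ω (c * u) ≡ ℤ.0ℤ ℤ.- 𝟙 (c ≟ inv u)
      ω≡ = cong₂ ℤ._-_ (𝟙-no ((c * u) ≟ 0#) (*-≢0 c≢0 u≢0)) (𝟙-cong ((c * u) ≟ 1#) (c ≟ inv u)
        (λ e → *-cancelˡ u≢0 (trans (*-comm u c) (trans e (sym (inv-r u≢0))))) λ e → trans (*-congʳ e) (inv-l u≢0))

  fixed-+* : ∀ {t c t′} → t ^ᶠ P ≡ t → InK c → t′ ^ᶠ P ≡ t′ → (t + c * t′) ^ᶠ P ≡ t + c * t′
  fixed-+* {t} {c} {t′} e c∈ e′ = trans (frobⁱ-+ ℓ t (c * t′)) (cong₂ _+_ e (trans (*-^ c t′ P) (cong₂ _*_ (InK⇒fixed c∈) e′)))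

  κ-guard : ∀ c {a b : ℤ} → (InK c → a ≡ b) → κ c ℤ.* a ≡ κ c ℤ.* b
  κ-guard c h with (c ^ᶠ (P ∸ 1)) ≟ 1#
  ... | yes e = cong (ℤ.1ℤ ℤ.*_) (h e)
  ... | no _ = refl

  -- This replaces ψ(t + t′) = ψ(t) ψ(t′) for an additive character: `ω` is not multiplicative, but
  -- it becomes so after independent averaging of both arguments over K.
  τ-product : ∀ t t′ → t ^ᶠ P ≡ t → t′ ^ᶠ P ≡ t′ → ΣF (λ c → κ c ℤ.* τ (t + c * t′)) ≡ τ t ℤ.* τ t′
  τ-product t t′ fix fix′ = begin
    ΣF (λ c → κ c ℤ.* τ (t + c * t′)) ≡⟨ Z.ΣL-cong elements (λ c → trans (κ-guard c λ c∈ → τ-val (t + c * t′) (fixed-+* fix c∈ fix′)) (alg₁ (κ c) (ℤ.+ P) (𝟙 ((t + c * t′) ≟ 0#)))) ⟩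
    ΣF (λ c → ℤ.+ P ℤ.* (κ c ℤ.* 𝟙 ((t + c * t′) ≟ 0#)) ℤ.+ ℤ.-1ℤ ℤ.* κ c) ≡⟨ trans (Z.ΣL-+ elements _ _) (cong₂ ℤ._+_ (Z.ΣL-*ˡ elements (ℤ.+ P) _) (trans (Z.ΣL-*ˡ elements ℤ.-1ℤ κ) (cong (ℤ.-1ℤ ℤ.*_) Σκ))) ⟩
    ℤ.+ P ℤ.* ΣF (λ c → κ c ℤ.* 𝟙 ((t + c * t′) ≟ 0#)) ℤ.+ ℤ.-1ℤ ℤ.* P₁ ≡⟨ cong (λ z → ℤ.+ P ℤ.* z ℤ.+ ℤ.-1ℤ ℤ.* P₁) count ⟩
    ℤ.+ P ℤ.* rhs ℤ.+ ℤ.-1ℤ ℤ.* P₁ ≡⟨ final ⟩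
    (ℤ.+ P ℤ.* 𝟙 (t ≟ 0#) ℤ.- ℤ.1ℤ) ℤ.* (ℤ.+ P ℤ.* 𝟙 (t′ ≟ 0#) ℤ.- ℤ.1ℤ) ≡⟨ sym (cong₂ ℤ._*_ (τ-val t fix) (τ-val t′ fix′)) ⟩
    τ t ℤ.* τ t′ ∎
    where
    open ≡-Reasoning
    open FSolver using (solve; _:=_; _:+_; _:*_; _:-_; :-_; con)
    alg₁ : ∀ a p d → a ℤ.* (p ℤ.* d ℤ.- ℤ.1ℤ) ≡ p ℤ.* (a ℤ.* d) ℤ.+ ℤ.-1ℤ ℤ.* a
    alg₁ = solve-∀
    -- The number of c in K with t + c t′ = 0: for t′ = 0 all or none, for t′ ≠ 0 one unless t = 0.
    rhs : ℤ
    rhs = if does (t′ ≟ 0#) then P₁ ℤ.* 𝟙 (t ≟ 0#) else (ℤ.1ℤ ℤ.- 𝟙 (t ≟ 0#))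
    count : ΣF (λ c → κ c ℤ.* 𝟙 ((t + c * t′) ≟ 0#)) ≡ rhs
    count with t′ ≟ 0#
    ... | yes refl = trans (Z.ΣL-cong elements λ c → cong (λ z → κ c ℤ.* 𝟙 (z ≟ 0#)) (trans (+-congˡ (zeroʳ c)) (+-identityʳ t)))
          (trans (Z.ΣL-*ʳ elements _ κ) (cong (ℤ._* 𝟙 (t ≟ 0#)) Σκ))
    ... | no t′≢0 = trans (Z.ΣL-cong elements λ c → cong (κ c ℤ.*_) (𝟙-cong ((t + c * t′) ≟ 0#) (c ≟ a) (to c) (from c))) (trans (Σκδ a) κa)
      where
      a : Carrier
      a = (- 1#) * (t * inv t′)
      from : ∀ c → c ≡ a → t + c * t′ ≡ 0#
      from c refl = trans (solve 3 (λ t i t′ → t :+ ((:- con (ℤ.+ 1)) :* (t :* i)) :* t′ := t :- t :* (i :* t′)) refl t (inv t′) t′)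
        (trans (cong (λ z → t − t * z) (inv-l t′≢0)) (≡⇒−≡0 (sym (*-identityʳ t))))
      to : ∀ c → t + c * t′ ≡ 0# → c ≡ a
      to c e = *-cancelˡ t′≢0 (−≡0 (trans (solve 3 (λ t c at → t :* c :- at := (at :* con (ℤ.+ 0) :+ t :* c) :- at) refl t′ c (t′ * a))
        (trans (cong (_− t′ * a) (trans (+-congʳ (zeroʳ _)) (+-identityˡ _)))
          (trans (solve 3 (λ t c b → t :* c :- t :* b := (c :* t) :- (b :* t)) refl t′ c a)
            (trans (solve 3 (λ t x y → x :- y := (t :+ x) :- (t :+ y)) refl t (c * t′) (a * t′))
              (≡⇒−≡0 (trans e (sym (from a refl)))))))))
      κa : κ a ≡ ℤ.1ℤ ℤ.- 𝟙 (t ≟ 0#)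
      κa with t ≟ 0#
      ... | yes refl = trans (cong κ (trans (*-congˡ (zeroˡ _)) (zeroʳ _))) κ-0
      ... | no t≢0 = κ-yes (InK-* InK-−1 (InK-* (fixed⇒InK t≢0 fix) (InK-inv (fixed⇒InK t′≢0 fix′))))
    final : ℤ.+ P ℤ.* rhs ℤ.+ ℤ.-1ℤ ℤ.* P₁ ≡ (ℤ.+ P ℤ.* 𝟙 (t ≟ 0#) ℤ.- ℤ.1ℤ) ℤ.* (ℤ.+ P ℤ.* 𝟙 (t′ ≟ 0#) ℤ.- ℤ.1ℤ)
    final = subst (λ z → z ℤ.* rhs ℤ.+ ℤ.-1ℤ ℤ.* P₁ ≡ (z ℤ.* 𝟙 (t ≟ 0#) ℤ.- ℤ.1ℤ) ℤ.* (z ℤ.* 𝟙 (t′ ≟ 0#) ℤ.- ℤ.1ℤ))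
      (cong (λ z → ℤ.+ z) suc-P₁) (cases P₁)
      where
      yy : ∀ n → (ℤ.1ℤ ℤ.+ n) ℤ.* (n ℤ.* ℤ.1ℤ) ℤ.+ ℤ.-1ℤ ℤ.* n ≡ ((ℤ.1ℤ ℤ.+ n) ℤ.* ℤ.1ℤ ℤ.- ℤ.1ℤ) ℤ.* ((ℤ.1ℤ ℤ.+ n) ℤ.* ℤ.1ℤ ℤ.- ℤ.1ℤ)
      yy = solve-∀
      yn : ∀ n → (ℤ.1ℤ ℤ.+ n) ℤ.* (n ℤ.* ℤ.0ℤ) ℤ.+ ℤ.-1ℤ ℤ.* n ≡ ((ℤ.1ℤ ℤ.+ n) ℤ.* ℤ.0ℤ ℤ.- ℤ.1ℤ) ℤ.* ((ℤ.1ℤ ℤ.+ n) ℤ.* ℤ.1ℤ ℤ.- ℤ.1ℤ)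
      yn = solve-∀
      ny : ∀ n → (ℤ.1ℤ ℤ.+ n) ℤ.* (ℤ.1ℤ ℤ.- ℤ.1ℤ) ℤ.+ ℤ.-1ℤ ℤ.* n ≡ ((ℤ.1ℤ ℤ.+ n) ℤ.* ℤ.1ℤ ℤ.- ℤ.1ℤ) ℤ.* ((ℤ.1ℤ ℤ.+ n) ℤ.* ℤ.0ℤ ℤ.- ℤ.1ℤ)
      ny = solve-∀
      nn : ∀ n → (ℤ.1ℤ ℤ.+ n) ℤ.* (ℤ.1ℤ ℤ.- ℤ.0ℤ) ℤ.+ ℤ.-1ℤ ℤ.* n ≡ ((ℤ.1ℤ ℤ.+ n) ℤ.* ℤ.0ℤ ℤ.- ℤ.1ℤ) ℤ.* ((ℤ.1ℤ ℤ.+ n) ℤ.* ℤ.0ℤ ℤ.- ℤ.1ℤ)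
      nn = solve-∀
      cases : ∀ n → (ℤ.1ℤ ℤ.+ n) ℤ.* (if does (t′ ≟ 0#) then n ℤ.* 𝟙 (t ≟ 0#) else (ℤ.1ℤ ℤ.- 𝟙 (t ≟ 0#))) ℤ.+ ℤ.-1ℤ ℤ.* n ≡ ((ℤ.1ℤ ℤ.+ n) ℤ.* 𝟙 (t ≟ 0#) ℤ.- ℤ.1ℤ) ℤ.* ((ℤ.1ℤ ℤ.+ n) ℤ.* 𝟙 (t′ ≟ 0#) ℤ.- ℤ.1ℤ)
      cases n with t ≟ 0# | t′ ≟ 0#
      ... | yes _ | yes _ = yy n
      ... | yes _ | no _ = ny n
      ... | no _ | yes _ = yn n
      ... | no _ | no _ = nn n

  module Bihat (G : Carrier → Carrier → ℤ)
               (G-x : ∀ c x y → InK c → G (c * x) y ≡ G x y)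
               (G-y : ∀ c x y → InK c → G x (c * y) ≡ G x y) where
    ΣΣ : (Carrier → Carrier → ℤ) → ℤ
    ΣΣ U = ΣF (λ x → ΣF (λ y → U x y ℤ.* G x y))

    ΣΣ-cong : ∀ {U V} → (∀ x y → U x y ≡ V x y) → ΣΣ U ≡ ΣΣ V
    ΣΣ-cong e = Z.ΣL-cong elements λ x → Z.ΣL-cong elements λ y → cong (ℤ._* G x y) (e x y)

    average : ∀ (U : Carrier → Carrier → Carrier → ℤ) L → (∀ c → InK c → L ≡ ΣΣ (U c)) →
      P₁ ℤ.* L ≡ ΣΣ (λ x y → ΣF (λ c → κ c ℤ.* U c x y))
    average U L inv-L = begin
      P₁ ℤ.* L ≡⟨ cong (ℤ._* L) (sym Σκ) ⟩
      ΣF κ ℤ.* L ≡⟨ sym (Z.ΣL-*ʳ elements L κ) ⟩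
      ΣF (λ c → κ c ℤ.* L) ≡⟨ Z.ΣL-cong elements (λ c → trans (κ-guard c (inv-L c)) (push c)) ⟩
      ΣF (λ c → ΣF (λ x → ΣF (λ y → κ c ℤ.* U c x y ℤ.* G x y))) ≡⟨ Z.ΣL-swap elements elements _ ⟩
      ΣF (λ x → ΣF (λ c → ΣF (λ y → κ c ℤ.* U c x y ℤ.* G x y))) ≡⟨ Z.ΣL-cong elements (λ x → trans (Z.ΣL-swap elements elements _)
           (Z.ΣL-cong elements λ y → Z.ΣL-*ʳ elements (G x y) (λ c → κ c ℤ.* U c x y))) ⟩
      ΣΣ (λ x y → ΣF (λ c → κ c ℤ.* U c x y)) ∎
      where
      open ≡-Reasoning
      push : ∀ c → κ c ℤ.* ΣΣ (U c) ≡ ΣF (λ x → ΣF (λ y → κ c ℤ.* U c x y ℤ.* G x y))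
      push c = trans (sym (Z.ΣL-*ˡ elements (κ c) _)) (Z.ΣL-cong elements λ x →
        trans (sym (Z.ΣL-*ˡ elements (κ c) _)) (Z.ΣL-cong elements λ y → sym (ℤP.*-assoc (κ c) (U c x y) (G x y))))

    scale-x : ∀ (W : Carrier → Carrier → ℤ) c → InK c → ΣΣ (λ x y → W (tr x) (tr y)) ≡ ΣΣ (λ x y → W (c * tr x) (tr y))
    scale-x W c c∈ = trans (sym (Z.ΣF-scale (InK-≢0 c∈) (λ x → ΣF (λ y → W (tr x) (tr y) ℤ.* G x y))))
      (Z.ΣL-cong elements λ x → Z.ΣL-cong elements λ y → cong₂ ℤ._*_ (cong (λ z → W z (tr y)) (tr-* x (InK⇒fixed c∈))) (G-x c x y c∈))

    scale-y : ∀ (W : Carrier → Carrier → ℤ) c → InK c → ΣΣ (λ x y → W (tr x) (tr y)) ≡ ΣΣ (λ x y → W (tr x) (c * tr y))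
    scale-y W c c∈ = Z.ΣL-cong elements λ x → trans (sym (Z.ΣF-scale (InK-≢0 c∈) (λ y → W (tr x) (tr y) ℤ.* G x y)))
      (Z.ΣL-cong elements λ y → cong₂ ℤ._*_ (cong (W (tr x)) (tr-* y (InK⇒fixed c∈))) (G-y c x y c∈))

    -- Multiplied by P₁², both sides become the sum of `τ (tr x) τ (tr y) G x y`. On the left x and
    -- y are first scaled together and then y alone, so that `τ-product` applies; on the right they
    -- are scaled one after the other.
    joint : ΣΣ (λ x y → ω (tr x + tr y)) ≡ ΣΣ (λ x y → ω (tr x) ℤ.* ω (tr y))
    joint = cancel (cancel (trans lhs (sym rhs)))
      where
      open ≡-Reasoning
      cancel : ∀ {a b} → P₁ ℤ.* a ≡ P₁ ℤ.* b → a ≡ b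
      cancel {a} {b} = ℤP.*-cancelˡ-≡ P₁ a b {{ℕ.>-nonZero 0<P₁}}
      lhs : P₁ ℤ.* (P₁ ℤ.* ΣΣ (λ x y → ω (tr x + tr y))) ≡ ΣΣ (λ x y → τ (tr x) ℤ.* τ (tr y))
      lhs = begin
        P₁ ℤ.* (P₁ ℤ.* ΣΣ (λ x y → ω (tr x + tr y))) ≡⟨ cong (P₁ ℤ.*_) (average (λ c x y → ω (c * (tr x + tr y))) _ λ c c∈ →
             trans (scale-x (λ t t′ → ω (t + t′)) c c∈) (trans (scale-y (λ t t′ → ω (c * t + t′)) c c∈)
               (ΣΣ-cong λ x y → cong ω (sym (distribˡ c (tr x) (tr y)))))) ⟩
        P₁ ℤ.* ΣΣ (λ x y → τ (tr x + tr y)) ≡⟨ average (λ c x y → τ (tr x + c * tr y)) _ (λ c c∈ → scale-y (λ t t′ → τ (t + t′)) c c∈) ⟩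
        ΣΣ (λ x y → ΣF (λ c → κ c ℤ.* τ (tr x + c * tr y))) ≡⟨ ΣΣ-cong (λ x y → τ-product (tr x) (tr y) (tr-fixed x) (tr-fixed y)) ⟩
        ΣΣ (λ x y → τ (tr x) ℤ.* τ (tr y)) ∎
      rhs : P₁ ℤ.* (P₁ ℤ.* ΣΣ (λ x y → ω (tr x) ℤ.* ω (tr y))) ≡ ΣΣ (λ x y → τ (tr x) ℤ.* τ (tr y))
      rhs = begin
        P₁ ℤ.* (P₁ ℤ.* ΣΣ (λ x y → ω (tr x) ℤ.* ω (tr y))) ≡⟨ cong (P₁ ℤ.*_) (trans (average (λ c x y → ω (c * tr x) ℤ.* ω (tr y)) _ λ c c∈ →
             scale-x (λ t t′ → ω t ℤ.* ω t′) c c∈) (ΣΣ-cong λ x y → trans (Z.ΣL-cong elements λ c → sym (ℤP.*-assoc (κ c) (ω (c * tr x)) (ω (tr y)))) (Z.ΣL-*ʳ elements (ω (tr y)) _))) ⟩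
        P₁ ℤ.* ΣΣ (λ x y → τ (tr x) ℤ.* ω (tr y)) ≡⟨ average (λ c x y → τ (tr x) ℤ.* ω (c * tr y)) _ (λ c c∈ → scale-y (λ t t′ → τ t ℤ.* ω t′) c c∈) ⟩
        ΣΣ (λ x y → ΣF (λ c → κ c ℤ.* (τ (tr x) ℤ.* ω (c * tr y)))) ≡⟨ ΣΣ-cong (λ x y → trans (Z.ΣL-cong elements λ c → alg (κ c) (τ (tr x)) (ω (c * tr y))) (Z.ΣL-*ˡ elements (τ (tr x)) _)) ⟩
        ΣΣ (λ x y → τ (tr x) ℤ.* τ (tr y)) ∎
        where
        alg : ∀ a b c → a ℤ.* (b ℤ.* c) ≡ b ℤ.* (a ℤ.* c)
        alg = solve-∀

    -- hat is multiplicative for additive convolution.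
    bihat : hat (λ z → ΣF (λ x → G x (z − x))) ≡ hat (λ y → hat (λ x → G x y))
    bihat = begin
      ΣF (λ z → ω (tr z) ℤ.* ΣF (λ x → G x (z − x))) ≡⟨ Z.ΣL-cong elements (λ z → sym (Z.ΣL-*ˡ elements (ω (tr z)) _)) ⟩
      ΣF (λ z → ΣF (λ x → ω (tr z) ℤ.* G x (z − x))) ≡⟨ Z.ΣL-swap elements elements _ ⟩
      ΣF (λ x → ΣF (λ z → ω (tr z) ℤ.* G x (z − x))) ≡⟨ Z.ΣL-cong elements (λ x → trans (sym (Z.ΣF-translate x _)) (Z.ΣL-cong elements λ y →
           cong₂ (λ a b → ω a ℤ.* G x b) (trans (tr-+ y x) (+-comm (tr y) (tr x))) (sub x y))) ⟩
      ΣΣ (λ x y → ω (tr x + tr y)) ≡⟨ joint ⟩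
      ΣΣ (λ x y → ω (tr x) ℤ.* ω (tr y)) ≡⟨ Z.ΣL-swap elements elements _ ⟩
      ΣF (λ y → ΣF (λ x → ω (tr x) ℤ.* ω (tr y) ℤ.* G x y)) ≡⟨ Z.ΣL-cong elements (λ y → trans (Z.ΣL-cong elements λ x → alg (ω (tr x)) (ω (tr y)) (G x y)) (Z.ΣL-*ˡ elements (ω (tr y)) _)) ⟩
      hat (λ y → hat (λ x → G x y)) ∎
      where
      open ≡-Reasoning
      sub : ∀ x y → (y + x) − x ≡ y
      sub = solve 2 (λ x y → (y :+ x) :- x := y) refl
        where open FSolver using (solve; _:=_; _:+_; _:-_)
      alg : ∀ a b c → a ℤ.* b ℤ.* c ≡ b ℤ.* (a ℤ.* c)
      alg = solve-∀

  private
    Σ≥0⇒0 : ∀ (xs : List Carrier) g → (∀ x → ℤ.0ℤ ℤ.≤ g x) → Z.ΣL xs g ≡ ℤ.0ℤ → ∀ {x} → x ∈ xs → g x ≡ ℤ.0ℤ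
    Σ≥0 : ∀ (xs : List Carrier) g → (∀ x → ℤ.0ℤ ℤ.≤ g x) → ℤ.0ℤ ℤ.≤ Z.ΣL xs g
    Σ≥0 [] g h = ℤP.≤-refl
    Σ≥0 (x ∷ xs) g h = ℤP.+-mono-≤ (h x) (Σ≥0 xs g h)
    Σ≥0⇒0 (x ∷ xs) g h e (here refl) = ℤP.≤-antisym (subst (g x ℤ.≤_) e (subst (ℤ._≤ g x ℤ.+ Z.ΣL xs g) (ℤP.+-identityʳ _) (ℤP.+-monoʳ-≤ (g x) (Σ≥0 xs g h)))) (h x)
    Σ≥0⇒0 (x ∷ xs) g h e (there x∈) = Σ≥0⇒0 xs g h (ℤP.≤-antisym (subst (Z.ΣL xs g ℤ.≤_) e (subst (ℤ._≤ g x ℤ.+ Z.ΣL xs g) (ℤP.+-identityˡ _) (ℤP.+-monoˡ-≤ (Z.ΣL xs g) (h x)))) (Σ≥0 xs g h)) x∈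

  -- Convolving the constant 1 with itself multiplies it by q, so h = hat 1 satisfies q h = h². The
  -- root h = q would force ω(tr x) = 1 for all x, hence a vanishing trace.
  hat-1 : hat (λ _ → ℤ.1ℤ) ≡ ℤ.0ℤ
  hat-1 = [ (λ e → ⊥-elim (tr≢0 λ x → zero-tr x (Σ≥0⇒0 elements (λ x → ℤ.1ℤ ℤ.- ω (tr x)) nonneg (total e) (complete x)))) , id ]′
    (ℤP.i*j≡0⇒i≡0∨j≡0 (Q ℤ.- h₀) {h₀} (trans (alg Q h₀) (ℤP.i≡j⇒i-j≡0 sq)))
    where
    open Bihat (λ _ _ → ℤ.1ℤ) (λ _ _ _ _ → refl) (λ _ _ _ _ → refl)
    h₀ Q : ℤ
    h₀ = hat (λ _ → ℤ.1ℤ)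
    Q = ΣF (λ _ → ℤ.1ℤ)
    alg : ∀ q h → (q ℤ.- h) ℤ.* h ≡ q ℤ.* h ℤ.- h ℤ.* h
    alg = solve-∀
    sq : Q ℤ.* h₀ ≡ h₀ ℤ.* h₀
    sq = trans (sym (hat-* Q (λ _ → ℤ.1ℤ))) (trans (hat-cong λ _ → ℤP.*-identityʳ Q) (trans bihat (trans (hat-cong λ _ → sym (ℤP.*-identityʳ h₀)) (hat-* h₀ (λ _ → ℤ.1ℤ)))))
    nonneg : ∀ x → ℤ.0ℤ ℤ.≤ ℤ.1ℤ ℤ.- ω (tr x)
    nonneg x with tr x ≟ 0# | tr x ≟ 1#
    ... | yes _ | yes _ = ℤ.+≤+ z≤n
    ... | yes _ | no _ = ℤ.+≤+ z≤n
    ... | no _ | yes _ = ℤ.+≤+ z≤n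
    ... | no _ | no _ = ℤ.+≤+ z≤n
    zero-tr : ∀ x → ℤ.1ℤ ℤ.- ω (tr x) ≡ ℤ.0ℤ → tr x ≡ 0#
    zero-tr x e with tr x ≟ 0# | tr x ≟ 1#
    zero-tr x e | yes z | _ = z
    zero-tr x () | no _ | yes _
    zero-tr x () | no _ | no _
    total : Q ℤ.- h₀ ≡ ℤ.0ℤ → ΣF (λ x → ℤ.1ℤ ℤ.- ω (tr x)) ≡ ℤ.0ℤ
    total e = trans (Z.ΣL-cong elements λ x → alg₂ (ω (tr x))) (trans (Z.ΣL-+ elements _ _) (trans (cong (λ z → ΣF (λ _ → ℤ.1ℤ) ℤ.+ z) (Z.ΣL-*ˡ elements ℤ.-1ℤ _)) (trans (cong (λ z → ΣF (λ _ → ℤ.1ℤ) ℤ.+ z) (ℤP.-1*i≡-i _)) e)))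
      where
      alg₂ : ∀ w → ℤ.1ℤ ℤ.- w ≡ ℤ.1ℤ ℤ.+ ℤ.-1ℤ ℤ.* (w ℤ.* ℤ.1ℤ)
      alg₂ = solve-∀

-- Frobenius-invariant class functions and the ring ℤ[√-2].

-- Values at γ^(t·n), t = 2^(j−3), of a class function of level j with values X at 1 and Y at γ^t.
octant : ℤ → ℤ → ℕ → ℤ
octant X Y 0 = X
octant X Y 1 = Y
octant X Y 2 = ℤ.0ℤ
octant X Y 3 = Y
octant X Y 4 = ℤ.- X
octant X Y 5 = ℤ.- Y
octant X Y 6 = ℤ.0ℤ
octant X Y 7 = ℤ.- Y
octant X Y (suc (suc (suc (suc (suc (suc (suc (suc n)))))))) = octant X Y n

-- The pattern with 1 at 1, 3 and -1 at 5, 7 is the sum of the basic pattern (1 at 0, -1 at 4)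
-- translated by -1 and by -3, that is by 7 and 5 modulo 8.
octant-decompose : ∀ X Y n → octant X Y n ≡
  X ℤ.* octant ℤ.1ℤ ℤ.0ℤ n ℤ.+ Y ℤ.* (octant ℤ.1ℤ ℤ.0ℤ (7 ℕ.+ n) ℤ.+ octant ℤ.1ℤ ℤ.0ℤ (5 ℕ.+ n))
octant-decompose X Y 0 = lem X Y
  where
  lem : ∀ X Y → X ≡ X ℤ.* ℤ.1ℤ ℤ.+ Y ℤ.* ℤ.0ℤ
  lem = solve-∀
octant-decompose X Y 1 = lem X Y
  where
  lem : ∀ X Y → Y ≡ X ℤ.* ℤ.0ℤ ℤ.+ Y ℤ.* ℤ.1ℤ
  lem = solve-∀
octant-decompose X Y 2 = lem X Y
  where
  lem : ∀ X Y → ℤ.0ℤ ≡ X ℤ.* ℤ.0ℤ ℤ.+ Y ℤ.* ℤ.0ℤ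
  lem = solve-∀
octant-decompose X Y 3 = lem X Y
  where
  lem : ∀ X Y → Y ≡ X ℤ.* ℤ.0ℤ ℤ.+ Y ℤ.* ℤ.1ℤ
  lem = solve-∀
octant-decompose X Y 4 = lem X Y
  where
  lem : ∀ X Y → ℤ.- X ≡ X ℤ.* ℤ.-1ℤ ℤ.+ Y ℤ.* ℤ.0ℤ
  lem = solve-∀
octant-decompose X Y 5 = lem X Y
  where
  lem : ∀ X Y → ℤ.- Y ≡ X ℤ.* ℤ.0ℤ ℤ.+ Y ℤ.* ℤ.-1ℤ
  lem = solve-∀
octant-decompose X Y 6 = lem X Y
  where
  lem : ∀ X Y → ℤ.0ℤ ≡ X ℤ.* ℤ.0ℤ ℤ.+ Y ℤ.* ℤ.0ℤ
  lem = solve-∀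
octant-decompose X Y 7 = lem X Y
  where
  lem : ∀ X Y → ℤ.- Y ≡ X ℤ.* ℤ.0ℤ ℤ.+ Y ℤ.* ℤ.-1ℤ
  lem = solve-∀
octant-decompose X Y (suc (suc (suc (suc (suc (suc (suc (suc n)))))))) = octant-decompose X Y n

octant-+8* : ∀ X Y r v → octant X Y (v ℕ.* 8 ℕ.+ r) ≡ octant X Y r
octant-+8* X Y r zero = refl
octant-+8* X Y r (suc v) = octant-+8* X Y r v

parity : ∀ n → (∃ λ h → n ≡ h ℕ.* 2) ⊎ (∃ λ h → n ≡ 1 ℕ.+ h ℕ.* 2)
parity zero = inj₁ (0 , refl)
parity (suc n) with parity n
... | inj₁ (h , e) = inj₂ (h , cong suc e)
... | inj₂ (h , e) = inj₁ (suc h , cong suc e)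

2-adic : ∀ n e → (∃ λ a → e ≡ 2 ℕ.^ n ℕ.* a) ⊎ (∃ λ i → ∃ λ b → (i ℕ.< n) × e ≡ 2 ℕ.^ i ℕ.* (1 ℕ.+ b ℕ.* 2))
2-adic zero e = inj₁ (e , sym (ℕP.+-identityʳ e))
2-adic (suc n) e with 2-adic n e
... | inj₂ (i , b , i<n , e≡) = inj₂ (i , b , ℕP.m<n⇒m<1+n i<n , e≡)
... | inj₁ (a , e≡) with parity a
... | inj₂ (h , refl) = inj₂ (n , h , ℕP.n<1+n n , e≡)
... | inj₁ (h , refl) = inj₁ (h , trans e≡ (lem (2 ℕ.^ n) h))
  where
  lem : ∀ x h → x ℕ.* (h ℕ.* 2) ≡ 2 ℕ.* x ℕ.* h
  lem = ℕSolver.solve-∀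

^2 : ∀ x → x ℕ.^ 2 ≡ x ℕ.* x
^2 x = cong (x ℕ.*_) (ℕP.*-identityʳ x)

-- p² - 1 is 8 times an odd number, and squaring 1 + 2^k · odd with k ≥ 2 raises the exact power of
-- 2 by one.
p^2^ : ∀ w c → ∃ λ a → (3 ℕ.+ w ℕ.* 8) ℕ.^ (2 ℕ.^ (1 ℕ.+ c)) ≡ 1 ℕ.+ 2 ℕ.^ (3 ℕ.+ c) ℕ.* (1 ℕ.+ a ℕ.* 2)
p^2^ w zero = w ℕ.* 3 ℕ.+ w ℕ.* w ℕ.* 4 , trans (^2 (3 ℕ.+ w ℕ.* 8)) (lem w)
  where
  lem : ∀ w → (3 ℕ.+ w ℕ.* 8) ℕ.* (3 ℕ.+ w ℕ.* 8) ≡ 1 ℕ.+ 8 ℕ.* (1 ℕ.+ (w ℕ.* 3 ℕ.+ w ℕ.* w ℕ.* 4) ℕ.* 2)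
  lem = ℕSolver.solve-∀
p^2^ w (suc c) with p^2^ w c
... | a , e = a ℕ.+ 2 ℕ.^ c ℕ.* 2 ℕ.* (1 ℕ.+ a ℕ.* 2) ℕ.* (1 ℕ.+ a ℕ.* 2) ,
    trans (cong ((3 ℕ.+ w ℕ.* 8) ℕ.^_) (ℕP.*-comm 2 (2 ℕ.^ (1 ℕ.+ c)))) (trans (sym (ℕP.^-*-assoc (3 ℕ.+ w ℕ.* 8) (2 ℕ.^ (1 ℕ.+ c)) 2))
      (trans (^2 ((3 ℕ.+ w ℕ.* 8) ℕ.^ (2 ℕ.^ (1 ℕ.+ c)))) (trans (cong (λ z → z ℕ.* z) e) (lem (2 ℕ.^ c) a))))
  where
  lem : ∀ x a → (1 ℕ.+ 2 ℕ.* (2 ℕ.* (2 ℕ.* x)) ℕ.* (1 ℕ.+ a ℕ.* 2)) ℕ.* (1 ℕ.+ 2 ℕ.* (2 ℕ.* (2 ℕ.* x)) ℕ.* (1 ℕ.+ a ℕ.* 2)) ≡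
    1 ℕ.+ 2 ℕ.* (2 ℕ.* (2 ℕ.* (2 ℕ.* x))) ℕ.* (1 ℕ.+ (a ℕ.+ x ℕ.* 2 ℕ.* (1 ℕ.+ a ℕ.* 2) ℕ.* (1 ℕ.+ a ℕ.* 2)) ℕ.* 2)
  lem = ℕSolver.solve-∀

module ClassFunctions (σ : Setting) where
  open TraceTransform σ public

  -- Such a φ lists the coefficients of an element of ℤ[ζ], ζ of order 2^j; `flip` encodes
  -- ζ^(2^(j-1)) = -1 and `frob` invariance under ζ ↦ ζ^p.
  record ClassFn (j : ℕ) (φ : Carrier → ℤ) : Set where
    field
      φ-0  : φ 0# ≡ ℤ.0ℤ
      same : ∀ u x → u ^ᶠ ex j ≡ 1# → φ (u * x) ≡ φ x
      flip : ∀ u x → u ^ᶠ ex j ≡ - 1# → φ (u * x) ≡ ℤ.- φ x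
      frob : ∀ x → φ (x ^ᶠ p) ≡ φ x
  open ClassFn

  ε-class : ∀ j → ClassFn j (ε j)
  ε-class j = record { φ-0 = ε-0 j ; same = λ _ → ε-same j ; flip = λ _ → ε-flip j ; frob = ε-frob j }

  -- For 1 ≤ j ≤ m, the mean of χ(g) G(χ) over the 2^(j-1) characters χ of exact order 2^j, where
  -- G(χ) is the Gauss sum.
  d : ℕ → Carrier → ℤ
  d j g = hat (λ x → ε j (g * x))

  d-class : ∀ j → ClassFn j (d j)
  d-class j = record
    { φ-0 = trans (hat-cong λ x → trans (cong (ε j) (zeroˡ x)) (ε-0 j)) (hat-* ℤ.0ℤ (λ _ → ℤ.0ℤ))
    ; same = λ u g e → hat-cong λ x → trans (cong (ε j) (*-assoc u g x)) (ε-same j (g * x) e)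
    ; flip = λ u g e → trans (hat-cong λ x → trans (cong (ε j) (*-assoc u g x)) (ε-flip j (g * x) e)) (hat-neg _)
    ; frob = λ g → trans (sym (hat-frob (λ x → ε j ((g ^ᶠ p) * x))))
        (hat-cong λ x → trans (cong (ε j) (sym (*-^ g x p))) (ε-frob j (g * x)))
    }

  -1^odd : ∀ h → (- 1#) ^ᶠ (1 ℕ.+ h ℕ.* 2) ≡ - 1#
  -1^odd h = trans (*-congˡ (-1^even h)) (*-identityʳ _)

  module _ {j} {φ} (cf : ClassFn j φ) where
    frobʳ : ∀ r x → φ (x ^ᶠ (p ℕ.^ r)) ≡ φ x
    frobʳ zero x = cong φ (*-identityʳ x)
    frobʳ (suc r) x = trans (cong φ (^-* x p (p ℕ.^ r))) (trans (frobʳ r (x ^ᶠ p)) (frob cf x))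

  γ-flip : ∀ j a → suc j ℕ.≤ m → (γ ^ᶠ (2 ℕ.^ j ℕ.* (1 ℕ.+ a ℕ.* 2))) ^ᶠ ex (suc j) ≡ - 1#
  γ-flip j a j<m = trans (cong (_^ᶠ ex (suc j)) (^-* γ (2 ℕ.^ j) (1 ℕ.+ a ℕ.* 2))) (trans (^-comm (γ ^ᶠ (2 ℕ.^ j)) (1 ℕ.+ a ℕ.* 2) (ex (suc j)))
    (trans (cong (_^ᶠ (1 ℕ.+ a ℕ.* 2)) (γ^half j j<m)) (-1^odd a)))

  -- The r-th Frobenius power multiplies γ^e by γ^(e n). It preserves φ, yet this factor lies in the
  -- class that changes the sign of φ.
  vanish : ∀ {j φ} → ClassFn (suc j) φ → suc j ℕ.≤ m → ∀ e r n a → p ℕ.^ r ≡ 1 ℕ.+ n → e ℕ.* n ≡ 2 ℕ.^ j ℕ.* (1 ℕ.+ a ℕ.* 2) →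
    φ (γ ^ᶠ e) ≡ ℤ.0ℤ
  vanish {j} {φ} cf j<m e r n a p^r en = x≡-x⇒x≡0 (trans (sym (frobʳ cf r (γ ^ᶠ e)))
    (trans (cong φ (trans (cong ((γ ^ᶠ e) ^ᶠ_) p^r) (trans (*-comm _ _) (*-congʳ (trans (sym (^-* γ e n)) (cong (γ ^ᶠ_) en))))))
      (flip cf (γ ^ᶠ (2 ℕ.^ j ℕ.* (1 ℕ.+ a ℕ.* 2))) (γ ^ᶠ e) (γ-flip j a j<m))))

  -- One Frobenius is enough, because p - 1 is 2 times an odd number.
  vanish-2 : ∀ {i φ} → ClassFn (2 ℕ.+ i) φ → 2 ℕ.+ i ℕ.≤ m → ∀ b → φ (γ ^ᶠ (2 ℕ.^ i ℕ.* (1 ℕ.+ b ℕ.* 2))) ≡ ℤ.0ℤ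
  vanish-2 {i} cf le b = vanish cf le (2 ℕ.^ i ℕ.* (1 ℕ.+ b ℕ.* 2)) 1 (2 ℕ.+ w ℕ.* 8) (b ℕ.+ w ℕ.* 2 ℕ.+ b ℕ.* w ℕ.* 4) (trans (ℕP.*-identityʳ p) p≡8w+3) (lem (2 ℕ.^ i) b w)
    where
    lem : ∀ x b w → x ℕ.* (1 ℕ.+ b ℕ.* 2) ℕ.* (2 ℕ.+ w ℕ.* 8) ≡ 2 ℕ.* x ℕ.* (1 ℕ.+ (b ℕ.+ w ℕ.* 2 ℕ.+ b ℕ.* w ℕ.* 4) ℕ.* 2)
    lem = ℕSolver.solve-∀

  -- The Frobenius power is the one from `p^2^`. Together with `vanish-2`, a class function of level
  -- j ≥ 3 survives only at exponents of 2-adic valuation j - 3, j - 1 or at least j.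
  vanish-4 : ∀ {i c φ} → ClassFn (4 ℕ.+ (i ℕ.+ c)) φ → 4 ℕ.+ (i ℕ.+ c) ℕ.≤ m → ∀ b → φ (γ ^ᶠ (2 ℕ.^ i ℕ.* (1 ℕ.+ b ℕ.* 2))) ≡ ℤ.0ℤ
  vanish-4 {i} {c} cf le b = vanish cf le (2 ℕ.^ i ℕ.* (1 ℕ.+ b ℕ.* 2)) (2 ℕ.^ (1 ℕ.+ c)) (2 ℕ.^ (3 ℕ.+ c) ℕ.* (1 ℕ.+ a ℕ.* 2)) (a ℕ.+ b ℕ.+ a ℕ.* b ℕ.* 2)
    (trans (cong (ℕ._^ (2 ℕ.^ (1 ℕ.+ c))) p≡8w+3) (proj₂ (p^2^ w c)))
    (trans (lem (2 ℕ.^ i) (2 ℕ.^ c) a b) (cong (λ z → 2 ℕ.* (2 ℕ.* (2 ℕ.* z)) ℕ.* (1 ℕ.+ (a ℕ.+ b ℕ.+ a ℕ.* b ℕ.* 2) ℕ.* 2)) (sym (ℕP.^-distribˡ-+-* 2 i c))))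
    where
    a : ℕ
    a = proj₁ (p^2^ w c)
    lem : ∀ x y a b → x ℕ.* (1 ℕ.+ b ℕ.* 2) ℕ.* (2 ℕ.* (2 ℕ.* (2 ℕ.* y)) ℕ.* (1 ℕ.+ a ℕ.* 2)) ≡
      2 ℕ.* (2 ℕ.* (2 ℕ.* (x ℕ.* y))) ℕ.* (1 ℕ.+ (a ℕ.+ b ℕ.+ a ℕ.* b ℕ.* 2) ℕ.* 2)
    lem = ℕSolver.solve-∀

  module Level (n : ℕ) (le : 3 ℕ.+ n ℕ.≤ m) where
    j t : ℕ
    j = 3 ℕ.+ n
    t = 2 ℕ.^ n

    γᵗ : ℕ → Carrier
    γᵗ i = γ ^ᶠ (t ℕ.* i)

    γᵗ-+ : ∀ a b → γᵗ (a ℕ.+ b) ≡ γᵗ a * γᵗ b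
    γᵗ-+ a b = trans (cong (γ ^ᶠ_) (ℕP.*-distribˡ-+ t a b)) (^-+ γ (t ℕ.* a) (t ℕ.* b))

    γᵗ-0 : γᵗ 0 ≡ 1#
    γᵗ-0 = cong (γ ^ᶠ_) (ℕP.*-zeroʳ t)

    8t : ∀ v → t ℕ.* (8 ℕ.* v) ≡ 2 ℕ.^ j ℕ.* v
    8t v = lem t v
      where
      lem : ∀ t v → t ℕ.* (8 ℕ.* v) ≡ 2 ℕ.* (2 ℕ.* (2 ℕ.* t)) ℕ.* v
      lem = ℕSolver.solve-∀

    γᵗ8 : ∀ v → γᵗ (8 ℕ.* v) ^ᶠ ex j ≡ 1#
    γᵗ8 v = trans (cong (λ e → (γ ^ᶠ e) ^ᶠ ex j) (8t v)) (γ^full j v le)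

    γᵗ4 : γᵗ 4 ^ᶠ ex j ≡ - 1#
    γᵗ4 = trans (cong (λ e → (γ ^ᶠ e) ^ᶠ ex j) (lem t)) (γ-flip (2 ℕ.+ n) 0 le)
      where
      lem : ∀ t → t ℕ.* 4 ≡ 2 ℕ.* (2 ℕ.* t) ℕ.* 1
      lem = ℕSolver.solve-∀

    module _ {φ} (cf : ClassFn j φ) where
      private
        φ3 : φ (γᵗ 3) ≡ φ (γᵗ 1)
        φ3 = trans (sym (same cf (γᵗ (8 ℕ.* w)) (γᵗ 3) (γᵗ8 w))) (trans (cong φ (trans (sym (γᵗ-+ (8 ℕ.* w) 3))
          (trans (cong (γ ^ᶠ_) (trans (lem t w) (cong (λ z → t ℕ.* 1 ℕ.* z) (sym p≡8w+3)))) (^-* γ (t ℕ.* 1) p)))) (frob cf (γᵗ 1)))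
          where
          lem : ∀ t w → t ℕ.* (8 ℕ.* w ℕ.+ 3) ≡ t ℕ.* 1 ℕ.* (3 ℕ.+ w ℕ.* 8)
          lem = ℕSolver.solve-∀

        φ2 : φ (γᵗ 2) ≡ ℤ.0ℤ
        φ2 = trans (cong (λ e → φ (γ ^ᶠ e)) (lem t)) (vanish-2 {1 ℕ.+ n} cf le 0)
          where
          lem : ∀ t → t ℕ.* 2 ≡ 2 ℕ.* t ℕ.* 1
          lem = ℕSolver.solve-∀

        φ4+ : ∀ i → φ (γᵗ (4 ℕ.+ i)) ≡ ℤ.- φ (γᵗ i)
        φ4+ i = trans (cong φ (γᵗ-+ 4 i)) (flip cf (γᵗ 4) (γᵗ i) γᵗ4)

      -- Frobenius sends the exponent t to p t, which is 3 t modulo 8 t, so the classes 1 and 3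
      -- agree; class 2 is killed by `vanish-2`, and adding 4 changes the sign.
      values : ∀ i → φ (γᵗ i) ≡ octant (φ 1#) (φ (γᵗ 1)) i
      values 0 = cong φ γᵗ-0
      values 1 = refl
      values 2 = φ2
      values 3 = φ3
      values 4 = trans (φ4+ 0) (cong ℤ.-_ (cong φ γᵗ-0))
      values 5 = φ4+ 1
      values 6 = trans (φ4+ 2) (cong ℤ.-_ φ2)
      values 7 = trans (φ4+ 3) (cong ℤ.-_ φ3)
      values (suc (suc (suc (suc (suc (suc (suc (suc i)))))))) =
        trans (cong φ (γᵗ-+ 8 i)) (trans (same cf (γᵗ 8) (γᵗ i) (γᵗ8 1)) (values i))

    ε-1 : ε j 1# ≡ ℤ.1ℤ
    ε-1 = sgn-1 (1^ (ex j))

    ε-γᵗ : ε j (γᵗ 1) ≡ ℤ.0ℤ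
    ε-γᵗ = sgn-0 (λ e → bad (trans (cong (λ z → z * z) e) (*-identityˡ 1#))) (λ e → bad (trans (cong (λ z → z * z) e) -1*-1))
      where
      bad : (γᵗ 1 ^ᶠ ex j) * (γᵗ 1 ^ᶠ ex j) ≢ 1#
      bad e = ℕP.<⇒≱ lt (∣ℕ.∣⇒≤ {{ℕ.>-nonZero (ℕP.*-mono-≤ {1} (ℕP.*-mono-≤ {1} (ℕP.m^n>0 2 n) (s≤s z≤n)) (0<ex j))}} (γ^≡1⇒∣ (t ℕ.* 2 ℕ.* ex j)
          (trans (^-* γ (t ℕ.* 2) (ex j)) (trans (cong (_^ᶠ ex j) (γᵗ-+ 1 1)) (trans (*-^ (γᵗ 1) (γᵗ 1) (ex j)) e)))))
        where
        lem : ∀ t e → e ℕ.* (2 ℕ.* (2 ℕ.* (2 ℕ.* t))) ≡ t ℕ.* 2 ℕ.* e ℕ.* 4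
        lem = ℕSolver.solve-∀
        lt : t ℕ.* 2 ℕ.* ex j ℕ.< q₁
        lt = subst (t ℕ.* 2 ℕ.* ex j ℕ.<_) (trans (sym (lem t (ex j))) (ex-2^ j le))
          (ℕP.m<m*n (t ℕ.* 2 ℕ.* ex j) 4 {{ℕ.>-nonZero (ℕP.*-mono-≤ {1} (ℕP.*-mono-≤ {1} (ℕP.m^n>0 2 n) (s≤s z≤n)) (0<ex j))}} (s≤s (s≤s z≤n)))

    ε-values : ∀ i → ε j (γᵗ i) ≡ octant ℤ.1ℤ ℤ.0ℤ i
    ε-values i = trans (values (ε-class j) i) (cong₂ (λ a b → octant a b i) ε-1 ε-γᵗ)

    -- The coordinates of φ in the basis 1, √-2: the two translates of `ε` are the coefficients of ζ
    -- + ζ³. At exponents not divisible by t both sides vanish.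
    structure : ∀ {φ} → ClassFn j φ → ∀ g → φ g ≡ φ 1# ℤ.* ε j g ℤ.+ φ (γᵗ 1) ℤ.* (ε j (γᵗ 7 * g) ℤ.+ ε j (γᵗ 5 * g))
    structure {φ} cf g with g ≟ 0#
    ... | yes refl = trans (φ-0 cf) (sym (trans (cong₂ (λ a b → φ 1# ℤ.* a ℤ.+ φ (γᵗ 1) ℤ.* b) (ε-0 j) (cong₂ ℤ._+_ (z (γᵗ 7)) (z (γᵗ 5)))) (lem (φ 1#) (φ (γᵗ 1)))))
      where
      z : ∀ u → ε j (u * 0#) ≡ ℤ.0ℤ
      z u = trans (cong (ε j) (zeroʳ u)) (ε-0 j)
      lem : ∀ X Y → X ℤ.* ℤ.0ℤ ℤ.+ Y ℤ.* ℤ.0ℤ ≡ ℤ.0ℤ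
      lem = solve-∀
    ... | no g≢0 with log g g≢0
    ... | e , refl with 2-adic n e
    ... | inj₁ (a , refl) = trans (values cf a) (trans (octant-decompose (φ 1#) (φ (γᵗ 1)) a)
          (cong₂ (λ x y → φ 1# ℤ.* x ℤ.+ φ (γᵗ 1) ℤ.* y) (sym (ε-values a))
            (cong₂ ℤ._+_ (sym (trans (cong (ε j) (sym (γᵗ-+ 7 a))) (ε-values (7 ℕ.+ a)))) (sym (trans (cong (ε j) (sym (γᵗ-+ 5 a))) (ε-values (5 ℕ.+ a)))))))
    ... | inj₂ (i , b , i<n , refl) = trans (van cf b) (sym (trans (cong₂ (λ x y → φ 1# ℤ.* x ℤ.+ φ (γᵗ 1) ℤ.* y) (van (ε-class j) b) (cong₂ ℤ._+_ (ε-van 7) (ε-van 5))) (lem (φ 1#) (φ (γᵗ 1)))))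
      where
      c : ℕ
      c = n ∸ suc i
      n≡ : suc (i ℕ.+ c) ≡ n
      n≡ = ℕP.m+[n∸m]≡n i<n
      j≡ : 4 ℕ.+ (i ℕ.+ c) ≡ j
      j≡ = cong (3 ℕ.+_) n≡
      van : ∀ {ψ} → ClassFn j ψ → ∀ b → ψ (γ ^ᶠ (2 ℕ.^ i ℕ.* (1 ℕ.+ b ℕ.* 2))) ≡ ℤ.0ℤ
      van {ψ} D = vanish-4 {i} {c} (subst (λ z → ClassFn z ψ) (sym j≡) D) (subst (ℕ._≤ m) (sym j≡) le)
      ε-van : ∀ r → ε j (γᵗ r * (γ ^ᶠ (2 ℕ.^ i ℕ.* (1 ℕ.+ b ℕ.* 2)))) ≡ ℤ.0ℤ
      ε-van r = trans (cong (ε j) (trans (sym (^-+ γ (t ℕ.* r) _)) (cong (γ ^ᶠ_) (trans (cong (λ z → z ℕ.* r ℕ.+ 2 ℕ.^ i ℕ.* (1 ℕ.+ b ℕ.* 2)) t≡) (alg (2 ℕ.^ i) (2 ℕ.^ c) b r)))))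
        (van (ε-class j) (b ℕ.+ 2 ℕ.^ c ℕ.* r))
        where
        t≡ : t ≡ 2 ℕ.* (2 ℕ.^ i ℕ.* 2 ℕ.^ c)
        t≡ = trans (cong (2 ℕ.^_) (sym n≡)) (cong (2 ℕ.*_) (ℕP.^-distribˡ-+-* 2 i c))
        alg : ∀ x y b r → 2 ℕ.* (x ℕ.* y) ℕ.* r ℕ.+ x ℕ.* (1 ℕ.+ b ℕ.* 2) ≡ x ℕ.* (1 ℕ.+ (b ℕ.+ y ℕ.* r) ℕ.* 2)
        alg = ℕSolver.solve-∀
      lem : ∀ X Y → X ℤ.* ℤ.0ℤ ℤ.+ Y ℤ.* ℤ.0ℤ ≡ ℤ.0ℤ
      lem = solve-∀

    x y : ℤ
    x = d j 1#
    y = d j (γᵗ 1)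

    private
      lin : ∀ X Y (a b c : Carrier → ℤ) → hat (λ z → X ℤ.* a z ℤ.+ Y ℤ.* (b z ℤ.+ c z)) ≡ X ℤ.* hat a ℤ.+ Y ℤ.* (hat b ℤ.+ hat c)
      lin X Y a b c = trans (hat-+ (λ z → X ℤ.* a z) (λ z → Y ℤ.* (b z ℤ.+ c z)))
        (cong₂ ℤ._+_ (hat-* X a) (trans (hat-* Y (λ z → b z ℤ.+ c z)) (cong (Y ℤ.*_) (hat-+ b c))))

    -- With `hat-class-γᵗ`: if φ stands for X + Y√-2, then `hat` multiplies it by x + y√-2. This is
    -- the rational part of the product and the other is the coefficient of √-2.
    hat-class : ∀ {φ} → ClassFn j φ → hat φ ≡ φ 1# ℤ.* x ℤ.- ℤ.+ 2 ℤ.* φ (γᵗ 1) ℤ.* y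
    hat-class {φ} cf = trans (hat-cong (structure cf)) (trans (lin X Y (ε j) (λ z → ε j (γᵗ 7 * z)) (λ z → ε j (γᵗ 5 * z)))
      (trans (cong₂ (λ a b → X ℤ.* a ℤ.+ Y ℤ.* b) (hat-cong λ z → cong (ε j) (sym (*-identityˡ z)))
        (cong₂ ℤ._+_ (values (d-class j) 7) (values (d-class j) 5))) (alg X Y x y)))
      where
      X Y : ℤ
      X = φ 1#
      Y = φ (γᵗ 1)
      alg : ∀ X Y x y → X ℤ.* x ℤ.+ Y ℤ.* (ℤ.- y ℤ.+ ℤ.- y) ≡ X ℤ.* x ℤ.- ℤ.+ 2 ℤ.* Y ℤ.* y
      alg = solve-∀

    hat-class-γᵗ : ∀ {φ} → ClassFn j φ → hat (λ z → φ (γᵗ 1 * z)) ≡ φ 1# ℤ.* y ℤ.+ φ (γᵗ 1) ℤ.* x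
    hat-class-γᵗ {φ} cf = trans (hat-cong λ z → structure cf (γᵗ 1 * z)) (trans (lin X Y (λ z → ε j (γᵗ 1 * z)) (λ z → ε j (γᵗ 7 * (γᵗ 1 * z))) (λ z → ε j (γᵗ 5 * (γᵗ 1 * z))))
      (trans (cong (λ b → X ℤ.* y ℤ.+ Y ℤ.* b) (cong₂ ℤ._+_ (shift-d 7) (shift-d 5))) (alg X Y x y)))
      where
      X Y : ℤ
      X = φ 1#
      Y = φ (γᵗ 1)
      shift-d : ∀ r → hat (λ z → ε j (γᵗ r * (γᵗ 1 * z))) ≡ octant x y (r ℕ.+ 1)
      shift-d r = trans (hat-cong λ z → cong (ε j) (trans (sym (*-assoc (γᵗ r) (γᵗ 1) z)) (*-congʳ (sym (γᵗ-+ r 1))))) (values (d-class j) (r ℕ.+ 1))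
      alg : ∀ X Y x y → X ℤ.* y ℤ.+ Y ℤ.* (x ℤ.+ ℤ.0ℤ) ≡ X ℤ.* y ℤ.+ Y ℤ.* x
      alg = solve-∀

  Q : ℤ
  Q = ℤ.+ suc q₁

  ΣF-1 : ΣF (λ _ → ℤ.1ℤ) ≡ Q
  ΣF-1 = trans (Z.ΣL-const elements ℤ.1ℤ) (trans (ℤP.*-identityʳ _) (trans (ιZ (length elements)) (cong (λ z → ℤ.+ z) (trans card≡p^s (sym suc-q₁)))))

  -- The convolution of the function x ↦ ε(x/y) is q δ₀ − 1.
  module Autocorrelation (j₀ : ℕ) (le : suc j₀ ℕ.≤ m) where
    private
      j : ℕ
      j = suc j₀
      -- q - 2, so that y^n is 1/y for y ≠ 0 and 0 for y = 0. As a power map, inversion visibly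
      -- respects products and Frobenius.
      n : ℕ
      n = q₁ ∸ 1
      sn : suc n ≡ q₁
      sn = ℕP.m+[n∸m]≡n 0<q₁

      G : Carrier → Carrier → ℤ
      G x y = ε j ((y ^ᶠ n) * x)

      G-x : ∀ c x y → InK c → G (c * x) y ≡ G x y
      G-x c x y c∈ = trans (cong (ε j) (swap c x (y ^ᶠ n))) (ε-same j ((y ^ᶠ n) * x) (InK-^ex j c∈))
        where
        swap : ∀ c x y → y * (c * x) ≡ c * (y * x)
        swap = solve 3 (λ c x y → y :* (c :* x) := c :* (y :* x)) refl
          where open FSolver

      G-y : ∀ c x y → InK c → G x (c * y) ≡ G x y
      G-y c x y c∈ = trans (cong (ε j) (trans (*-congʳ (*-^ c y n)) (*-assoc (c ^ᶠ n) (y ^ᶠ n) x)))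
        (ε-same j ((y ^ᶠ n) * x) (trans (^-comm c n (ex j)) (trans (cong (_^ᶠ n) (InK-^ex j c∈)) (1^ n))))

      S : Carrier → ℤ
      S z = ΣF (λ x → G x (z − x))

      S-0 : S 0# ≡ Q ℤ.- ℤ.1ℤ
      S-0 = trans (Z.ΣL-cong elements pt) (trans (Z.ΣL-+ elements (λ _ → ℤ.1ℤ) (λ x → ℤ.-1ℤ ℤ.* 𝟙 (x ≟ 0#)))
        (cong₂ ℤ._+_ ΣF-1 (trans (Z.ΣL-*ˡ elements ℤ.-1ℤ (λ x → 𝟙 (x ≟ 0#))) (cong (ℤ.-1ℤ ℤ.*_) (trans (Z.ΣL-cong elements λ x → sym (ℤP.*-identityʳ (𝟙 (x ≟ 0#)))) (Z.ΣF-δ 0# (λ _ → ℤ.1ℤ)))))))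
        where
        pt : ∀ x → G x (0# − x) ≡ ℤ.1ℤ ℤ.+ ℤ.-1ℤ ℤ.* 𝟙 (x ≟ 0#)
        pt x with x ≟ 0#
        ... | yes refl = trans (cong (ε j) (zeroʳ _)) (ε-0 j)
        ... | no x≢0 = trans (cong (ε j) e₁) (sgn-1 e₂)
          where
          e₁ : ((0# − x) ^ᶠ n) * x ≡ (- 1#) ^ᶠ n
          e₁ = trans (*-congʳ (trans (cong (_^ᶠ n) (solve 1 (λ x → con (ℤ.+ 0) :- x := (:- con (ℤ.+ 1)) :* x) refl x)) (*-^ (- 1#) x n)))
            (trans (*-assoc _ _ _) (trans (*-congˡ (trans (*-comm _ x) (trans (cong (x ^ᶠ_) sn) (x^q₁ x≢0)))) (*-identityʳ _)))
            where open FSolver using (solve; _:=_; _:-_; _:*_; :-_; con)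
          e₂ : ((- 1#) ^ᶠ n) ^ᶠ ex j ≡ 1#
          e₂ = trans (^-comm (- 1#) n (ex j)) (trans (cong (_^ᶠ n) (-1^ex j)) (1^ n))

      S-≢0 : ∀ z → z ≢ 0# → S z ≡ S 1#
      S-≢0 z z≢0 = trans (sym (Z.ΣF-scale z≢0 (λ x → G x (z − x)))) (Z.ΣL-cong elements λ x → cong (ε j) (begin
        ((z − z * x) ^ᶠ n) * (z * x) ≡⟨ *-congʳ (trans (cong (_^ᶠ n) (solve 2 (λ z x → z :- z :* x := z :* (con (ℤ.+ 1) :- x)) refl z x)) (*-^ z (1# − x) n)) ⟩
        ((z ^ᶠ n) * ((1# − x) ^ᶠ n)) * (z * x) ≡⟨ solve 4 (λ a b z x → (a :* b) :* (z :* x) := (z :* a) :* (b :* x)) refl (z ^ᶠ n) ((1# − x) ^ᶠ n) z x ⟩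
        (z ^ᶠ suc n) * (((1# − x) ^ᶠ n) * x) ≡⟨ trans (*-congʳ (trans (cong (z ^ᶠ_) sn) (x^q₁ z≢0))) (*-identityˡ _) ⟩
        ((1# − x) ^ᶠ n) * x ∎))
        where
        open ≡-Reasoning
        open FSolver using (solve; _:=_; _:-_; _:*_; con)

      S-all : ∀ z → S z ≡ (S 0# ℤ.- S 1#) ℤ.* 𝟙 (z ≟ 0#) ℤ.+ S 1# ℤ.* ℤ.1ℤ
      S-all z with z ≟ 0#
      ... | yes refl = alg (S 0#) (S 1#)
        where
        alg : ∀ a b → a ≡ (a ℤ.- b) ℤ.* ℤ.1ℤ ℤ.+ b ℤ.* ℤ.1ℤ
        alg = solve-∀
      ... | no z≢0 = trans (S-≢0 z z≢0) (alg (S 0#) (S 1#))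
        where
        alg : ∀ a b → b ≡ (a ℤ.- b) ℤ.* ℤ.0ℤ ℤ.+ b ℤ.* ℤ.1ℤ
        alg = solve-∀

      ΣS : ΣF S ≡ ℤ.0ℤ
      ΣS = trans (Z.ΣL-swap elements elements _) (trans (Z.ΣL-cong elements λ x → trans (sym (Z.ΣF-translate x (λ z → G x (z − x))))
        (Z.ΣL-cong elements λ y → cong (G x) (solve 2 (λ x y → (y :+ x) :- x := y) refl x y)))
        (trans (Z.ΣL-swap elements elements _) (Z.ΣL-0 elements λ y → Σε j₀ (y ^ᶠ n) le)))
        where open FSolver using (solve; _:=_; _:-_; _:+_)

      -- `S` is q - 1 at 0, constant elsewhere, and has total 0, so (q - 1)(1 + S 1) = 0.
      S-1 : S 1# ≡ ℤ.-1ℤ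
      S-1 = ℤP.i-j≡0⇒i≡j (S 1#) ℤ.-1ℤ ([ (λ e → ⊥-elim (ℕP.<⇒≢ 0<q₁ (sym (ℤP.+-injective e)))) , id ]′
        (ℤP.i*j≡0⇒i≡0∨j≡0 (ℤ.+ q₁) (trans (alg (ℤ.+ q₁) (S 1#)) (trans (cong (λ a → (a ℤ.- S 1#) ℤ.+ S 1# ℤ.* Q) (sym S-0)) (trans (sym total) ΣS)))))
        where
        alg : ∀ q s → q ℤ.* (s ℤ.- ℤ.-1ℤ) ≡ ((ℤ.1ℤ ℤ.+ q ℤ.- ℤ.1ℤ) ℤ.- s) ℤ.+ s ℤ.* (ℤ.1ℤ ℤ.+ q)
        alg = solve-∀
        total : ΣF S ≡ (S 0# ℤ.- S 1#) ℤ.+ S 1# ℤ.* Q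
        total = trans (Z.ΣL-cong elements S-all) (trans (Z.ΣL-+ elements _ _) (cong₂ ℤ._+_
          (trans (Z.ΣL-cong elements λ z → ℤP.*-comm (S 0# ℤ.- S 1#) (𝟙 (z ≟ 0#))) (Z.ΣF-δ 0# (λ _ → S 0# ℤ.- S 1#)))
          (trans (Z.ΣL-*ˡ elements (S 1#) (λ _ → ℤ.1ℤ)) (cong (S 1# ℤ.*_) ΣF-1))))

      hatS : hat S ≡ Q
      hatS = trans (hat-cong S-all) (trans (hat-+ (λ z → (S 0# ℤ.- S 1#) ℤ.* 𝟙 (z ≟ 0#)) (λ _ → S 1# ℤ.* ℤ.1ℤ)) (trans (cong₂ ℤ._+_ (trans (hat-* (S 0# ℤ.- S 1#) (λ z → 𝟙 (z ≟ 0#))) (cong₂ (λ a b → (a ℤ.- b) ℤ.* hat (λ z → 𝟙 (z ≟ 0#))) S-0 S-1)) (trans (hat-* (S 1#) (λ _ → ℤ.1ℤ)) (cong (S 1# ℤ.*_) hat-1)))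
        (trans (cong₂ (λ a b → (Q ℤ.- ℤ.1ℤ ℤ.- ℤ.-1ℤ) ℤ.* a ℤ.+ b) hat-δ (ℤP.*-zeroʳ (S 1#))) (alg Q))))
        where
        alg : ∀ q → (q ℤ.- ℤ.1ℤ ℤ.- ℤ.-1ℤ) ℤ.* ℤ.1ℤ ℤ.+ ℤ.0ℤ ≡ q
        alg = solve-∀

    d⁻¹ : Carrier → ℤ
    d⁻¹ y = d j (y ^ᶠ n)

    -- The counterpart of G(χ) times its conjugate being q; there is no sign, since every `ex j` is
    -- even and so χ(-1) = 1.
    hat-d⁻¹ : hat d⁻¹ ≡ Q
    hat-d⁻¹ = trans (sym (Bihat.bihat G G-x G-y)) hatS

    n-odd : ∃ λ h → n ≡ 1 ℕ.+ h ℕ.* 2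
    n-odd with parity n
    ... | inj₂ o = o
    ... | inj₁ (h , e) = ⊥-elim (even≢odd (proj₁ q₁-even) h (trans (sym (proj₂ q₁-even)) (trans (sym sn) (cong suc e))))
      where
      q₁-even : ∃ λ h → q₁ ≡ h ℕ.* 2
      q₁-even = ex 1 , sym (trans (ex-suc 0 1≤m) ex0)
      even≢odd : ∀ h b → h ℕ.* 2 ≡ 1 ℕ.+ b ℕ.* 2 → ⊥
      even≢odd zero b ()
      even≢odd (suc h) zero ()
      even≢odd (suc h) (suc b) e = even≢odd h b (ℕP.suc-injective (ℕP.suc-injective e))

    d⁻¹-class : ClassFn j d⁻¹
    d⁻¹-class = record
      { φ-0 = trans (cong (d j) (0^ n (subst (0 ℕ.<_) (sym (proj₂ n-odd)) (s≤s z≤n)))) (φ-0 (d-class j))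
      ; same = λ u x e → trans (cong (d j) (*-^ u x n)) (same (d-class j) (u ^ᶠ n) (x ^ᶠ n) (trans (^-comm u n (ex j)) (trans (cong (_^ᶠ n) e) (1^ n))))
      ; flip = λ u x e → trans (cong (d j) (*-^ u x n)) (flip (d-class j) (u ^ᶠ n) (x ^ᶠ n) (trans (^-comm u n (ex j)) (trans (cong (_^ᶠ n) e) (trans (cong ((- 1#) ^ᶠ_) (proj₂ n-odd)) (-1^odd (proj₁ n-odd))))))
      ; frob = λ x → trans (cong (d j) (^-comm x p n)) (frob (d-class j) (x ^ᶠ n))
      }

    d⁻¹-1 : d⁻¹ 1# ≡ d j 1#
    d⁻¹-1 = cong (d j) (1^ n)

  -- At level 1 the power x^(ex 1) is ±1 for every x ≠ 0. At level 2 the odd exponents are killed by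
  -- `vanish-2`. So the value at 1 determines everything.
  structure-low : ∀ j₀ → j₀ ℕ.≤ 1 → ∀ {φ} → ClassFn (suc j₀) φ → ∀ g → φ g ≡ φ 1# ℤ.* ε (suc j₀) g
  structure-low j₀ j₀≤1 {φ} cf g with g ≟ 0#
  ... | yes refl = trans (φ-0 cf) (sym (trans (cong (φ 1# ℤ.*_) (ε-0 (suc j₀))) (ℤP.*-zeroʳ (φ 1#))))
  ... | no g≢0 with sgnView (g ^ᶠ ex (suc j₀))
  ... | pos e v = trans (cong φ (sym (*-identityʳ g))) (trans (same cf g 1# e) (sym (trans (cong (φ 1# ℤ.*_) v) (ℤP.*-identityʳ (φ 1#)))))
  ... | neg e v = trans (cong φ (sym (*-identityʳ g))) (trans (flip cf g 1# e) (sym (trans (cong (φ 1# ℤ.*_) v) (alg (φ 1#)))))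
    where
    alg : ∀ x → x ℤ.* ℤ.-1ℤ ≡ ℤ.- x
    alg = solve-∀
  structure-low zero j₀≤1 {φ} cf g | no g≢0 | none a b v with ρ-view g≢0
  ... | inj₁ (e , _) = ⊥-elim (a e)
  ... | inj₂ (e , _) = ⊥-elim (b e)
  structure-low (suc zero) j₀≤1 {φ} cf g | no g≢0 | none a b v with log g g≢0
  ... | e , refl with 2-adic 2 e
  ... | inj₁ (h , refl) = ⊥-elim (a (γ^full 2 h (ℕP.≤-trans (s≤s (s≤s z≤n)) 3≤m)))
  ... | inj₂ (0 , h , _ , refl) = trans (vanish-2 {0} cf (ℕP.≤-trans (s≤s (s≤s z≤n)) 3≤m) h) (sym (trans (cong (φ 1# ℤ.*_) v) (ℤP.*-zeroʳ (φ 1#))))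
  ... | inj₂ (1 , h , _ , refl) = ⊥-elim (b (γ-flip 1 h (ℕP.≤-trans (s≤s (s≤s z≤n)) 3≤m)))
  ... | inj₂ (suc (suc _) , h , s≤s (s≤s ()) , refl)
  structure-low (suc (suc _)) (s≤s ()) cf g | no _ | none _ _ _

  d²-low : ∀ j₀ → j₀ ℕ.≤ 1 → d (suc j₀) 1# ℤ.* d (suc j₀) 1# ≡ Q
  d²-low j₀ j₀≤1 = trans (trans (cong (λ z → z ℤ.* d (suc j₀) 1#) (sym A.d⁻¹-1)) (trans (cong (A.d⁻¹ 1# ℤ.*_) (hat-cong λ z → cong (ε (suc j₀)) (*-identityˡ z)))
    (sym (trans (hat-cong (structure-low j₀ j₀≤1 A.d⁻¹-class)) (hat-* (A.d⁻¹ 1#) (ε (suc j₀))))))) A.hat-d⁻¹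
    where
    module A = Autocorrelation j₀ (ℕP.≤-trans (s≤s j₀≤1) (ℕP.≤-trans (s≤s (s≤s z≤n)) 3≤m))

-- Norms, Jacobi sums and the recurrence between consecutive levels.

module Identities (σ : Setting) where
  open ClassFunctions σ public
  open ClassFn

  -- Inversion moves class 1 to class 7 and thereby conjugates √-2; so `hat-d⁻¹` becomes the norm of
  -- x + y√-2.
  sum-of-squares : ∀ n (le : 3 ℕ.+ n ℕ.≤ m) → let open Level n le in x ℤ.* x ℤ.+ ℤ.+ 2 ℤ.* y ℤ.* y ≡ Q
  sum-of-squares n le = trans (alg x y) (trans (cong₂ (λ a b → a ℤ.* x ℤ.- ℤ.+ 2 ℤ.* b ℤ.* y) (sym A.d⁻¹-1) (sym d⁻¹-γᵗ)) (trans (sym (hat-class A.d⁻¹-class)) A.hat-d⁻¹))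
    where
    open Level n le
    module A = Autocorrelation (2 ℕ.+ n) le
    alg : ∀ x y → x ℤ.* x ℤ.+ ℤ.+ 2 ℤ.* y ℤ.* y ≡ x ℤ.* x ℤ.- ℤ.+ 2 ℤ.* (ℤ.- y) ℤ.* y
    alg = solve-∀
    q₁-1 : ∀ e → 0 ℕ.< e → e ℕ.* 8 ≡ q₁ → octant x y (q₁ ∸ 1) ≡ ℤ.- y
    q₁-1 (suc v) _ e = trans (cong (λ z → octant x y (z ∸ 1)) (sym e)) (trans (cong (octant x y) (ℕP.+-comm 7 (v ℕ.* 8))) (octant-+8* x y 7 v))
    d⁻¹-γᵗ : A.d⁻¹ (γᵗ 1) ≡ ℤ.- y
    d⁻¹-γᵗ = trans (cong (d j) (trans (sym (^-* γ (t ℕ.* 1) (q₁ ∸ 1))) (cong (λ e → γ ^ᶠ (e ℕ.* (q₁ ∸ 1))) (ℕP.*-identityʳ t))))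
      (trans (values (d-class j) (q₁ ∸ 1)) (q₁-1 (ex 3) (0<ex 3) (ex-2^ 3 3≤m)))

  ^ex1 : ∀ j₀ g → 2 ℕ.+ j₀ ℕ.≤ m → g ^ᶠ ex 1 ≡ (g ^ᶠ ex (2 ℕ.+ j₀)) ^ᶠ (2 ℕ.^ suc j₀)
  ^ex1 j₀ g le = trans (cong (g ^ᶠ_) (sym (ex-suc-2^ (suc j₀) le))) (^-* g (ex (2 ℕ.+ j₀)) (2 ℕ.^ suc j₀))

  -- Where `ε` is nonzero, g^(ex 1) is an even power of ±1. So the support of `ε` consists of
  -- squares from level 2 on.
  ε-ρ : ∀ j₀ g → 2 ℕ.+ j₀ ℕ.≤ m → ε (2 ℕ.+ j₀) g ℤ.* ρ g ≡ ε (2 ℕ.+ j₀) g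
  ε-ρ j₀ g le with sgnView (g ^ᶠ ex (2 ℕ.+ j₀))
  ... | none _ _ v = trans (cong (ℤ._* ρ g) v) (sym v)
  ... | pos e _ = trans (cong (ε (2 ℕ.+ j₀) g ℤ.*_) (sgn-1 (trans (^ex1 j₀ g le) (trans (cong (_^ᶠ (2 ℕ.^ suc j₀)) e) (1^ (2 ℕ.^ suc j₀)))))) (ℤP.*-identityʳ _)
  ... | neg e _ = trans (cong (ε (2 ℕ.+ j₀) g ℤ.*_) (sgn-1 (trans (^ex1 j₀ g le) (trans (cong (_^ᶠ (2 ℕ.^ suc j₀)) e) (trans (cong ((- 1#) ^ᶠ_) (ℕP.*-comm 2 (2 ℕ.^ j₀))) (-1^even (2 ℕ.^ j₀))))))) (ℤP.*-identityʳ _)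

  ρ-neg : ∀ x → ρ (0# − x) ≡ ρ x
  ρ-neg x = trans (cong ρ (solve 1 (λ x → con (ℤ.+ 0) :- x := (:- con (ℤ.+ 1)) :* x) refl x)) (ε-same 1 x (-1^ex 1))
    where open FSolver using (solve; _:=_; _:-_; _:*_; :-_; con)

  ρ-square : ∀ {z} → z ≢ 0# → ρ (z * z) ≡ ℤ.1ℤ
  ρ-square {z} z≢0 = sgn-1 (trans (sq-^ z 0 1≤m) (trans (cong (z ^ᶠ_) ex0) (x^q₁ z≢0)))

  InK-2 : InK (1# + 1#)
  InK-2 = fixed⇒InK (λ e → -1≢1 (sym (−≡0 (trans (cong (1# +_) (-‿involutive 1#)) e))))
    (trans (frobⁱ-+ ℓ 1# 1#) (cong₂ _+_ (1^ P) (1^ P)))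

  -- The Jacobi sum J(χ, ρ), collected by class.
  Jac : ℕ → Carrier → ℤ
  Jac j c = ΣF (λ w → ε j (c * w) ℤ.* ρ (1# − w))

  J-class : ∀ j → ClassFn j (Jac j)
  J-class j = record
    { φ-0 = Z.ΣL-0 elements λ w → trans (cong (ℤ._* ρ (1# − w)) (trans (cong (ε j) (zeroˡ w)) (ε-0 j))) (ℤP.*-zeroˡ (ρ (1# − w)))
    ; same = λ u c e → Z.ΣL-cong elements λ w → cong (ℤ._* ρ (1# − w)) (trans (cong (ε j) (*-assoc u c w)) (ε-same j (c * w) e))
    ; flip = λ u c e → trans (Z.ΣL-cong elements λ w → trans (cong (ℤ._* ρ (1# − w)) (trans (cong (ε j) (*-assoc u c w)) (ε-flip j (c * w) e))) (alg (ε j (c * w)) (ρ (1# − w))))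
        (trans (Z.ΣL-*ˡ elements ℤ.-1ℤ _) (ℤP.-1*i≡-i _))
    ; frob = λ c → trans (sym (ΣF-frob (λ w → ε j ((c ^ᶠ p) * w) ℤ.* ρ (1# − w)))) (Z.ΣL-cong elements λ w → cong₂ ℤ._*_
        (trans (cong (ε j) (sym (*-^ c w p))) (ε-frob j (c * w)))
        (trans (cong ρ (trans (+-congʳ (sym (1^ p))) (sym (frob-− 1# w)))) (ε-frob 1 (1# − w))))
    }
    where
    alg : ∀ a b → (ℤ.- a) ℤ.* b ≡ ℤ.-1ℤ ℤ.* (a ℤ.* b)
    alg = solve-∀

  module Products (n : ℕ) (le : 3 ℕ.+ n ℕ.≤ m) where
    open Level n le public

    private
      Φ : Carrier → ℤ
      Φ z = ΣF (λ x → ε j ((z − x) * x))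

    -- `Φ` is the convolution of a character with itself, so its transform stands for the square of
    -- the Gauss sum, again collected by class.
    hat-Φ : hat Φ ≡ hat (d j)
    hat-Φ = Bihat.bihat (λ x y → ε j (y * x))
      (λ c x y c∈ → trans (cong (ε j) (solve 3 (λ c x y → y :* (c :* x) := c :* (y :* x)) refl c x y)) (ε-same j (y * x) (InK-^ex j c∈)))
      (λ c x y c∈ → trans (cong (ε j) (*-assoc c y x)) (ε-same j (y * x) (InK-^ex j c∈)))
      where open FSolver using (solve; _:=_; _:*_)

    Φ-scale : ∀ c z → InK c → Φ (c * z) ≡ Φ z
    Φ-scale c z c∈ = trans (sym (Z.ΣF-scale (InK-≢0 c∈) (λ x → ε j ((c * z − x) * x)))) (Z.ΣL-cong elements λ x →
      trans (cong (ε j) (solve 3 (λ c z x → (c :* z :- c :* x) :* (c :* x) := (c :* c) :* ((z :- x) :* x)) refl c z x))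
        (ε-same j ((z − x) * x) (InK-^ex j (InK-* c∈ c∈))))
      where open FSolver using (solve; _:=_; _:*_; _:-_)

    Σε0 : ΣF (ε j) ≡ ℤ.0ℤ
    Σε0 = trans (Z.ΣL-cong elements λ x → cong (ε j) (sym (*-identityˡ x))) (Σε (2 ℕ.+ n) 1# le)

    -- Completing the square: (z + v)(z − v) = z² − v².
    Φ-double : ∀ z → Φ ((1# + 1#) * z) ≡ Jac j (z * z)
    Φ-double z = begin
      Φ ((1# + 1#) * z) ≡⟨ sym (Z.ΣF-translate z _) ⟩
      ΣF (λ v → ε j (((1# + 1#) * z − (v + z)) * (v + z))) ≡⟨ Z.ΣL-cong elements (λ v → cong (ε j)
          (solve 2 (λ z v → ((con (ℤ.+ 1) :+ con (ℤ.+ 1)) :* z :- (v :+ z)) :* (v :+ z) := z :* z :- v :* v) refl z v)) ⟩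
      ΣF (λ v → ε j (z * z − v * v)) ≡⟨ Σ-squares (λ u → ε j (z * z − u)) ⟩
      ΣF (λ u → (ℤ.1ℤ ℤ.+ ρ u) ℤ.* ε j (z * z − u)) ≡⟨ trans (Z.ΣL-cong elements λ u → alg (ρ u) (ε j (z * z − u))) (Z.ΣL-+ elements _ _) ⟩
      ΣF (λ u → ε j (z * z − u)) ℤ.+ ΣF (λ u → ρ u ℤ.* ε j (z * z − u)) ≡⟨ cong₂ ℤ._+_ (trans (Z.ΣF-reflect (z * z) (ε j)) Σε0)
          (trans (sym (Z.ΣF-reflect (z * z) _)) (Z.ΣL-cong elements λ w → cong (λ v → ρ (z * z − w) ℤ.* ε j v) (solve 2 (λ a w → a :- (a :- w) := w) refl (z * z) w))) ⟩
      ℤ.0ℤ ℤ.+ ΣF (λ w → ρ (z * z − w) ℤ.* ε j w) ≡⟨ ℤP.+-identityˡ _ ⟩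
      ΣF (λ w → ρ (z * z − w) ℤ.* ε j w) ≡⟨ rest ⟩
      Jac j (z * z) ∎
      where
      open ≡-Reasoning
      open FSolver using (solve; _:=_; _:*_; _:-_; _:+_; con)
      alg : ∀ a b → (ℤ.1ℤ ℤ.+ a) ℤ.* b ≡ b ℤ.+ a ℤ.* b
      alg = solve-∀
      rest : ΣF (λ w → ρ (z * z − w) ℤ.* ε j w) ≡ Jac j (z * z)
      rest with z ≟ 0#
      ... | yes refl = trans (Z.ΣL-cong elements λ w → trans (cong (λ v → ρ (v − w) ℤ.* ε j w) (zeroˡ 0#)) (trans (cong (ℤ._* ε j w) (ρ-neg w))
            (trans (ℤP.*-comm (ρ w) (ε j w)) (ε-ρ (suc n) w le)))) (trans Σε0 (sym (trans (cong (Jac j) (zeroˡ 0#)) (φ-0 (J-class j)))))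
      ... | no z≢0 = trans (sym (Z.ΣF-scale (*-≢0 z≢0 z≢0) _)) (Z.ΣL-cong elements λ w → trans (ℤP.*-comm (ρ (z * z − (z * z) * w)) (ε j ((z * z) * w)))
            (cong (ε j ((z * z) * w) ℤ.*_) (trans (cong ρ (solve 2 (λ a w → a :- a :* w := a :* (con (ℤ.+ 1) :- w)) refl (z * z) w))
              (trans (ρ-* (z * z) (1# − w)) (trans (cong (ℤ._* ρ (1# − w)) (ρ-square z≢0)) (ℤP.*-identityˡ _))))))

    -- The right side is the rational part of (x + y√-2)². The factor 2 introduced by completing the
    -- square disappears because 2 lies in K.
    hat-J-square : hat (λ z → Jac j (z * z)) ≡ x ℤ.* x ℤ.- ℤ.+ 2 ℤ.* y ℤ.* y
    hat-J-square = trans (hat-cong λ z → trans (sym (Φ-double z)) (Φ-scale (1# + 1#) z InK-2)) (trans hat-Φ (hat-class (d-class j)))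

    hat-ε-square : hat (λ z → ε j (z * z)) ≡ d (2 ℕ.+ n) 1#
    hat-ε-square = hat-cong λ z → trans (ε-sq (2 ℕ.+ n) z le) (cong (ε (2 ℕ.+ n)) (sym (*-identityˡ z)))

  -- At level 3 the √-2-part of J sits on odd powers of γ, while the argument z² is a square; only
  -- the multiple `Jac 3 1#` of `ε 3` remains, and `ε 3` on squares is `ε 2`.
  recurrence-3 : (le : 3 ℕ.≤ m) → let open Products 0 le in x ℤ.* x ℤ.- ℤ.+ 2 ℤ.* y ℤ.* y ≡ Jac 3 1# ℤ.* d 2 1#
  recurrence-3 le = trans (sym hat-J-square) (trans (hat-cong pt) (trans (hat-* (Jac 3 1#) (λ z → ε 3 (z * z))) (cong (Jac 3 1# ℤ.*_) hat-ε-square)))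
    where
    open Products 0 le
    odd-zero : ∀ h z → ε 3 (γᵗ (1 ℕ.+ h ℕ.* 2) * (z * z)) ≡ ℤ.0ℤ
    odd-zero h z with z ≟ 0#
    ... | yes refl = trans (cong (ε 3) (trans (*-congˡ (zeroˡ 0#)) (zeroʳ _))) (ε-0 3)
    ... | no z≢0 = x≡-x⇒x≡0 (trans (sym (ε-ρ 1 g le)) (trans (cong (ε 3 g ℤ.*_) (trans (ρ-* (γᵗ (1 ℕ.+ h ℕ.* 2)) (z * z)) (cong₂ ℤ._*_
        (trans (cong (λ e → ρ (γ ^ᶠ e)) (ℕP.*-identityˡ (1 ℕ.+ h ℕ.* 2))) (ρ-odd h)) (ρ-square z≢0)))) (alg (ε 3 g))))
      where
      g : Carrier
      g = γᵗ (1 ℕ.+ h ℕ.* 2) * (z * z)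
      alg : ∀ a → a ℤ.* (ℤ.-1ℤ ℤ.* ℤ.1ℤ) ≡ ℤ.- a
      alg = solve-∀
    pt : ∀ z → Jac 3 (z * z) ≡ Jac 3 1# ℤ.* ε 3 (z * z)
    pt z = trans (structure (J-class 3) (z * z)) (trans (cong (λ b → Jac 3 1# ℤ.* ε 3 (z * z) ℤ.+ Jac 3 (γᵗ 1) ℤ.* b) (cong₂ ℤ._+_ (odd-zero 3 z) (odd-zero 2 z)))
      (alg (Jac 3 1# ℤ.* ε 3 (z * z)) (Jac 3 (γᵗ 1))))
      where
      alg : ∀ a b → a ℤ.+ b ℤ.* (ℤ.0ℤ ℤ.+ ℤ.0ℤ) ≡ a
      alg = solve-∀

  -- From level 4 on γᵗ is a square, so all class functions are supported on squares and twisting by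
  -- ρ does not change them. Then G(χ) G(ρ) = J(χ, ρ) G(χρ) reads J · (x + y√-2) = x₁ · (x + y√-2),
  -- which is `eq₁` and `eq₂`.
  module EvenLevel (n₀ : ℕ) (le : 4 ℕ.+ n₀ ℕ.≤ m) where
    open Products (suc n₀) le public

    private
      ρ-γᵗ : ∀ r → ρ (γᵗ r) ≡ ℤ.1ℤ
      ρ-γᵗ r = trans (cong (λ e → ρ (γ ^ᶠ e)) (lem (2 ℕ.^ n₀) r)) (ρ-even (2 ℕ.^ n₀ ℕ.* r))
        where
        lem : ∀ a r → 2 ℕ.* a ℕ.* r ≡ a ℕ.* r ℕ.* 2
        lem = ℕSolver.solve-∀

      ρ-γᵗ* : ∀ r g → ρ (γᵗ r * g) ≡ ρ g
      ρ-γᵗ* r g = trans (ρ-* (γᵗ r) g) (trans (cong (ℤ._* ρ g) (ρ-γᵗ r)) (ℤP.*-identityˡ (ρ g)))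

      J-ρ : ∀ g → Jac j g ℤ.* ρ g ≡ Jac j g
      J-ρ g = trans (cong (ℤ._* ρ g) (structure (J-class j) g)) (trans (alg (Jac j 1#) (Jac j (γᵗ 1)) (ε j g) (ε j (γᵗ 7 * g)) (ε j (γᵗ 5 * g)) (ρ g))
        (trans (cong₂ (λ a b → Jac j 1# ℤ.* a ℤ.+ Jac j (γᵗ 1) ℤ.* b) (ε-ρ (2 ℕ.+ n₀) g le) (cong₂ ℤ._+_ (shifted 7) (shifted 5))) (sym (structure (J-class j) g))))
        where
        alg : ∀ X Y a b c r → (X ℤ.* a ℤ.+ Y ℤ.* (b ℤ.+ c)) ℤ.* r ≡ X ℤ.* (a ℤ.* r) ℤ.+ Y ℤ.* (b ℤ.* r ℤ.+ c ℤ.* r)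
        alg = solve-∀
        shifted : ∀ r → ε j (γᵗ r * g) ℤ.* ρ g ≡ ε j (γᵗ r * g)
        shifted r = trans (cong (ε j (γᵗ r * g) ℤ.*_) (sym (ρ-γᵗ* r g))) (ε-ρ (2 ℕ.+ n₀) (γᵗ r * g) le)

      convolution : ∀ r z → ΣF (λ x → ε j (γᵗ r * x) ℤ.* ρ (z − x)) ≡ Jac j (γᵗ r * z)
      convolution r z with z ≟ 0#
      ... | yes refl = trans (Z.ΣL-cong elements λ x → trans (cong (ε j (γᵗ r * x) ℤ.*_) (trans (ρ-neg x) (sym (ρ-γᵗ* r x)))) (ε-ρ (2 ℕ.+ n₀) (γᵗ r * x) le))
            (trans (Σε (3 ℕ.+ n₀) (γᵗ r) le) (sym (trans (cong (Jac j) (zeroʳ _)) (φ-0 (J-class j)))))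
      ... | no z≢0 = trans (sym (Z.ΣF-scale z≢0 _)) (trans (Z.ΣL-cong elements λ x → trans (cong₂ (λ a b → ε j a ℤ.* b) (sym (*-assoc (γᵗ r) z x))
            (trans (cong ρ (solve 2 (λ z x → z :- z :* x := z :* (con (ℤ.+ 1) :- x)) refl z x)) (trans (ρ-* z (1# − x)) (ℤP.*-comm (ρ z) (ρ (1# − x))))))
            (sym (ℤP.*-assoc (ε j ((γᵗ r * z) * x)) (ρ (1# − x)) (ρ z)))) (trans (Z.ΣL-*ʳ elements (ρ z) _)
            (trans (cong (Jac j (γᵗ r * z) ℤ.*_) (sym (ρ-γᵗ* r z))) (J-ρ (γᵗ r * z)))))
        where open FSolver using (solve; _:=_; _:*_; _:-_; con)

      hat-J : ∀ r → hat (λ z → Jac j (γᵗ r * z)) ≡ d j (γᵗ r) ℤ.* d 1 1#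
      hat-J r = trans (hat-cong λ z → sym (convolution r z)) (trans (Bihat.bihat (λ x y → ε j (γᵗ r * x) ℤ.* ρ y)
          (λ c x y c∈ → cong (ℤ._* ρ y) (trans (cong (ε j) (solve 3 (λ g c x → g :* (c :* x) := c :* (g :* x)) refl (γᵗ r) c x)) (ε-same j (γᵗ r * x) (InK-^ex j c∈))))
          (λ c x y c∈ → cong (ε j (γᵗ r * x) ℤ.*_) (ε-same 1 y (InK-^ex 1 c∈))))
        (trans (hat-cong λ y → trans (hat-cong λ x → ℤP.*-comm (ε j (γᵗ r * x)) (ρ y)) (trans (hat-* (ρ y) (λ x → ε j (γᵗ r * x))) (ℤP.*-comm (ρ y) (d j (γᵗ r)))))
          (trans (hat-* (d j (γᵗ r)) ρ) (cong (d j (γᵗ r) ℤ.*_) (hat-cong λ x → cong ρ (sym (*-identityˡ x)))))))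
        where open FSolver using (solve; _:=_; _:*_)

      X Y x₁ : ℤ
      X = Jac j 1#
      Y = Jac j (γᵗ 1)
      x₁ = d 1 1#

      eq₁ : X ℤ.* x ℤ.- ℤ.+ 2 ℤ.* Y ℤ.* y ≡ x ℤ.* x₁
      eq₁ = trans (sym (hat-class (J-class j))) (trans (hat-cong λ z → cong (Jac j) (trans (sym (*-identityˡ z)) (*-congʳ (sym γᵗ-0)))) (trans (hat-J 0) (cong (λ g → d j g ℤ.* x₁) γᵗ-0)))

      eq₂ : X ℤ.* y ℤ.+ Y ℤ.* x ≡ y ℤ.* x₁
      eq₂ = trans (sym (hat-class-γᵗ (J-class j))) (hat-J 1)

      cancel-Q : ∀ {a} → a ℤ.* Q ≡ ℤ.0ℤ → a ≡ ℤ.0ℤ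
      cancel-Q {a} e = ℤP.*-cancelʳ-≡ a ℤ.0ℤ Q (trans e (sym (ℤP.*-zeroˡ Q)))

    -- The linear system `eq₁`, `eq₂` for X and Y has determinant x² + 2y² = q, which is nonzero.
    J-1 : Jac j 1# ≡ d 1 1#
    J-1 = ℤP.i-j≡0⇒i≡j X x₁ (cancel-Q (trans (cong ((X ℤ.- x₁) ℤ.*_) (sym (sum-of-squares (suc n₀) le)))
      (trans (alg X Y x y x₁) (trans (cong₂ (λ a b → x ℤ.* (a ℤ.- x ℤ.* x₁) ℤ.+ ℤ.+ 2 ℤ.* y ℤ.* (b ℤ.- y ℤ.* x₁)) eq₁ eq₂) (alg₂ x y x₁)))))
      where
      alg : ∀ X Y x y x₁ → (X ℤ.- x₁) ℤ.* (x ℤ.* x ℤ.+ ℤ.+ 2 ℤ.* y ℤ.* y) ≡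
        x ℤ.* ((X ℤ.* x ℤ.- ℤ.+ 2 ℤ.* Y ℤ.* y) ℤ.- x ℤ.* x₁) ℤ.+ ℤ.+ 2 ℤ.* y ℤ.* ((X ℤ.* y ℤ.+ Y ℤ.* x) ℤ.- y ℤ.* x₁)
      alg = solve-∀
      alg₂ : ∀ x y x₁ → x ℤ.* (x ℤ.* x₁ ℤ.- x ℤ.* x₁) ℤ.+ ℤ.+ 2 ℤ.* y ℤ.* (y ℤ.* x₁ ℤ.- y ℤ.* x₁) ≡ ℤ.0ℤ
      alg₂ = solve-∀

    J-γᵗ : Jac j (γᵗ 1) ≡ ℤ.0ℤ
    J-γᵗ = cancel-Q (trans (cong (Y ℤ.*_) (sym (sum-of-squares (suc n₀) le)))
      (trans (alg X Y x y) (trans (cong₂ (λ a b → x ℤ.* b ℤ.- y ℤ.* a) eq₁ eq₂) (alg₂ x y x₁))))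
      where
      alg : ∀ X Y x y → Y ℤ.* (x ℤ.* x ℤ.+ ℤ.+ 2 ℤ.* y ℤ.* y) ≡
        x ℤ.* (X ℤ.* y ℤ.+ Y ℤ.* x) ℤ.- y ℤ.* (X ℤ.* x ℤ.- ℤ.+ 2 ℤ.* Y ℤ.* y)
      alg = solve-∀
      alg₂ : ∀ x y x₁ → x ℤ.* (y ℤ.* x₁) ℤ.- y ℤ.* (x ℤ.* x₁) ≡ ℤ.0ℤ
      alg₂ = solve-∀

    recurrence : x ℤ.* x ℤ.- ℤ.+ 2 ℤ.* y ℤ.* y ≡ d 1 1# ℤ.* d (3 ℕ.+ n₀) 1#
    recurrence = trans (sym hat-J-square) (trans (hat-cong pt) (trans (hat-* X (λ z → ε j (z * z))) (cong₂ ℤ._*_ J-1 hat-ε-square)))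
      where
      alg : ∀ a b → a ℤ.+ ℤ.0ℤ ℤ.* b ≡ a
      alg = solve-∀
      pt : ∀ z → Jac j (z * z) ≡ X ℤ.* ε j (z * z)
      pt z = trans (structure (J-class j) (z * z)) (trans (cong (λ a → X ℤ.* ε j (z * z) ℤ.+ a ℤ.* (ε j (γᵗ 7 * (z * z)) ℤ.+ ε j (γᵗ 5 * (z * z)))) J-γᵗ)
        (alg (X ℤ.* ε j (z * z)) (ε j (γᵗ 7 * (z * z)) ℤ.+ ε j (γᵗ 5 * (z * z)))))

-- Powers of 2 dividing p^s - 1.

odd-cancel : ∀ i h o c → (1 ℕ.+ h ℕ.* 2) ℕ.* o ≡ 2 ℕ.^ i ℕ.* c → ∃ λ c′ → o ≡ 2 ℕ.^ i ℕ.* c′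
odd-cancel zero h o c e = o , sym (ℕP.+-identityʳ o)
odd-cancel (suc i) h o c e = [ even , odd ]′ (parity o)
  where
  lem₁ : ∀ h a → (1 ℕ.+ h ℕ.* 2) ℕ.* (1 ℕ.+ a ℕ.* 2) ≡ 1 ℕ.+ (h ℕ.+ a ℕ.+ h ℕ.* a ℕ.* 2) ℕ.* 2
  lem₁ = ℕSolver.solve-∀
  lem₂ : ∀ x c → 2 ℕ.* x ℕ.* c ≡ x ℕ.* c ℕ.* 2
  lem₂ = ℕSolver.solve-∀
  lem₃ : ∀ h a → (1 ℕ.+ h ℕ.* 2) ℕ.* a ℕ.* 2 ≡ (1 ℕ.+ h ℕ.* 2) ℕ.* (a ℕ.* 2)
  lem₃ = ℕSolver.solve-∀
  clash : ∀ a b → 1 ℕ.+ a ℕ.* 2 ≡ b ℕ.* 2 → ⊥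
  clash a zero ()
  clash zero (suc b) ()
  clash (suc a) (suc b) e = clash a b (ℕP.suc-injective (ℕP.suc-injective e))
  odd : (∃ λ a → o ≡ 1 ℕ.+ a ℕ.* 2) → ∃ λ c′ → o ≡ 2 ℕ.^ suc i ℕ.* c′
  odd (a , o≡) = ⊥-elim (clash (h ℕ.+ a ℕ.+ h ℕ.* a ℕ.* 2) (2 ℕ.^ i ℕ.* c)
    (trans (sym (lem₁ h a)) (trans (cong ((1 ℕ.+ h ℕ.* 2) ℕ.*_) (sym o≡)) (trans e (lem₂ (2 ℕ.^ i) c)))))
  even : (∃ λ a → o ≡ a ℕ.* 2) → ∃ λ c′ → o ≡ 2 ℕ.^ suc i ℕ.* c′
  even (a , o≡) = proj₁ rec , trans o≡ (trans (cong (ℕ._* 2) (proj₂ rec)) (sym (lem₂ (2 ℕ.^ i) (proj₁ rec))))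
    where
    rec : ∃ λ c′ → a ≡ 2 ℕ.^ i ℕ.* c′
    rec = odd-cancel i h a c (ℕP.*-cancelʳ-≡ _ _ 2 (trans (lem₃ h a) (trans (cong ((1 ℕ.+ h ℕ.* 2) ℕ.*_) (sym o≡)) (trans e (lem₂ (2 ℕ.^ i) c)))))

module TwoAdic (p w : ℕ) (p≡ : p ≡ 3 ℕ.+ w ℕ.* 8) where
  -- (p² − 1) / 8 and (p²ᵛ − 1) / 8
  e₈ : ℕ
  e₈ = 1 ℕ.+ 6 ℕ.* w ℕ.+ 8 ℕ.* (w ℕ.* w)

  eighth : ℕ → ℕ
  eighth zero = 0
  eighth (suc v) = p ℕ.* p ℕ.* eighth v ℕ.+ e₈

  p^even : ∀ v → p ℕ.^ (v ℕ.* 2) ≡ 1 ℕ.+ 8 ℕ.* eighth v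
  p^even zero = refl
  p^even (suc v) = trans (sym (ℕP.*-assoc p p _)) (trans (cong (p ℕ.* p ℕ.*_) (p^even v)) (subst (λ z → z ℕ.* z ℕ.* (1 ℕ.+ 8 ℕ.* eighth v) ≡ 1 ℕ.+ 8 ℕ.* (z ℕ.* z ℕ.* eighth v ℕ.+ e₈)) (sym p≡) (lem w (eighth v))))
    where
    lem : ∀ w b → (3 ℕ.+ w ℕ.* 8) ℕ.* (3 ℕ.+ w ℕ.* 8) ℕ.* (1 ℕ.+ 8 ℕ.* b) ≡
      1 ℕ.+ 8 ℕ.* ((3 ℕ.+ w ℕ.* 8) ℕ.* (3 ℕ.+ w ℕ.* 8) ℕ.* b ℕ.+ (1 ℕ.+ 6 ℕ.* w ℕ.+ 8 ℕ.* (w ℕ.* w)))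
    lem = ℕSolver.solve-∀

  p^odd : ∀ v → p ℕ.^ (1 ℕ.+ v ℕ.* 2) ≡ 3 ℕ.+ 8 ℕ.* (w ℕ.+ 3 ℕ.* eighth v ℕ.+ 8 ℕ.* w ℕ.* eighth v)
  p^odd v = trans (cong₂ ℕ._*_ p≡ (p^even v)) (lem w (eighth v))
    where
    lem : ∀ w b → (3 ℕ.+ w ℕ.* 8) ℕ.* (1 ℕ.+ 8 ℕ.* b) ≡ 3 ℕ.+ 8 ℕ.* (w ℕ.+ 3 ℕ.* b ℕ.+ 8 ℕ.* w ℕ.* b)
    lem = ℕSolver.solve-∀

  private
    3≢1 : ∀ a b → 3 ℕ.+ 8 ℕ.* a ≡ 1 ℕ.+ 8 ℕ.* b → ⊥
    3≢1 a b e = go a b (trans (cong (3 ℕ.+_) (ℕP.*-comm a 8)) (trans e (cong (1 ℕ.+_) (ℕP.*-comm 8 b))))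
      where
      go : ∀ a b → 3 ℕ.+ a ℕ.* 8 ≡ 1 ℕ.+ b ℕ.* 8 → ⊥
      go zero (suc b) ()
      go (suc a) (suc b) e = go a b (ℕP.+-cancelˡ-≡ 8 _ _ e)
    9≢1 : ∀ a b → 9 ℕ.+ a ℕ.* 16 ≡ 1 ℕ.+ b ℕ.* 16 → ⊥
    9≢1 zero (suc b) ()
    9≢1 (suc a) (suc b) e = 9≢1 a b (ℕP.+-cancelˡ-≡ 16 _ _ e)

  halve : ∀ s c → p ℕ.^ s ≡ 1 ℕ.+ 8 ℕ.* c → ∃ λ v → (s ≡ v ℕ.* 2) × (c ≡ eighth v)
  halve s c e with parity s
  ... | inj₁ (v , refl) = v , refl , ℕP.*-cancelˡ-≡ _ _ 8 (ℕP.suc-injective (trans (sym e) (p^even v)))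
  ... | inj₂ (v , refl) = ⊥-elim (3≢1 (w ℕ.+ 3 ℕ.* eighth v ℕ.+ 8 ℕ.* w ℕ.* eighth v) c (trans (sym (p^odd v)) e))

  -- With s = 2v, an odd v would make p^s congruent to 9 modulo 16. So p^v = 1 + 8a, and p^s - 1 =
  -- 16 a (1 + 4a) puts all further powers of 2 into a.
  halve-16 : ∀ i s c → p ℕ.^ s ≡ 1 ℕ.+ 2 ℕ.^ (4 ℕ.+ i) ℕ.* c →
    ∃ λ v → (s ≡ v ℕ.* 2) × (∃ λ c′ → p ℕ.^ v ≡ 1 ℕ.+ 2 ℕ.^ (3 ℕ.+ i) ℕ.* c′)
  halve-16 i s c e = case-v (halve s (2 ℕ.* 2 ℕ.^ i ℕ.* c) (trans e (lem₀ (2 ℕ.^ i) c)))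
    where
    lem₀ : ∀ x c → 1 ℕ.+ 2 ℕ.* (2 ℕ.* (2 ℕ.* (2 ℕ.* x))) ℕ.* c ≡ 1 ℕ.+ 8 ℕ.* (2 ℕ.* x ℕ.* c)
    lem₀ = ℕSolver.solve-∀
    lem₁ : ∀ a → 9 ℕ.+ (3 ℕ.* a ℕ.+ 4 ℕ.* (a ℕ.* a)) ℕ.* 16 ≡ (3 ℕ.+ 8 ℕ.* a) ℕ.* (3 ℕ.+ 8 ℕ.* a)
    lem₁ = ℕSolver.solve-∀
    lem₂ : ∀ x c → 1 ℕ.+ 2 ℕ.* (2 ℕ.* (2 ℕ.* (2 ℕ.* x))) ℕ.* c ≡ 1 ℕ.+ x ℕ.* c ℕ.* 16
    lem₂ = ℕSolver.solve-∀
    lem₃ : ∀ a → (1 ℕ.+ 8 ℕ.* a) ℕ.* (1 ℕ.+ 8 ℕ.* a) ≡ 1 ℕ.+ (1 ℕ.+ a ℕ.* 2 ℕ.* 2) ℕ.* a ℕ.* 16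
    lem₃ = ℕSolver.solve-∀
    lem₄ : ∀ x c → 1 ℕ.+ 8 ℕ.* (x ℕ.* c) ≡ 1 ℕ.+ 2 ℕ.* (2 ℕ.* (2 ℕ.* x)) ℕ.* c
    lem₄ = ℕSolver.solve-∀
    square : ∀ v {x} → s ≡ v ℕ.* 2 → p ℕ.^ v ≡ x → x ℕ.* x ≡ 1 ℕ.+ 2 ℕ.^ i ℕ.* c ℕ.* 16
    square v refl refl = trans (sym (^2 (p ℕ.^ v))) (trans (ℕP.^-*-assoc p v 2) (trans e (lem₂ (2 ℕ.^ i) c)))
    case-v : (∃ λ v → (s ≡ v ℕ.* 2) × (2 ℕ.* 2 ℕ.^ i ℕ.* c ≡ eighth v)) →
      ∃ λ v → (s ≡ v ℕ.* 2) × (∃ λ c′ → p ℕ.^ v ≡ 1 ℕ.+ 2 ℕ.^ (3 ℕ.+ i) ℕ.* c′)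
    case-v (v , s≡ , _) = [ even , odd ]′ (parity v)
      where
      odd : (∃ λ u → v ≡ 1 ℕ.+ u ℕ.* 2) → ∃ λ v → (s ≡ v ℕ.* 2) × (∃ λ c′ → p ℕ.^ v ≡ 1 ℕ.+ 2 ℕ.^ (3 ℕ.+ i) ℕ.* c′)
      odd (u , v≡) = ⊥-elim (9≢1 (3 ℕ.* a ℕ.+ 4 ℕ.* (a ℕ.* a)) (2 ℕ.^ i ℕ.* c) (trans (lem₁ a) (square v s≡ (trans (cong (p ℕ.^_) v≡) (p^odd u)))))
        where
        a : ℕ
        a = w ℕ.+ 3 ℕ.* eighth u ℕ.+ 8 ℕ.* w ℕ.* eighth u
      even : (∃ λ u → v ≡ u ℕ.* 2) → ∃ λ v → (s ≡ v ℕ.* 2) × (∃ λ c′ → p ℕ.^ v ≡ 1 ℕ.+ 2 ℕ.^ (3 ℕ.+ i) ℕ.* c′)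
      even (u , v≡) = v , s≡ , proj₁ quarter , trans p^v (trans (cong (λ z → 1 ℕ.+ 8 ℕ.* z) (proj₂ quarter)) (lem₄ (2 ℕ.^ i) (proj₁ quarter)))
        where
        p^v : p ℕ.^ v ≡ 1 ℕ.+ 8 ℕ.* eighth u
        p^v = trans (cong (p ℕ.^_) v≡) (p^even u)
        quarter : ∃ λ c′ → eighth u ≡ 2 ℕ.^ i ℕ.* c′
        quarter = odd-cancel i (eighth u ℕ.* 2) (eighth u) c (ℕP.*-cancelʳ-≡ _ _ 16 (ℕP.suc-injective (trans (sym (lem₃ (eighth u))) (square v s≡ p^v))))

  -- Repeated halving. It is the reason why the roots q^(1/2^k) of the enumerator are integral
  -- powers of p.
  2-power∣exponent : ∀ i s c → p ℕ.^ s ≡ 1 ℕ.+ 2 ℕ.^ (3 ℕ.+ i) ℕ.* c → ∃ λ u → s ≡ u ℕ.* 2 ℕ.^ (1 ℕ.+ i)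
  2-power∣exponent zero s c e = proj₁ h , proj₁ (proj₂ h)
    where
    h : ∃ λ v → (s ≡ v ℕ.* 2) × (c ≡ eighth v)
    h = halve s c e
  2-power∣exponent (suc i) s c e = proj₁ r , trans s≡ (trans (cong (ℕ._* 2) (proj₂ r)) (lem (proj₁ r) (2 ℕ.^ i)))
    where
    h : ∃ λ v → (s ≡ v ℕ.* 2) × (∃ λ c′ → p ℕ.^ v ≡ 1 ℕ.+ 2 ℕ.^ (3 ℕ.+ i) ℕ.* c′)
    h = halve-16 i s c e
    s≡ : s ≡ proj₁ h ℕ.* 2
    s≡ = proj₁ (proj₂ h)
    r : ∃ λ u → proj₁ h ≡ u ℕ.* 2 ℕ.^ (1 ℕ.+ i)
    r = 2-power∣exponent i (proj₁ h) (proj₁ (proj₂ (proj₂ h))) (proj₂ (proj₂ (proj₂ h)))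
    lem : ∀ u x → u ℕ.* (2 ℕ.* x) ℕ.* 2 ≡ u ℕ.* (2 ℕ.* (2 ℕ.* x))
    lem = ℕSolver.solve-∀

-- The Jacobi sum of level 3 modulo p.

module ModP (σ : Setting) where
  open Identities σ public
  private module S = CyclicSum isCommutativeSemiring

  private
    pascal : ∀ n i → ι (suc n C suc i) ≡ ι (n C i) + ι (n C suc i)
    pascal n i = trans (cong ι (sym (nCk+nC[k+1]≡[n+1]C[k+1] n i))) (ι-+ (n C i) _)

    C>-0 : ∀ {n i} → n ℕ.< i → ι (n C i) ≡ 0#
    C>-0 lt = cong ι (k>n⇒nCk≡0 lt)

    -- With `shift-high`: comparison of coefficients in (1 + X)^(n+p) = (1 + X)^n (1 + X^p) modulo
    -- p, below and from X^p on.
    shift-low : ∀ n i → i ℕ.< p → ι ((n ℕ.+ p) C i) ≡ ι (n C i)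
    shift-low n zero _ = refl
    shift-low zero (suc i) i<p = trans (ι-pCi (suc i) (s≤s z≤n) i<p) (sym (C>-0 {0} {suc i} (s≤s z≤n)))
    shift-low (suc n) (suc i) i<p = trans (pascal (n ℕ.+ p) i) (trans (cong₂ _+_ (shift-low n i (ℕP.<-trans (ℕP.n<1+n i) i<p)) (shift-low n (suc i) i<p)) (sym (pascal n i)))

    shift-high : ∀ n i → ι ((n ℕ.+ p) C (i ℕ.+ p)) ≡ ι (n C i) + ι (n C (i ℕ.+ p))
    shift-high zero zero = trans (cong ι (nCn≡1 p)) (sym (trans (+-congˡ (C>-0 {0} (ℕP.<-trans (s≤s z≤n) 1<p))) (+-identityʳ _)))
    shift-high zero (suc i) = trans (C>-0 (ℕP.m<n+m p (s≤s z≤n))) (sym (trans (cong₂ _+_ (C>-0 {0} {suc i} (s≤s z≤n)) (C>-0 {0} {suc i ℕ.+ p} (s≤s z≤n))) (+-identityʳ _)))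
    shift-high (suc n) zero = subst (λ r → ι (suc (n ℕ.+ p) C r) ≡ ι (suc n C 0) + ι (suc n C r)) p≡ (begin
      ι (suc (n ℕ.+ p) C suc r) ≡⟨ pascal (n ℕ.+ p) r ⟩
      ι ((n ℕ.+ p) C r) + ι ((n ℕ.+ p) C suc r) ≡⟨ cong₂ _+_ (shift-low n r (ℕP.≤-reflexive p≡)) (subst (λ z → ι ((n ℕ.+ p) C z) ≡ ι (n C 0) + ι (n C z)) (sym p≡) (shift-high n zero)) ⟩
      ι (n C r) + (ι (n C 0) + ι (n C suc r)) ≡⟨ solve 3 (λ a b c → a :+ (b :+ c) := b :+ (a :+ c)) refl (ι (n C r)) (ι (n C 0)) (ι (n C suc r)) ⟩
      ι (n C 0) + (ι (n C r) + ι (n C suc r)) ≡⟨ +-congˡ (sym (pascal n r)) ⟩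
      ι (suc n C 0) + ι (suc n C suc r) ∎)
      where
      open ≡-Reasoning
      open FSolver using (solve; _:=_; _:+_)
      r : ℕ
      r = p ∸ 1
      p≡ : suc r ≡ p
      p≡ = ℕP.m+[n∸m]≡n (ℕP.<⇒≤ 1<p)
    shift-high (suc n) (suc i) = begin
      ι ((suc n ℕ.+ p) C suc (i ℕ.+ p)) ≡⟨ pascal (n ℕ.+ p) (i ℕ.+ p) ⟩
      ι ((n ℕ.+ p) C (i ℕ.+ p)) + ι ((n ℕ.+ p) C (suc i ℕ.+ p)) ≡⟨ cong₂ _+_ (shift-high n i) (shift-high n (suc i)) ⟩
      (ι (n C i) + ι (n C (i ℕ.+ p))) + (ι (n C suc i) + ι (n C suc (i ℕ.+ p))) ≡⟨ solve 4 (λ a b c d → (a :+ b) :+ (c :+ d) := (a :+ c) :+ (b :+ d)) refl (ι (n C i)) _ _ _ ⟩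
      (ι (n C i) + ι (n C suc i)) + (ι (n C (i ℕ.+ p)) + ι (n C suc (i ℕ.+ p))) ≡⟨ sym (cong₂ _+_ (pascal n i) (pascal n (i ℕ.+ p))) ⟩
      ι (suc n C suc i) + ι (suc n C suc (i ℕ.+ p)) ∎
      where
      open ≡-Reasoning
      open FSolver using (solve; _:=_; _:+_)

  -- Lucas' theorem, with congruence modulo p read as equality in F.
  lucas : ∀ a b c d → b ℕ.< p → d ℕ.< p → ι ((b ℕ.+ a ℕ.* p) C (d ℕ.+ c ℕ.* p)) ≡ ι (a C c) * ι (b C d)
  lucas zero b zero d b<p d<p = trans (cong₂ (λ x y → ι (x C y)) (ℕP.+-identityʳ b) (ℕP.+-identityʳ d)) (sym (trans (*-congʳ (+-identityʳ 1#)) (*-identityˡ _)))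
  lucas zero b (suc c) d b<p d<p = trans (C>-0 (ℕP.<-≤-trans (subst (ℕ._< p) (sym (ℕP.+-identityʳ b)) b<p) (ℕP.≤-trans (ℕP.m≤m+n p (c ℕ.* p)) (ℕP.m≤n+m (p ℕ.+ c ℕ.* p) d))))
    (sym (trans (*-congʳ (C>-0 {0} {suc c} (s≤s z≤n))) (zeroˡ _)))
  lucas (suc a) b zero d b<p d<p = begin
    ι ((b ℕ.+ suc a ℕ.* p) C (d ℕ.+ 0)) ≡⟨ cong₂ (λ x y → ι (x C y)) (lem b a p) (ℕP.+-identityʳ d) ⟩
    ι ((b ℕ.+ a ℕ.* p ℕ.+ p) C d) ≡⟨ shift-low (b ℕ.+ a ℕ.* p) d d<p ⟩
    ι ((b ℕ.+ a ℕ.* p) C d) ≡⟨ cong (λ y → ι ((b ℕ.+ a ℕ.* p) C y)) (sym (ℕP.+-identityʳ d)) ⟩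
    ι ((b ℕ.+ a ℕ.* p) C (d ℕ.+ 0)) ≡⟨ lucas a b zero d b<p d<p ⟩
    ι (a C 0) * ι (b C d) ∎
    where
    open ≡-Reasoning
    lem : ∀ b a p → b ℕ.+ (p ℕ.+ a ℕ.* p) ≡ b ℕ.+ a ℕ.* p ℕ.+ p
    lem = ℕSolver.solve-∀
  lucas (suc a) b (suc c) d b<p d<p = begin
    ι ((b ℕ.+ suc a ℕ.* p) C (d ℕ.+ suc c ℕ.* p)) ≡⟨ cong₂ (λ x y → ι (x C y)) (lem b a p) (lem d c p) ⟩
    ι ((b ℕ.+ a ℕ.* p ℕ.+ p) C (d ℕ.+ c ℕ.* p ℕ.+ p)) ≡⟨ shift-high (b ℕ.+ a ℕ.* p) (d ℕ.+ c ℕ.* p) ⟩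
    ι ((b ℕ.+ a ℕ.* p) C (d ℕ.+ c ℕ.* p)) + ι ((b ℕ.+ a ℕ.* p) C (d ℕ.+ c ℕ.* p ℕ.+ p)) ≡⟨ cong₂ _+_ (lucas a b c d b<p d<p)
        (trans (cong (λ y → ι ((b ℕ.+ a ℕ.* p) C y)) (sym (lem d c p))) (lucas a b (suc c) d b<p d<p)) ⟩
    ι (a C c) * ι (b C d) + ι (a C suc c) * ι (b C d) ≡⟨ sym (distribʳ _ _ _) ⟩
    (ι (a C c) + ι (a C suc c)) * ι (b C d) ≡⟨ *-congʳ (sym (pascal a c)) ⟩
    ι (suc a C suc c) * ι (b C d) ∎
    where
    open ≡-Reasoning
    lem : ∀ b a p → b ℕ.+ (p ℕ.+ a ℕ.* p) ≡ b ℕ.+ a ℕ.* p ℕ.+ p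
    lem = ℕSolver.solve-∀

  open TwoAdic p w p≡8w+3 public

  -- In base p, 4 · eighth v has all digits 4w + 1 and eighth v has digits w and 3w + 1.
  C-eighth-≢0 : ∀ v → ι ((4 ℕ.* eighth v) C eighth v) ≢ 0#
  C-eighth-≢0 zero e = 1≢0 (trans (sym (+-identityʳ 1#)) e)
  C-eighth-≢0 (suc v) e = *-≢0 (*-≢0 (C-eighth-≢0 v) (ι-C-≢0 {D} {w} w≤D D<p)) (ι-C-≢0 {D} {E} E≤D D<p) (trans (sym split) e)
    where
    D E b : ℕ
    D = 1 ℕ.+ 4 ℕ.* w
    E = 1 ℕ.+ 3 ℕ.* w
    b = eighth v
    w≤D : w ℕ.≤ D
    w≤D = ℕP.≤-trans (ℕP.m≤m+n w (3 ℕ.* w)) (ℕP.n≤1+n _)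
    E≤D : E ℕ.≤ D
    E≤D = s≤s (ℕP.*-monoˡ-≤ w {3} {4} (s≤s (s≤s (s≤s z≤n))))
    D<p : D ℕ.< p
    D<p = subst (D ℕ.<_) (sym p≡8w+3) (s≤s (s≤s (ℕP.≤-trans (subst (ℕ._≤ w ℕ.* 8) (ℕP.*-comm w 4) (ℕP.*-monoʳ-≤ w (s≤s (s≤s (s≤s (s≤s z≤n)))))) (ℕP.n≤1+n _))))
    lem₁ : ∀ w b → 4 ℕ.* ((3 ℕ.+ w ℕ.* 8) ℕ.* (3 ℕ.+ w ℕ.* 8) ℕ.* b ℕ.+ (1 ℕ.+ 6 ℕ.* w ℕ.+ 8 ℕ.* (w ℕ.* w))) ≡
      1 ℕ.+ 4 ℕ.* w ℕ.+ (1 ℕ.+ 4 ℕ.* w ℕ.+ 4 ℕ.* b ℕ.* (3 ℕ.+ w ℕ.* 8)) ℕ.* (3 ℕ.+ w ℕ.* 8)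
    lem₁ = ℕSolver.solve-∀
    lem₂ : ∀ w b → (3 ℕ.+ w ℕ.* 8) ℕ.* (3 ℕ.+ w ℕ.* 8) ℕ.* b ℕ.+ (1 ℕ.+ 6 ℕ.* w ℕ.+ 8 ℕ.* (w ℕ.* w)) ≡
      1 ℕ.+ 3 ℕ.* w ℕ.+ (w ℕ.+ b ℕ.* (3 ℕ.+ w ℕ.* 8)) ℕ.* (3 ℕ.+ w ℕ.* 8)
    lem₂ = ℕSolver.solve-∀
    split : ι ((4 ℕ.* eighth (suc v)) C eighth (suc v)) ≡ (ι ((4 ℕ.* b) C b) * ι (D C w)) * ι (D C E)
    split = trans (cong₂ (λ x y → ι (x C y))
        (subst (λ z → 4 ℕ.* (z ℕ.* z ℕ.* b ℕ.+ e₈) ≡ D ℕ.+ (D ℕ.+ 4 ℕ.* b ℕ.* z) ℕ.* z) (sym p≡8w+3) (lem₁ w b))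
        (subst (λ z → z ℕ.* z ℕ.* b ℕ.+ e₈ ≡ E ℕ.+ (w ℕ.+ b ℕ.* z) ℕ.* z) (sym p≡8w+3) (lem₂ w b)))
      (trans (lucas (D ℕ.+ 4 ℕ.* b ℕ.* p) D (w ℕ.+ b ℕ.* p) E D<p (ℕP.≤-<-trans E≤D D<p))
        (*-congʳ (lucas (4 ℕ.* b) D b w D<p (ℕP.≤-<-trans w≤D D<p))))

  ιℤ-ρ : ∀ z → ιℤ (ρ z) ≡ z ^ᶠ ex 1
  ιℤ-ρ z with z ≟ 0#
  ... | yes refl = trans (cong ιℤ (ε-0 1)) (sym (0^ (ex 1) (0<ex 1)))
  ... | no z≢0 with ρ-view z≢0
  ... | inj₁ (e , v) = trans (cong ιℤ v) (sym e)
  ... | inj₂ (e , v) = trans (cong ιℤ v) (trans (cong -_ (+-identityʳ 1#)) (sym e))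

  ιℤ-Σ : ∀ (xs : List Carrier) g → ιℤ (Z.ΣL xs g) ≡ S.ΣL xs (λ x → ιℤ (g x))
  ιℤ-Σ [] g = refl
  ιℤ-Σ (x ∷ xs) g = trans (ιℤ-+ (g x) (Z.ΣL xs g)) (+-congˡ (ιℤ-Σ xs g))

  -- The substitution u = t⁴ turns the sign function of order 8 into the quadratic character, and
  -- `ε 3` is supported on fourth powers. Only `ρ` is left, which Euler's criterion `ιℤ-ρ` expresses
  -- as a power in F.
  4J : ΣF (λ t → ρ t ℤ.* ρ (1# − (t ^ᶠ 4))) ≡ ℤ.+ 4 ℤ.* Jac 3 1#
  4J = trans (Z.ΣL-cong elements λ t → cong (ℤ._* ρ (1# − (t ^ᶠ 4))) (sym (ε-4 t)))
    (trans (Σ-powers 2 (λ u → ε 3 u ℤ.* ρ (1# − u)) (trans (cong (ℤ._* ρ (1# − 0#)) (ε-0 3)) (ℤP.*-zeroˡ (ρ (1# − 0#)))) (ℕP.≤-trans (s≤s (s≤s z≤n)) 3≤m))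
      (cong (ℤ.+ 4 ℤ.*_) (Z.ΣL-cong elements λ u → trans (sym (ℤP.*-assoc (one 2 u) (ε 3 u) (ρ (1# − u)))) (cong (ℤ._* ρ (1# − u)) (trans (supp u) (cong (ε 3) (sym (*-identityˡ u))))))))
    where
    ε-4 : ∀ t → ε 3 (t ^ᶠ 4) ≡ ρ t
    ε-4 t = cong sgn (trans (sym (^-* t 4 (ex 3))) (cong (t ^ᶠ_) (trans (ℕP.*-comm 4 (ex 3)) (ex-+ 2 1 3≤m))))
    supp : ∀ u → one 2 u ℤ.* ε 3 u ≡ ε 3 u
    supp u with sgnView (u ^ᶠ ex 3)
    ... | none _ _ v = trans (cong (one 2 u ℤ.*_) v) (trans (ℤP.*-zeroʳ (one 2 u)) (sym v))
    ... | pos e _ = trans (cong (ℤ._* ε 3 u) (𝟙-yes ((u ^ᶠ ex 2) ≟ 1#) (trans (trans (sym (sq-^ u 2 3≤m)) (*-^ u u (ex 3))) (trans (cong (λ z → z * z) e) (*-identityˡ 1#))))) (ℤP.*-identityˡ (ε 3 u))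
    ... | neg e _ = trans (cong (ℤ._* ε 3 u) (𝟙-yes ((u ^ᶠ ex 2) ≟ 1#) (trans (trans (sym (sq-^ u 2 3≤m)) (*-^ u u (ex 3))) (trans (cong (λ z → z * z) e) -1*-1)))) (ℤP.*-identityˡ (ε 3 u))

  private
    b : ℕ
    b = ex 3

    T : ℕ → Carrier
    T i = ι (ex 1 C i) * (((- 1#) ^ᶠ i) * S.ΣF (_^ᶠ (ex 1 ℕ.+ 4 ℕ.* i)))

    expand : S.ΣF (λ t → (t ^ᶠ ex 1) * ((1# − (t ^ᶠ 4)) ^ᶠ ex 1)) ≡ S.Σ< (suc (ex 1)) T
    expand = trans (S.ΣL-cong elements λ t → trans (*-congˡ (binomial (- (t ^ᶠ 4)) (ex 1) (suc (ex 1)) ℕP.≤-refl)) (trans (sym (S.Σ<-*ˡ (suc (ex 1)) (t ^ᶠ ex 1) (λ i → ι (ex 1 C i) * ((- (t ^ᶠ 4)) ^ᶠ i)))) (S.Σ<-cong (suc (ex 1)) λ i _ → term t i)))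
      (trans (sym (S.Σ<-swapL (suc (ex 1)) elements (λ i t → ι (ex 1 C i) * (((- 1#) ^ᶠ i) * (t ^ᶠ (ex 1 ℕ.+ 4 ℕ.* i)))))) (S.Σ<-cong (suc (ex 1)) λ i _ → trans (S.ΣL-*ˡ elements (ι (ex 1 C i)) (λ t → ((- 1#) ^ᶠ i) * (t ^ᶠ (ex 1 ℕ.+ 4 ℕ.* i)))) (*-congˡ (S.ΣL-*ˡ elements ((- 1#) ^ᶠ i) (_^ᶠ (ex 1 ℕ.+ 4 ℕ.* i))))))
      where
      open FSolver using (solve; _:=_; _:*_; :-_; con)
      term : ∀ t i → (t ^ᶠ ex 1) * (ι (ex 1 C i) * ((- (t ^ᶠ 4)) ^ᶠ i)) ≡ ι (ex 1 C i) * (((- 1#) ^ᶠ i) * (t ^ᶠ (ex 1 ℕ.+ 4 ℕ.* i)))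
      term t i = trans (cong (λ z → (t ^ᶠ ex 1) * (ι (ex 1 C i) * z)) (trans (cong (_^ᶠ i) (solve 1 (λ x → :- x := (:- con (ℤ.+ 1)) :* x) refl (t ^ᶠ 4))) (trans (*-^ (- 1#) (t ^ᶠ 4) i) (*-congˡ (sym (^-* t 4 i))))))
        (trans (solve 4 (λ a c n x → a :* (c :* (n :* x)) := c :* (n :* (a :* x))) refl (t ^ᶠ ex 1) (ι (ex 1 C i)) ((- 1#) ^ᶠ i) (t ^ᶠ (4 ℕ.* i))) (cong (λ z → ι (ex 1 C i) * (((- 1#) ^ᶠ i) * z)) (sym (^-+ t (ex 1) (4 ℕ.* i)))))

    ex1≡ : ex 1 ≡ 4 ℕ.* b
    ex1≡ = trans (sym (ex-+ 2 1 3≤m)) (ℕP.*-comm b 4)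

    q₁≡8b : q₁ ≡ 4 ℕ.* (2 ℕ.* b)
    q₁≡8b = trans (sym (ex-2^ 3 3≤m)) (lem b)
      where
      lem : ∀ b → b ℕ.* 8 ≡ 4 ℕ.* (2 ℕ.* b)
      lem = ℕSolver.solve-∀

    exponent : ∀ i → ex 1 ℕ.+ 4 ℕ.* i ≡ 4 ℕ.* (b ℕ.+ i)
    exponent i = trans (cong (ℕ._+ 4 ℕ.* i) ex1≡) (sym (ℕP.*-distribˡ-+ 4 b i))

    between : ∀ n c x → n ℕ.* c ℕ.< x → x ℕ.< suc n ℕ.* c → ¬ (c ∣ℕ.∣ x)
    between n c x lo hi (divides a refl) = ℕP.<⇒≱ (ℕP.*-cancelʳ-< c n a lo) (ℕP.≤-pred (ℕP.*-cancelʳ-< c a (suc n) hi))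

    T-0 : ∀ i → ¬ (2 ℕ.* b ∣ℕ.∣ b ℕ.+ i) → T i ≡ 0#
    T-0 i nd = trans (*-congˡ (trans (*-congˡ (power-sum-0 (ex 1 ℕ.+ 4 ℕ.* i) λ d → nd (∣ℕ.*-cancelˡ-∣ 4 (subst₂ ∣ℕ._∣_ q₁≡8b (exponent i) d)))) (zeroʳ _))) (zeroʳ _)

    T-val : ∀ i → 2 ℕ.* b ∣ℕ.∣ b ℕ.+ i → (- 1#) ^ᶠ i ≡ 1# → T i ≡ - ι (ex 1 C i)
    T-val i dv e = trans (*-congˡ (trans (*-congʳ e) (trans (*-identityˡ _) (power-sum-neg1 (ex 1 ℕ.+ 4 ℕ.* i) (ℕP.≤-trans (0<ex 1) (ℕP.m≤m+n (ex 1) _))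
      (subst₂ ∣ℕ._∣_ (sym q₁≡8b) (sym (exponent i)) (∣ℕ.*-monoʳ-∣ 4 dv)))))) (solve 1 (λ c → c :* (:- con (ℤ.+ 1)) := :- c) refl (ι (ex 1 C i)))
      where open FSolver using (solve; _:=_; _:*_; :-_; con)

    -- With b = (q-1)/8, a term survives only if 2b divides b + i. For 0 ≤ i ≤ 4b this means i = b
    -- or i = 3b, and the two binomial coefficients agree by symmetry.
    ΣT : S.Σ< (suc (ex 1)) T ≡ - (ι ((4 ℕ.* b) C b) + ι ((4 ℕ.* b) C b))
    ΣT = go b refl (0<ex 3)
      where
      go : ∀ b′ → b′ ≡ b → 0 ℕ.< b′ → S.Σ< (suc (ex 1)) T ≡ - (ι ((4 ℕ.* b) C b) + ι ((4 ℕ.* b) C b))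
      go (suc a) a≡ _ = begin
        S.Σ< (suc (ex 1)) T ≡⟨ cong (λ n → S.Σ< n T) (trans (cong suc (trans ex1≡ (cong (4 ℕ.*_) (sym a≡)))) (len a)) ⟩
        S.Σ< (suc a ℕ.+ suc (suc (a ℕ.* 2) ℕ.+ suc (suc a))) T ≡⟨ S.Σ<-++ (suc a) _ T ⟩
        S.Σ< (suc a) T + (T (suc a ℕ.+ 0) + S.Σ< (suc (a ℕ.* 2) ℕ.+ suc (suc a)) (λ i → T (suc a ℕ.+ suc i)))
          ≡⟨ cong₂ _+_ (S.Σ<-0 (suc a) z₁) (cong₂ _+_ t₁ (trans (S.Σ<-++ (suc (a ℕ.* 2)) (suc (suc a)) (λ i → T (suc a ℕ.+ suc i))) (cong₂ _+_ (S.Σ<-0 (suc (a ℕ.* 2)) z₂) (cong₂ _+_ t₂ (S.Σ<-0 (suc a) z₃))))) ⟩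
        0# + (- c + (0# + (- c + 0#))) ≡⟨ solve 1 (λ c → con (ℤ.+ 0) :+ (:- c :+ (con (ℤ.+ 0) :+ (:- c :+ con (ℤ.+ 0)))) := :- (c :+ c)) refl c ⟩
        - (c + c) ∎
        where
        open ≡-Reasoning
        open FSolver using (solve; _:=_; _:+_; :-_; con)
        c : Carrier
        c = ι ((4 ℕ.* b) C b)
        -- The lengths are b, 1, 2b - 1, 1, b with b = a + 1; the two single places are i = b and i
        -- = 3b.
        len : ∀ a → suc (4 ℕ.* suc a) ≡ suc a ℕ.+ suc (suc (a ℕ.* 2) ℕ.+ suc (suc a))
        len = ℕSolver.solve-∀
        nd : ∀ k i → k ℕ.* (2 ℕ.* suc a) ℕ.< suc a ℕ.+ i → suc a ℕ.+ i ℕ.< suc k ℕ.* (2 ℕ.* suc a) → T i ≡ 0#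
        nd k i lo hi = T-0 i (subst (λ z → ¬ (2 ℕ.* z ∣ℕ.∣ z ℕ.+ i)) a≡ (between k (2 ℕ.* suc a) (suc a ℕ.+ i) lo hi))
        z₁ : ∀ i → i ℕ.< suc a → T i ≡ 0#
        z₁ i i< = nd 0 i (s≤s z≤n) (subst (suc a ℕ.+ i ℕ.<_) (e a) (ℕP.+-monoʳ-< (suc a) i<))
          where
          e : ∀ a → suc a ℕ.+ suc a ≡ 1 ℕ.* (2 ℕ.* suc a)
          e = ℕSolver.solve-∀
        z₂ : ∀ i → i ℕ.< suc (a ℕ.* 2) → T (suc a ℕ.+ suc i) ≡ 0#
        z₂ i i< = nd 1 (suc a ℕ.+ suc i) (subst₂ ℕ._<_ (e₁ a) (e₂ a i) (ℕP.m<m+n (suc a ℕ.+ suc a) (s≤s z≤n)))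
          (subst₂ ℕ._<_ (e₂ a i) (e₃ a) (ℕP.+-monoʳ-< (suc a ℕ.+ suc a) (s≤s i<)))
          where
          e₁ : ∀ a → suc a ℕ.+ suc a ≡ 1 ℕ.* (2 ℕ.* suc a)
          e₁ = ℕSolver.solve-∀
          e₂ : ∀ a i → suc a ℕ.+ suc a ℕ.+ suc i ≡ suc a ℕ.+ (suc a ℕ.+ suc i)
          e₂ = ℕSolver.solve-∀
          e₃ : ∀ a → suc a ℕ.+ suc a ℕ.+ suc (suc (a ℕ.* 2)) ≡ 2 ℕ.* (2 ℕ.* suc a)
          e₃ = ℕSolver.solve-∀
        z₃ : ∀ i → i ℕ.< suc a → T (suc a ℕ.+ suc (suc (a ℕ.* 2) ℕ.+ suc i)) ≡ 0#
        z₃ i i< = nd 2 (suc a ℕ.+ suc (suc (a ℕ.* 2) ℕ.+ suc i)) (subst₂ ℕ._<_ (e₁ a) (e₂ a i) (ℕP.m<m+n (4 ℕ.* suc a) (s≤s z≤n)))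
          (ℕP.<-≤-trans (subst₂ ℕ._<_ (e₂ a i) (e₃ a) (ℕP.+-monoʳ-< (4 ℕ.* suc a) (s≤s i<))) (subst (suc (5 ℕ.* suc a) ℕ.≤_) (e₄ a) (ℕP.m≤m+n (suc (5 ℕ.* suc a)) a)))
          where
          e₁ : ∀ a → 4 ℕ.* suc a ≡ 2 ℕ.* (2 ℕ.* suc a)
          e₁ = ℕSolver.solve-∀
          e₂ : ∀ a i → 4 ℕ.* suc a ℕ.+ suc i ≡ suc a ℕ.+ (suc a ℕ.+ suc (suc (a ℕ.* 2) ℕ.+ suc i))
          e₂ = ℕSolver.solve-∀
          e₃ : ∀ a → 4 ℕ.* suc a ℕ.+ suc (suc a) ≡ suc (5 ℕ.* suc a)
          e₃ = ℕSolver.solve-∀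
          e₄ : ∀ a → suc (5 ℕ.* suc a) ℕ.+ a ≡ 3 ℕ.* (2 ℕ.* suc a)
          e₄ = ℕSolver.solve-∀
        t₁ : T (suc a ℕ.+ 0) ≡ - c
        t₁ = trans (cong T (trans (ℕP.+-identityʳ (suc a)) a≡)) (trans (T-val b (divides 1 (e b)) (-1^ex 3)) (cong (λ z → - ι (z C b)) ex1≡))
          where
          e : ∀ b → b ℕ.+ b ≡ 1 ℕ.* (2 ℕ.* b)
          e = ℕSolver.solve-∀
        t₂ : T (suc a ℕ.+ suc (suc (a ℕ.* 2) ℕ.+ 0)) ≡ - c
        t₂ = trans (cong T (trans (e₀ a) (cong (3 ℕ.*_) a≡))) (trans (T-val (3 ℕ.* b) (divides 2 (e b)) (trans (cong ((- 1#) ^ᶠ_) (ℕP.*-comm 3 b)) (trans (^-* (- 1#) b 3) (trans (cong (_^ᶠ 3) (-1^ex 3)) (1^ 3)))))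
          (cong (λ z → - ι z) (trans (cong (_C (3 ℕ.* b)) ex1≡) (trans (nCk≡nC[n∸k] {3 ℕ.* b} {4 ℕ.* b} (ℕP.*-monoˡ-≤ b {3} {4} (s≤s (s≤s (s≤s z≤n))))) (cong ((4 ℕ.* b) C_) (ℕP.m+n∸n≡m b (3 ℕ.* b)))))))
          where
          e₀ : ∀ a → suc a ℕ.+ suc (suc (a ℕ.* 2) ℕ.+ 0) ≡ 3 ℕ.* suc a
          e₀ = ℕSolver.solve-∀
          e : ∀ b → b ℕ.+ 3 ℕ.* b ≡ 2 ℕ.* (2 ℕ.* b)
          e = ℕSolver.solve-∀

  -- In F the integer 4 J(1) becomes -2 C(4b, b), and b is `eighth v` for s = 2v, so `C-eighth-≢0`
  -- applies.
  p∤Jac : ¬ (p ∣ℕ.∣ ℤ.∣ Jac 3 1# ∣)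
  p∤Jac p∣J = *-≢0 2≢0 ιC≢0 (trans (solve 1 (λ c → (con (ℤ.+ 1) :+ con (ℤ.+ 1)) :* c := :- (:- (c :+ c))) refl c) (trans (cong -_ zero-sum) -0#≈0#))
    where
    open FSolver using (solve; _:=_; _:+_; _:*_; :-_; con)
    c : Carrier
    c = ι ((4 ℕ.* b) C b)
    2≢0 : 1# + 1# ≢ 0#
    2≢0 = InK-≢0 InK-2
    zero-sum : - (c + c) ≡ 0#
    zero-sum = trans (sym (trans expand ΣT)) (trans (S.ΣL-cong elements λ t → sym (trans (ιℤ-* (ρ t) (ρ (1# − (t ^ᶠ 4)))) (cong₂ _*_ (ιℤ-ρ t) (ιℤ-ρ (1# − (t ^ᶠ 4))))))
      (trans (sym (ιℤ-Σ elements (λ t → ρ t ℤ.* ρ (1# − (t ^ᶠ 4))))) (trans (cong ιℤ 4J) (trans (ιℤ-* (ℤ.+ 4) (Jac 3 1#)) (trans (*-congˡ (p∣⇒ιℤ≡0 {Jac 3 1#} p∣J)) (zeroʳ _))))))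
    ιC≢0 : c ≢ 0#
    ιC≢0 = subst (λ z → ι ((4 ℕ.* z) C z) ≢ 0#) (sym (proj₂ (proj₂ half))) (C-eighth-≢0 (proj₁ half))
      where
      half : ∃ λ v → (s ≡ v ℕ.* 2) × (b ≡ eighth v)
      half = halve s b (trans (sym suc-q₁) (cong suc (trans (sym (ex-2^ 3 3≤m)) (ℕP.*-comm b 8))))

-- Integer arithmetic: parity, p-adic valuation and the form a² + 2b².

parityℤ : ∀ z → (∃ λ h → z ≡ ℤ.+ 2 ℤ.* h) ⊎ (∃ λ h → z ≡ ℤ.1ℤ ℤ.+ ℤ.+ 2 ℤ.* h)
parityℤ (ℤ.+ n) = [ (λ (h , e) → inj₁ (ℤ.+ h , trans (cong (λ z → ℤ.+ z) (trans e (ℕP.*-comm h 2))) (ℤP.pos-* 2 h)))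
                  , (λ (h , e) → inj₂ (ℤ.+ h , trans (cong (λ z → ℤ.+ z) (trans e (cong suc (ℕP.*-comm h 2)))) (cong (λ z → ℤ.1ℤ ℤ.+ z) (ℤP.pos-* 2 h)))) ]′ (parity n)
parityℤ -[1+ n ] = [ (λ (h , e) → inj₂ (ℤ.- ℤ.+ suc h , trans (cong -[1+_] e) (odd h)))
                   , (λ (h , e) → inj₁ (ℤ.- ℤ.+ suc h , trans (cong -[1+_] e) (even h))) ]′ (parity n)
  where
  alg₁ : ∀ h → ℤ.- (ℤ.1ℤ ℤ.+ h ℤ.* ℤ.+ 2) ≡ ℤ.1ℤ ℤ.+ ℤ.+ 2 ℤ.* (ℤ.- (ℤ.1ℤ ℤ.+ h))
  alg₁ = solve-∀
  odd : ∀ h → -[1+ h ℕ.* 2 ] ≡ ℤ.1ℤ ℤ.+ ℤ.+ 2 ℤ.* (ℤ.- ℤ.+ suc h)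
  odd h = trans (cong (λ z → ℤ.- (ℤ.1ℤ ℤ.+ z)) (ℤP.pos-* h 2)) (alg₁ (ℤ.+ h))
  alg₂ : ∀ h → ℤ.- (ℤ.+ 2 ℤ.+ h ℤ.* ℤ.+ 2) ≡ ℤ.+ 2 ℤ.* (ℤ.- (ℤ.1ℤ ℤ.+ h))
  alg₂ = solve-∀
  even : ∀ h → -[1+ 1 ℕ.+ h ℕ.* 2 ] ≡ ℤ.+ 2 ℤ.* (ℤ.- ℤ.+ suc h)
  even h = trans (cong (λ z → ℤ.- (ℤ.+ 2 ℤ.+ z)) (ℤP.pos-* h 2)) (alg₂ (ℤ.+ h))

2≢4* : ∀ a → ℤ.+ 2 ≢ ℤ.+ 4 ℤ.* a
2≢4* a e = go ℤ.∣ a ∣ (trans (cong ℤ.∣_∣ e) (ℤP.abs-* (ℤ.+ 4) a))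
  where
  go : ∀ n → 2 ≡ 4 ℕ.* n → ⊥
  go zero ()
  go (suc n) e = absurd (trans e (ℕP.*-comm 4 (suc n)))
    where
    absurd : 2 ≡ 4 ℕ.+ n ℕ.* 4 → ⊥
    absurd ()

1≢4* : ∀ a → ℤ.1ℤ ≢ ℤ.+ 4 ℤ.* a
1≢4* a e = 2≢4* (ℤ.+ 2 ℤ.* a) (trans (cong (ℤ.+ 2 ℤ.*_) e) (alg a))
  where
  alg : ∀ a → ℤ.+ 2 ℤ.* (ℤ.+ 4 ℤ.* a) ≡ ℤ.+ 4 ℤ.* (ℤ.+ 2 ℤ.* a)
  alg = solve-∀

-- x² ≡ 0 or 1 modulo 4, so x² + 2y² ≡ 1 forces y to be even.
y-even : ∀ x y c → x ℤ.* x ℤ.+ ℤ.+ 2 ℤ.* y ℤ.* y ≡ ℤ.1ℤ ℤ.+ ℤ.+ 4 ℤ.* c → ∃ λ h → y ≡ ℤ.+ 2 ℤ.* h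
y-even x y c e = [ id , (λ (h , y≡) → ⊥-elim ([ (λ (a , x≡) → 1≢4* (ℤ.- (a ℤ.* a ℤ.+ ℤ.+ 2 ℤ.* (h ℤ.* h) ℤ.+ ℤ.+ 2 ℤ.* h ℤ.- c)) (alg₁ a h c (subst₂ (λ x y → x ℤ.* x ℤ.+ ℤ.+ 2 ℤ.* y ℤ.* y ≡ ℤ.1ℤ ℤ.+ ℤ.+ 4 ℤ.* c) x≡ y≡ e)))
                                              , (λ (a , x≡) → 2≢4* (ℤ.- (a ℤ.* a ℤ.+ a ℤ.+ ℤ.+ 2 ℤ.* (h ℤ.* h) ℤ.+ ℤ.+ 2 ℤ.* h ℤ.- c)) (alg₂ a h c (subst₂ (λ x y → x ℤ.* x ℤ.+ ℤ.+ 2 ℤ.* y ℤ.* y ≡ ℤ.1ℤ ℤ.+ ℤ.+ 4 ℤ.* c) x≡ y≡ e))) ]′ (parityℤ x))) ]′ (parityℤ y)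
  where
  move : ∀ {l r} d → l ≡ r → d ≡ (l ℤ.- r) ℤ.+ d
  move {l} d refl = alg l d
    where
    alg : ∀ l d → d ≡ (l ℤ.- l) ℤ.+ d
    alg = solve-∀
  lem₁ : ∀ a h c → ((ℤ.+ 2 ℤ.* a) ℤ.* (ℤ.+ 2 ℤ.* a) ℤ.+ ℤ.+ 2 ℤ.* (ℤ.1ℤ ℤ.+ ℤ.+ 2 ℤ.* h) ℤ.* (ℤ.1ℤ ℤ.+ ℤ.+ 2 ℤ.* h) ℤ.- (ℤ.1ℤ ℤ.+ ℤ.+ 4 ℤ.* c)) ℤ.+ (ℤ.- ℤ.1ℤ) ≡
    ℤ.+ 4 ℤ.* (a ℤ.* a ℤ.+ ℤ.+ 2 ℤ.* (h ℤ.* h) ℤ.+ ℤ.+ 2 ℤ.* h ℤ.- c)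
  lem₁ = solve-∀
  neg4 : ∀ a → ℤ.- (ℤ.+ 4 ℤ.* a) ≡ ℤ.+ 4 ℤ.* (ℤ.- a)
  neg4 = solve-∀
  alg₁ : ∀ a h c → (ℤ.+ 2 ℤ.* a) ℤ.* (ℤ.+ 2 ℤ.* a) ℤ.+ ℤ.+ 2 ℤ.* (ℤ.1ℤ ℤ.+ ℤ.+ 2 ℤ.* h) ℤ.* (ℤ.1ℤ ℤ.+ ℤ.+ 2 ℤ.* h) ≡ ℤ.1ℤ ℤ.+ ℤ.+ 4 ℤ.* c →
    ℤ.1ℤ ≡ ℤ.+ 4 ℤ.* (ℤ.- (a ℤ.* a ℤ.+ ℤ.+ 2 ℤ.* (h ℤ.* h) ℤ.+ ℤ.+ 2 ℤ.* h ℤ.- c))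
  alg₁ a h c e = trans (cong ℤ.-_ (trans (move (ℤ.- ℤ.1ℤ) e) (lem₁ a h c))) (neg4 _)
  lem₂ : ∀ a h c → ((ℤ.1ℤ ℤ.+ ℤ.+ 2 ℤ.* a) ℤ.* (ℤ.1ℤ ℤ.+ ℤ.+ 2 ℤ.* a) ℤ.+ ℤ.+ 2 ℤ.* (ℤ.1ℤ ℤ.+ ℤ.+ 2 ℤ.* h) ℤ.* (ℤ.1ℤ ℤ.+ ℤ.+ 2 ℤ.* h) ℤ.- (ℤ.1ℤ ℤ.+ ℤ.+ 4 ℤ.* c)) ℤ.+ (ℤ.- ℤ.+ 2) ≡
    ℤ.+ 4 ℤ.* (a ℤ.* a ℤ.+ a ℤ.+ ℤ.+ 2 ℤ.* (h ℤ.* h) ℤ.+ ℤ.+ 2 ℤ.* h ℤ.- c)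
  lem₂ = solve-∀
  alg₂ : ∀ a h c → (ℤ.1ℤ ℤ.+ ℤ.+ 2 ℤ.* a) ℤ.* (ℤ.1ℤ ℤ.+ ℤ.+ 2 ℤ.* a) ℤ.+ ℤ.+ 2 ℤ.* (ℤ.1ℤ ℤ.+ ℤ.+ 2 ℤ.* h) ℤ.* (ℤ.1ℤ ℤ.+ ℤ.+ 2 ℤ.* h) ≡ ℤ.1ℤ ℤ.+ ℤ.+ 4 ℤ.* c →
    ℤ.+ 2 ≡ ℤ.+ 4 ℤ.* (ℤ.- (a ℤ.* a ℤ.+ a ℤ.+ ℤ.+ 2 ℤ.* (h ℤ.* h) ℤ.+ ℤ.+ 2 ℤ.* h ℤ.- c))
  alg₂ a h c e = trans (cong ℤ.-_ (trans (move (ℤ.- ℤ.+ 2) e) (lem₂ a h c))) (neg4 _)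

square-≡ : ∀ a b → a ℤ.* a ≡ b ℤ.* b → a ≡ b ⊎ a ≡ ℤ.- b
square-≡ a b e = [ (λ z → inj₁ (ℤP.i-j≡0⇒i≡j a b z)) , (λ z → inj₂ (ℤP.i-j≡0⇒i≡j a (ℤ.- b) (trans (cong (λ w → a ℤ.+ w) (ℤP.neg-involutive b)) z))) ]′
  (ℤP.i*j≡0⇒i≡0∨j≡0 (a ℤ.- b) (trans (alg a b) (ℤP.i≡j⇒i-j≡0 e)))
  where
  alg : ∀ a b → (a ℤ.- b) ℤ.* (a ℤ.+ b) ≡ a ℤ.* a ℤ.- b ℤ.* b
  alg = solve-∀

half^-exact : ∀ k a → half^ k (a ℕ.* 2 ℕ.^ k) ≡ a
half^-exact zero a = ℕP.*-identityʳ a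
half^-exact (suc k) a = trans (cong (half^ k) (trans (cong ℕ.⌊_/2⌋ (lem a (2 ℕ.^ k))) (sym (ℕP.n≡⌊n+n/2⌋ (a ℕ.* 2 ℕ.^ k))))) (half^-exact k a)
  where
  lem : ∀ a x → a ℕ.* (2 ℕ.* x) ≡ a ℕ.* x ℕ.+ a ℕ.* x
  lem = ℕSolver.solve-∀

module Valuation (p : ℕ) (prime : Prime p) (p∤2 : ¬ (p ∣ℕ.∣ 2)) where
  infix 4 p∣_
  p∣_ : ℤ → Set
  p∣ x = ∃ λ k → x ≡ ℤ.+ p ℤ.* k

  from-ℕ : ∀ x → p ∣ℕ.∣ ℤ.∣ x ∣ → p∣ x
  from-ℕ (ℤ.+ n) (divides k e) = ℤ.+ k , trans (cong (λ z → ℤ.+ z) (trans e (ℕP.*-comm k p))) (ℤP.pos-* p k)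
  from-ℕ -[1+ n ] (divides k e) = ℤ.- ℤ.+ k , trans (cong (λ z → ℤ.- (ℤ.+ z)) (trans e (ℕP.*-comm k p))) (trans (cong ℤ.-_ (ℤP.pos-* p k)) (ℤP.neg-distribʳ-* (ℤ.+ p) (ℤ.+ k)))

  to-ℕ : ∀ {x} → p∣ x → p ∣ℕ.∣ ℤ.∣ x ∣
  to-ℕ (k , refl) = divides ℤ.∣ k ∣ (trans (ℤP.abs-* (ℤ.+ p) k) (ℕP.*-comm p ℤ.∣ k ∣))

  euclid : ∀ x y → p∣ x ℤ.* y → p∣ x ⊎ p∣ y
  euclid x y h = [ (λ d → inj₁ (from-ℕ x d)) , (λ d → inj₂ (from-ℕ y d)) ]′
    (euclidsLemma ℤ.∣ x ∣ ℤ.∣ y ∣ prime (subst (p ∣ℕ.∣_) (ℤP.abs-* x y) (to-ℕ h)))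

  p∤2ℤ : ¬ (p∣ ℤ.+ 2)
  p∤2ℤ h = p∤2 (to-ℕ h)

  p∣+ : ∀ {x y} → p∣ x → p∣ y → p∣ x ℤ.+ y
  p∣+ (a , refl) (b , refl) = a ℤ.+ b , sym (ℤP.*-distribˡ-+ (ℤ.+ p) a b)

  p∣*ˡ : ∀ x {y} → p∣ y → p∣ x ℤ.* y
  p∣*ˡ x (b , refl) = x ℤ.* b , alg x (ℤ.+ p) b
    where
    alg : ∀ x p b → x ℤ.* (p ℤ.* b) ≡ p ℤ.* (x ℤ.* b)
    alg = solve-∀

  instance
    p-nonZero : ℕ.NonZero p
    p-nonZero = prime⇒nonZero prime

  pw : ℕ → ℤ
  pw e = ℤ.+ (p ℕ.^ e)

  pw-suc : ∀ e → pw (suc e) ≡ ℤ.+ p ℤ.* pw e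
  pw-suc e = ℤP.pos-* p (p ℕ.^ e)

  pw-+ : ∀ a b → pw (a ℕ.+ b) ≡ pw a ℤ.* pw b
  pw-+ a b = trans (cong (λ z → ℤ.+ z) (ℕP.^-distribˡ-+-* p a b)) (ℤP.pos-* (p ℕ.^ a) (p ℕ.^ b))

  pw-cancel : ∀ e {a b} → pw e ℤ.* a ≡ pw e ℤ.* b → a ≡ b
  pw-cancel e {a} {b} = ℤP.*-cancelˡ-≡ (pw e) a b {{ℕP.m^n≢0 p e}}

  p∣pw : ∀ e → 0 ℕ.< e → p∣ pw e
  p∣pw (suc e) _ = pw e , pw-suc e

  -- As p is an odd prime, a factor p on the right divides x; then p² cancels and e drops by one.
  extract : ∀ e x c → ℤ.+ 2 ℤ.* x ℤ.* x ≡ pw (e ℕ.+ e) ℤ.* c → ∃ λ a → (x ≡ pw e ℤ.* a) × (ℤ.+ 2 ℤ.* a ℤ.* a ≡ c)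
  extract zero x c h = x , sym (ℤP.*-identityˡ x) , trans h (ℤP.*-identityˡ c)
  extract (suc e) x c h = proj₁ rec , trans x≡ (trans (cong (ℤ.+ p ℤ.*_) (proj₁ (proj₂ rec))) (trans (sym (ℤP.*-assoc (ℤ.+ p) (pw e) _)) (cong (ℤ._* proj₁ rec) (sym (pw-suc e))))) , proj₂ (proj₂ rec)
    where
    h′ : ℤ.+ 2 ℤ.* x ℤ.* x ≡ ℤ.+ p ℤ.* (ℤ.+ p ℤ.* (pw (e ℕ.+ e) ℤ.* c))
    h′ = trans h (trans (cong (ℤ._* c) (trans (cong pw (cong suc (ℕP.+-suc e e))) (trans (pw-suc (suc (e ℕ.+ e))) (cong (ℤ.+ p ℤ.*_) (pw-suc (e ℕ.+ e)))))) (alg (ℤ.+ p) (pw (e ℕ.+ e)) c))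
      where
      alg : ∀ p w c → p ℤ.* (p ℤ.* w) ℤ.* c ≡ p ℤ.* (p ℤ.* (w ℤ.* c))
      alg = solve-∀
    p∣x : p∣ x
    p∣x = [ (λ d → [ (λ z → ⊥-elim (p∤2ℤ z)) , id ]′ (euclid (ℤ.+ 2) x d)) , id ]′ (euclid (ℤ.+ 2 ℤ.* x) x (ℤ.+ p ℤ.* (pw (e ℕ.+ e) ℤ.* c) , h′))
    x′ : ℤ
    x′ = proj₁ p∣x
    x≡ : x ≡ ℤ.+ p ℤ.* x′
    x≡ = proj₂ p∣x
    alg₂ : ∀ p x → ℤ.+ 2 ℤ.* (p ℤ.* x) ℤ.* (p ℤ.* x) ≡ p ℤ.* (p ℤ.* (ℤ.+ 2 ℤ.* x ℤ.* x))
    alg₂ = solve-∀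
    cancel : ∀ {a b} → ℤ.+ p ℤ.* a ≡ ℤ.+ p ℤ.* b → a ≡ b
    cancel {a} {b} = ℤP.*-cancelˡ-≡ (ℤ.+ p) a b
    rec : ∃ λ a → (x′ ≡ pw e ℤ.* a) × (ℤ.+ 2 ℤ.* a ℤ.* a ≡ c)
    rec = extract e x′ c (cancel (cancel (trans (sym (alg₂ (ℤ.+ p) x′)) (trans (sym (cong (λ z → ℤ.+ 2 ℤ.* z ℤ.* z) x≡)) h′))))

  coprime-pw : ∀ r u v k → ¬ (p∣ u) → u ℤ.* v ≡ pw r ℤ.* k → ∃ λ c → v ≡ pw r ℤ.* c
  coprime-pw zero u v k _ _ = v , sym (ℤP.*-identityˡ v)
  coprime-pw (suc r) u v k p∤u h = proj₁ rec , trans v≡ (trans (cong (ℤ.+ p ℤ.*_) (proj₂ rec)) (trans (sym (ℤP.*-assoc (ℤ.+ p) (pw r) _)) (cong (ℤ._* proj₁ rec) (sym (pw-suc r)))))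
    where
    h′ : u ℤ.* v ≡ ℤ.+ p ℤ.* (pw r ℤ.* k)
    h′ = trans h (trans (cong (ℤ._* k) (pw-suc r)) (ℤP.*-assoc (ℤ.+ p) (pw r) k))
    p∣v : p∣ v
    p∣v = [ (λ d → ⊥-elim (p∤u d)) , id ]′ (euclid u v (pw r ℤ.* k , h′))
    v′ : ℤ
    v′ = proj₁ p∣v
    v≡ : v ≡ ℤ.+ p ℤ.* v′
    v≡ = proj₂ p∣v
    alg : ∀ u p v → p ℤ.* (u ℤ.* v) ≡ u ℤ.* (p ℤ.* v)
    alg = solve-∀
    rec : ∃ λ c → v′ ≡ pw r ℤ.* c
    rec = coprime-pw r u v′ k p∤u (ℤP.*-cancelˡ-≡ (ℤ.+ p) _ _ (trans (alg u (ℤ.+ p) v′) (trans (sym (cong (u ℤ.*_) v≡)) h′)))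

  private
    square≥0 : ∀ z → ℤ.0ℤ ℤ.≤ z ℤ.* z
    square≥0 (ℤ.+ n) = subst (ℤ.0ℤ ℤ.≤_) (ℤP.pos-* n n) (ℤ.+≤+ z≤n)
    square≥0 -[1+ n ] = ℤ.+≤+ z≤n

    square≥1 : ∀ z → z ≢ ℤ.0ℤ → ℤ.1ℤ ℤ.≤ z ℤ.* z
    square≥1 (ℤ.+ zero) z≢0 = ⊥-elim (z≢0 refl)
    square≥1 (ℤ.+ suc n) _ = ℤ.+≤+ (s≤s z≤n)
    square≥1 -[1+ n ] _ = ℤ.+≤+ (s≤s z≤n)

  -- If v = aB − Ab (or aB + Ab) is divisible by N = a² + 2b² = A² + 2B², then v² < N² by the
  -- multiplicativity of the form, so v = 0.
  small-multiple : ∀ N u v c → 0 ℕ.< N → (ℤ.+ N) ℤ.* (ℤ.+ N) ≡ u ℤ.* u ℤ.+ ℤ.+ 2 ℤ.* v ℤ.* v → v ≡ (ℤ.+ N) ℤ.* c → v ≡ ℤ.0ℤ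
  small-multiple N u v c 0<N h v≡ with c ℤ.≟ ℤ.0ℤ
  ... | yes refl = trans v≡ (ℤP.*-zeroʳ (ℤ.+ N))
  ... | no c≢0 = ⊥-elim (ℤP.<⇒≱ N²<2N² (ℤP.≤-trans 2N²≤2v² (ℤP.≤-trans 2v²≤ (ℤP.≤-reflexive (sym h)))))
    where
    N² : ℤ
    N² = (ℤ.+ N) ℤ.* (ℤ.+ N)
    N²>0 : ℤ.0ℤ ℤ.< N²
    N²>0 = ℤP.<-≤-trans (ℤ.+<+ (s≤s z≤n)) (square≥1 (ℤ.+ N) λ e → ℕP.<⇒≢ 0<N (sym (ℤP.+-injective e)))
    N²<2N² : N² ℤ.< ℤ.+ 2 ℤ.* N²
    N²<2N² = subst₂ ℤ._<_ (ℤP.+-identityʳ N²) (alg N²) (ℤP.+-monoʳ-< N² N²>0)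
      where
      alg : ∀ x → x ℤ.+ x ≡ ℤ.+ 2 ℤ.* x
      alg = solve-∀
    N²≤v² : N² ℤ.≤ v ℤ.* v
    N²≤v² = subst₂ ℤ._≤_ (ℤP.*-identityʳ N²) (trans (alg (ℤ.+ N) c) (sym (cong (λ z → z ℤ.* z) v≡))) (ℤP.*-monoˡ-≤-nonNeg N² {{ℤ.nonNegative (ℤP.<⇒≤ N²>0)}} (square≥1 c c≢0))
      where
      alg : ∀ n c → (n ℤ.* n) ℤ.* (c ℤ.* c) ≡ (n ℤ.* c) ℤ.* (n ℤ.* c)
      alg = solve-∀
    2N²≤2v² : ℤ.+ 2 ℤ.* N² ℤ.≤ ℤ.+ 2 ℤ.* (v ℤ.* v)
    2N²≤2v² = ℤP.*-monoˡ-≤-nonNeg (ℤ.+ 2) N²≤v²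
    2v²≤ : ℤ.+ 2 ℤ.* (v ℤ.* v) ℤ.≤ u ℤ.* u ℤ.+ ℤ.+ 2 ℤ.* v ℤ.* v
    2v²≤ = subst₂ ℤ._≤_ (ℤP.+-identityˡ _) (cong (λ z → u ℤ.* u ℤ.+ z) (sym (ℤP.*-assoc (ℤ.+ 2) v v))) (ℤP.+-monoˡ-≤ (ℤ.+ 2 ℤ.* (v ℤ.* v)) (square≥0 u))

  -- The product of aB - Ab and aB + Ab is a multiple of p^r. Their sum 2aB is prime to p, so p^r
  -- divides one of them, and `small-multiple` makes that one 0. Either way b² = B².
  unique-rep : ∀ r → 0 ℕ.< r → ∀ a b A B → a ℤ.* a ℤ.+ ℤ.+ 2 ℤ.* b ℤ.* b ≡ pw r → A ℤ.* A ℤ.+ ℤ.+ 2 ℤ.* B ℤ.* B ≡ pw r →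
    ¬ (p∣ a) → ¬ (p∣ A) → (a ℤ.* a ≡ A ℤ.* A) × (b ℤ.* b ≡ B ℤ.* B)
  unique-rep r 0<r a b A B rep Rep p∤a p∤A = a²≡A² , b²≡B²
    where
    N : ℤ
    N = pw r
    U V : ℤ
    U = a ℤ.* B ℤ.- A ℤ.* b
    V = a ℤ.* B ℤ.+ A ℤ.* b
    alg-UV : ∀ a b A B → (a ℤ.* B ℤ.- A ℤ.* b) ℤ.* (a ℤ.* B ℤ.+ A ℤ.* b) ≡
      (a ℤ.* a ℤ.+ ℤ.+ 2 ℤ.* b ℤ.* b) ℤ.* (B ℤ.* B) ℤ.- (A ℤ.* A ℤ.+ ℤ.+ 2 ℤ.* B ℤ.* B) ℤ.* (b ℤ.* b)
    alg-UV = solve-∀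
    factor : ∀ n x y → n ℤ.* x ℤ.- n ℤ.* y ≡ n ℤ.* (x ℤ.- y)
    factor = solve-∀
    UV : U ℤ.* V ≡ N ℤ.* (B ℤ.* B ℤ.- b ℤ.* b)
    UV = trans (alg-UV a b A B) (trans (cong₂ (λ x y → x ℤ.* (B ℤ.* B) ℤ.- y ℤ.* (b ℤ.* b)) rep Rep) (factor N (B ℤ.* B) (b ℤ.* b)))
    norm-U : N ℤ.* N ≡ (a ℤ.* A ℤ.+ ℤ.+ 2 ℤ.* b ℤ.* B) ℤ.* (a ℤ.* A ℤ.+ ℤ.+ 2 ℤ.* b ℤ.* B) ℤ.+ ℤ.+ 2 ℤ.* U ℤ.* U
    norm-U = trans (sym (cong₂ ℤ._*_ rep Rep)) (alg a b A B)
      where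
      alg : ∀ a b A B → (a ℤ.* a ℤ.+ ℤ.+ 2 ℤ.* b ℤ.* b) ℤ.* (A ℤ.* A ℤ.+ ℤ.+ 2 ℤ.* B ℤ.* B) ≡
        (a ℤ.* A ℤ.+ ℤ.+ 2 ℤ.* b ℤ.* B) ℤ.* (a ℤ.* A ℤ.+ ℤ.+ 2 ℤ.* b ℤ.* B) ℤ.+ ℤ.+ 2 ℤ.* (a ℤ.* B ℤ.- A ℤ.* b) ℤ.* (a ℤ.* B ℤ.- A ℤ.* b)
      alg = solve-∀
    norm-V : N ℤ.* N ≡ (a ℤ.* A ℤ.- ℤ.+ 2 ℤ.* b ℤ.* B) ℤ.* (a ℤ.* A ℤ.- ℤ.+ 2 ℤ.* b ℤ.* B) ℤ.+ ℤ.+ 2 ℤ.* V ℤ.* V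
    norm-V = trans (sym (cong₂ ℤ._*_ rep Rep)) (alg a b A B)
      where
      alg : ∀ a b A B → (a ℤ.* a ℤ.+ ℤ.+ 2 ℤ.* b ℤ.* b) ℤ.* (A ℤ.* A ℤ.+ ℤ.+ 2 ℤ.* B ℤ.* B) ≡
        (a ℤ.* A ℤ.- ℤ.+ 2 ℤ.* b ℤ.* B) ℤ.* (a ℤ.* A ℤ.- ℤ.+ 2 ℤ.* b ℤ.* B) ℤ.+ ℤ.+ 2 ℤ.* (a ℤ.* B ℤ.+ A ℤ.* b) ℤ.* (a ℤ.* B ℤ.+ A ℤ.* b)
      alg = solve-∀
    p∤B : ¬ (p∣ B)
    p∤B d = p∤A ([ id , id ]′ (euclid A A (subst p∣_ (trans (cong (λ z → z ℤ.+ (ℤ.- (ℤ.+ 2 ℤ.* B)) ℤ.* B) (sym Rep)) (alg A B)) (p∣+ (p∣pw r 0<r) (p∣*ˡ (ℤ.- (ℤ.+ 2 ℤ.* B)) d)))))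
      where
      alg : ∀ A B → A ℤ.* A ℤ.+ ℤ.+ 2 ℤ.* B ℤ.* B ℤ.+ (ℤ.- (ℤ.+ 2 ℤ.* B)) ℤ.* B ≡ A ℤ.* A
      alg = solve-∀
    not-both : p∣ U → p∣ V → ⊥
    not-both dU dV = [ (λ d → [ p∤2ℤ , p∤a ]′ (euclid (ℤ.+ 2) a d)) , p∤B ]′ (euclid (ℤ.+ 2 ℤ.* a) B (subst p∣_ (alg a b A B) (p∣+ dU dV)))
      where
      alg : ∀ a b A B → (a ℤ.* B ℤ.- A ℤ.* b) ℤ.+ (a ℤ.* B ℤ.+ A ℤ.* b) ≡ ℤ.+ 2 ℤ.* a ℤ.* B
      alg = solve-∀
    0<N : 0 ℕ.< p ℕ.^ r
    0<N = ℕP.m^n>0 p r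
    U-or-V : (U ≡ ℤ.0ℤ) ⊎ (V ≡ ℤ.0ℤ)
    U-or-V with p ∣ℕ.∣? ℤ.∣ U ∣
    ... | no p∤U = inj₂ (small-multiple (p ℕ.^ r) (a ℤ.* A ℤ.- ℤ.+ 2 ℤ.* b ℤ.* B) V (proj₁ m) 0<N norm-V (proj₂ m))
      where
      m : ∃ λ c → V ≡ pw r ℤ.* c
      m = coprime-pw r U V (B ℤ.* B ℤ.- b ℤ.* b) (λ d → p∤U (to-ℕ d)) UV
    ... | yes p∣U = inj₁ (small-multiple (p ℕ.^ r) (a ℤ.* A ℤ.+ ℤ.+ 2 ℤ.* b ℤ.* B) U (proj₁ m) 0<N norm-U (proj₂ m))
      where
      m : ∃ λ c → U ≡ pw r ℤ.* c
      m = coprime-pw r V U (B ℤ.* B ℤ.- b ℤ.* b) (not-both (from-ℕ U p∣U)) (trans (ℤP.*-comm V U) UV)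
    UV≡0 : U ℤ.* V ≡ ℤ.0ℤ
    UV≡0 = [ (λ e → trans (cong (ℤ._* V) e) (ℤP.*-zeroˡ V)) , (λ e → trans (cong (U ℤ.*_) e) (ℤP.*-zeroʳ U)) ]′ U-or-V
    b²≡B² : b ℤ.* b ≡ B ℤ.* B
    b²≡B² = sym (ℤP.i-j≡0⇒i≡j (B ℤ.* B) (b ℤ.* b) (pw-cancel r (trans (sym UV) (trans UV≡0 (sym (ℤP.*-zeroʳ N))))))
    a²≡A² : a ℤ.* a ≡ A ℤ.* A
    a²≡A² = trans (alg a b) (trans (cong₂ (λ x y → x ℤ.- ℤ.+ 2 ℤ.* y) (trans rep (sym Rep)) b²≡B²) (sym (alg A B)))
      where
      alg : ∀ a b → a ℤ.* a ≡ a ℤ.* a ℤ.+ ℤ.+ 2 ℤ.* b ℤ.* b ℤ.- ℤ.+ 2 ℤ.* (b ℤ.* b)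
      alg = solve-∀

-- Evaluation of the periods: residues modulo 4, valuations and signs.

module Evaluation (σ : Setting) where
  open ModP σ public
  open ClassFn

  2^ : ℕ → ℤ
  2^ j = ℤ.+ (2 ℕ.^ j)

  2^-suc : ∀ j → 2^ (suc j) ≡ ℤ.+ 2 ℤ.* 2^ j
  2^-suc j = ℤP.pos-* 2 (2 ℕ.^ j)

  -- The reduced Gauss period of order 2ʲ: 1 + 2ʲ η, with η the sum of a nontrivial additive
  -- character over g⁻¹ times the subgroup of index 2ʲ.
  period : ℕ → Carrier → ℤ
  period j g = ℤ.1ℤ ℤ.+ 2^ j ℤ.* hat (λ x → one j (g * x))

  period-0 : ∀ {g} → g ≢ 0# → period 0 g ≡ ℤ.0ℤ
  period-0 {g} g≢0 = cong (λ z → ℤ.1ℤ ℤ.+ ℤ.1ℤ ℤ.* z) (trans (hat-cong pt) (trans (hat-+ (λ _ → ℤ.1ℤ) (λ x → ℤ.-1ℤ ℤ.* 𝟙 (x ≟ 0#)))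
    (cong₂ ℤ._+_ hat-1 (trans (hat-* ℤ.-1ℤ (λ x → 𝟙 (x ≟ 0#))) (cong (ℤ.-1ℤ ℤ.*_) hat-δ)))))
    where
    pt : ∀ x → one 0 (g * x) ≡ ℤ.1ℤ ℤ.+ ℤ.-1ℤ ℤ.* 𝟙 (x ≟ 0#)
    pt x with x ≟ 0#
    ... | yes refl = trans (cong (one 0) (zeroʳ g)) (one-0 0)
    ... | no x≢0 = 𝟙-yes (((g * x) ^ᶠ ex 0) ≟ 1#) (trans (cong ((g * x) ^ᶠ_) ex0) (x^q₁ (*-≢0 g≢0 x≢0)))

  period-suc : ∀ j g → suc j ℕ.≤ m → period (suc j) g ≡ period j g ℤ.+ 2^ j ℤ.* d (suc j) g
  period-suc j g j<m = begin
    ℤ.1ℤ ℤ.+ 2^ (suc j) ℤ.* hat (λ x → one (suc j) (g * x)) ≡⟨ cong (λ z → ℤ.1ℤ ℤ.+ z ℤ.* hat (λ x → one (suc j) (g * x))) (2^-suc j) ⟩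
    ℤ.1ℤ ℤ.+ ℤ.+ 2 ℤ.* 2^ j ℤ.* hat (λ x → one (suc j) (g * x)) ≡⟨ alg₁ (2^ j) (hat (λ x → one (suc j) (g * x))) ⟩
    ℤ.1ℤ ℤ.+ 2^ j ℤ.* (ℤ.+ 2 ℤ.* hat (λ x → one (suc j) (g * x))) ≡⟨ cong (λ z → ℤ.1ℤ ℤ.+ 2^ j ℤ.* z) (trans (sym (hat-* (ℤ.+ 2) (λ x → one (suc j) (g * x)))) (trans (hat-cong λ x → one-rec j (g * x) j<m) (hat-+ (λ x → one j (g * x)) (λ x → ε (suc j) (g * x))))) ⟩
    ℤ.1ℤ ℤ.+ 2^ j ℤ.* (hat (λ x → one j (g * x)) ℤ.+ d (suc j) g) ≡⟨ alg₂ (2^ j) (hat (λ x → one j (g * x))) (d (suc j) g) ⟩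
    period j g ℤ.+ 2^ j ℤ.* d (suc j) g ∎
    where
    open ≡-Reasoning
    alg₁ : ∀ a h → ℤ.1ℤ ℤ.+ ℤ.+ 2 ℤ.* a ℤ.* h ≡ ℤ.1ℤ ℤ.+ a ℤ.* (ℤ.+ 2 ℤ.* h)
    alg₁ = solve-∀
    alg₂ : ∀ a h d → ℤ.1ℤ ℤ.+ a ℤ.* (h ℤ.+ d) ≡ ℤ.1ℤ ℤ.+ a ℤ.* h ℤ.+ a ℤ.* d
    alg₂ = solve-∀

  period-same : ∀ j u g → u ^ᶠ ex j ≡ 1# → period j (u * g) ≡ period j g
  period-same j u g e = cong (λ z → ℤ.1ℤ ℤ.+ 2^ j ℤ.* z) (hat-cong λ x → cong (λ z → 𝟙 (z ≟ 1#))
    (trans (cong (_^ᶠ ex j) (*-assoc u g x)) (trans (*-^ u (g * x) (ex j)) (trans (*-congʳ e) (*-identityˡ _)))))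

  period-same-1 : ∀ j u → u ^ᶠ ex j ≡ 1# → period j u ≡ period j 1#
  period-same-1 j u e = trans (cong (period j) (sym (*-identityʳ u))) (period-same j u 1# e)

  xv : ℕ → ℤ
  xv j = d j 1#

  yv : ℕ → ℤ
  yv n = d (3 ℕ.+ n) (γ ^ᶠ (2 ℕ.^ n ℕ.* 1))

  private
    i₀ : ℕ
    i₀ = m ∸ 3

    m≡ : 3 ℕ.+ i₀ ≡ m
    m≡ = ℕP.m+[n∸m]≡n 3≤m

    c₀ : ℕ
    c₀ = proj₁ f-even

    p^s≡ : p ℕ.^ s ≡ 1 ℕ.+ 2 ℕ.^ (4 ℕ.+ i₀) ℕ.* c₀
    p^s≡ = trans (sym suc-q₁) (cong suc (trans q₁≡f*2^m (trans (cong₂ (λ a b → a ℕ.* 2 ℕ.^ b) (proj₂ f-even) (sym m≡)) (lem c₀ (2 ℕ.^ (3 ℕ.+ i₀))))))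
      where
      lem : ∀ c x → c ℕ.* 2 ℕ.* x ≡ 2 ℕ.* x ℕ.* c
      lem = ℕSolver.solve-∀

  abstract
    -- Since (q-1)/2^m is still even, q is 1 modulo 2^(m+1); passing to the square root costs one
    -- power of 2.
    half-s : ∃ λ v → (s ≡ v ℕ.* 2) × (∃ λ c′ → p ℕ.^ v ≡ 1 ℕ.+ 2 ℕ.^ m ℕ.* c′)
    half-s = proj₁ h , proj₁ (proj₂ h) , proj₁ (proj₂ (proj₂ h)) , trans (proj₂ (proj₂ (proj₂ h))) (cong (λ z → 1 ℕ.+ 2 ℕ.^ z ℕ.* proj₁ (proj₂ (proj₂ h))) m≡)
      where
      h : ∃ λ v → (s ≡ v ℕ.* 2) × (∃ λ c′ → p ℕ.^ v ≡ 1 ℕ.+ 2 ℕ.^ (3 ℕ.+ i₀) ℕ.* c′)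
      h = halve-16 i₀ s c₀ p^s≡

  v : ℕ
  v = proj₁ half-s

  abstract
    s-factor : ∃ λ u → s ≡ u ℕ.* 2 ℕ.^ (2 ℕ.+ i₀)
    s-factor = 2-power∣exponent (suc i₀) s c₀ p^s≡

  u : ℕ
  u = proj₁ s-factor

  s≡u : s ≡ u ℕ.* 2 ℕ.^ (2 ℕ.+ i₀)
  s≡u = proj₂ s-factor

  rt : ℤ
  rt = ℤ.+ (p ℕ.^ v)

  rt² : rt ℤ.* rt ≡ Q
  rt² = trans (sym (ℤP.pos-* (p ℕ.^ v) (p ℕ.^ v))) (cong (λ z → ℤ.+ z) (trans (sym (^2 (p ℕ.^ v))) (trans (ℕP.^-*-assoc p v 2) (trans (cong (p ℕ.^_) (sym (proj₁ (proj₂ half-s)))) (sym suc-q₁)))))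

  rt≡1+4 : ∃ λ c → rt ≡ ℤ.1ℤ ℤ.+ ℤ.+ 4 ℤ.* c
  rt≡1+4 = ℤ.+ (2 ℕ.* 2 ℕ.^ i₀ ℕ.* c′) , trans (cong (λ z → ℤ.+ z) (trans (proj₂ (proj₂ (proj₂ half-s))) (trans (cong (λ z → 1 ℕ.+ 2 ℕ.^ z ℕ.* c′) (sym m≡)) (lem (2 ℕ.^ i₀) c′)))) (cong (λ z → ℤ.1ℤ ℤ.+ z) (ℤP.pos-* 4 (2 ℕ.* 2 ℕ.^ i₀ ℕ.* c′)))
    where
    c′ : ℕ
    c′ = proj₁ (proj₂ (proj₂ half-s))
    lem : ∀ x c → 1 ℕ.+ 2 ℕ.* (2 ℕ.* (2 ℕ.* x)) ℕ.* c ≡ 1 ℕ.+ 4 ℕ.* (2 ℕ.* x ℕ.* c)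
    lem = ℕSolver.solve-∀

  Q≡1+4 : ∃ λ c → Q ≡ ℤ.1ℤ ℤ.+ ℤ.+ 4 ℤ.* c
  Q≡1+4 = ℤ.+ 2 ℤ.* c₁ ℤ.+ ℤ.+ 4 ℤ.* c₁ ℤ.* c₁ , trans (sym rt²) (trans (cong (λ z → z ℤ.* z) (proj₂ rt≡1+4)) (alg c₁))
    where
    c₁ : ℤ
    c₁ = proj₁ rt≡1+4
    alg : ∀ c → (ℤ.1ℤ ℤ.+ ℤ.+ 4 ℤ.* c) ℤ.* (ℤ.1ℤ ℤ.+ ℤ.+ 4 ℤ.* c) ≡ ℤ.1ℤ ℤ.+ ℤ.+ 4 ℤ.* (ℤ.+ 2 ℤ.* c ℤ.+ ℤ.+ 4 ℤ.* c ℤ.* c)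
    alg = solve-∀

  yv-even : ∀ n → 3 ℕ.+ n ℕ.≤ m → ∃ λ h → yv n ≡ ℤ.+ 2 ℤ.* h
  yv-even n le = y-even (xv (3 ℕ.+ n)) (yv n) (proj₁ Q≡1+4) (trans (sum-of-squares n le) (proj₂ Q≡1+4))

  private
    g₁ : ℕ → Carrier
    g₁ j = γ ^ᶠ (2 ℕ.^ j ℕ.* 1)

  d-flip : ∀ j b → suc j ℕ.≤ m → d (suc j) (γ ^ᶠ (2 ℕ.^ j ℕ.* (1 ℕ.+ b ℕ.* 2))) ≡ ℤ.- xv (suc j)
  d-flip j b j<m = trans (cong (d (suc j)) (sym (*-identityʳ _))) (flip (d-class (suc j)) _ 1# (γ-flip j b j<m))

  period-at : ∀ i b → suc i ℕ.≤ m → period (suc i) (γ ^ᶠ (2 ℕ.^ i ℕ.* (1 ℕ.+ b ℕ.* 2))) ≡ period i 1# ℤ.- 2^ i ℤ.* xv (suc i)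
  period-at i b i<m = trans (period-suc i _ i<m) (trans (cong₂ (λ a c → a ℤ.+ 2^ i ℤ.* c) (period-same-1 i _ (γ^full i (1 ℕ.+ b ℕ.* 2) (ℕP.<⇒≤ i<m))) (d-flip i b i<m)) (alg (period i 1#) (2^ i) (xv (suc i))))
    where
    alg : ∀ a t x → a ℤ.+ t ℤ.* (ℤ.- x) ≡ a ℤ.- t ℤ.* x
    alg = solve-∀

  period-at₂ : ∀ i b → 2 ℕ.+ i ℕ.≤ m → period (2 ℕ.+ i) (γ ^ᶠ (2 ℕ.^ i ℕ.* (1 ℕ.+ b ℕ.* 2))) ≡ period i 1# ℤ.- 2^ i ℤ.* xv (suc i)
  period-at₂ i b le = trans (period-suc (suc i) _ le) (trans (cong₂ (λ a c → a ℤ.+ 2^ (suc i) ℤ.* c) (period-at i b (ℕP.<⇒≤ le)) (vanish-2 {i} (d-class (2 ℕ.+ i)) le b))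
    (trans (cong (λ z → period i 1# ℤ.- 2^ i ℤ.* xv (suc i) ℤ.+ z) (ℤP.*-zeroʳ (2^ (suc i)))) (ℤP.+-identityʳ _)))

  private
    -- The left side is the period of order 2^(i+2) at γ^(2^i), by `period-at₂`, and any period of
    -- order 2^j is 1 modulo 2^j.
    residue : ∀ i → 2 ℕ.+ i ℕ.≤ m → ∃ λ k → period i 1# ℤ.- 2^ i ℤ.* xv (suc i) ≡ ℤ.1ℤ ℤ.+ ℤ.+ 4 ℤ.* 2^ i ℤ.* k
    residue i le = hat (λ x → one (2 ℕ.+ i) (g₁ i * x)) , trans (sym (period-at₂ i 0 le)) (cong (λ z → ℤ.1ℤ ℤ.+ z ℤ.* hat (λ x → one (2 ℕ.+ i) (g₁ i * x)))
      (trans (2^-suc (suc i)) (trans (cong (ℤ.+ 2 ℤ.*_) (2^-suc i)) (alg (2^ i)))))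
      where
      alg : ∀ x → ℤ.+ 2 ℤ.* (ℤ.+ 2 ℤ.* x) ≡ ℤ.+ 4 ℤ.* x
      alg = solve-∀

    -- One level higher the same period gains 2^(i+2) times `yv i`, which is even; so the congruence
    -- improves by a factor 2.
    residue₂ : ∀ i → 3 ℕ.+ i ℕ.≤ m → ∃ λ k → period i 1# ℤ.- 2^ i ℤ.* xv (suc i) ≡ ℤ.1ℤ ℤ.+ ℤ.+ 8 ℤ.* 2^ i ℤ.* k
    residue₂ i le = H ℤ.- h , alg (period i 1# ℤ.- 2^ i ℤ.* xv (suc i)) (2^ i) h H (trans (cong (λ z → period i 1# ℤ.- 2^ i ℤ.* xv (suc i) ℤ.+ z) (sym expand)) (trans (sym step) eq))
      where
      H h : ℤ
      H = hat (λ x → one (3 ℕ.+ i) (g₁ i * x))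
      h = proj₁ (yv-even i le)
      four : 2^ (2 ℕ.+ i) ≡ ℤ.+ 2 ℤ.* (ℤ.+ 2 ℤ.* 2^ i)
      four = trans (2^-suc (suc i)) (cong (ℤ.+ 2 ℤ.*_) (2^-suc i))
      step : period (3 ℕ.+ i) (g₁ i) ≡ (period i 1# ℤ.- 2^ i ℤ.* xv (suc i)) ℤ.+ 2^ (2 ℕ.+ i) ℤ.* yv i
      step = trans (period-suc (2 ℕ.+ i) (g₁ i) le) (cong (λ z → z ℤ.+ 2^ (2 ℕ.+ i) ℤ.* yv i) (period-at₂ i 0 (ℕP.<⇒≤ le)))
      expand : 2^ (2 ℕ.+ i) ℤ.* yv i ≡ ℤ.+ 2 ℤ.* (ℤ.+ 2 ℤ.* 2^ i) ℤ.* (ℤ.+ 2 ℤ.* h)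
      expand = cong₂ ℤ._*_ four (proj₂ (yv-even i le))
      eq : period (3 ℕ.+ i) (g₁ i) ≡ ℤ.1ℤ ℤ.+ ℤ.+ 2 ℤ.* (ℤ.+ 2 ℤ.* (ℤ.+ 2 ℤ.* 2^ i)) ℤ.* H
      eq = cong (λ z → ℤ.1ℤ ℤ.+ z ℤ.* H) (trans (2^-suc (2 ℕ.+ i)) (cong (ℤ.+ 2 ℤ.*_) four))
      alg : ∀ z t h H → z ℤ.+ ℤ.+ 2 ℤ.* (ℤ.+ 2 ℤ.* t) ℤ.* (ℤ.+ 2 ℤ.* h) ≡ ℤ.1ℤ ℤ.+ ℤ.+ 2 ℤ.* (ℤ.+ 2 ℤ.* (ℤ.+ 2 ℤ.* t)) ℤ.* H → z ≡ ℤ.1ℤ ℤ.+ ℤ.+ 8 ℤ.* t ℤ.* (H ℤ.- h)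
      alg z t h H e = trans (a₁ z t h) (trans (cong (λ w → w ℤ.- ℤ.+ 8 ℤ.* t ℤ.* h) e) (a₂ t h H))
        where
        a₁ : ∀ z t h → z ≡ z ℤ.+ ℤ.+ 2 ℤ.* (ℤ.+ 2 ℤ.* t) ℤ.* (ℤ.+ 2 ℤ.* h) ℤ.- ℤ.+ 8 ℤ.* t ℤ.* h
        a₁ = solve-∀
        a₂ : ∀ t h H → ℤ.1ℤ ℤ.+ ℤ.+ 2 ℤ.* (ℤ.+ 2 ℤ.* (ℤ.+ 2 ℤ.* t)) ℤ.* H ℤ.- ℤ.+ 8 ℤ.* t ℤ.* h ≡ ℤ.1ℤ ℤ.+ ℤ.+ 8 ℤ.* t ℤ.* (H ℤ.- h)
        a₂ = solve-∀

  -- `residue₂` at i and `residue` at i + 1 both hold modulo 2^(i+3); their difference gives x_(i+2)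
  -- ≡ x_(i+1) modulo 4. The start is -x₁ ≡ 1 because the period of order 1 is 0.
  xv-residue : ∀ i → 2 ℕ.+ i ℕ.≤ m → ∃ λ k → xv (suc i) ≡ ℤ.-1ℤ ℤ.+ ℤ.+ 4 ℤ.* k
  xv-residue zero le = ℤ.- k₀ , alg (period 0 1#) (xv 1) k₀ (proj₂ r) (period-0 1≢0)
    where
    r : ∃ λ k → period 0 1# ℤ.- 2^ 0 ℤ.* xv 1 ≡ ℤ.1ℤ ℤ.+ ℤ.+ 4 ℤ.* 2^ 0 ℤ.* k
    r = residue 0 le
    k₀ : ℤ
    k₀ = proj₁ r
    alg : ∀ z x k → z ℤ.- ℤ.1ℤ ℤ.* x ≡ ℤ.1ℤ ℤ.+ ℤ.+ 4 ℤ.* ℤ.1ℤ ℤ.* k → z ≡ ℤ.0ℤ → x ≡ ℤ.-1ℤ ℤ.+ ℤ.+ 4 ℤ.* (ℤ.- k)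
    alg z x k e refl = trans (a₁ x) (trans (cong ℤ.-_ e) (a₂ k))
      where
      a₁ : ∀ x → x ≡ ℤ.- (ℤ.0ℤ ℤ.- ℤ.1ℤ ℤ.* x)
      a₁ = solve-∀
      a₂ : ∀ k → ℤ.- (ℤ.1ℤ ℤ.+ ℤ.+ 4 ℤ.* ℤ.1ℤ ℤ.* k) ≡ ℤ.-1ℤ ℤ.+ ℤ.+ 4 ℤ.* (ℤ.- k)
      a₂ = solve-∀
  xv-residue (suc i) le = k₀ ℤ.+ (k₁ ℤ.- k₂) , ℤP.*-cancelˡ-≡ (2^ (suc i)) _ _ {{ℕP.m^n≢0 2 (suc i)}} main
    where
    rec : ∃ λ k → xv (suc i) ≡ ℤ.-1ℤ ℤ.+ ℤ.+ 4 ℤ.* k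
    rec = xv-residue i (ℕP.<⇒≤ le)
    A : ∃ λ k → period i 1# ℤ.- 2^ i ℤ.* xv (suc i) ≡ ℤ.1ℤ ℤ.+ ℤ.+ 8 ℤ.* 2^ i ℤ.* k
    A = residue₂ i le
    B : ∃ λ k → period (suc i) 1# ℤ.- 2^ (suc i) ℤ.* xv (2 ℕ.+ i) ≡ ℤ.1ℤ ℤ.+ ℤ.+ 4 ℤ.* 2^ (suc i) ℤ.* k
    B = residue (suc i) le
    k₀ k₁ k₂ : ℤ
    k₀ = proj₁ rec
    k₁ = proj₁ A
    k₂ = proj₁ B
    main : 2^ (suc i) ℤ.* xv (2 ℕ.+ i) ≡ 2^ (suc i) ℤ.* (ℤ.-1ℤ ℤ.+ ℤ.+ 4 ℤ.* (k₀ ℤ.+ (k₁ ℤ.- k₂)))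
    main = trans (isolate (period (suc i) 1#) (2^ (suc i) ℤ.* xv (2 ℕ.+ i))) (trans (cong₂ ℤ._-_ P₁≡ (proj₂ B))
      (trans (cong (λ t → ℤ.1ℤ ℤ.+ ℤ.+ 8 ℤ.* 2^ i ℤ.* k₁ ℤ.+ ℤ.+ 2 ℤ.* (2^ i ℤ.* xv (suc i)) ℤ.- (ℤ.1ℤ ℤ.+ ℤ.+ 4 ℤ.* t ℤ.* k₂)) (2^-suc i))
        (trans (cong (λ x → ℤ.1ℤ ℤ.+ ℤ.+ 8 ℤ.* 2^ i ℤ.* k₁ ℤ.+ ℤ.+ 2 ℤ.* (2^ i ℤ.* x) ℤ.- (ℤ.1ℤ ℤ.+ ℤ.+ 4 ℤ.* (ℤ.+ 2 ℤ.* 2^ i) ℤ.* k₂)) (proj₂ rec))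
          (trans (a₂ (2^ i) k₀ k₁ k₂) (cong (ℤ._* (ℤ.-1ℤ ℤ.+ ℤ.+ 4 ℤ.* (k₀ ℤ.+ (k₁ ℤ.- k₂)))) (sym (2^-suc i)))))))
      where
      isolate : ∀ p a → a ≡ p ℤ.- (p ℤ.- a)
      isolate = solve-∀
      P₁≡ : period (suc i) 1# ≡ ℤ.1ℤ ℤ.+ ℤ.+ 8 ℤ.* 2^ i ℤ.* k₁ ℤ.+ ℤ.+ 2 ℤ.* (2^ i ℤ.* xv (suc i))
      P₁≡ = trans (period-suc i 1# (ℕP.<⇒≤ (ℕP.<⇒≤ le))) (trans (a₁ (period i 1#) (2^ i ℤ.* xv (suc i))) (cong (λ z → z ℤ.+ ℤ.+ 2 ℤ.* (2^ i ℤ.* xv (suc i))) (proj₂ A)))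
        where
        a₁ : ∀ p b → p ℤ.+ b ≡ p ℤ.- b ℤ.+ ℤ.+ 2 ℤ.* b
        a₁ = solve-∀
      a₂ : ∀ t k₀ k₁ k₂ → ℤ.1ℤ ℤ.+ ℤ.+ 8 ℤ.* t ℤ.* k₁ ℤ.+ ℤ.+ 2 ℤ.* (t ℤ.* (ℤ.-1ℤ ℤ.+ ℤ.+ 4 ℤ.* k₀)) ℤ.- (ℤ.1ℤ ℤ.+ ℤ.+ 4 ℤ.* (ℤ.+ 2 ℤ.* t) ℤ.* k₂) ≡
        ℤ.+ 2 ℤ.* t ℤ.* (ℤ.-1ℤ ℤ.+ ℤ.+ 4 ℤ.* (k₀ ℤ.+ (k₁ ℤ.- k₂)))
      a₂ = solve-∀

  private
    residue-clash : ∀ c k → ℤ.1ℤ ℤ.+ ℤ.+ 4 ℤ.* c ≢ ℤ.-1ℤ ℤ.+ ℤ.+ 4 ℤ.* k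
    residue-clash c k e = 2≢4* (k ℤ.- c) (trans (a₁ c) (trans (cong (λ z → z ℤ.- ℤ.+ 4 ℤ.* c ℤ.+ ℤ.1ℤ) e) (a₂ c k)))
      where
      a₁ : ∀ c → ℤ.+ 2 ≡ ℤ.1ℤ ℤ.+ ℤ.+ 4 ℤ.* c ℤ.- ℤ.+ 4 ℤ.* c ℤ.+ ℤ.1ℤ
      a₁ = solve-∀
      a₂ : ∀ c k → ℤ.-1ℤ ℤ.+ ℤ.+ 4 ℤ.* k ℤ.- ℤ.+ 4 ℤ.* c ℤ.+ ℤ.1ℤ ≡ ℤ.+ 4 ℤ.* (k ℤ.- c)
      a₂ = solve-∀

  -- The square is q, while √q is 1 and the value itself -1 modulo 4.
  xv-low : ∀ j₀ → j₀ ℕ.≤ 1 → xv (suc j₀) ≡ ℤ.- rt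
  xv-low j₀ le = [ (λ e → ⊥-elim (residue-clash (proj₁ rt≡1+4) (proj₁ r) (trans (sym (proj₂ rt≡1+4)) (trans (sym e) (proj₂ r))))) , id ]′
    (square-≡ (xv (suc j₀)) rt (trans (d²-low j₀ le) (sym rt²)))
    where
    r : ∃ λ k → xv (suc j₀) ≡ ℤ.-1ℤ ℤ.+ ℤ.+ 4 ℤ.* k
    r = xv-residue j₀ (ℕP.≤-trans (ℕP.+-monoʳ-≤ 2 le) 3≤m)

  p∤2 : ¬ (p ∣ℕ.∣ 2)
  p∤2 p∣2 = ℕP.<⇒≱ (subst (2 ℕ.<_) (sym p≡8w+3) (s≤s (s≤s (s≤s z≤n)))) (∣ℕ.∣⇒≤ p∣2)

  open Valuation p prime p∤2 public

  -- s / 2^(j−1) and the exact exponent of p in the Gauss sums of order 2ʲ, for j = 3 + n.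
  σf e : ℕ → ℕ
  σf n = u ℕ.* 2 ℕ.^ (i₀ ∸ n)
  e n = σf n ℕ.* (2 ℕ.^ (1 ℕ.+ n) ∸ 1)

  private
    Tn : ∀ n → suc (2 ℕ.^ (1 ℕ.+ n) ∸ 1) ≡ 2 ℕ.^ (1 ℕ.+ n)
    Tn n = ℕP.m+[n∸m]≡n (ℕP.m^n>0 2 (1 ℕ.+ n))

    n≤i₀ : ∀ n → 3 ℕ.+ n ℕ.≤ m → n ℕ.≤ i₀
    n≤i₀ n le = ℕP.∸-monoˡ-≤ 3 le

  s≡σf : ∀ n → 3 ℕ.+ n ℕ.≤ m → s ≡ σf n ℕ.* 2 ℕ.^ (2 ℕ.+ n)
  s≡σf n le = trans s≡u (trans (cong (λ z → u ℕ.* 2 ℕ.^ z) (trans (cong (2 ℕ.+_) (sym (ℕP.m∸n+n≡m (n≤i₀ n le)))) (lem (i₀ ∸ n) n))) (trans (cong (u ℕ.*_) (ℕP.^-distribˡ-+-* 2 (i₀ ∸ n) (2 ℕ.+ n))) (sym (ℕP.*-assoc u _ _))))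
    where
    lem : ∀ a n → 2 ℕ.+ (a ℕ.+ n) ≡ a ℕ.+ (2 ℕ.+ n)
    lem = ℕSolver.solve-∀

  s≡2e+2σ : ∀ n → 3 ℕ.+ n ℕ.≤ m → s ≡ (e n ℕ.+ e n) ℕ.+ (σf n ℕ.+ σf n)
  s≡2e+2σ n le = trans (s≡σf n le) (trans (cong (λ z → σf n ℕ.* (2 ℕ.* z)) (sym (Tn n))) (lem (σf n) (2 ℕ.^ (1 ℕ.+ n) ∸ 1)))
    where
    lem : ∀ a t → a ℕ.* (2 ℕ.* suc t) ≡ (a ℕ.* t ℕ.+ a ℕ.* t) ℕ.+ (a ℕ.+ a)
    lem = ℕSolver.solve-∀

  v≡e+σ : ∀ n → 3 ℕ.+ n ℕ.≤ m → v ≡ e n ℕ.+ σf n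
  v≡e+σ n le = ℕP.*-cancelʳ-≡ v _ 2 (trans (sym (proj₁ (proj₂ half-s))) (trans (s≡2e+2σ n le) (lem (e n) (σf n))))
    where
    lem : ∀ a b → (a ℕ.+ a) ℕ.+ (b ℕ.+ b) ≡ (a ℕ.+ b) ℕ.* 2
    lem = ℕSolver.solve-∀

  0<σf : ∀ n → 3 ℕ.+ n ℕ.≤ m → 0 ℕ.< σf n
  0<σf n le = ℕP.n≢0⇒n>0 λ z → ℕP.<⇒≢ 0<s (sym (trans (s≡σf n le) (cong (ℕ._* 2 ℕ.^ (2 ℕ.+ n)) z)))

  σf-suc : ∀ n → 4 ℕ.+ n ℕ.≤ m → σf n ≡ σf (suc n) ℕ.* 2
  σf-suc n le = trans (cong (λ z → u ℕ.* 2 ℕ.^ z) (ℕP.+-∸-assoc 1 n≤)) (lem u (2 ℕ.^ (i₀ ∸ suc n)))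
    where
    n≤ : suc n ℕ.≤ i₀
    n≤ = n≤i₀ (suc n) le
    lem : ∀ u x → u ℕ.* (2 ℕ.* x) ≡ u ℕ.* x ℕ.* 2
    lem = ℕSolver.solve-∀

  v+e : ∀ n → 4 ℕ.+ n ℕ.≤ m → v ℕ.+ e n ≡ e (suc n) ℕ.+ e (suc n)
  v+e n le = trans (cong₂ ℕ._+_ (v≡e+σ n (ℕP.<⇒≤ le)) refl) (trans (cong (λ z → z ℕ.* T ℕ.+ z ℕ.+ z ℕ.* T) (σf-suc n le)) (trans (lem (σf (suc n)) T) (cong (λ z → σf (suc n) ℕ.* z ℕ.+ σf (suc n) ℕ.* z) T′)))
    where
    T : ℕ
    T = 2 ℕ.^ (1 ℕ.+ n) ∸ 1
    T′ : 1 ℕ.+ 2 ℕ.* T ≡ 2 ℕ.^ (2 ℕ.+ n) ∸ 1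
    T′ = ℕP.suc-injective (trans (lem₂ T) (trans (cong (2 ℕ.*_) (Tn n)) (sym (Tn (suc n)))))
      where
      lem₂ : ∀ t → suc (1 ℕ.+ 2 ℕ.* t) ≡ 2 ℕ.* suc t
      lem₂ = ℕSolver.solve-∀
    lem : ∀ a t → a ℕ.* 2 ℕ.* t ℕ.+ a ℕ.* 2 ℕ.+ a ℕ.* 2 ℕ.* t ≡ a ℕ.* (1 ℕ.+ 2 ℕ.* t) ℕ.+ a ℕ.* (1 ℕ.+ 2 ℕ.* t)
    lem = ℕSolver.solve-∀

  private
    p∤-from : ∀ a c r → 0 ℕ.< r → ¬ (p∣ c) → ℤ.+ 2 ℤ.* a ℤ.* a ≡ pw r ℤ.- c → ¬ (p∣ a)
    p∤-from a c r 0<r p∤c h d = p∤c (subst p∣_ (trans (cong (λ z → pw r ℤ.+ ℤ.-1ℤ ℤ.* z) h) (alg (pw r) c)) (p∣+ (p∣pw r 0<r) (p∣*ˡ ℤ.-1ℤ (p∣*ˡ (ℤ.+ 2 ℤ.* a) d))))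
      where
      alg : ∀ r c → r ℤ.+ ℤ.-1ℤ ℤ.* (r ℤ.- c) ≡ c
      alg = solve-∀

    -- Adding the norm equation to a recurrence eliminates y.
    double : ∀ n → 3 ℕ.+ n ℕ.≤ m → ∀ {D} → xv (3 ℕ.+ n) ℤ.* xv (3 ℕ.+ n) ℤ.- ℤ.+ 2 ℤ.* yv n ℤ.* yv n ≡ D → ℤ.+ 2 ℤ.* xv (3 ℕ.+ n) ℤ.* xv (3 ℕ.+ n) ≡ rt ℤ.* rt ℤ.+ D
    double n le e = trans (alg (xv (3 ℕ.+ n)) (yv n)) (cong₂ ℤ._+_ (trans (sum-of-squares n le) (sym rt²)) e)
      where
      alg : ∀ x y → ℤ.+ 2 ℤ.* x ℤ.* x ≡ (x ℤ.* x ℤ.+ ℤ.+ 2 ℤ.* y ℤ.* y) ℤ.+ (x ℤ.* x ℤ.- ℤ.+ 2 ℤ.* y ℤ.* y)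
      alg = solve-∀

  abstract
    -- By `double`, 2x² is √q (√q - J) at level 3 and √q (√q - x′) above, with x′ the value one
    -- level lower. At level 3 the second factor is prime to p; above, p^(e n) can be taken out of
    -- it and leaves p^(σf n) - a₀, prime to p. The power of p collected is p^(2e) by `v≡e+σ` and
    -- `v+e`.
    xv-valuation : ∀ n → 3 ℕ.+ n ℕ.≤ m → ∃ λ a → (xv (3 ℕ.+ n) ≡ pw (e n) ℤ.* a) × ¬ (p∣ a)
    xv-valuation zero le = proj₁ r , proj₁ (proj₂ r) , p∤-from (proj₁ r) (Jac 3 1#) v 0<v (λ d → p∤Jac (to-ℕ d)) (proj₂ (proj₂ r))
      where
      v≡ : v ≡ e 0 ℕ.+ e 0
      v≡ = trans (v≡e+σ 0 le) (cong (e 0 ℕ.+_) (sym (ℕP.*-identityʳ (σf 0))))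
      0<v : 0 ℕ.< v
      0<v = ℕP.<-≤-trans (0<σf 0 le) (subst (σf 0 ℕ.≤_) (sym (v≡e+σ 0 le)) (ℕP.m≤n+m (σf 0) (e 0)))
      r : ∃ λ a → (xv 3 ≡ pw (e 0) ℤ.* a) × (ℤ.+ 2 ℤ.* a ℤ.* a ≡ rt ℤ.- Jac 3 1#)
      r = extract (e 0) (xv 3) (rt ℤ.- Jac 3 1#) (trans (double 0 le (trans (recurrence-3 le) (cong (Jac 3 1# ℤ.*_) (xv-low 1 ℕP.≤-refl)))) (trans (alg rt (Jac 3 1#)) (cong (ℤ._* (rt ℤ.- Jac 3 1#)) (cong pw v≡))))
        where
        alg : ∀ r c → r ℤ.* r ℤ.+ c ℤ.* (ℤ.- r) ≡ r ℤ.* (r ℤ.- c)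
        alg = solve-∀
    xv-valuation (suc n) le = proj₁ r , proj₁ (proj₂ r) , p∤-from (proj₁ r) a₀ (σf n) (0<σf n (ℕP.<⇒≤ le)) (proj₂ (proj₂ rec)) (proj₂ (proj₂ r))
      where
      rec : ∃ λ a → (xv (3 ℕ.+ n) ≡ pw (e n) ℤ.* a) × ¬ (p∣ a)
      rec = xv-valuation n (ℕP.<⇒≤ le)
      a₀ : ℤ
      a₀ = proj₁ rec
      r : ∃ λ a → (xv (4 ℕ.+ n) ≡ pw (e (suc n)) ℤ.* a) × (ℤ.+ 2 ℤ.* a ℤ.* a ≡ pw (σf n) ℤ.- a₀)
      r = extract (e (suc n)) (xv (4 ℕ.+ n)) (pw (σf n) ℤ.- a₀) (trans (double (suc n) le (trans (EvenLevel.recurrence n le) (cong₂ ℤ._*_ (xv-low 0 z≤n) (proj₁ (proj₂ rec)))))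
        (trans (alg₁ rt (pw (e n)) a₀) (trans (cong (λ z → rt ℤ.* (z ℤ.- pw (e n) ℤ.* a₀)) (trans (cong pw (v≡e+σ n (ℕP.<⇒≤ le))) (pw-+ (e n) (σf n)))) (trans (alg₂ rt (pw (e n)) (pw (σf n)) a₀)
          (cong (ℤ._* (pw (σf n) ℤ.- a₀)) (trans (sym (pw-+ v (e n))) (cong pw (v+e n le))))))))
        where
        alg₁ : ∀ r e a → r ℤ.* r ℤ.+ (ℤ.- r) ℤ.* (e ℤ.* a) ≡ r ℤ.* (r ℤ.- e ℤ.* a)
        alg₁ = solve-∀
        alg₂ : ∀ r e s a → r ℤ.* (e ℤ.* s ℤ.- e ℤ.* a) ≡ r ℤ.* e ℤ.* (s ℤ.- a)
        alg₂ = solve-∀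

    xy-valuation : ∀ n → 3 ℕ.+ n ℕ.≤ m → ∃ λ a → ∃ λ b → (xv (3 ℕ.+ n) ≡ pw (e n) ℤ.* a) × (yv n ≡ pw (e n) ℤ.* b) ×
      ¬ (p∣ a) × (a ℤ.* a ℤ.+ ℤ.+ 2 ℤ.* b ℤ.* b ≡ pw (σf n ℕ.+ σf n))
    xy-valuation n le = a , proj₁ r , proj₁ (proj₂ X) , proj₁ (proj₂ r) , proj₂ (proj₂ X) , trans (cong (λ z → a ℤ.* a ℤ.+ z) (proj₂ (proj₂ r))) (alg₃ (a ℤ.* a) (pw (σf n ℕ.+ σf n)))
      where
      X : ∃ λ a → (xv (3 ℕ.+ n) ≡ pw (e n) ℤ.* a) × ¬ (p∣ a)
      X = xv-valuation n le
      a : ℤ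
      a = proj₁ X
      alg₁ : ∀ x y → ℤ.+ 2 ℤ.* y ℤ.* y ≡ (x ℤ.* x ℤ.+ ℤ.+ 2 ℤ.* y ℤ.* y) ℤ.- x ℤ.* x
      alg₁ = solve-∀
      alg₂ : ∀ e a s → e ℤ.* e ℤ.* s ℤ.- (e ℤ.* a) ℤ.* (e ℤ.* a) ≡ e ℤ.* e ℤ.* (s ℤ.- a ℤ.* a)
      alg₂ = solve-∀
      alg₃ : ∀ x s → x ℤ.+ (s ℤ.- x) ≡ s
      alg₃ = solve-∀
      Q≡ : Q ≡ pw (e n) ℤ.* pw (e n) ℤ.* pw (σf n ℕ.+ σf n)
      Q≡ = trans (cong (λ z → ℤ.+ z) (trans suc-q₁ (cong (p ℕ.^_) (s≡2e+2σ n le)))) (trans (pw-+ (e n ℕ.+ e n) (σf n ℕ.+ σf n)) (cong (ℤ._* pw (σf n ℕ.+ σf n)) (pw-+ (e n) (e n))))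
      r : ∃ λ b → (yv n ≡ pw (e n) ℤ.* b) × (ℤ.+ 2 ℤ.* b ℤ.* b ≡ pw (σf n ℕ.+ σf n) ℤ.- a ℤ.* a)
      r = extract (e n) (yv n) (pw (σf n ℕ.+ σf n) ℤ.- a ℤ.* a) (trans (alg₁ (xv (3 ℕ.+ n)) (yv n)) (trans (cong₂ (λ q x → q ℤ.- x ℤ.* x) (trans (sum-of-squares n le) Q≡) (proj₁ (proj₂ X)))
        (trans (alg₂ (pw (e n)) a (pw (σf n ℕ.+ σf n))) (cong (ℤ._* (pw (σf n ℕ.+ σf n) ℤ.- a ℤ.* a)) (sym (pw-+ (e n) (e n)))))))

  qpow-e : ∀ n → 3 ℕ.+ n ℕ.≤ m → qpow p s (2 ℕ.^ (1 ℕ.+ n) ∸ 1) (2 ℕ.+ n) ≡ pw (e n)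
  qpow-e n le = cong pw (trans (cong (half^ (2 ℕ.+ n)) (trans (cong (ℕ._* T) (s≡σf n le)) (lem (σf n) (2 ℕ.^ (2 ℕ.+ n)) T))) (half^-exact (2 ℕ.+ n) (e n)))
    where
    T : ℕ
    T = 2 ℕ.^ (1 ℕ.+ n) ∸ 1
    lem : ∀ a x t → a ℕ.* x ℕ.* t ≡ a ℕ.* t ℕ.* x
    lem = ℕSolver.solve-∀

  qpow-rt : qpow p s 1 1 ≡ rt
  qpow-rt = cong pw (trans (cong (half^ 1) (trans (ℕP.*-identityʳ s) (proj₁ (proj₂ half-s)))) (half^-exact 1 v))

  module Coefficients (A B : ℕ → ℤ)
    (AB : ∀ r → 3 ℕ.≤ r → r ℕ.≤ m → (ℤ.+ (p ℕ.^ half^ (r ∸ 2) s) ≡ A r ℤ.* A r ℤ.+ ℤ.+ 2 ℤ.* B r ℤ.* B r)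
                                   × (4 ∣ℕ.∣ ℤ.∣ A r ℤ.+ ℤ.1ℤ ∣) × ¬ (p ∣ℕ.∣ ℤ.∣ A r ∣)) where
    XX YY : ℕ → ℤ
    XX n = A (3 ℕ.+ n) ℤ.* qpow p s (2 ℕ.^ (1 ℕ.+ n) ∸ 1) (2 ℕ.+ n)
    YY n = B (3 ℕ.+ n) ℤ.* qpow p s (2 ℕ.^ (1 ℕ.+ n) ∸ 1) (2 ℕ.+ n)

    abstract
      compare : ∀ n → 3 ℕ.+ n ℕ.≤ m → ∃ λ a → ∃ λ b → (xv (3 ℕ.+ n) ≡ pw (e n) ℤ.* a) × (yv n ≡ pw (e n) ℤ.* b) ×
        (a ≡ A (3 ℕ.+ n) ⊎ a ≡ ℤ.- A (3 ℕ.+ n)) × (b ≡ B (3 ℕ.+ n) ⊎ b ≡ ℤ.- B (3 ℕ.+ n))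
      compare n le = proj₁ X , proj₁ (proj₂ X) , proj₁ (proj₂ (proj₂ X)) , proj₁ (proj₂ (proj₂ (proj₂ X))) ,
          square-≡ (proj₁ X) (A (3 ℕ.+ n)) (proj₁ U) , square-≡ (proj₁ (proj₂ X)) (B (3 ℕ.+ n)) (proj₂ U)
        where
        X : ∃ λ a → ∃ λ b → (xv (3 ℕ.+ n) ≡ pw (e n) ℤ.* a) × (yv n ≡ pw (e n) ℤ.* b) × ¬ (p∣ a) × (a ℤ.* a ℤ.+ ℤ.+ 2 ℤ.* b ℤ.* b ≡ pw (σf n ℕ.+ σf n))
        X = xy-valuation n le
        h : (ℤ.+ (p ℕ.^ half^ (1 ℕ.+ n) s) ≡ A (3 ℕ.+ n) ℤ.* A (3 ℕ.+ n) ℤ.+ ℤ.+ 2 ℤ.* B (3 ℕ.+ n) ℤ.* B (3 ℕ.+ n))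
          × (4 ∣ℕ.∣ ℤ.∣ A (3 ℕ.+ n) ℤ.+ ℤ.1ℤ ∣) × ¬ (p ∣ℕ.∣ ℤ.∣ A (3 ℕ.+ n) ∣)
        h = AB (3 ℕ.+ n) (ℕP.m≤m+n 3 n) le
        half≡ : half^ (1 ℕ.+ n) s ≡ σf n ℕ.+ σf n
        half≡ = trans (cong (half^ (1 ℕ.+ n)) (trans (s≡σf n le) (lem (σf n) (2 ℕ.^ (1 ℕ.+ n))))) (half^-exact (1 ℕ.+ n) (σf n ℕ.+ σf n))
          where
          lem : ∀ a x → a ℕ.* (2 ℕ.* x) ≡ (a ℕ.+ a) ℕ.* x
          lem = ℕSolver.solve-∀
        U : (proj₁ X ℤ.* proj₁ X ≡ A (3 ℕ.+ n) ℤ.* A (3 ℕ.+ n)) × (proj₁ (proj₂ X) ℤ.* proj₁ (proj₂ X) ≡ B (3 ℕ.+ n) ℤ.* B (3 ℕ.+ n))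
        U = unique-rep (σf n ℕ.+ σf n) (ℕP.<-≤-trans (0<σf n le) (ℕP.m≤m+n (σf n) (σf n))) (proj₁ X) (proj₁ (proj₂ X)) (A (3 ℕ.+ n)) (B (3 ℕ.+ n))
          (proj₂ (proj₂ (proj₂ (proj₂ (proj₂ X))))) (trans (sym (proj₁ h)) (cong pw half≡)) (proj₁ (proj₂ (proj₂ (proj₂ (proj₂ X))))) (λ d → proj₂ (proj₂ h) (to-ℕ d))

    private
      pos-case : ∀ {n} (le : 3 ℕ.+ n ℕ.≤ m) {z a c} → z ≡ pw (e n) ℤ.* a → a ≡ c → z ≡ c ℤ.* qpow p s (2 ℕ.^ (1 ℕ.+ n) ∸ 1) (2 ℕ.+ n)
      pos-case {n} le {c = c} h refl = trans h (trans (ℤP.*-comm (pw (e n)) c) (cong (c ℤ.*_) (sym (qpow-e n le))))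

      neg-case : ∀ {n} (le : 3 ℕ.+ n ℕ.≤ m) {z a c} → z ≡ pw (e n) ℤ.* a → a ≡ ℤ.- c → z ≡ ℤ.- (c ℤ.* qpow p s (2 ℕ.^ (1 ℕ.+ n) ∸ 1) (2 ℕ.+ n))
      neg-case {n} le {c = c} h refl = trans h (trans (alg (pw (e n)) c) (cong (λ w → ℤ.- (c ℤ.* w)) (sym (qpow-e n le))))
        where
        alg : ∀ p c → p ℤ.* (ℤ.- c) ≡ ℤ.- (c ℤ.* p)
        alg = solve-∀

    yv≡ : ∀ n → 3 ℕ.+ n ℕ.≤ m → yv n ≡ YY n ⊎ yv n ≡ ℤ.- YY n
    yv≡ n le = let (_ , _ , _ , y≡ , _ , cb) = compare n le in [ (λ c → inj₁ (pos-case le y≡ c)) , (λ c → inj₂ (neg-case le y≡ c)) ]′ cb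

    xv≡ : ∀ n → 3 ℕ.+ n ℕ.≤ m → xv (3 ℕ.+ n) ≡ XX n ⊎ xv (3 ℕ.+ n) ≡ ℤ.- XX n
    xv≡ n le = let (_ , _ , x≡ , _ , ca , _) = compare n le in [ (λ c → inj₁ (pos-case le x≡ c)) , (λ c → inj₂ (neg-case le x≡ c)) ]′ ca

    private
      pw-e : ∀ n → 4 ℕ.+ n ℕ.≤ m → ∃ λ c → pw (e n) ≡ ℤ.1ℤ ℤ.+ ℤ.+ 4 ℤ.* c
      pw-e n le = ℤ.+ (2 ℕ.* eighth k₀) , trans (cong pw e≡) (trans (cong (λ z → ℤ.+ z) (trans (p^even k₀) (cong (1 ℕ.+_) (ℕP.*-assoc 4 2 (eighth k₀))))) (cong (λ z → ℤ.1ℤ ℤ.+ z) (ℤP.pos-* 4 (2 ℕ.* eighth k₀))))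
        where
        k₀ : ℕ
        k₀ = σf (suc n) ℕ.* (2 ℕ.^ (1 ℕ.+ n) ∸ 1)
        e≡ : e n ≡ k₀ ℕ.* 2
        e≡ = trans (cong (ℕ._* (2 ℕ.^ (1 ℕ.+ n) ∸ 1)) (σf-suc n le)) (lem (σf (suc n)) (2 ℕ.^ (1 ℕ.+ n) ∸ 1))
          where
          lem : ∀ a t → a ℕ.* 2 ℕ.* t ≡ a ℕ.* t ℕ.* 2
          lem = ℕSolver.solve-∀

      A≡-1 : ∀ n → 3 ℕ.+ n ℕ.≤ m → ∃ λ c → A (3 ℕ.+ n) ≡ ℤ.-1ℤ ℤ.+ ℤ.+ 4 ℤ.* c
      A≡-1 n le = proj₁ D , trans (alg₁ (A (3 ℕ.+ n))) (cong (λ z → ℤ.-1ℤ ℤ.+ z) (proj₂ D))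
        where
        alg₁ : ∀ a → a ≡ ℤ.-1ℤ ℤ.+ (a ℤ.+ ℤ.1ℤ)
        alg₁ = solve-∀
        signed : ∀ x → 4 ∣ℕ.∣ ℤ.∣ x ∣ → ∃ λ c → x ≡ ℤ.+ 4 ℤ.* c
        signed (ℤ.+ n) (divides k h) = ℤ.+ k , trans (cong (λ z → ℤ.+ z) (trans h (ℕP.*-comm k 4))) (ℤP.pos-* 4 k)
        signed -[1+ n ] (divides k h) = ℤ.- ℤ.+ k , trans (cong (λ z → ℤ.- (ℤ.+ z)) (trans h (ℕP.*-comm k 4))) (trans (cong ℤ.-_ (ℤP.pos-* 4 k)) (ℤP.neg-distribʳ-* (ℤ.+ 4) (ℤ.+ k)))
        D : ∃ λ c → A (3 ℕ.+ n) ℤ.+ ℤ.1ℤ ≡ ℤ.+ 4 ℤ.* c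
        D = signed (A (3 ℕ.+ n) ℤ.+ ℤ.1ℤ) (proj₁ (proj₂ (AB (3 ℕ.+ n) (ℕP.m≤m+n 3 n) le)))

    -- Below level m the exponent `e n` is even, so p^(e n) is 1 modulo 4; x and A are both -1
    -- modulo 4, which excludes the minus sign.
    xv-sign : ∀ n → 4 ℕ.+ n ℕ.≤ m → xv (3 ℕ.+ n) ≡ XX n
    xv-sign n le = [ id , (λ h → ⊥-elim (residue-clash (K l c) (proj₁ r) (trans (sym (trans h (trans (cong₂ (λ x y → ℤ.- (x ℤ.* y)) (proj₂ a≡) (trans (qpow-e n (ℕP.<⇒≤ le)) (proj₂ p≡))) (alg l c)))) (proj₂ r)))) ]′ (xv≡ n (ℕP.<⇒≤ le))
      where
      r : ∃ λ k → xv (3 ℕ.+ n) ≡ ℤ.-1ℤ ℤ.+ ℤ.+ 4 ℤ.* k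
      r = xv-residue (2 ℕ.+ n) le
      a≡ : ∃ λ c → A (3 ℕ.+ n) ≡ ℤ.-1ℤ ℤ.+ ℤ.+ 4 ℤ.* c
      a≡ = A≡-1 n (ℕP.<⇒≤ le)
      p≡ : ∃ λ c → pw (e n) ≡ ℤ.1ℤ ℤ.+ ℤ.+ 4 ℤ.* c
      p≡ = pw-e n le
      l c : ℤ
      l = proj₁ a≡
      c = proj₁ p≡
      K : ℤ → ℤ → ℤ
      K l c = c ℤ.- l ℤ.- ℤ.+ 4 ℤ.* l ℤ.* c
      alg : ∀ l c → ℤ.- ((ℤ.-1ℤ ℤ.+ ℤ.+ 4 ℤ.* l) ℤ.* (ℤ.1ℤ ℤ.+ ℤ.+ 4 ℤ.* c)) ≡ ℤ.1ℤ ℤ.+ ℤ.+ 4 ℤ.* (c ℤ.- l ℤ.- ℤ.+ 4 ℤ.* l ℤ.* c)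
      alg = solve-∀

-- Weights of the codewords, dimension and irreducibility of the code.

module Weights (σ : Setting) (N n : ℕ) (nN≡q₁ : n ℕ.* N ≡ Characteristic.q₁ σ)
               (gcd≡ : gcd N (Setting.R′ σ ℕ.* 2 ℕ.^ Setting.m σ) ≡ 2 ℕ.^ Setting.m σ) where
  open Evaluation σ public
  open ClassFn

  R M : ℕ
  R = R′ ℕ.* 2 ℕ.^ m
  M = 2 ℕ.^ m

  θ : Carrier
  θ = γ ^ᶠ N

  0<n : 0 ℕ.< n
  0<n = ℕP.n≢0⇒n>0 λ e → ℕP.<⇒≢ 0<q₁ (sym (trans (sym nN≡q₁) (cong (ℕ._* N) e)))

  0<N : 0 ℕ.< N
  0<N = ℕP.n≢0⇒n>0 λ e → ℕP.<⇒≢ 0<q₁ (sym (trans (sym nN≡q₁) (trans (cong (n ℕ.*_) e) (ℕP.*-zeroʳ n))))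

  θ^n : θ ^ᶠ n ≡ 1#
  θ^n = trans (sym (^-* γ N n)) (trans (cong (γ ^ᶠ_) (trans (ℕP.*-comm N n) nN≡q₁)) γ^q₁)

  nz : Carrier → ℤ
  nz t = 𝟙 (¬? (t ≟ 0#))

  wt-tabulate : ∀ r (g : ℕ → Carrier) → ℤ.+ wt (tabulate {n = r} (λ i → g (toℕ i))) ≡ Z.Σ< r (λ i → nz (g i))
  wt-tabulate zero g = refl
  wt-tabulate (suc r) g with g 0 ≟ 0#
  ... | yes _ = trans (wt-tabulate r (g ∘ suc)) (sym (ℤP.+-identityˡ _))
  ... | no _ = trans (ℤP.pos-+ 1 (wt (tabulate {n = r} (λ i → g (suc (toℕ i)))))) (cong (λ z → ℤ.1ℤ ℤ.+ z) (wt-tabulate r (g ∘ suc)))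

  cw : Carrier → Vec Carrier n
  cw = codeword p ℓ k N n γ

  module _ (β : Carrier) (β≢0 : β ≢ 0#) where
    private
      h : Carrier → ℤ
      h z = nz (tr (β * z))

      h-0 : h 0# ≡ ℤ.0ℤ
      h-0 = 𝟙-no (¬? (tr (β * 0#) ≟ 0#)) λ ne → ne (trans (cong tr (zeroʳ β)) tr-0)

      h-K : ∀ c z → InK c → h (c * z) ≡ h z
      h-K c z c∈ = 𝟙-cong (¬? (tr (β * (c * z)) ≟ 0#)) (¬? (tr (β * z) ≟ 0#))
          (λ ne e → ne (trans scale (trans (*-congˡ e) (zeroʳ c)))) (λ ne e → ne (*-cancelˡ (InK-≢0 c∈) (trans (sym scale) (trans e (sym (zeroʳ c))))))
        where
        scale : tr (β * (c * z)) ≡ c * tr (β * z)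
        scale = trans (cong tr (solve 3 (λ b c z → b :* (c :* z) := c :* (b :* z)) refl β c z)) (tr-* (β * z) (InK⇒fixed c∈))
          where open FSolver using (solve; _:=_; _:*_)

      -- As x runs through the nonzero elements, x^N runs N times through the n powers of θ.
      S-N : ΣF (λ x → h (x ^ᶠ N)) ≡ ℤ.+ N ℤ.* ℤ.+ wt (cw β)
      S-N = begin
        ΣF (λ x → h (x ^ᶠ N)) ≡⟨ Z.ΣF-powers _ ⟩
        h (0# ^ᶠ N) ℤ.+ Z.Σ< q₁ (λ e → h ((γ ^ᶠ e) ^ᶠ N)) ≡⟨ cong₂ ℤ._+_ (trans (cong h (0^ N 0<N)) h-0) (cong (λ r → Z.Σ< r (λ e → h ((γ ^ᶠ e) ^ᶠ N))) (trans (sym nN≡q₁) (ℕP.*-comm n N))) ⟩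
        ℤ.0ℤ ℤ.+ Z.Σ< (N ℕ.* n) (λ e → h ((γ ^ᶠ e) ^ᶠ N)) ≡⟨ trans (ℤP.+-identityˡ _) (Z.Σ<-cong (N ℕ.* n) λ e _ → cong h (^-comm γ e N)) ⟩
        Z.Σ< (N ℕ.* n) (λ e → h (θ ^ᶠ e)) ≡⟨ Z.Σ<-periodic N n (λ e → h (θ ^ᶠ e)) (λ e → cong h (trans (^-+ θ n e) (trans (*-congʳ θ^n) (*-identityˡ _)))) ⟩
        Z.ι N ℤ.* Z.Σ< n (λ e → h (θ ^ᶠ e)) ≡⟨ cong₂ ℤ._*_ (ιZ N) (sym (wt-tabulate n (λ i → tr (β * (θ ^ᶠ i))))) ⟩
        ℤ.+ N ℤ.* ℤ.+ wt (cw β) ∎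
        where open ≡-Reasoning

      y^R∈K : ∀ {y} b → y ≢ 0# → InK ((y ^ᶠ b) ^ᶠ R)
      y^R∈K {y} b y≢0 = trans (sym (^-* (y ^ᶠ b) R (P ∸ 1))) (trans (cong ((y ^ᶠ b) ^ᶠ_) R≡) (x^q₁ (^-≢0 b y≢0)))

      double : Carrier → Carrier → ℤ
      double x y = h ((x ^ᶠ N) * (y ^ᶠ M))

      M∣N : M ∣ℕ.∣ N
      M∣N = subst (∣ℕ._∣ N) gcd≡ (gcd[m,n]∣m N R)

      sum-y : ∀ x → x ≢ 0# → ΣF (double x) ≡ ΣF (λ y → h (y ^ᶠ M))
      sum-y x x≢0 with M∣N
      ... | divides N′ refl = trans (Z.ΣL-cong elements λ y → cong h (trans (*-congʳ (^-* x N′ M)) (sym (*-^ (x ^ᶠ N′) y M)))) (Z.ΣF-scale (^-≢0 N′ x≢0) (λ y → h (y ^ᶠ M)))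

      bezout : Bézout.Identity M N R
      bezout = Bézout.identity (subst (GCD N R) gcd≡ (gcd-GCD N R))

      -- Bézout writes M as a combination of N and R. The R-th power of y^b lies in K and is
      -- absorbed by `h`; the N-th power of y^a is absorbed by scaling x. The two cases are the two
      -- signs in Bézout's identity.
      sum-x : ∀ y → y ≢ 0# → ΣF (λ x → double x y) ≡ ΣF (λ x → h (x ^ᶠ N))
      sum-x y y≢0 = go bezout
        where
        open FSolver using (solve; _:=_; _:*_)
        pt : ∀ {c a z} → InK c → a ≡ c * z → h a ≡ h z
        pt c∈ refl = h-K _ _ c∈
        go : Bézout.Identity M N R → ΣF (λ x → double x y) ≡ ΣF (λ x → h (x ^ᶠ N))
        go (Bézout.+- a b eq) = trans (Z.ΣL-cong elements λ x → sym (pt (y^R∈K b y≢0) (shape x))) (Z.ΣF-scale (^-≢0 a y≢0) (λ x → h (x ^ᶠ N)))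
          where
          y^ : (y ^ᶠ a) ^ᶠ N ≡ ((y ^ᶠ b) ^ᶠ R) * (y ^ᶠ M)
          y^ = trans (sym (^-* y a N)) (trans (cong (y ^ᶠ_) (sym eq)) (trans (^-+ y M (b ℕ.* R)) (trans (*-comm _ _) (*-congʳ (^-* y b R)))))
          shape : ∀ x → ((y ^ᶠ a) * x) ^ᶠ N ≡ ((y ^ᶠ b) ^ᶠ R) * ((x ^ᶠ N) * (y ^ᶠ M))
          shape x = trans (*-^ (y ^ᶠ a) x N) (trans (*-congʳ y^) (solve 3 (λ k m x → (k :* m) :* x := k :* (x :* m)) refl ((y ^ᶠ b) ^ᶠ R) (y ^ᶠ M) (x ^ᶠ N)))
        go (Bézout.-+ a b eq) = trans (sym (Z.ΣF-scale (^-≢0 a y≢0) (λ x → double x y))) (Z.ΣL-cong elements λ x → pt (y^R∈K b y≢0) (shape x))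
          where
          y^ : ((y ^ᶠ a) ^ᶠ N) * (y ^ᶠ M) ≡ (y ^ᶠ b) ^ᶠ R
          y^ = trans (*-congʳ (sym (^-* y a N))) (trans (*-comm _ _) (trans (sym (^-+ y M (a ℕ.* N))) (trans (cong (y ^ᶠ_) eq) (^-* y b R))))
          shape : ∀ x → (((y ^ᶠ a) * x) ^ᶠ N) * (y ^ᶠ M) ≡ ((y ^ᶠ b) ^ᶠ R) * (x ^ᶠ N)
          shape x = trans (*-congʳ (*-^ (y ^ᶠ a) x N)) (trans (solve 3 (λ a x m → (a :* x) :* m := (a :* m) :* x) refl ((y ^ᶠ a) ^ᶠ N) (x ^ᶠ N) (y ^ᶠ M)) (*-congʳ y^))

      collapse : ∀ (g : Carrier → ℤ) c → g 0# ≡ ℤ.0ℤ → (∀ x → x ≢ 0# → g x ≡ c) → ΣF g ≡ ℤ.+ q₁ ℤ.* c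
      collapse g c g0 gc = trans (Z.ΣF-powers g) (trans (cong₂ ℤ._+_ g0 (trans (Z.Σ<-cong q₁ λ e _ → gc (γ ^ᶠ e) (^-≢0 e γ≢0)) (Z.Σ<-const q₁ c))) (trans (ℤP.+-identityˡ _) (cong (ℤ._* c) (ιZ q₁))))

      -- Both sums equal (q − 1)⁻¹ times the sum of h(x^N y^M): modulo the exponent R, which K
      -- absorbs, the multiples of N and of M = gcd(N, R) coincide.
      S-N≡S-M : ΣF (λ x → h (x ^ᶠ N)) ≡ ΣF (λ y → h (y ^ᶠ M))
      S-N≡S-M = ℤP.*-cancelˡ-≡ (ℤ.+ q₁) _ _ {{ℕ.>-nonZero 0<q₁}}
        (trans (sym (collapse (λ y → ΣF (λ x → double x y)) _ (Z.ΣL-0 elements λ x → trans (cong h (trans (*-congˡ (0^ M (ℕP.m^n>0 2 m))) (zeroʳ _))) h-0) sum-x))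
          (trans (Z.ΣL-swap elements elements (λ y x → double x y)) (collapse (λ x → ΣF (double x)) _ (Z.ΣL-0 elements λ y → trans (cong h (trans (*-congʳ (0^ N 0<N)) (zeroˡ _))) h-0) sum-y)))

      g : Carrier
      g = inv β

      φ : Carrier → ℤ
      φ z = one m (g * z)

      T : ℤ
      T = ΣF (λ z → φ z ℤ.* nz (tr z))

      S-M : ΣF (λ y → h (y ^ᶠ M)) ≡ ℤ.+ M ℤ.* T
      S-M = trans (Σ-powers m h h-0 ℕP.≤-refl) (cong (ℤ.+ M ℤ.*_) (trans (sym (Z.ΣF-scale (inv-≢0 β≢0) (λ y → one m y ℤ.* h y)))
        (Z.ΣL-cong elements λ z → cong (λ w → one m (g * z) ℤ.* nz (tr w)) (inv-cancel z β≢0))))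

      Σφ : ℤ.+ M ℤ.* ΣF φ ≡ ℤ.+ q₁
      Σφ = trans (cong (ℤ.+ M ℤ.*_) (trans (Z.ΣF-scale (inv-≢0 β≢0) (one m)) (Z.ΣL-cong elements pt)))
        (trans (sym (Σ-powers m (λ y → 𝟙 (¬? (y ≟ 0#))) (𝟙-no (¬? (0# ≟ 0#)) λ ne → ne refl) ℕP.≤-refl))
          (trans (collapse (λ x → 𝟙 (¬? ((x ^ᶠ M) ≟ 0#))) ℤ.1ℤ (𝟙-no (¬? ((0# ^ᶠ M) ≟ 0#)) λ ne → ne (0^ M (ℕP.m^n>0 2 m))) λ x x≢0 → 𝟙-yes (¬? ((x ^ᶠ M) ≟ 0#)) (^-≢0 M x≢0)) (ℤP.*-identityʳ _)))
        where
        pt : ∀ y → one m y ≡ one m y ℤ.* 𝟙 (¬? (y ≟ 0#))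
        pt y with y ≟ 0#
        ... | yes refl = trans (one-0 m) (sym (ℤP.*-zeroʳ (one m 0#)))
        ... | no _ = sym (ℤP.*-identityʳ (one m y))

      φ-K : ∀ c z → InK c → φ (c * z) ≡ φ z
      φ-K c z c∈ = cong (λ w → 𝟙 (w ≟ 1#)) (trans (cong (_^ᶠ ex m) (solve 3 (λ g c z → g :* (c :* z) := c :* (g :* z)) refl g c z))
        (trans (*-^ c (g * z) (ex m)) (trans (*-congʳ (InK-^ex m c∈)) (*-identityˡ _))))
        where open FSolver using (solve; _:=_; _:*_)

      hat-φ : P₁ ℤ.* hat φ ≡ ΣF (λ x → τ (tr x) ℤ.* φ x)
      hat-φ = begin
        P₁ ℤ.* hat φ ≡⟨ cong (ℤ._* hat φ) (sym Σκ) ⟩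
        ΣF κ ℤ.* hat φ ≡⟨ sym (Z.ΣL-*ʳ elements (hat φ) κ) ⟩
        ΣF (λ c → κ c ℤ.* hat φ) ≡⟨ Z.ΣL-cong elements (λ c → trans (κ-guard c (scaled c)) (sym (Z.ΣL-*ˡ elements (κ c) (λ x → ω (c * tr x) ℤ.* φ x)))) ⟩
        ΣF (λ c → ΣF (λ x → κ c ℤ.* (ω (c * tr x) ℤ.* φ x))) ≡⟨ Z.ΣL-swap elements elements _ ⟩
        ΣF (λ x → ΣF (λ c → κ c ℤ.* (ω (c * tr x) ℤ.* φ x))) ≡⟨ Z.ΣL-cong elements (λ x → trans (Z.ΣL-cong elements λ c → sym (ℤP.*-assoc (κ c) (ω (c * tr x)) (φ x))) (Z.ΣL-*ʳ elements (φ x) (λ c → κ c ℤ.* ω (c * tr x)))) ⟩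
        ΣF (λ x → τ (tr x) ℤ.* φ x) ∎
        where
        open ≡-Reasoning
        scaled : ∀ c → InK c → hat φ ≡ ΣF (λ x → ω (c * tr x) ℤ.* φ x)
        scaled c c∈ = trans (sym (Z.ΣF-scale (InK-≢0 c∈) (λ x → ω (tr x) ℤ.* φ x))) (Z.ΣL-cong elements λ x → cong₂ (λ a b → ω a ℤ.* b) (tr-* x (InK⇒fixed c∈)) (φ-K c x c∈))

      -- On the subfield P · nz t = P₁ - τ t, and `hat-φ` evaluates the sum with `τ`.
      P-T : ℤ.+ P ℤ.* T ≡ P₁ ℤ.* (ΣF φ ℤ.- hat φ)
      P-T = begin
        ℤ.+ P ℤ.* T ≡⟨ sym (Z.ΣL-*ˡ elements (ℤ.+ P) _) ⟩
        ΣF (λ z → ℤ.+ P ℤ.* (φ z ℤ.* nz (tr z))) ≡⟨ Z.ΣL-cong elements pt ⟩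
        ΣF (λ z → P₁ ℤ.* φ z ℤ.+ ℤ.-1ℤ ℤ.* (τ (tr z) ℤ.* φ z)) ≡⟨ trans (Z.ΣL-+ elements _ _) (cong₂ ℤ._+_ (Z.ΣL-*ˡ elements P₁ φ) (trans (Z.ΣL-*ˡ elements ℤ.-1ℤ _) (cong (ℤ.-1ℤ ℤ.*_) (sym hat-φ)))) ⟩
        P₁ ℤ.* ΣF φ ℤ.+ ℤ.-1ℤ ℤ.* (P₁ ℤ.* hat φ) ≡⟨ alg P₁ (ΣF φ) (hat φ) ⟩
        P₁ ℤ.* (ΣF φ ℤ.- hat φ) ∎
        where
        open ≡-Reasoning
        alg : ∀ p a b → p ℤ.* a ℤ.+ ℤ.-1ℤ ℤ.* (p ℤ.* b) ≡ p ℤ.* (a ℤ.- b)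
        alg = solve-∀
        nz≡ : ∀ t → nz t ≡ ℤ.1ℤ ℤ.- 𝟙 (t ≟ 0#)
        nz≡ t with t ≟ 0#
        ... | yes _ = refl
        ... | no _ = refl
        alg₂ : ∀ p f d → (ℤ.1ℤ ℤ.+ p) ℤ.* (f ℤ.* (ℤ.1ℤ ℤ.- d)) ≡ p ℤ.* f ℤ.+ ℤ.-1ℤ ℤ.* (((ℤ.1ℤ ℤ.+ p) ℤ.* d ℤ.- ℤ.1ℤ) ℤ.* f)
        alg₂ = solve-∀
        pt : ∀ z → ℤ.+ P ℤ.* (φ z ℤ.* nz (tr z)) ≡ P₁ ℤ.* φ z ℤ.+ ℤ.-1ℤ ℤ.* (τ (tr z) ℤ.* φ z)
        pt z = trans (cong (λ w → ℤ.+ P ℤ.* (φ z ℤ.* w)) (nz≡ (tr z))) (trans (subst (λ w → w ℤ.* (φ z ℤ.* (ℤ.1ℤ ℤ.- 𝟙 (tr z ≟ 0#))) ≡ P₁ ℤ.* φ z ℤ.+ ℤ.-1ℤ ℤ.* ((w ℤ.* 𝟙 (tr z ≟ 0#) ℤ.- ℤ.1ℤ) ℤ.* φ z)) (cong (λ z → ℤ.+ z) suc-P₁) (alg₂ P₁ (φ z) (𝟙 (tr z ≟ 0#))))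
          (cong (λ w → P₁ ℤ.* φ z ℤ.+ ℤ.-1ℤ ℤ.* (w ℤ.* φ z)) (sym (τ-val (tr z) (tr-fixed z)))))

    -- Cleared of denominators, this has the shape of the test by which `enumCoeff` assigns a term
    -- (a, E) to X^j, with E = q - period.
    weight : ℤ.+ (P ℕ.* N ℕ.* wt (cw β)) ≡ P₁ ℤ.* (Q ℤ.- period m (inv β))
    weight = begin
      ℤ.+ (P ℕ.* N ℕ.* wt (cw β)) ≡⟨ trans (ℤP.pos-* (P ℕ.* N) (wt (cw β))) (cong (ℤ._* ℤ.+ wt (cw β)) (ℤP.pos-* P N)) ⟩
      ℤ.+ P ℤ.* ℤ.+ N ℤ.* ℤ.+ wt (cw β) ≡⟨ trans (ℤP.*-assoc (ℤ.+ P) (ℤ.+ N) _) (cong (ℤ.+ P ℤ.*_) (trans (sym S-N) (trans S-N≡S-M S-M))) ⟩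
      ℤ.+ P ℤ.* (ℤ.+ M ℤ.* T) ≡⟨ alg₁ (ℤ.+ P) (ℤ.+ M) T ⟩
      ℤ.+ M ℤ.* (ℤ.+ P ℤ.* T) ≡⟨ cong (ℤ.+ M ℤ.*_) P-T ⟩
      ℤ.+ M ℤ.* (P₁ ℤ.* (ΣF φ ℤ.- hat φ)) ≡⟨ alg₂ (ℤ.+ M) P₁ (ΣF φ) (hat φ) ⟩
      P₁ ℤ.* (ℤ.+ M ℤ.* ΣF φ ℤ.- ℤ.+ M ℤ.* hat φ) ≡⟨ cong (λ w → P₁ ℤ.* (w ℤ.- ℤ.+ M ℤ.* hat φ)) Σφ ⟩
      P₁ ℤ.* (ℤ.+ q₁ ℤ.- ℤ.+ M ℤ.* hat φ) ≡⟨ alg₃ P₁ (ℤ.+ q₁) (ℤ.+ M ℤ.* hat φ) ⟩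
      P₁ ℤ.* (Q ℤ.- period m (inv β)) ∎
      where
      open ≡-Reasoning
      alg₁ : ∀ p m t → p ℤ.* (m ℤ.* t) ≡ m ℤ.* (p ℤ.* t)
      alg₁ = solve-∀
      alg₂ : ∀ m p a b → m ℤ.* (p ℤ.* (a ℤ.- b)) ≡ p ℤ.* (m ℤ.* a ℤ.- m ℤ.* b)
      alg₂ = solve-∀
      alg₃ : ∀ p q h → p ℤ.* (q ℤ.- h) ≡ p ℤ.* ((ℤ.1ℤ ℤ.+ q) ℤ.- (ℤ.1ℤ ℤ.+ h))
      alg₃ = solve-∀

  private
    r : ℕ
    r = p ℕ.^ v

    sq-bound : ∀ z → z ℤ.* z ℤ.≤ rt ℤ.* rt → ℤ.∣ z ∣ ℕ.≤ r
    sq-bound z le = ℕP.≮⇒≥ λ lt → ℕP.<⇒≱ (ℕP.*-mono-< lt lt) (ℤP.drop‿+≤+ (subst₂ ℤ._≤_ (abs² z) (sym (ℤP.pos-* r r)) le))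
      where
      abs² : ∀ z → z ℤ.* z ≡ ℤ.+ (ℤ.∣ z ∣ ℕ.* ℤ.∣ z ∣)
      abs² (ℤ.+ n) = sym (ℤP.pos-* n n)
      abs² -[1+ n ] = refl

    sq≥0 : ∀ z → ℤ.0ℤ ℤ.≤ z ℤ.* z
    sq≥0 (ℤ.+ n) = subst (ℤ.0ℤ ℤ.≤_) (ℤP.pos-* n n) (ℤ.+≤+ z≤n)
    sq≥0 -[1+ n ] = ℤ.+≤+ z≤n

    x-bound : ∀ n → 3 ℕ.+ n ℕ.≤ m → ℤ.∣ xv (3 ℕ.+ n) ∣ ℕ.≤ r
    x-bound n le = sq-bound x (subst (x ℤ.* x ℤ.≤_) (trans (cong (λ z → x ℤ.* x ℤ.+ z) (sym (ℤP.*-assoc (ℤ.+ 2) y y))) (trans (sum-of-squares n le) (sym rt²)))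
      (subst (ℤ._≤ x ℤ.* x ℤ.+ ℤ.+ 2 ℤ.* (y ℤ.* y)) (ℤP.+-identityʳ _) (ℤP.+-monoʳ-≤ (x ℤ.* x) (ℤP.*-monoˡ-≤-nonNeg (ℤ.+ 2) (sq≥0 y)))))
      where open Level n le using (x; y)

    y-bound : ∀ n → 3 ℕ.+ n ℕ.≤ m → ℤ.∣ yv n ∣ ℕ.≤ r
    y-bound n le = sq-bound y (ℤP.≤-trans (subst₂ ℤ._≤_ (ℤP.+-identityʳ _) (alg₁ (y ℤ.* y)) (ℤP.+-monoʳ-≤ (y ℤ.* y) (sq≥0 y)))
        (subst (ℤ.+ 2 ℤ.* (y ℤ.* y) ℤ.≤_) (trans (cong (λ z → x ℤ.* x ℤ.+ z) (sym (ℤP.*-assoc (ℤ.+ 2) y y))) (trans (sum-of-squares n le) (sym rt²)))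
          (subst (ℤ._≤ x ℤ.* x ℤ.+ ℤ.+ 2 ℤ.* (y ℤ.* y)) (ℤP.+-identityˡ _) (ℤP.+-monoˡ-≤ (ℤ.+ 2 ℤ.* (y ℤ.* y)) (sq≥0 x)))))
      where
      open Level n le using (x; y)
      alg₁ : ∀ a → a ℤ.+ a ≡ ℤ.+ 2 ℤ.* a
      alg₁ = solve-∀

    octant-bound : ∀ X Y → ℤ.∣ X ∣ ℕ.≤ r → ℤ.∣ Y ∣ ℕ.≤ r → ∀ i → ℤ.∣ octant X Y i ∣ ℕ.≤ r
    octant-bound X Y bx by 0 = bx
    octant-bound X Y bx by 1 = by
    octant-bound X Y bx by 2 = z≤n
    octant-bound X Y bx by 3 = by
    octant-bound X Y bx by 4 = subst (ℕ._≤ r) (sym (ℤP.∣-i∣≡∣i∣ X)) bx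
    octant-bound X Y bx by 5 = subst (ℕ._≤ r) (sym (ℤP.∣-i∣≡∣i∣ Y)) by
    octant-bound X Y bx by 6 = z≤n
    octant-bound X Y bx by 7 = subst (ℕ._≤ r) (sym (ℤP.∣-i∣≡∣i∣ Y)) by
    octant-bound X Y bx by (suc (suc (suc (suc (suc (suc (suc (suc i)))))))) = octant-bound X Y bx by i

    d-bound-low : ∀ j₀ → j₀ ℕ.≤ 1 → ∀ g → ℤ.∣ d (suc j₀) g ∣ ℕ.≤ r
    d-bound-low j₀ le g = subst (ℕ._≤ r) (sym (trans (cong ℤ.∣_∣ (trans (structure-low j₀ le (d-class (suc j₀)) g) (cong (ℤ._* ε (suc j₀) g) (xv-low j₀ le)))) (trans (ℤP.abs-* (ℤ.- rt) (ε (suc j₀) g)) (cong (ℕ._* ℤ.∣ ε (suc j₀) g ∣) (ℤP.∣-i∣≡∣i∣ rt)))))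
      (subst (r ℕ.* ℤ.∣ ε (suc j₀) g ∣ ℕ.≤_) (ℕP.*-identityʳ r) (ℕP.*-monoʳ-≤ r ε≤1))
      where
      ε≤1 : ℤ.∣ ε (suc j₀) g ∣ ℕ.≤ 1
      ε≤1 with sgnView (g ^ᶠ ex (suc j₀))
      ... | pos _ v = ℕP.≤-reflexive (cong ℤ.∣_∣ v)
      ... | neg _ v = ℕP.≤-reflexive (cong ℤ.∣_∣ v)
      ... | none _ _ v = subst (ℕ._≤ 1) (sym (cong ℤ.∣_∣ v)) z≤n

    d-bound-high : ∀ n → 3 ℕ.+ n ℕ.≤ m → ∀ e → ℤ.∣ d (3 ℕ.+ n) (γ ^ᶠ e) ∣ ℕ.≤ r
    d-bound-high n le e with 2-adic n e
    ... | inj₁ (a , refl) = subst (ℕ._≤ r) (cong ℤ.∣_∣ (sym (Level.values n le (d-class (3 ℕ.+ n)) a))) (octant-bound (xv (3 ℕ.+ n)) (yv n) (x-bound n le) (y-bound n le) a)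
    ... | inj₂ (i , b , i<n , refl) = subst (ℕ._≤ r) (cong ℤ.∣_∣ (sym zero-d)) z≤n
      where
      c : ℕ
      c = n ∸ suc i
      j≡ : 4 ℕ.+ (i ℕ.+ c) ≡ 3 ℕ.+ n
      j≡ = cong (3 ℕ.+_) (ℕP.m+[n∸m]≡n i<n)
      zero-d : d (3 ℕ.+ n) (γ ^ᶠ (2 ℕ.^ i ℕ.* (1 ℕ.+ b ℕ.* 2))) ≡ ℤ.0ℤ
      zero-d = vanish-4 {i} {c} (subst (λ z → ClassFn z (d (3 ℕ.+ n))) (sym j≡) (d-class (3 ℕ.+ n))) (subst (ℕ._≤ m) (sym j≡) le) b

    d-bound : ∀ j → suc j ℕ.≤ m → ∀ e → ℤ.∣ d (suc j) (γ ^ᶠ e) ∣ ℕ.≤ r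
    d-bound 0 le e = d-bound-low 0 z≤n (γ ^ᶠ e)
    d-bound 1 le e = d-bound-low 1 ℕP.≤-refl (γ ^ᶠ e)
    d-bound (suc (suc n)) le e = d-bound-high n le e

    -- Each `d` is at most r = √q in absolute value, by `sum-of-squares` and, at the first two
    -- levels, `xv-low`. Telescoping bounds the period by (2^j - 1) r; the term r stands on the left
    -- to avoid a subtraction.
    period-bound : ∀ j → j ℕ.≤ m → ∀ e → ℤ.∣ period j (γ ^ᶠ e) ∣ ℕ.+ r ℕ.≤ 2 ℕ.^ j ℕ.* r
    period-bound zero le e = ℕP.≤-reflexive (trans (cong (λ z → ℤ.∣ z ∣ ℕ.+ r) (period-0 (^-≢0 e γ≢0))) (sym (ℕP.*-identityˡ r)))
    period-bound (suc j) le e = subst (ℕ._≤ 2 ℕ.^ suc j ℕ.* r) (cong (λ z → ℤ.∣ z ∣ ℕ.+ r) (sym (period-suc j (γ ^ᶠ e) le)))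
      (ℕP.≤-trans (ℕP.+-monoˡ-≤ r (ℕP.≤-trans (ℤP.∣i+j∣≤∣i∣+∣j∣ (period j (γ ^ᶠ e)) (2^ j ℤ.* d (suc j) (γ ^ᶠ e))) (ℕP.+-monoʳ-≤ ℤ.∣ period j (γ ^ᶠ e) ∣ (ℕP.≤-trans (ℕP.≤-reflexive (ℤP.abs-* (2^ j) (d (suc j) (γ ^ᶠ e)))) (ℕP.*-monoʳ-≤ (2 ℕ.^ j) (d-bound j le e))))))
        (subst₂ ℕ._≤_ (swap-r ℤ.∣ period j (γ ^ᶠ e) ∣ r (2 ℕ.^ j ℕ.* r)) (twice (2 ℕ.^ j) r) (ℕP.+-monoˡ-≤ (2 ℕ.^ j ℕ.* r) (period-bound j (ℕP.<⇒≤ le) e))))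
      where
      swap-r : ∀ a r b → a ℕ.+ r ℕ.+ b ≡ a ℕ.+ b ℕ.+ r
      swap-r = ℕSolver.solve-∀
      twice : ∀ t r → t ℕ.* r ℕ.+ t ℕ.* r ≡ 2 ℕ.* t ℕ.* r
      twice = ℕSolver.solve-∀

    M<r : M ℕ.< r
    M<r = subst (M ℕ.<_) (sym p^v) (s≤s (subst (ℕ._≤ M ℕ.* c′) (ℕP.*-identityʳ M) (ℕP.*-monoʳ-≤ M 0<c′)))
      where
      c′ : ℕ
      c′ = proj₁ (proj₂ (proj₂ half-s))
      p^v : r ≡ 1 ℕ.+ M ℕ.* c′
      p^v = proj₂ (proj₂ (proj₂ half-s))
      0<v : 0 ℕ.< v
      0<v = ℕP.n≢0⇒n>0 λ z → ℕP.<⇒≢ 0<s (sym (trans (proj₁ (proj₂ half-s)) (cong (ℕ._* 2) z)))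
      0<c′ : 0 ℕ.< c′
      0<c′ = ℕP.n≢0⇒n>0 λ z → ℕP.<⇒≢ (p^<p^ 0<v) (sym (trans p^v (cong suc (trans (cong (M ℕ.*_) z) (ℕP.*-zeroʳ M)))))

  -- The period is less than 2^m √q in absolute value, and 2^m < √q because √q is 1 modulo 2^m and
  -- greater than 1. So no nonzero β has weight 0, which makes β ↦ `cw β` injective and the
  -- dimension s/ℓ.
  period≢Q : ∀ g → g ≢ 0# → period m g ≢ Q
  period≢Q g g≢0 with log g g≢0
  ... | e , refl = λ eq → ℕP.<⇒≱ (ℕP.*-monoˡ-< r {{ℕ.>-nonZero (1≤p^ v)}} M<r)
    (ℕP.≤-trans (ℕP.≤-reflexive (trans rr (sym (cong ℤ.∣_∣ eq)))) (ℕP.≤-trans (ℕP.m≤m+n _ r) (period-bound m ℕP.≤-refl e)))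
    where
    rr : r ℕ.* r ≡ suc q₁
    rr = ℤP.+-injective (trans (ℤP.pos-* r r) rt²)

  wt≢0 : ∀ β → β ≢ 0# → wt (cw β) ≢ 0
  wt≢0 β β≢0 e = period≢Q (inv β) (inv-≢0 β≢0) (sym (ℤP.i-j≡0⇒i≡j Q (period m (inv β)) ([ (λ z → ⊥-elim (ℕP.<⇒≢ 0<P₁ (sym (ℤP.+-injective z)))) , id ]′
    (ℤP.i*j≡0⇒i≡0∨j≡0 P₁ (trans (sym (weight β β≢0)) (cong (λ z → ℤ.+ z) (trans (cong (P ℕ.* N ℕ.*_) e) (ℕP.*-zeroʳ (P ℕ.* N)))))))))

  cw-entry : ∀ β i → lookup (cw β) i ≡ tr (β * (θ ^ᶠ toℕ i))
  cw-entry β i = VecP.lookup∘tabulate (λ i → tr (β * (θ ^ᶠ toℕ i))) i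

  vec-ext : ∀ {r} {u v : Vec Carrier r} → (∀ i → lookup u i ≡ lookup v i) → u ≡ v
  vec-ext {u = u} {v} h = trans (sym (VecP.tabulate∘lookup u)) (trans (VecP.tabulate-cong h) (VecP.tabulate∘lookup v))

  cw-0 : cw 0# ≡ zeroVec
  cw-0 = vec-ext λ i → trans (cw-entry 0# i) (trans (cong tr (zeroˡ _)) (trans tr-0 (sym (VecP.lookup-replicate i 0#))))

  wt-zeroVec : ∀ r → wt (zeroVec {r}) ≡ 0
  wt-zeroVec zero = refl
  wt-zeroVec (suc r) with 0# ≟ 0#
  ... | yes _ = wt-zeroVec r
  ... | no ne = ⊥-elim (ne refl)

  cw-kernel : ∀ β → cw β ≡ zeroVec → β ≡ 0#
  cw-kernel β e with β ≟ 0#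
  ... | yes z = z
  ... | no β≢0 = ⊥-elim (wt≢0 β β≢0 (trans (cong wt e) (wt-zeroVec n)))

  cw-+ : ∀ x y → cw (x + y) ≡ cw x ⊕ cw y
  cw-+ x y = vec-ext λ i → trans (cw-entry (x + y) i) (trans (cong tr (distribʳ _ x y)) (trans (tr-+ _ _) (sym (trans (VecP.lookup-zipWith _+_ i (cw x) (cw y)) (cong₂ _+_ (cw-entry x i) (cw-entry y i))))))

  cw-⊙ : ∀ c x → c ^ᶠ P ≡ c → cw (c * x) ≡ c ⊙ cw x
  cw-⊙ c x fix = vec-ext λ i → trans (cw-entry (c * x) i) (trans (cong tr (*-assoc c x _)) (trans (tr-* _ fix) (sym (trans (VecP.lookup-map i (c *_) (cw x)) (*-congˡ (cw-entry x i))))))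

  -1-fixed : (- 1#) ^ᶠ P ≡ - 1#
  -1-fixed = InK⇒fixed InK-−1

  cw-injective : ∀ {x y} → cw x ≡ cw y → x ≡ y
  cw-injective {x} {y} e = −≡0 (trans (+-congˡ (solve 1 (λ y → :- y := (:- con (ℤ.+ 1)) :* y) refl y)) (cw-kernel (x + (- 1#) * y)
    (trans (cw-+ x ((- 1#) * y)) (trans (cong₂ _⊕_ e (cw-⊙ (- 1#) y -1-fixed)) (vec-ext λ i →
      trans (VecP.lookup-zipWith _+_ i (cw y) ((- 1#) ⊙ cw y)) (trans (+-congˡ (VecP.lookup-map i ((- 1#) *_) (cw y))) (trans (solve 1 (λ a → a :+ (:- con (ℤ.+ 1)) :* a := con (ℤ.+ 0)) refl (lookup (cw y) i)) (sym (VecP.lookup-replicate i 0#))))))))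
    )
    where open FSolver using (solve; _:=_; _:+_; _:*_; :-_; con)

  θ≢0 : θ ≢ 0#
  θ≢0 = ^-≢0 N γ≢0

  θ⁻ : Carrier
  θ⁻ = inv θ

  private
    last-tabulate : ∀ r (g : Fin (suc r) → Carrier) → Vec.last (tabulate g) ≡ g (fromℕ r)
    last-tabulate zero g = refl
    last-tabulate (suc r) g = last-tabulate r (g ∘ Fin.suc)

    init-tabulate : ∀ r (g : Fin (suc r) → Carrier) → Vec.init (tabulate g) ≡ tabulate (g ∘ inject₁)
    init-tabulate zero g = refl
    init-tabulate (suc r) g = cong (g Fin.zero Vec.∷_) (init-tabulate r (g ∘ Fin.suc))

    shift-tabulate : ∀ r (a b : ℕ → Carrier) → (∀ i → b (suc i) ≡ a i) → b 0 ≡ a (r ∸ 1) →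
      tabulate {n = r} (λ i → b (toℕ i)) ≡ shift (tabulate (λ i → a (toℕ i)))
    shift-tabulate zero a b _ _ = refl
    shift-tabulate (suc r) a b hs h0 = cong₂ Vec._∷_ (trans h0 (sym (trans (last-tabulate r (λ i → a (toℕ i))) (cong a (FinP.toℕ-fromℕ r)))))
      (trans (VecP.tabulate-cong λ i → trans (hs (toℕ i)) (cong a (sym (FinP.toℕ-inject₁ i)))) (sym (init-tabulate r (λ i → a (toℕ i)))))

  -- `shift` moves the last coordinate to the front, hence the inverse of θ; the front entry matches
  -- because θ^n = 1.
  cw-shift : ∀ x → cw (θ⁻ * x) ≡ shift (cw x)
  cw-shift x = shift-tabulate n (λ i → tr (x * (θ ^ᶠ i))) (λ i → tr ((θ⁻ * x) * (θ ^ᶠ i)))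
      (λ i → cong tr (trans (solve 4 (λ t′ x t y → (t′ :* x) :* (t :* y) := (t :* t′) :* (x :* y)) refl θ⁻ x θ (θ ^ᶠ i)) (trans (*-congʳ (inv-r θ≢0)) (*-identityˡ _))))
      (cong tr (trans (*-identityʳ _) (trans (*-comm θ⁻ x) (*-congˡ θ⁻≡))))
    where
    open FSolver using (solve; _:=_; _:*_)
    θ⁻≡ : θ⁻ ≡ θ ^ᶠ (n ∸ 1)
    θ⁻≡ = *-cancelˡ θ≢0 (trans (inv-r θ≢0) (sym (trans (cong (θ ^ᶠ_) (ℕP.m+[n∸m]≡n 0<n)) θ^n)))

  ι-n≢0 : ι n ≢ 0#
  ι-n≢0 e = 1≢0 (trans (sym (+-identityʳ 1#)) (trans (+-congˡ (sym (trans (sym (cong ι nN≡q₁)) (trans (ι-* n N) (trans (*-congʳ e) (zeroˡ _)))))) ι-card))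

  private module S = CyclicSum isCommutativeSemiring

  tr-conj : ∀ r x → tr (conj r x) ≡ tr x
  tr-conj r x = trans (frobs (ℓ ℕ.* r) x) (conj-fix r (tr-fixed x))
    where
    frobs : ∀ i x → tr (x ^ᶠ (p ℕ.^ i)) ≡ tr x ^ᶠ (p ℕ.^ i)
    frobs zero x = trans (cong tr (*-identityʳ x)) (sym (*-identityʳ (tr x)))
    frobs (suc i) x = trans (cong tr (^-* x p (p ℕ.^ i))) (trans (frobs i (x ^ᶠ p)) (trans (cong (_^ᶠ (p ℕ.^ i)) (tr-frob x)) (sym (^-* (tr x) p (p ℕ.^ i)))))

  -- If θ lay in a proper subfield, γ and its conjugate would have the same codeword.
  θ-primitive : ∀ r → 0 ℕ.< r → r ℕ.< k → conj r θ ≢ θ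
  θ-primitive r 0<r r<k fix = ℕP.<⇒≱ small (∣ℕ.∣⇒≤ {{ℕ.>-nonZero pos′}} (γ^≡1⇒∣ (p ℕ.^ (ℓ ℕ.* r) ∸ 1)
      (*-cancelˡ γ≢0 (trans (cong (γ ^ᶠ_) (ℕP.m+[n∸m]≡n (1≤p^ (ℓ ℕ.* r)))) (trans fixγ (sym (*-identityʳ γ)))))))
    where
    pos′ : 0 ℕ.< p ℕ.^ (ℓ ℕ.* r) ∸ 1
    pos′ = ℕP.m<n⇒0<n∸m (p^<p^ (ℕP.*-mono-≤ 1≤ℓ 0<r))
    small : p ℕ.^ (ℓ ℕ.* r) ∸ 1 ℕ.< q₁
    small = ℕP.∸-monoˡ-< (p^<p^ (subst (ℓ ℕ.* r ℕ.<_) (sym s≡ℓk) (ℕP.*-monoʳ-< ℓ {{ℕ.>-nonZero 1≤ℓ}} r<k))) (1≤p^ (ℓ ℕ.* r))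
    fixγ : conj r γ ≡ γ
    fixγ = cw-injective (vec-ext λ i → trans (cw-entry (conj r γ) i) (trans (cong tr (entry (toℕ i))) (trans (tr-conj r (γ * (θ ^ᶠ toℕ i))) (sym (cw-entry γ i)))))
      where
      entry : ∀ i → conj r γ * (θ ^ᶠ i) ≡ conj r (γ * (θ ^ᶠ i))
      entry i = sym (trans (*-^ γ (θ ^ᶠ i) (p ℕ.^ (ℓ ℕ.* r))) (*-congˡ (trans (^-comm θ i (p ℕ.^ (ℓ ℕ.* r))) (cong (_^ᶠ i) fix))))

  geometric : ∀ z r → (z − 1#) * S.Σ< r (z ^ᶠ_) ≡ (z ^ᶠ r) − 1#
  geometric z zero = trans (zeroʳ _) (sym (-‿inverseʳ 1#))
  geometric z (suc r) = trans (distribˡ _ _ _) (trans (+-congˡ (trans (*-congˡ (S.Σ<-*ˡ r z (z ^ᶠ_))) (trans (solve 3 (λ a z s → a :* (z :* s) := z :* (a :* s)) refl (z − 1#) z (S.Σ< r (z ^ᶠ_))) (*-congˡ (geometric z r)))))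
    (solve 2 (λ z x → (z :- con (ℤ.+ 1)) :* con (ℤ.+ 1) :+ z :* (x :- con (ℤ.+ 1)) := z :* x :- con (ℤ.+ 1)) refl z (z ^ᶠ r)))
    where open FSolver using (solve; _:=_; _:+_; _:*_; _:-_; con)

  -- The powers of θ span F over the subfield, with dual coordinates given by the trace.
  dual-expansion : ∀ δ → S.Σ< n (λ i → tr (δ * (θ ^ᶠ i)) * (θ⁻ ^ᶠ i)) ≡ ι n * δ
  dual-expansion δ = begin
    S.Σ< n (λ i → tr (δ * (θ ^ᶠ i)) * (θ⁻ ^ᶠ i)) ≡⟨ S.Σ<-cong n (λ i _ → trans (*-comm _ _) (trans (*-congˡ (tr≡ (δ * (θ ^ᶠ i)))) (trans (sym (S.Σ<-*ˡ k (θ⁻ ^ᶠ i) _)) (S.Σ<-cong k λ r _ → term i r)))) ⟩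
    S.Σ< n (λ i → S.Σ< k (λ r → conj r δ * (ζ r ^ᶠ i))) ≡⟨ S.Σ<-swap n k _ ⟩
    S.Σ< k (λ r → S.Σ< n (λ i → conj r δ * (ζ r ^ᶠ i))) ≡⟨ S.Σ<-cong k (λ r _ → S.Σ<-*ˡ n (conj r δ) (ζ r ^ᶠ_)) ⟩
    S.Σ< k G ≡⟨ split k refl 0<k ⟩
    ι n * δ ∎
    where
    open ≡-Reasoning
    open FSolver using (solve; _:=_; _:*_)
    ζ : ℕ → Carrier
    ζ r = conj r θ * θ⁻
    G : ℕ → Carrier
    G r = conj r δ * S.Σ< n (ζ r ^ᶠ_)
    term : ∀ i r → (θ⁻ ^ᶠ i) * conj r (δ * (θ ^ᶠ i)) ≡ conj r δ * (ζ r ^ᶠ i)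
    term i r = trans (*-congˡ (trans (*-^ δ (θ ^ᶠ i) (p ℕ.^ (ℓ ℕ.* r))) (*-congˡ (^-comm θ i (p ℕ.^ (ℓ ℕ.* r))))))
      (trans (solve 3 (λ a b c → a :* (b :* c) := b :* (c :* a)) refl (θ⁻ ^ᶠ i) (conj r δ) (conj r θ ^ᶠ i)) (*-congˡ (sym (*-^ (conj r θ) θ⁻ i))))
    ζ^n : ∀ r → ζ r ^ᶠ n ≡ 1#
    ζ^n r = trans (*-^ (conj r θ) θ⁻ n) (trans (cong₂ _*_ (trans (^-comm θ (p ℕ.^ (ℓ ℕ.* r)) n) (trans (cong (_^ᶠ (p ℕ.^ (ℓ ℕ.* r))) θ^n) (1^ (p ℕ.^ (ℓ ℕ.* r)))))
      (trans (sym (*-identityˡ _)) (trans (*-congʳ (sym θ^n)) (trans (sym (*-^ θ θ⁻ n)) (trans (cong (_^ᶠ n) (inv-r θ≢0)) (1^ n)))))) (*-identityˡ 1#))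
    -- The ratio of a conjugate of θ to θ is an n-th root of unity different from 1, so its
    -- geometric sum vanishes.
    G-0 : ∀ r → 0 ℕ.< r → r ℕ.< k → G r ≡ 0#
    G-0 r 0<r r<k = trans (*-congˡ ([ (λ e → ⊥-elim (θ-primitive r 0<r r<k (trans (sym (inv-cancel′ (conj r θ))) (trans (*-congˡ (−≡0 e)) (*-identityʳ θ))))) , id ]′
      (integral (trans (geometric (ζ r) n) (≡⇒−≡0 (ζ^n r)))))) (zeroʳ _)
      where
      inv-cancel′ : ∀ a → θ * (a * θ⁻) ≡ a
      inv-cancel′ a = trans (solve 3 (λ t a i → t :* (a :* i) := (t :* i) :* a) refl θ a θ⁻) (trans (*-congʳ (inv-r θ≢0)) (*-identityˡ a))
    G-first : G 0 ≡ ι n * δ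
    G-first = trans (cong₂ _*_ (conj-0 δ) (trans (S.Σ<-cong n λ i _ → trans (cong (_^ᶠ i) (trans (*-congʳ (conj-0 θ)) (inv-r θ≢0))) (1^ i)) (trans (S.Σ<-const n 1#) (*-identityʳ _)))) (*-comm δ (ι n))
    split : ∀ r → r ≡ k → 0 ℕ.< r → S.Σ< r G ≡ ι n * δ
    split (suc r) r≡k _ = trans (cong₂ _+_ G-first (S.Σ<-0 r λ i i<r → G-0 (suc i) (s≤s z≤n) (subst (suc i ℕ.<_) r≡k (s≤s i<r)))) (+-identityʳ _)

  private
    D : Vec Carrier n → Set
    D = InCode p ℓ k N n γ

  code-cyclic : IsCyclicSubspace p ℓ n D
  code-cyclic = (λ { _ (β , refl) i → trans (cong (_^ᶠ P) (cw-entry β i)) (trans (tr-fixed _) (sym (cw-entry β i))) })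
    , (0# , cw-0)
    , (λ { _ _ (x , refl) (y , refl) → x + y , cw-+ x y })
    , (λ { a _ fix (x , refl) → a * x , cw-⊙ a x fix })
    , (λ { _ (x , refl) → θ⁻ * x , cw-shift x })

  fixed-ι : ∀ r → ι r ^ᶠ P ≡ ι r
  fixed-ι zero = 0^p^ ℓ
  fixed-ι (suc r) = trans (frobⁱ-+ ℓ 1# (ι r)) (cong₂ _+_ (1^ P) (fixed-ι r))

  -- A nonzero `E` contains some `cw β` with β ≠ 0, hence by shifts all codewords of θ^(-i) β.
  -- `dual-expansion` for δ = β′/β writes n β′ as a combination of these arguments over the
  -- subfield, and n is invertible there.
  code-minimal : ∀ (E : Vec Carrier n → Set) → IsCyclicSubspace p ℓ n E → (∀ v → E v → D v) → (∃ λ v → E v × v ≢ zeroVec) → ∀ v → D v → E v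
  code-minimal E (_ , E-0 , E-+ , E-⊙ , E-shift) E⊆D (v₀ , Ev₀ , v₀≢0) _ (β′ , refl) = generate (E⊆D v₀ Ev₀)
    where
    B : Carrier → Set
    B x = E (cw x)
    B-Σ : ∀ r (g : ℕ → Carrier) → (∀ i → B (g i)) → B (S.Σ< r g)
    B-Σ zero g h = subst E (sym cw-0) E-0
    B-Σ (suc r) g h = subst E (sym (cw-+ (g 0) (S.Σ< r (g ∘ suc)))) (E-+ _ _ (h 0) (B-Σ r (g ∘ suc) (h ∘ suc)))
    B-⊙ : ∀ c x → c ^ᶠ P ≡ c → B x → B (c * x)
    B-⊙ c x fix Bx = subst E (sym (cw-⊙ c x fix)) (E-⊙ c (cw x) fix Bx)
    B-θ : ∀ i x → B x → B ((θ⁻ ^ᶠ i) * x)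
    B-θ zero x Bx = subst B (sym (*-identityˡ x)) Bx
    B-θ (suc i) x Bx = subst B (sym (*-assoc θ⁻ (θ⁻ ^ᶠ i) x)) (subst E (sym (cw-shift ((θ⁻ ^ᶠ i) * x))) (E-shift _ (B-θ i x Bx)))
    generate : D v₀ → B β′
    generate (β , refl) = subst B total (B-⊙ c (S.Σ< n g) c-fixed (B-Σ n g λ i → B-⊙ (tr (δ * (θ ^ᶠ i))) ((θ⁻ ^ᶠ i) * β) (tr-fixed _) (B-θ i β Ev₀)))
      where
      β≢0 : β ≢ 0#
      β≢0 refl = v₀≢0 cw-0
      δ c : Carrier
      δ = β′ * inv β
      c = inv (ι n)
      c-fixed : c ^ᶠ P ≡ c
      c-fixed = InK⇒fixed (InK-inv (fixed⇒InK ι-n≢0 (fixed-ι n)))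
      g : ℕ → Carrier
      g i = tr (δ * (θ ^ᶠ i)) * ((θ⁻ ^ᶠ i) * β)
      total : c * S.Σ< n g ≡ β′
      total = trans (*-congˡ (trans (S.Σ<-cong n λ i _ → trans (sym (*-assoc _ _ β)) (*-comm _ β)) (trans (S.Σ<-*ˡ n β _) (*-congˡ (dual-expansion δ)))))
        (trans (solve 5 (λ c b n b′ i → c :* (b :* (n :* (b′ :* i))) := ((c :* n) :* (b :* i)) :* b′) refl c β (ι n) β′ (inv β))
          (trans (*-congʳ (trans (cong₂ _*_ (inv-l ι-n≢0) (inv-r β≢0)) (*-identityˡ 1#))) (*-identityˡ β′)))
        where open FSolver using (solve; _:=_; _:*_)

  code-irreducible : IsIrreducibleCyclic p ℓ n D
  code-irreducible = code-cyclic , (cw 1# , (1# , refl) , λ e → 1≢0 (cw-kernel 1# e)) , code-minimal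

-- Counting codewords by the 2-adic valuation of the exponent.

deduplicate-unique : {X : Set} (_≈?_ : (x y : X) → Dec (x ≡ y)) (xs : List X) → Unique xs → List.deduplicate _≈?_ xs ≡ xs
deduplicate-unique _≈?_ [] _ = refl
deduplicate-unique _≈?_ (x ∷ xs) (x∉ ∷ u) = cong (x ∷_) (trans (cong (List.filter (λ y → ¬? (x ≈? y))) (deduplicate-unique _≈?_ xs u))
  (ListP.filter-all (λ y → ¬? (x ≈? y)) x∉))

foldr-map-Σ< : ∀ (g : ℕ → ℤ) (h f : ℕ → ℕ) r → List.foldr ℤ._+_ ℤ.0ℤ (map g (map h (applyUpTo f r))) ≡ Sum.Σ< ℤP.+-*-isCommutativeSemiring r (λ i → g (h (f i)))
foldr-map-Σ< g h f zero = refl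
foldr-map-Σ< g h f (suc r) = cong (λ z → g (h (f 0)) ℤ.+ z) (foldr-map-Σ< g h (f ∘ suc) r)

module Enumeration (σ : Setting) (N n : ℕ) (nN≡q₁ : n ℕ.* N ≡ Characteristic.q₁ σ)
                   (gcd≡ : gcd N (Setting.R′ σ ℕ.* 2 ℕ.^ Setting.m σ) ≡ 2 ℕ.^ Setting.m σ)
                   (A B : ℕ → ℤ)
                   (AB : ∀ r → 3 ℕ.≤ r → r ℕ.≤ Setting.m σ →
                     (ℤ.+ (Setting.p σ ℕ.^ half^ (r ∸ 2) (Setting.s σ)) ≡ A r ℤ.* A r ℤ.+ ℤ.+ 2 ℤ.* B r ℤ.* B r)
                     × (4 ∣ℕ.∣ ℤ.∣ A r ℤ.+ ℤ.1ℤ ∣) × ¬ (Setting.p σ ∣ℕ.∣ ℤ.∣ A r ∣)) where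
  open Weights σ N n nN≡q₁ gcd≡ public
  open Coefficients A B AB public
  module C = CyclicSum ℕP.+-*-isCommutativeSemiring

  private
    ιN : ∀ r → C.ι r ≡ r
    ιN zero = refl
    ιN (suc r) = cong suc (ιN r)

    codewords≡ : codewords p ℓ k N n γ ≡ map cw elements
    codewords≡ = deduplicate-unique (VecP.≡-dec _≟_) (map cw elements) (UniqueP.map⁺ cw-injective unique)

  code-size : length (codewords p ℓ k N n γ) ≡ (p ℕ.^ ℓ) ℕ.^ k
  code-size = trans (cong length codewords≡) (trans (ListP.length-map cw elements) (trans card≡p^s (trans (cong (p ℕ.^_) s≡ℓk) (sym (ℕP.^-*-assoc p ℓ k)))))

  -- The value at exponents of valuation exactly i of the periods of order 2^(i+1) and, by
  -- `period-at₂`, of order 2^(i+2).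
  base : ℕ → ℤ
  base i = period i 1# ℤ.- 2^ i ℤ.* xv (suc i)

  module _ (j : ℕ) where
    hits : ℤ → ℕ
    hits E = C.𝟙 (ℤ.+ (p ℕ.^ ℓ ℕ.* N ℕ.* j) ℤ.≟ ℤ.+ (p ℕ.^ ℓ ∸ 1) ℤ.* E)

    total : List Term → ℕ
    total [] = 0
    total ((a , E) ∷ ts) = a ℕ.* hits E ℕ.+ total ts

    total-++ : ∀ xs ys → total (xs ++ ys) ≡ total xs ℕ.+ total ys
    total-++ [] ys = refl
    total-++ ((a , E) ∷ xs) ys = trans (cong (a ℕ.* hits E ℕ.+_) (total-++ xs ys)) (sym (ℕP.+-assoc (a ℕ.* hits E) (total xs) (total ys)))

    private
      if-* : ∀ {X : Set} a (dec : Dec X) → (if ⌊ dec ⌋ then a else 0) ≡ a ℕ.* C.𝟙 dec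
      if-* a (yes _) = sym (ℕP.*-identityʳ a)
      if-* a (no _) = sym (ℕP.*-zeroʳ a)

    enumCoeff-total : ∀ ts → enumCoeff p ℓ N ts j ≡ C.𝟙 (j ℕ.≟ 0) ℕ.+ total ts
    enumCoeff-total [] = cong (ℕ._+ 0) (trans (if-* 1 (j ℕ.≟ 0)) (ℕP.*-identityˡ _))
    enumCoeff-total ((a , E) ∷ ts) = trans (swap3 (if ⌊ j ℕ.≟ 0 ⌋ then 1 else 0) (if ⌊ ℤ.+ (p ℕ.^ ℓ ℕ.* N ℕ.* j) ℤ.≟ ℤ.+ (p ℕ.^ ℓ ∸ 1) ℤ.* E ⌋ then a else 0) _)
      (trans (cong₂ ℕ._+_ (if-* a (ℤ.+ (p ℕ.^ ℓ ℕ.* N ℕ.* j) ℤ.≟ ℤ.+ (p ℕ.^ ℓ ∸ 1) ℤ.* E)) (enumCoeff-total ts)) (swap3 (a ℕ.* hits E) (C.𝟙 (j ℕ.≟ 0)) (total ts)))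
      where
      swap3 : ∀ a b c → a ℕ.+ (b ℕ.+ c) ≡ b ℕ.+ (a ℕ.+ c)
      swap3 = ℕSolver.solve-∀

    φ : Carrier → ℕ
    φ g = hits (Q ℤ.- period m g)

    private
      length-filter-map : ∀ {X Y : Set} {T : Y → Set} (T? : ∀ y → Dec (T y)) (g : X → Y) xs → length (List.filter T? (map g xs)) ≡ C.ΣL xs (λ x → C.𝟙 (T? (g x)))
      length-filter-map T? g [] = refl
      length-filter-map T? g (x ∷ xs) with T? (g x)
      ... | yes _ = cong suc (length-filter-map T? g xs)
      ... | no _ = length-filter-map T? g xs

      wt-φ : ∀ β → β ≢ 0# → C.𝟙 (wt (cw β) ℕ.≟ j) ≡ φ (inv β)
      wt-φ β β≢0 = C.𝟙-cong (wt (cw β) ℕ.≟ j) (ℤ.+ (p ℕ.^ ℓ ℕ.* N ℕ.* j) ℤ.≟ ℤ.+ (p ℕ.^ ℓ ∸ 1) ℤ.* (Q ℤ.- period m (inv β)))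
        (λ e → trans (cong (λ z → ℤ.+ (P ℕ.* N ℕ.* z)) (sym e)) (weight β β≢0))
        (λ e → ℕP.*-cancelˡ-≡ _ _ (P ℕ.* N) {{ℕ.>-nonZero (ℕP.*-mono-≤ {1} (1≤p^ ℓ) 0<N)}} (ℤP.+-injective (trans (weight β β≢0) (sym e))))

      inv-0 : inv 0# ≡ 0#
      inv-0 with 0# ≟ 0#
      ... | yes _ = refl
      ... | no ne = ⊥-elim (ne refl)

      inv-inv : ∀ x → inv (inv x) ≡ x
      inv-inv x with x ≟ 0#
      ... | yes refl = inv-0
      ... | no x≢0 = *-cancelˡ i≢0 (trans (inv-r i≢0) (sym i*x))
        where
        i*x : proj₁ (inverse x x≢0) * x ≡ 1#
        i*x = trans (*-comm _ x) (proj₂ (inverse x x≢0))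
        i≢0 : proj₁ (inverse x x≢0) ≢ 0#
        i≢0 e = 1≢0 (trans (sym i*x) (trans (*-congʳ e) (zeroˡ x)))

    -- The share of exponents divisible by 2^i. Peeling off valuation exactly i produces one group
    -- of terms of the enumerator at a time.
    tally : ℕ → ℕ
    tally i = C.Σ< (f ℕ.* 2 ℕ.^ (m ∸ i)) (λ b → φ (γ ^ᶠ (2 ℕ.^ i ℕ.* b)))

    weightCount-S : weightCount p ℓ k N n γ j ≡ C.𝟙 (j ℕ.≟ 0) ℕ.+ tally 0
    weightCount-S = begin
      weightCount p ℓ k N n γ j ≡⟨ cong (λ cs → length (List.filter (λ v → wt v ℕ.≟ j) cs)) codewords≡ ⟩
      length (List.filter (λ v → wt v ℕ.≟ j) (map cw elements)) ≡⟨ length-filter-map (λ v → wt v ℕ.≟ j) cw elements ⟩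
      C.ΣF (λ β → C.𝟙 (wt (cw β) ℕ.≟ j)) ≡⟨ C.ΣF-powers _ ⟩
      C.𝟙 (wt (cw 0#) ℕ.≟ j) ℕ.+ C.Σ< q₁ (λ e → C.𝟙 (wt (cw (γ ^ᶠ e)) ℕ.≟ j)) ≡⟨ cong₂ ℕ._+_ (C.𝟙-cong (wt (cw 0#) ℕ.≟ j) (j ℕ.≟ 0) (λ e → trans (sym e) wt0) (λ e → trans wt0 (sym e)))
           (trans (C.Σ<-cong q₁ λ e _ → wt-φ (γ ^ᶠ e) (^-≢0 e γ≢0)) reindexed) ⟩
      C.𝟙 (j ℕ.≟ 0) ℕ.+ tally 0 ∎
      where
      open ≡-Reasoning
      wt0 : wt (cw 0#) ≡ 0
      wt0 = trans (cong wt cw-0) (wt-zeroVec n)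
      reindexed : C.Σ< q₁ (λ e → φ (inv (γ ^ᶠ e))) ≡ tally 0
      reindexed = trans (ℕP.+-cancelˡ-≡ (φ 0#) _ _ (trans (cong (λ z → φ z ℕ.+ C.Σ< q₁ (λ e → φ (inv (γ ^ᶠ e)))) (sym inv-0))
        (trans (sym (C.ΣF-powers (λ x → φ (inv x)))) (trans (C.ΣF-reindex inv inv inv-inv φ) (C.ΣF-powers φ)))))
        (trans (cong (λ r → C.Σ< r (λ e → φ (γ ^ᶠ e))) q₁≡f*2^m) (C.Σ<-cong (f ℕ.* 2 ℕ.^ m) λ e _ → cong (λ z → φ (γ ^ᶠ z)) (sym (ℕP.*-identityˡ e))))

    private
      odd : ℕ → ℕ → ℕ
      odd i b = 2 ℕ.^ i ℕ.* (1 ℕ.+ b ℕ.* 2)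

      -- Level 3 + i adds the value y or -y; all higher levels contribute 0 at valuation i, by
      -- `vanish-4`. So the period of order 2^m is settled at level 3 + i.
      period-3 : ∀ i c b → 3 ℕ.+ (i ℕ.+ c) ℕ.≤ m → period (3 ℕ.+ (i ℕ.+ c)) (γ ^ᶠ odd i b) ≡ base i ℤ.+ 2^ (2 ℕ.+ i) ℤ.* octant (xv (3 ℕ.+ i)) (yv i) (1 ℕ.+ b ℕ.* 2)
      period-3 i zero b le = subst (λ z → 3 ℕ.+ z ℕ.≤ m → period (3 ℕ.+ z) (γ ^ᶠ odd i b) ≡ base i ℤ.+ 2^ (2 ℕ.+ i) ℤ.* octant (xv (3 ℕ.+ i)) (yv i) (1 ℕ.+ b ℕ.* 2)) (sym (ℕP.+-identityʳ i))
        (λ le → trans (period-suc (2 ℕ.+ i) (γ ^ᶠ odd i b) le) (cong₂ (λ a c → a ℤ.+ 2^ (2 ℕ.+ i) ℤ.* c) (period-at₂ i b (ℕP.<⇒≤ le)) (Level.values i le (d-class (3 ℕ.+ i)) (1 ℕ.+ b ℕ.* 2)))) le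
      period-3 i (suc c) b le = subst (λ z → 3 ℕ.+ z ℕ.≤ m → period (3 ℕ.+ z) (γ ^ᶠ odd i b) ≡ base i ℤ.+ 2^ (2 ℕ.+ i) ℤ.* octant (xv (3 ℕ.+ i)) (yv i) (1 ℕ.+ b ℕ.* 2)) (sym (ℕP.+-suc i c))
        (λ le → trans (period-suc (3 ℕ.+ (i ℕ.+ c)) (γ ^ᶠ odd i b) le) (trans (cong₂ (λ a z → a ℤ.+ 2^ (3 ℕ.+ (i ℕ.+ c)) ℤ.* z) (period-3 i c b (ℕP.<⇒≤ le)) (vanish-4 {i} {c} (d-class (4 ℕ.+ (i ℕ.+ c))) le b))
          (trans (cong (λ z → base i ℤ.+ 2^ (2 ℕ.+ i) ℤ.* octant (xv (3 ℕ.+ i)) (yv i) (1 ℕ.+ b ℕ.* 2) ℤ.+ z) (ℤP.*-zeroʳ (2^ (3 ℕ.+ (i ℕ.+ c))))) (ℤP.+-identityʳ _)))) le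

      q₁≡ : ∀ a b → a ℕ.+ b ≡ m → q₁ ≡ f ℕ.* 2 ℕ.^ a ℕ.* 2 ℕ.^ b
      q₁≡ a b e = trans q₁≡f*2^m (trans (cong (λ z → f ℕ.* 2 ℕ.^ z) (sym e)) (trans (cong (f ℕ.*_) (ℕP.^-distribˡ-+-* 2 a b)) (sym (ℕP.*-assoc f (2 ℕ.^ a) (2 ℕ.^ b)))))

      half-q₁ : ∀ a b → a ℕ.+ b ≡ m → half^ b q₁ ≡ f ℕ.* 2 ℕ.^ a
      half-q₁ a b e = trans (cong (half^ b) (q₁≡ a b e)) (half^-exact b (f ℕ.* 2 ℕ.^ a))

      even-odd : ∀ a i → m ∸ i ≡ suc a → tally i ≡ C.Σ< (f ℕ.* 2 ℕ.^ a) (λ b → φ (γ ^ᶠ odd i b)) ℕ.+ tally (suc i)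
      even-odd a i e = begin
        tally i ≡⟨ cong (λ r → C.Σ< r F) (trans (cong (λ z → f ℕ.* 2 ℕ.^ z) e) (lem f (2 ℕ.^ a))) ⟩
        C.Σ< (f ℕ.* 2 ℕ.^ a ℕ.* 2) F ≡⟨ C.Σ<-even-odd (f ℕ.* 2 ℕ.^ a) F ⟩
        C.Σ< (f ℕ.* 2 ℕ.^ a) (λ b → F (b ℕ.* 2)) ℕ.+ C.Σ< (f ℕ.* 2 ℕ.^ a) (λ b → φ (γ ^ᶠ odd i b)) ≡⟨ ℕP.+-comm _ (C.Σ< (f ℕ.* 2 ℕ.^ a) (λ b → φ (γ ^ᶠ odd i b))) ⟩
        C.Σ< (f ℕ.* 2 ℕ.^ a) (λ b → φ (γ ^ᶠ odd i b)) ℕ.+ C.Σ< (f ℕ.* 2 ℕ.^ a) (λ b → F (b ℕ.* 2)) ≡⟨ cong (C.Σ< (f ℕ.* 2 ℕ.^ a) (λ b → φ (γ ^ᶠ odd i b)) ℕ.+_)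
             (trans (C.Σ<-cong (f ℕ.* 2 ℕ.^ a) λ b _ → cong (λ z → φ (γ ^ᶠ z)) (lem₂ (2 ℕ.^ i) b)) (cong (λ z → C.Σ< (f ℕ.* 2 ℕ.^ z) (λ b → φ (γ ^ᶠ (2 ℕ.^ suc i ℕ.* b)))) (sym m∸))) ⟩
        C.Σ< (f ℕ.* 2 ℕ.^ a) (λ b → φ (γ ^ᶠ odd i b)) ℕ.+ tally (suc i) ∎
        where
        open ≡-Reasoning
        F : ℕ → ℕ
        F b = φ (γ ^ᶠ (2 ℕ.^ i ℕ.* b))
        m∸ : m ∸ suc i ≡ a
        m∸ = trans (sym (ℕP.pred[m∸n]≡m∸[1+n] m i)) (cong ℕ.pred e)
        lem : ∀ f x → f ℕ.* (2 ℕ.* x) ≡ f ℕ.* x ℕ.* 2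
        lem = ℕSolver.solve-∀
        lem₂ : ∀ x b → x ℕ.* (b ℕ.* 2) ≡ 2 ℕ.* x ℕ.* b
        lem₂ = ℕSolver.solve-∀

      const-sum : ∀ r {F : ℕ → ℕ} c → (∀ b → F b ≡ c) → C.Σ< r F ≡ r ℕ.* c
      const-sum r c h = trans (C.Σ<-cong r λ b _ → h b) (trans (C.Σ<-const r c) (cong (ℕ._* c) (ιN r)))

    -- At odd places the octant pattern reads y, y, -y, -y. So the (q-1)/2^(i+1) exponents of
    -- valuation i split into two halves, and replacing y by -y only exchanges them.
    step-3 : ∀ i → 3 ℕ.+ i ℕ.≤ m → tally i ≡
      half^ (2 ℕ.+ i) q₁ ℕ.* hits (Q ℤ.- (base i ℤ.+ 2^ (2 ℕ.+ i) ℤ.* YY i)) ℕ.+ half^ (2 ℕ.+ i) q₁ ℕ.* hits (Q ℤ.- (base i ℤ.- 2^ (2 ℕ.+ i) ℤ.* YY i)) ℕ.+ tally (suc i)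
    step-3 i le = trans (even-odd (2 ℕ.+ c) i m∸i) (cong (ℕ._+ tally (suc i)) (trans odd-sum (trans (cong (λ z → z ℕ.* (α (yv i) ℕ.+ α (ℤ.- yv i))) (sym half≡)) (trans (cong (half^ (2 ℕ.+ i) q₁ ℕ.*_) (sign (yv≡ i le)))
        (trans (ℕP.*-distribˡ-+ (half^ (2 ℕ.+ i) q₁) (α (YY i)) (α (ℤ.- YY i))) (cong (λ z → half^ (2 ℕ.+ i) q₁ ℕ.* α (YY i) ℕ.+ half^ (2 ℕ.+ i) q₁ ℕ.* hits (Q ℤ.- (base i ℤ.+ z))) (sym (ℤP.neg-distribʳ-* (2^ (2 ℕ.+ i)) (YY i)))))))))
      where
      c : ℕ
      c = m ∸ (3 ℕ.+ i)
      m≡ic : 3 ℕ.+ (i ℕ.+ c) ≡ m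
      m≡ic = ℕP.m+[n∸m]≡n le
      m∸i : m ∸ i ≡ 3 ℕ.+ c
      m∸i = trans (cong (_∸ i) (trans (sym m≡ic) (lem i c))) (ℕP.m+n∸m≡n i (3 ℕ.+ c))
        where
        lem : ∀ i c → 3 ℕ.+ (i ℕ.+ c) ≡ i ℕ.+ (3 ℕ.+ c)
        lem = ℕSolver.solve-∀
      α : ℤ → ℕ
      α z = hits (Q ℤ.- (base i ℤ.+ 2^ (2 ℕ.+ i) ℤ.* z))
      half≡ : half^ (2 ℕ.+ i) q₁ ≡ f ℕ.* 2 ℕ.^ (1 ℕ.+ c)
      half≡ = half-q₁ (1 ℕ.+ c) (2 ℕ.+ i) (trans (lem i c) m≡ic)
        where
        lem : ∀ i c → (1 ℕ.+ c) ℕ.+ (2 ℕ.+ i) ≡ 3 ℕ.+ (i ℕ.+ c)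
        lem = ℕSolver.solve-∀
      sign : yv i ≡ YY i ⊎ yv i ≡ ℤ.- YY i → α (yv i) ℕ.+ α (ℤ.- yv i) ≡ α (YY i) ℕ.+ α (ℤ.- YY i)
      sign (inj₁ e) = cong (λ z → α z ℕ.+ α (ℤ.- z)) e
      sign (inj₂ e) = trans (cong (λ z → α z ℕ.+ α (ℤ.- z)) e) (trans (cong (λ z → α (ℤ.- YY i) ℕ.+ α z) (ℤP.neg-involutive (YY i))) (ℕP.+-comm (α (ℤ.- YY i)) (α (YY i))))
      O : ℕ → ℕ
      O b = α (octant (xv (3 ℕ.+ i)) (yv i) (1 ℕ.+ b ℕ.* 2))
      odd-sum : C.Σ< (f ℕ.* 2 ℕ.^ (2 ℕ.+ c)) (λ b → φ (γ ^ᶠ odd i b)) ≡ f ℕ.* 2 ℕ.^ (1 ℕ.+ c) ℕ.* (α (yv i) ℕ.+ α (ℤ.- yv i))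
      odd-sum = begin
        C.Σ< (f ℕ.* 2 ℕ.^ (2 ℕ.+ c)) (λ b → φ (γ ^ᶠ odd i b)) ≡⟨ C.Σ<-cong (f ℕ.* 2 ℕ.^ (2 ℕ.+ c)) (λ b _ → cong (λ z → hits (Q ℤ.- z)) (subst (λ z → period z (γ ^ᶠ odd i b) ≡ base i ℤ.+ 2^ (2 ℕ.+ i) ℤ.* octant (xv (3 ℕ.+ i)) (yv i) (1 ℕ.+ b ℕ.* 2)) m≡ic (period-3 i c b (ℕP.≤-reflexive m≡ic)))) ⟩
        C.Σ< (f ℕ.* 2 ℕ.^ (2 ℕ.+ c)) O ≡⟨ cong (λ r → C.Σ< r O) (lem f (2 ℕ.^ c)) ⟩
        C.Σ< (f ℕ.* 2 ℕ.^ c ℕ.* 4) O ≡⟨ C.Σ<-periodic (f ℕ.* 2 ℕ.^ c) 4 O (λ _ → refl) ⟩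
        C.ι (f ℕ.* 2 ℕ.^ c) ℕ.* (α (yv i) ℕ.+ (α (yv i) ℕ.+ (α (ℤ.- yv i) ℕ.+ (α (ℤ.- yv i) ℕ.+ 0)))) ≡⟨ cong (ℕ._* (α (yv i) ℕ.+ (α (yv i) ℕ.+ (α (ℤ.- yv i) ℕ.+ (α (ℤ.- yv i) ℕ.+ 0))))) (ιN (f ℕ.* 2 ℕ.^ c)) ⟩
        f ℕ.* 2 ℕ.^ c ℕ.* (α (yv i) ℕ.+ (α (yv i) ℕ.+ (α (ℤ.- yv i) ℕ.+ (α (ℤ.- yv i) ℕ.+ 0)))) ≡⟨ lem₂ f (2 ℕ.^ c) (α (yv i)) (α (ℤ.- yv i)) ⟩
        f ℕ.* 2 ℕ.^ (1 ℕ.+ c) ℕ.* (α (yv i) ℕ.+ α (ℤ.- yv i)) ∎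
        where
        open ≡-Reasoning
        lem : ∀ f x → f ℕ.* (2 ℕ.* (2 ℕ.* x)) ≡ f ℕ.* x ℕ.* 4
        lem = ℕSolver.solve-∀
        lem₂ : ∀ f x a b → f ℕ.* x ℕ.* (a ℕ.+ (a ℕ.+ (b ℕ.+ (b ℕ.+ 0)))) ≡ f ℕ.* (2 ℕ.* x) ℕ.* (a ℕ.+ b)
        lem₂ = ℕSolver.solve-∀

    -- Valuation m - 2: level m contributes 0, so all these exponents share one value.
    step-2 : ∀ i → 2 ℕ.+ i ≡ m → tally i ≡ half^ (1 ℕ.+ i) q₁ ℕ.* hits (Q ℤ.- base i) ℕ.+ tally (suc i)
    step-2 i e = trans (even-odd 1 i (trans (cong (_∸ i) (sym e)) (ℕP.m+n∸n≡m 2 i))) (cong (ℕ._+ tally (suc i))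
      (trans (const-sum (f ℕ.* 2 ℕ.^ 1) (hits (Q ℤ.- base i)) λ b → cong (λ z → hits (Q ℤ.- z)) (subst (λ z → period z (γ ^ᶠ odd i b) ≡ base i) e (period-at₂ i b (ℕP.≤-reflexive e))))
        (cong (ℕ._* hits (Q ℤ.- base i)) (sym (half-q₁ 1 (1 ℕ.+ i) e)))))

    -- The two last classes: valuation exactly m - 1, and the exponents divisible by 2^m, where the
    -- period is its value at 1.
    step-1 : ∀ i → 1 ℕ.+ i ≡ m → tally i ≡ half^ (1 ℕ.+ i) q₁ ℕ.* hits (Q ℤ.- base i) ℕ.+ half^ (1 ℕ.+ i) q₁ ℕ.* hits (Q ℤ.- (period i 1# ℤ.+ 2^ i ℤ.* xv (suc i)))
    step-1 i e = trans (even-odd 0 i (trans (cong (_∸ i) (sym e)) (ℕP.m+n∸n≡m 1 i))) (cong₂ ℕ._+_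
      (trans (const-sum (f ℕ.* 1) (hits (Q ℤ.- base i)) λ b → cong (λ z → hits (Q ℤ.- z)) (subst (λ z → period z (γ ^ᶠ odd i b) ≡ base i) e (period-at i b (ℕP.≤-reflexive e))))
        (cong (ℕ._* hits (Q ℤ.- base i)) (sym (half-q₁ 0 (1 ℕ.+ i) e))))
      (trans (cong tally e) (trans (cong (λ z → C.Σ< (f ℕ.* 2 ℕ.^ z) (λ b → φ (γ ^ᶠ (2 ℕ.^ m ℕ.* b)))) (ℕP.n∸n≡0 m))
        (trans (const-sum (f ℕ.* 1) (hits (Q ℤ.- (period i 1# ℤ.+ 2^ i ℤ.* xv (suc i)))) λ b → cong (λ z → hits (Q ℤ.- z)) (trans (period-same-1 m (γ ^ᶠ (2 ℕ.^ m ℕ.* b)) (γ^full m b ℕP.≤-refl)) (trans (cong (λ z → period z 1#) (sym e)) (period-suc i 1# (ℕP.≤-reflexive e)))))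
          (cong (ℕ._* hits (Q ℤ.- (period i 1# ℤ.+ 2^ i ℤ.* xv (suc i)))) (sym (half-q₁ 0 (1 ℕ.+ i) e)))))))

-- Matching the count with the terms of the enumerator.

module Distribution (σ : Setting) (N n : ℕ) (nN≡q₁ : n ℕ.* N ≡ Characteristic.q₁ σ)
                    (gcd≡ : gcd N (Setting.R′ σ ℕ.* 2 ℕ.^ Setting.m σ) ≡ 2 ℕ.^ Setting.m σ)
                    (A B : ℕ → ℤ)
                    (AB : ∀ r → 3 ℕ.≤ r → r ℕ.≤ Setting.m σ →
                      (ℤ.+ (Setting.p σ ℕ.^ half^ (r ∸ 2) (Setting.s σ)) ≡ A r ℤ.* A r ℤ.+ ℤ.+ 2 ℤ.* B r ℤ.* B r)
                      × (4 ∣ℕ.∣ ℤ.∣ A r ℤ.+ ℤ.1ℤ ∣) × ¬ (Setting.p σ ∣ℕ.∣ ℤ.∣ A r ∣)) where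
  open Enumeration σ N n nN≡q₁ gcd≡ A B AB public

  private
    qp : ℕ → ℤ
    qp a = qpow p s (2 ℕ.^ (1 ℕ.+ a) ∸ 1) (2 ℕ.+ a)

    Q′ R₂ : ℤ
    Q′ = ℤ.+ (p ℕ.^ s)
    R₂ = qpow p s 1 1

    Q≡Q′ : Q ≡ Q′
    Q≡Q′ = cong (λ z → ℤ.+ z) suc-q₁

    rt≡R₂ : rt ≡ R₂
    rt≡R₂ = sym qpow-rt

    base₀ : ℕ → ℤ
    base₀ i = Q′ ℤ.+ ℤ.+ 3 ℤ.* R₂ ℤ.- Ssum p s A i

    Ssum≡ : ∀ a → Ssum p s A (2 ℕ.+ a) ≡ Z.Σ< a (λ i → 2^ (2 ℕ.+ i) ℤ.* A (3 ℕ.+ i) ℤ.* qp i)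
    Ssum≡ a = foldr-map-Σ< (λ r → ℤ.+ (2 ℕ.^ (r ∸ 1)) ℤ.* A r ℤ.* qpow p s (2 ℕ.^ (r ∸ 2) ∸ 1) (r ∸ 1)) (3 ℕ.+_) id a

    period-1 : period 1 1# ≡ ℤ.- R₂
    period-1 = trans (period-suc 0 1# 1≤m) (trans (cong₂ (λ a b → a ℤ.+ ℤ.1ℤ ℤ.* b) (period-0 1≢0) (trans (xv-low 0 z≤n) (cong ℤ.-_ rt≡R₂))) (alg R₂))
      where
      alg : ∀ r → ℤ.0ℤ ℤ.+ ℤ.1ℤ ℤ.* (ℤ.- r) ≡ ℤ.- r
      alg = solve-∀

    period-2 : period 2 1# ≡ ℤ.- (ℤ.+ 3 ℤ.* R₂)
    period-2 = trans (period-suc 1 1# (ℕP.<⇒≤ 3≤m)) (trans (cong₂ (λ a b → a ℤ.+ ℤ.+ 2 ℤ.* b) period-1 (trans (xv-low 1 ℕP.≤-refl) (cong ℤ.-_ rt≡R₂))) (alg R₂))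
      where
      alg : ∀ r → ℤ.- r ℤ.+ ℤ.+ 2 ℤ.* (ℤ.- r) ≡ ℤ.- (ℤ.+ 3 ℤ.* r)
      alg = solve-∀

    -- The levels 1 and 2 contribute -√q - 2√q; from level 3 on the summands of `Ssum` are the
    -- contributions 2^(j-1) x_j. The bound 3 + a ≤ m keeps all levels below m, where `xv-sign` is
    -- available.
    period-Ssum : ∀ a → 3 ℕ.+ a ℕ.≤ m → period (2 ℕ.+ a) 1# ≡ ℤ.- (ℤ.+ 3 ℤ.* R₂) ℤ.+ Ssum p s A (2 ℕ.+ a)
    period-Ssum zero le = trans period-2 (sym (ℤP.+-identityʳ _))
    period-Ssum (suc a) le = begin
      period (3 ℕ.+ a) 1# ≡⟨ period-suc (2 ℕ.+ a) 1# (ℕP.<⇒≤ le) ⟩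
      period (2 ℕ.+ a) 1# ℤ.+ 2^ (2 ℕ.+ a) ℤ.* xv (3 ℕ.+ a) ≡⟨ cong₂ (λ x y → x ℤ.+ 2^ (2 ℕ.+ a) ℤ.* y) (period-Ssum a (ℕP.<⇒≤ le)) (xv-sign a le) ⟩
      ℤ.- (ℤ.+ 3 ℤ.* R₂) ℤ.+ Ssum p s A (2 ℕ.+ a) ℤ.+ 2^ (2 ℕ.+ a) ℤ.* (A (3 ℕ.+ a) ℤ.* qp a) ≡⟨ alg (ℤ.- (ℤ.+ 3 ℤ.* R₂)) (Ssum p s A (2 ℕ.+ a)) (2^ (2 ℕ.+ a)) (A (3 ℕ.+ a)) (qp a) ⟩
      ℤ.- (ℤ.+ 3 ℤ.* R₂) ℤ.+ (Ssum p s A (2 ℕ.+ a) ℤ.+ 2^ (2 ℕ.+ a) ℤ.* A (3 ℕ.+ a) ℤ.* qp a) ≡⟨ cong (λ z → ℤ.- (ℤ.+ 3 ℤ.* R₂) ℤ.+ z) (trans (cong (ℤ._+ 2^ (2 ℕ.+ a) ℤ.* A (3 ℕ.+ a) ℤ.* qp a) (Ssum≡ a)) (trans (sym (Z.Σ<-snoc a _)) (sym (Ssum≡ (suc a))))) ⟩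
      ℤ.- (ℤ.+ 3 ℤ.* R₂) ℤ.+ Ssum p s A (3 ℕ.+ a) ∎
      where
      open ≡-Reasoning
      alg : ∀ r s t a q → r ℤ.+ s ℤ.+ t ℤ.* (a ℤ.* q) ≡ r ℤ.+ (s ℤ.+ t ℤ.* a ℤ.* q)
      alg = solve-∀

    -- With `base-1`: since x₁ = x₂ = -√q, valuations 0 and 1 have the same base √q, which is why
    -- the first terms are centred at q - √q.
    base-0 : base 0 ≡ R₂
    base-0 = trans (cong₂ (λ a b → a ℤ.- ℤ.1ℤ ℤ.* b) (period-0 1≢0) (trans (xv-low 0 z≤n) (cong ℤ.-_ rt≡R₂))) (alg R₂)
      where
      alg : ∀ r → ℤ.0ℤ ℤ.- ℤ.1ℤ ℤ.* (ℤ.- r) ≡ r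
      alg = solve-∀

    base-1 : base 1 ≡ R₂
    base-1 = trans (cong₂ (λ a b → a ℤ.- ℤ.+ 2 ℤ.* b) period-1 (trans (xv-low 1 ℕP.≤-refl) (cong ℤ.-_ rt≡R₂))) (alg R₂)
      where
      alg : ∀ r → ℤ.- r ℤ.- ℤ.+ 2 ℤ.* (ℤ.- r) ≡ r
      alg = solve-∀

    Q-base : ∀ a → 4 ℕ.+ a ℕ.≤ m → Q ℤ.- base (2 ℕ.+ a) ≡ base₀ (2 ℕ.+ a) ℤ.+ 2^ (2 ℕ.+ a) ℤ.* A (3 ℕ.+ a) ℤ.* qp a
    Q-base a le = trans (cong₂ (λ x y → x ℤ.- y) Q≡Q′ (cong₂ (λ x y → x ℤ.- 2^ (2 ℕ.+ a) ℤ.* y) (period-Ssum a (ℕP.<⇒≤ le)) (xv-sign a le)))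
      (alg Q′ R₂ (Ssum p s A (2 ℕ.+ a)) (2^ (2 ℕ.+ a)) (A (3 ℕ.+ a)) (qp a))
      where
      alg : ∀ q r s t a w → q ℤ.- (ℤ.- (ℤ.+ 3 ℤ.* r) ℤ.+ s ℤ.- t ℤ.* (a ℤ.* w)) ≡ q ℤ.+ ℤ.+ 3 ℤ.* r ℤ.- s ℤ.+ t ℤ.* a ℤ.* w
      alg = solve-∀

    minus-plus : ∀ q b t c w → q ℤ.- (b ℤ.+ t ℤ.* (c ℤ.* w)) ≡ q ℤ.- b ℤ.- t ℤ.* c ℤ.* w
    minus-plus = solve-∀

    minus-minus : ∀ q b t c w → q ℤ.- (b ℤ.- t ℤ.* (c ℤ.* w)) ≡ q ℤ.- b ℤ.+ t ℤ.* c ℤ.* w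
    minus-minus = solve-∀

  module _ (j : ℕ) where
    private
      H : ℤ → ℕ
      H = hits j

    step-3′ : ∀ i E → 3 ℕ.+ i ℕ.≤ m → Q ℤ.- base i ≡ E → tally j i ≡
      half^ (2 ℕ.+ i) q₁ ℕ.* H (E ℤ.+ 2^ (2 ℕ.+ i) ℤ.* B (3 ℕ.+ i) ℤ.* qp i) ℕ.+ (half^ (2 ℕ.+ i) q₁ ℕ.* H (E ℤ.- 2^ (2 ℕ.+ i) ℤ.* B (3 ℕ.+ i) ℤ.* qp i) ℕ.+ tally j (suc i))
    step-3′ i E le e = trans (step-3 j i le) (trans (cong₂ (λ x y → half^ (2 ℕ.+ i) q₁ ℕ.* H x ℕ.+ half^ (2 ℕ.+ i) q₁ ℕ.* H y ℕ.+ tally j (suc i))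
        (trans (minus-plus Q (base i) (2^ (2 ℕ.+ i)) (B (3 ℕ.+ i)) (qp i)) (cong (λ z → z ℤ.- 2^ (2 ℕ.+ i) ℤ.* B (3 ℕ.+ i) ℤ.* qp i) e))
        (trans (minus-minus Q (base i) (2^ (2 ℕ.+ i)) (B (3 ℕ.+ i)) (qp i)) (cong (λ z → z ℤ.+ 2^ (2 ℕ.+ i) ℤ.* B (3 ℕ.+ i) ℤ.* qp i) e)))
      (swap3 (half^ (2 ℕ.+ i) q₁ ℕ.* H (E ℤ.- 2^ (2 ℕ.+ i) ℤ.* B (3 ℕ.+ i) ℤ.* qp i)) (half^ (2 ℕ.+ i) q₁ ℕ.* H (E ℤ.+ 2^ (2 ℕ.+ i) ℤ.* B (3 ℕ.+ i) ℤ.* qp i)) (tally j (suc i))))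
      where
      swap3 : ∀ a b c → a ℕ.+ b ℕ.+ c ≡ b ℕ.+ (a ℕ.+ c)
      swap3 = ℕSolver.solve-∀

    -- The sign of x_m is not known, but both choices give the same unordered pair of exponents with
    -- the same coefficient.
    step-1′ : ∀ a E → 3 ℕ.+ a ≡ m → Q ℤ.- period (2 ℕ.+ a) 1# ≡ E → tally j (2 ℕ.+ a) ≡
      half^ (3 ℕ.+ a) q₁ ℕ.* H (E ℤ.+ 2^ (2 ℕ.+ a) ℤ.* A (3 ℕ.+ a) ℤ.* qp a) ℕ.+ half^ (3 ℕ.+ a) q₁ ℕ.* H (E ℤ.- 2^ (2 ℕ.+ a) ℤ.* A (3 ℕ.+ a) ℤ.* qp a)
    step-1′ a E m≡ e = trans (step-1 j (2 ℕ.+ a) m≡) ([ plus , minus ]′ (xv≡ a (ℕP.≤-reflexive m≡)))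
      where
      t : ℤ
      t = 2^ (2 ℕ.+ a)
      h : ℕ
      h = half^ (3 ℕ.+ a) q₁
      W : ℤ
      W = t ℤ.* A (3 ℕ.+ a) ℤ.* qp a
      alg₁ : ∀ q b t c w → q ℤ.- (b ℤ.- t ℤ.* (ℤ.- (c ℤ.* w))) ≡ q ℤ.- b ℤ.- t ℤ.* c ℤ.* w
      alg₁ = solve-∀
      alg₂ : ∀ q b t c w → q ℤ.- (b ℤ.+ t ℤ.* (ℤ.- (c ℤ.* w))) ≡ q ℤ.- b ℤ.+ t ℤ.* c ℤ.* w
      alg₂ = solve-∀
      plus : xv (3 ℕ.+ a) ≡ XX a → h ℕ.* H (Q ℤ.- (period (2 ℕ.+ a) 1# ℤ.- t ℤ.* xv (3 ℕ.+ a))) ℕ.+ h ℕ.* H (Q ℤ.- (period (2 ℕ.+ a) 1# ℤ.+ t ℤ.* xv (3 ℕ.+ a))) ≡ h ℕ.* H (E ℤ.+ W) ℕ.+ h ℕ.* H (E ℤ.- W)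
      plus x≡ = cong₂ (λ x y → h ℕ.* H x ℕ.+ h ℕ.* H y)
        (trans (cong (λ x → Q ℤ.- (period (2 ℕ.+ a) 1# ℤ.- t ℤ.* x)) x≡) (trans (minus-minus Q (period (2 ℕ.+ a) 1#) t (A (3 ℕ.+ a)) (qp a)) (cong (ℤ._+ W) e)))
        (trans (cong (λ x → Q ℤ.- (period (2 ℕ.+ a) 1# ℤ.+ t ℤ.* x)) x≡) (trans (minus-plus Q (period (2 ℕ.+ a) 1#) t (A (3 ℕ.+ a)) (qp a)) (cong (ℤ._- W) e)))
      minus : xv (3 ℕ.+ a) ≡ ℤ.- XX a → h ℕ.* H (Q ℤ.- (period (2 ℕ.+ a) 1# ℤ.- t ℤ.* xv (3 ℕ.+ a))) ℕ.+ h ℕ.* H (Q ℤ.- (period (2 ℕ.+ a) 1# ℤ.+ t ℤ.* xv (3 ℕ.+ a))) ≡ h ℕ.* H (E ℤ.+ W) ℕ.+ h ℕ.* H (E ℤ.- W)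
      minus x≡ = trans (cong₂ (λ x y → h ℕ.* H x ℕ.+ h ℕ.* H y)
        (trans (cong (λ x → Q ℤ.- (period (2 ℕ.+ a) 1# ℤ.- t ℤ.* x)) x≡) (trans (alg₁ Q (period (2 ℕ.+ a) 1#) t (A (3 ℕ.+ a)) (qp a)) (cong (ℤ._- W) e)))
        (trans (cong (λ x → Q ℤ.- (period (2 ℕ.+ a) 1# ℤ.+ t ℤ.* x)) x≡) (trans (alg₂ Q (period (2 ℕ.+ a) 1#) t (A (3 ℕ.+ a)) (qp a)) (cong (ℤ._+ W) e))))
        (ℕP.+-comm (h ℕ.* H (E ℤ.- W)) (h ℕ.* H (E ℤ.+ W)))

    private
      Q-R₂ : ∀ i → base i ≡ R₂ → Q ℤ.- base i ≡ Q′ ℤ.- R₂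
      Q-R₂ i e = cong₂ ℤ._-_ Q≡Q′ e

    -- Valuation 0 gives the two terms with B₃, valuation 1 the single term q - √q, valuation 2 and
    -- the multiples of 8 the two terms with A₃.
    distribution-3 : m ≡ 3 → weightCount p ℓ k N n γ j ≡ enumCoeff p ℓ N (terms3 p s A B) j
    distribution-3 m≡3 = trans (weightCount-S j) (trans (cong (C.𝟙 (j ℕ.≟ 0) ℕ.+_) (trans (step-3′ 0 (Q′ ℤ.- R₂) 3≤m (Q-R₂ 0 base-0))
        (trans (cong (λ z → h₁ ℕ.+ (h₂ ℕ.+ z)) (trans (step-2 j 1 (sym m≡3)) (cong₂ ℕ._+_ (cong (λ z → half^ 2 q₁ ℕ.* H z) (Q-R₂ 1 base-1))
          (step-1′ 0 (Q′ ℤ.+ ℤ.+ 3 ℤ.* R₂) (sym m≡3) (trans (cong₂ ℤ._-_ Q≡Q′ period-2) (alg Q′ R₂)))))) (reorder h₁ h₂ (half^ 2 q₁ ℕ.* H (Q′ ℤ.- R₂)) h₃ h₄)))) (sym (enumCoeff-total j (terms3 p s A B))))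
      where
      h₁ h₂ h₃ h₄ : ℕ
      h₁ = half^ 2 q₁ ℕ.* H (Q′ ℤ.- R₂ ℤ.+ 2^ 2 ℤ.* B 3 ℤ.* qp 0)
      h₂ = half^ 2 q₁ ℕ.* H (Q′ ℤ.- R₂ ℤ.- 2^ 2 ℤ.* B 3 ℤ.* qp 0)
      h₃ = half^ 3 q₁ ℕ.* H (Q′ ℤ.+ ℤ.+ 3 ℤ.* R₂ ℤ.+ 2^ 2 ℤ.* A 3 ℤ.* qp 0)
      h₄ = half^ 3 q₁ ℕ.* H (Q′ ℤ.+ ℤ.+ 3 ℤ.* R₂ ℤ.- 2^ 2 ℤ.* A 3 ℤ.* qp 0)
      alg : ∀ q r → q ℤ.- (ℤ.- (ℤ.+ 3 ℤ.* r)) ≡ q ℤ.+ ℤ.+ 3 ℤ.* r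
      alg = solve-∀
      reorder : ∀ a b c d e → a ℕ.+ (b ℕ.+ (c ℕ.+ (d ℕ.+ e))) ≡ c ℕ.+ (a ℕ.+ (b ℕ.+ (d ℕ.+ (e ℕ.+ 0))))
      reorder = ℕSolver.solve-∀

    private
      -- The indices t + 1, t + 2 and t + 3 are separate parameters, so that replacing them by 1 +
      -- t, 2 + t and 3 + t is a plain congruence.
      pair : ℕ → ℕ → ℕ → ℕ → List Term
      pair t t₁ t₂ t₃ =
          (half^ t₂ q₁ , base₀ t ℤ.+ 2^ t ℤ.* A t₁ ℤ.* qpow p s (2 ℕ.^ (t ∸ 1) ∸ 1) t ℤ.+ 2^ t₂ ℤ.* B t₃ ℤ.* qpow p s (2 ℕ.^ t₁ ∸ 1) t₂)
        ∷ (half^ t₂ q₁ , base₀ t ℤ.+ 2^ t ℤ.* A t₁ ℤ.* qpow p s (2 ℕ.^ (t ∸ 1) ∸ 1) t ℤ.- 2^ t₂ ℤ.* B t₃ ℤ.* qpow p s (2 ℕ.^ t₁ ∸ 1) t₂)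
        ∷ []

      middle : ℕ → List Term
      middle t = pair t (t ℕ.+ 1) (t ℕ.+ 2) (t ℕ.+ 3)

      middle≡ : ∀ t → middle t ≡ pair t (1 ℕ.+ t) (2 ℕ.+ t) (3 ℕ.+ t)
      middle≡ t = trans (cong (λ z → pair t z (t ℕ.+ 2) (t ℕ.+ 3)) (ℕP.+-comm t 1)) (cong₂ (pair t (1 ℕ.+ t)) (ℕP.+-comm t 2) (ℕP.+-comm t 3))

      -- The summation index t is the valuation: t = 2 + a up to 1 + a + r. The function g is left
      -- general because the tail of an initial segment of ℕ is again enumerated, but with a shifted
      -- function.
      tally-middle : ∀ r a (g : ℕ → ℕ) → (∀ i → g i ≡ a ℕ.+ i) → 4 ℕ.+ (a ℕ.+ r) ℕ.≤ m →
        tally j (2 ℕ.+ a) ≡ total j (List.concatMap middle (map (2 ℕ.+_) (applyUpTo g r))) ℕ.+ tally j (2 ℕ.+ (a ℕ.+ r))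
      tally-middle zero a g g≡ le = cong (λ z → tally j (2 ℕ.+ z)) (sym (ℕP.+-identityʳ a))
      tally-middle (suc r) a g g≡ le = begin
        tally j (2 ℕ.+ a) ≡⟨ step-3′ (2 ℕ.+ a) (base₀ (2 ℕ.+ a) ℤ.+ 2^ (2 ℕ.+ a) ℤ.* A (3 ℕ.+ a) ℤ.* qp a) 5+a≤m (Q-base a (ℕP.<⇒≤ 5+a≤m)) ⟩
        u₁ ℕ.+ (u₂ ℕ.+ tally j (3 ℕ.+ a)) ≡⟨ cong (λ z → u₁ ℕ.+ (u₂ ℕ.+ z)) (tally-middle r (suc a) (g ∘ suc) (λ i → trans (g≡ (suc i)) (ℕP.+-suc a i)) (subst (λ z → 4 ℕ.+ z ℕ.≤ m) (ℕP.+-suc a r) le)) ⟩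
        u₁ ℕ.+ (u₂ ℕ.+ (rest ℕ.+ tally j (2 ℕ.+ (suc a ℕ.+ r)))) ≡⟨ assoc4 u₁ u₂ rest (tally j (2 ℕ.+ (suc a ℕ.+ r))) ⟩
        u₁ ℕ.+ (u₂ ℕ.+ 0) ℕ.+ rest ℕ.+ tally j (2 ℕ.+ (suc a ℕ.+ r)) ≡⟨ cong₂ (λ x y → x ℕ.+ tally j (2 ℕ.+ y)) (sym expand) (sym (ℕP.+-suc a r)) ⟩
        total j (List.concatMap middle (map (2 ℕ.+_) (applyUpTo g (suc r)))) ℕ.+ tally j (2 ℕ.+ (a ℕ.+ suc r)) ∎
        where
        open ≡-Reasoning
        5+a≤m : 5 ℕ.+ a ℕ.≤ m
        5+a≤m = ℕP.≤-trans (ℕP.≤-trans (ℕP.m≤m+n (5 ℕ.+ a) r) (ℕP.≤-reflexive (lem a r))) le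
          where
          lem : ∀ a r → 5 ℕ.+ a ℕ.+ r ≡ 4 ℕ.+ (a ℕ.+ suc r)
          lem = ℕSolver.solve-∀
        rest u₁ u₂ : ℕ
        rest = total j (List.concatMap middle (map (2 ℕ.+_) (applyUpTo (g ∘ suc) r)))
        u₁ = half^ (4 ℕ.+ a) q₁ ℕ.* H (base₀ (2 ℕ.+ a) ℤ.+ 2^ (2 ℕ.+ a) ℤ.* A (3 ℕ.+ a) ℤ.* qp a ℤ.+ 2^ (4 ℕ.+ a) ℤ.* B (5 ℕ.+ a) ℤ.* qp (2 ℕ.+ a))
        u₂ = half^ (4 ℕ.+ a) q₁ ℕ.* H (base₀ (2 ℕ.+ a) ℤ.+ 2^ (2 ℕ.+ a) ℤ.* A (3 ℕ.+ a) ℤ.* qp a ℤ.- 2^ (4 ℕ.+ a) ℤ.* B (5 ℕ.+ a) ℤ.* qp (2 ℕ.+ a))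
        assoc4 : ∀ a b c d → a ℕ.+ (b ℕ.+ (c ℕ.+ d)) ≡ a ℕ.+ (b ℕ.+ 0) ℕ.+ c ℕ.+ d
        assoc4 = ℕSolver.solve-∀
        expand : total j (List.concatMap middle (map (2 ℕ.+_) (applyUpTo g (suc r)))) ≡ u₁ ℕ.+ (u₂ ℕ.+ 0) ℕ.+ rest
        expand = trans (total-++ j (middle (2 ℕ.+ g 0)) (List.concatMap middle (map (2 ℕ.+_) (applyUpTo (g ∘ suc) r)))) (cong (ℕ._+ rest) (cong (total j) (trans (cong (λ z → middle (2 ℕ.+ z)) (trans (g≡ 0) (ℕP.+-identityʳ a))) (middle≡ (2 ℕ.+ a)))))

    -- Valuation 0 gives the terms with B₃, valuation 1 those with B₄, valuations 2 to m - 3 the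
    -- sums over t, valuation m - 2 the single term, and valuation m - 1 together with the multiples
    -- of 2^m the last two.
    distribution-≥4 : ∀ μ → m ≡ 4 ℕ.+ μ → weightCount p ℓ k N n γ j ≡ enumCoeff p ℓ N (terms≥4 p s (4 ℕ.+ μ) A B) j
    distribution-≥4 μ m≡ = trans (weightCount-S j) (trans (cong (C.𝟙 (j ℕ.≟ 0) ℕ.+_) chain) (sym (enumCoeff-total j (terms≥4 p s (4 ℕ.+ μ) A B))))
      where
      4≤m : 4 ℕ.≤ m
      4≤m = subst (4 ℕ.≤_) (sym m≡) (ℕP.m≤m+n 4 μ)
      mids last : List Term
      mids = List.concatMap middle (map (2 ℕ.+_) (upTo μ))
      last =
          (half^ (3 ℕ.+ μ) q₁ , base₀ (2 ℕ.+ μ) ℤ.+ 2^ (2 ℕ.+ μ) ℤ.* A (3 ℕ.+ μ) ℤ.* qp μ)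
        ∷ (half^ (4 ℕ.+ μ) q₁ , base₀ (3 ℕ.+ μ) ℤ.+ 2^ (3 ℕ.+ μ) ℤ.* A (4 ℕ.+ μ) ℤ.* qp (1 ℕ.+ μ))
        ∷ (half^ (4 ℕ.+ μ) q₁ , base₀ (3 ℕ.+ μ) ℤ.- 2^ (3 ℕ.+ μ) ℤ.* A (4 ℕ.+ μ) ℤ.* qp (1 ℕ.+ μ))
        ∷ []
      tail-last : tally j (2 ℕ.+ μ) ≡ total j last
      tail-last = trans (step-2 j (2 ℕ.+ μ) (sym m≡)) (cong₂ ℕ._+_ (cong (λ z → half^ (3 ℕ.+ μ) q₁ ℕ.* H z) (Q-base μ (ℕP.≤-reflexive (sym m≡))))
        (trans (step-1′ (1 ℕ.+ μ) (base₀ (3 ℕ.+ μ)) (sym m≡) (trans (cong₂ ℤ._-_ Q≡Q′ (period-Ssum (1 ℕ.+ μ) (ℕP.≤-reflexive (sym m≡)))) (alg Q′ R₂ (Ssum p s A (3 ℕ.+ μ)))))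
          (cong (half^ (4 ℕ.+ μ) q₁ ℕ.* H (base₀ (3 ℕ.+ μ) ℤ.+ 2^ (3 ℕ.+ μ) ℤ.* A (4 ℕ.+ μ) ℤ.* qp (1 ℕ.+ μ)) ℕ.+_) (sym (ℕP.+-identityʳ _)))))
        where
        alg : ∀ q r s → q ℤ.- (ℤ.- (ℤ.+ 3 ℤ.* r) ℤ.+ s) ≡ q ℤ.+ ℤ.+ 3 ℤ.* r ℤ.- s
        alg = solve-∀
      chain : tally j 0 ≡ total j (terms≥4 p s (4 ℕ.+ μ) A B)
      chain = trans (step-3′ 0 (Q′ ℤ.- R₂) 3≤m (Q-R₂ 0 base-0)) (cong (λ z → half^ 2 q₁ ℕ.* H (Q′ ℤ.- R₂ ℤ.+ 2^ 2 ℤ.* B 3 ℤ.* qp 0) ℕ.+ (half^ 2 q₁ ℕ.* H (Q′ ℤ.- R₂ ℤ.- 2^ 2 ℤ.* B 3 ℤ.* qp 0) ℕ.+ z))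
        (trans (step-3′ 1 (Q′ ℤ.- R₂) 4≤m (Q-R₂ 1 base-1)) (cong (λ z → half^ 3 q₁ ℕ.* H (Q′ ℤ.- R₂ ℤ.+ 2^ 3 ℤ.* B 4 ℤ.* qp 1) ℕ.+ (half^ 3 q₁ ℕ.* H (Q′ ℤ.- R₂ ℤ.- 2^ 3 ℤ.* B 4 ℤ.* qp 1) ℕ.+ z))
          (trans (tally-middle μ 0 id (λ _ → refl) (ℕP.≤-reflexive (sym m≡))) (trans (cong (total j mids ℕ.+_) tail-last) (sym (total-++ j mids last)))))))

open import Data.Nat using (ℕ; _≤_; _∸_; _^_; _%_)
open import Data.Nat.Primality using (Prime)
open import Data.Nat.GCD using (gcd)
open import Data.Integer as ℤ using (ℤ; +_)
open import Data.Integer.Divisibility using (_∣_)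
open import Data.List using (length)
open import Data.Product using (_×_)
open import Relation.Binary.PropositionalEquality using (_≡_)
open import Relation.Nullary using (¬_)

theorem3 : (p : ℕ) → Prime p → p % 8 ≡ 3 →
    (s ℓ k : ℕ) → 1 ≤ ℓ → ℓ Data.Nat.* k ≡ s →
    (F : FiniteField) → FiniteField.card F ≡ p ^ s →
    (γ : FiniteField.Carrier F) → FiniteField.IsGenerator F γ →
    (N n : ℕ) → 1 ≤ N → n Data.Nat.* N ≡ p ^ s ∸ 1 →
    (R : ℕ) → R Data.Nat.* (p ^ ℓ ∸ 1) ≡ p ^ s ∸ 1 →
    (m : ℕ) → gcd N R ≡ 2 ^ m → 3 ≤ m →
    (A B : ℕ → ℤ) →
    (∀ r → 3 ≤ r → r ≤ m →
    (+ (p ^ half^ (r ∸ 2) s) ≡ A r ℤ.* A r ℤ.+ + 2 ℤ.* B r ℤ.* B r)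
    × (+ 4 ∣ A r ℤ.+ + 1)
    × ¬ (+ p ∣ A r)) →
    FiniteField.IsIrreducibleCyclic F p ℓ n (FiniteField.InCode F p ℓ k N n γ)
    × length (FiniteField.codewords F p ℓ k N n γ) ≡ (p ^ ℓ) ^ k
    × (m ≡ 3 → ∀ j → FiniteField.weightCount F p ℓ k N n γ j
    ≡ enumCoeff p ℓ N (terms3 p s A B) j)
    × (4 ≤ m → ∀ j → FiniteField.weightCount F p ℓ k N n γ j
    ≡ enumCoeff p ℓ N (terms≥4 p s m A B) j)
theorem3 p p-prime p%8≡3 s ℓ k 1≤ℓ ℓk≡s F card≡ γ γ-gen N n _ nN≡ R R≡ m gcd≡ 3≤m A B AB =
  Code.code-irreducible , Code.code-size , (λ m≡3 j → Code.distribution-3 j m≡3) , λ 4≤m j →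
    let μ≡ = sym (ℕP.m+[n∸m]≡n 4≤m) in
    trans (Code.distribution-≥4 j (m ∸ 4) μ≡) (cong (λ z → enumCoeff p ℓ N (terms≥4 p s z A B) j) (sym μ≡))
  where
  2^m∣R : ∃ λ R′ → R ≡ R′ Data.Nat.* 2 ^ m
  2^m∣R with subst (∣ℕ._∣ R) gcd≡ (gcd[m,n]∣n N R)
  ... | divides R′ R≡R′ = R′ , R≡R′

  setting : Setting
  setting = record
    { F = F ; γ = γ ; gen = γ-gen ; p = p ; w = p / 8 ; prime = p-prime
    ; p≡8w+3 = trans (m≡m%n+[m/n]*n p 8) (cong (Data.Nat._+ p / 8 Data.Nat.* 8) p%8≡3)
    ; s = s ; ℓ = ℓ ; k = k ; 1≤ℓ = 1≤ℓ ; s≡ℓk = sym ℓk≡s ; card≡p^s = card≡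
    ; m = m ; R′ = proj₁ 2^m∣R ; 3≤m = 3≤m
    ; R≡ = trans (cong (Data.Nat._* (p ^ ℓ ∸ 1)) (sym (proj₂ 2^m∣R))) R≡
    }

  module Code = Distribution setting N n nN≡ (trans (cong (gcd N) (sym (proj₂ 2^m∣R))) gcd≡) A B AB
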